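{- Let $\lambda$ and $\mu$ be partitions. Then (a) $S(G_\mu)=(-1)^{|\mu|}\sum_\lambda P^{\mu^t}_\lambda G_\lambda$, where $S$ is the antipode of $\mathfrak{m}\mathrm{QSym}$ (restricted to $\mathfrak{m}\mathrm{Sym}$) and the sum, possibly infinite, is over all partitions $\lambda$; and (b) $S(\tilde j_\lambda)=(-1)^{|\lambda|}\sum_\mu P^{\mu}_{\lambda^t}\tilde j_\mu$, where $S$ is the antipode of the Hopf algebra $\Lambda$ of symmetric functions over $\mathbb{Z}$ and the sum is over all partitions $\mu$.
   Context: Young diagrams in English notation; $\lambda^t$ is the conjugate (transpose) partition. Restricted plane partitions: for partitions $\mu\subseteq\lambda$, a restricted plane partition of $\lambda/\mu$ is a filling of the cells of $\lambda/\mu$ with positive integers weakly decreasing along rows (left to right) and down columns, such that every cell $b\in\lambda/\mu$ for which $\mu\cup\{b\}$ is a partition has label in $[1,h(b)]$, where $h(b)$ is the number of cells of $\mu$ lying above $b$ in its column or to the left of $b$ in its row. $P^\mu_\lambda=0$ if $\mu\not\subseteq\lambda$, $P^\mu_\lambda=1$ if $\lambda=\mu$, and otherwise $P^\mu_\lambda$ is the number of restricted plane partitions of $\lambda/\mu$. Stable Grothendieck polynomials: a set-valued tableau of shape $\lambda$ fills each cell with a finite nonempty set of positive integers so that the largest entry of a cell is $\le$ the smallest entry of the cell to its right and $<$ the smallest entry of the cell below; $G_\lambda=\sum_T(-1)^{|T|-|\lambda|}\prod_r x_r^{\#\{\text{cells containing }r\}}$, $|T|$ the total number of entries; $\tilde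 K_\lambda=(-1)^{|\lambda|}G_\lambda(-x_1,-x_2,\dots)$. $\mathfrak{m}\mathrm{QSym}$: for a composition $\alpha$ of $n$ with partial-sum set $S_\alpha$, fix $w\in\mathfrak S_n$ with descent set $S_\alpha$ and a chain $p_1<\dots<p_n$; $\tilde L_\alpha=\sum_\sigma\prod_r x_r^{\#\{j:r\in\sigma(p_j)\}}$ over maps to finite nonempty sets with $\max\sigma(p_j)\le\min\sigma(p_{j+1})$ if $w_j<w_{j+1}$ and $<$ if $w_j>w_{j+1}$; $\tilde L_\emptyset=1$. $\mathfrak{m}\mathrm{QSym}$ is the set of all (possibly infinite) $\mathbb{Z}$-combinations of the $\tilde L_\alpha$, a completed Hopf algebra with product of power series, coproduct $\Delta f=f(x_1,x_2,\dots,y_1,y_2,\dots)$, counit the constant term, and continuous antipode $S$; $\mathfrak{m}\mathrm{Sym}$ is the set of all (possibly infinite) combinations of the $\tilde K_\lambda$, containing the $G_\lambda$. $\Lambda$ has the standard Hopf structure (coproduct $f(x,y)$, antipode $S$). $\tilde j_\lambda=(-1)^{|\lambda|}j_\lambda(-x_1,-x_2,\dots)$, where $j_\lambda$ is the sum over valued-set tableaux of shape $\lambda$ — fillings with positive integers strictly increasing along rows and weakly increasing down columns, together with a decomposition of the cells into groups of vertically consecutive cells in one column with equal entries — of $\prod_r x_r^{a_r}$, $a_r$ the number of groups containing $r$. -}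

module Defs where

open import Data.Nat.Base using (ℕ; zero; suc; _+_; _∸_; _≤_; _≥_; _≤ᵇ_; _<ᵇ_; _≡ᵇ_)
open import Data.Integer.Base using (ℤ; +_; -_) renaming (_+_ to _+ℤ_; _*_ to _*ℤ_)
open import Data.Bool.Base using (Bool; true; false; if_then_else_; _∧_; _∨_; not)
open import Data.List.Base using (List; []; _∷_; _++_; map; concatMap; upTo; length; take; drop; foldr; filterᵇ; null)
open import Data.Nat.ListAction using (sum)
open import Data.Bool.ListAction using (and; all; any)
open import Data.List.Relation.Unary.All using (All)
open import Data.List.Relation.Unary.Linked using (Linked)
open import Data.Product.Base using (_×_; _,_; proj₁; proj₂)
open import Data.Maybe.Base using (Maybe; just; nothing)

at : List ℕ → ℕ → ℕ
at []       _       = 0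
at (x ∷ _)  zero    = x
at (_ ∷ xs) (suc i) = at xs i

oneTo : ℕ → List ℕ
oneTo n = map suc (upTo n)

countᵇ : {A : Set} → (A → Bool) → List A → ℕ
countᵇ p xs = length (filterᵇ p xs)

sumℤ : List ℤ → ℤ
sumℤ = foldr _+ℤ_ (+ 0)

sign : ℕ → ℤ
sign zero          = + 1
sign (suc zero)    = - (+ 1)
sign (suc (suc n)) = sign n

eqList : List ℕ → List ℕ → Bool
eqList []       []       = true
eqList (x ∷ xs) (y ∷ ys) = (x ≡ᵇ y) ∧ eqList xs ys
eqList _        _        = false

Cell : Set
Cell = ℕ × ℕ   -- (row , column), 0-based, English notation

eqCell : Cell → Cell → Bool
eqCell (i , j) (k , l) = (i ≡ᵇ k) ∧ (j ≡ᵇ l)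

assignments : {X V : Set} → List X → List V → List (List (X × V))
assignments []       vs = [] ∷ []
assignments (x ∷ xs) vs = concatMap (λ v → map ((x , v) ∷_) (assignments xs vs)) vs

lookupCell : {V : Set} → Cell → List (Cell × V) → Maybe V
lookupCell c []              = nothing
lookupCell c ((d , v) ∷ fs)  = if eqCell c d then just v else lookupCell c fs

atCell : {V : Set} → List (Cell × V) → Cell → (V → Bool) → Bool
atCell f c p with lookupCell c f
... | just v  = p v
... | nothing = true

IsPartition : List ℕ → Set
IsPartition λ′ = All (λ k → 1 ≤ k) λ′ × Linked _≥_ λ′

size : List ℕ → ℕ
size = sum

cells : List ℕ → List Cell
cells λ′ = concatMap (λ i → map (i ,_) (upTo (at λ′ i))) (upTo (length λ′))

inDiagram : List ℕ → Cell → Bool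
inDiagram λ′ (i , j) = j <ᵇ at λ′ i

conj : List ℕ → List ℕ
conj λ′ = map (λ j → countᵇ (λ r → j <ᵇ r) λ′) (upTo (at λ′ 0))

contained : List ℕ → List ℕ → Bool
contained μ λ′ = and (map (λ i → at μ i ≤ᵇ at λ′ i) (upTo (length μ)))

compsF : ℕ → ℕ → List (List ℕ)
compsF _        zero    = [] ∷ []
compsF zero     (suc m) = []
compsF (suc f)  (suc m) = concatMap (λ k → map (suc k ∷_) (compsF f (m ∸ k))) (upTo (suc m))

compositions : ℕ → List (List ℕ)
compositions n = compsF n n

decreasingᵇ : List ℕ → Bool
decreasingᵇ []            = true
decreasingᵇ (x ∷ [])      = true
decreasingᵇ (x ∷ y ∷ xs)  = (y ≤ᵇ x) ∧ decreasingᵇ (y ∷ xs)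

partitionsOf : ℕ → List (List ℕ)
partitionsOf n = filterᵇ decreasingᵇ (compositions n)

partitionsUpTo : ℕ → List (List ℕ)
partitionsUpTo d = concatMap partitionsOf (upTo (suc d))

skewCells : List ℕ → List ℕ → List Cell
skewCells λ′ μ = filterᵇ (λ c → not (inDiagram μ c)) (cells λ′)

addable : List ℕ → Cell → Bool
addable μ (zero  , j) = j ≡ᵇ at μ 0
addable μ (suc i , j) = (j ≡ᵇ at μ (suc i)) ∧ (j <ᵇ at μ i)

hook : List ℕ → Cell → ℕ
hook μ (i , j) = countᵇ (λ c → ((proj₂ c ≡ᵇ j) ∧ (proj₁ c <ᵇ i)) ∨ ((proj₁ c ≡ᵇ i) ∧ (proj₂ c <ᵇ j))) (cells μ)

isRPP : List ℕ → List (Cell × ℕ) → Bool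
isRPP μ f = all ok f
  where
  ok : Cell × ℕ → Bool
  ok ((i , j) , v) =
    atCell f (i , suc j) (λ w → w ≤ᵇ v) ∧
    atCell f (suc i , j) (λ w → w ≤ᵇ v) ∧
    (if addable μ (i , j) then ((1 ≤ᵇ v) ∧ (v ≤ᵇ hook μ (i , j))) else true)

-- P^μ_λ  (written  P μ λ).  Labels can be enumerated in [1, |μ|]: every cell of
-- λ/μ is weakly below/right of an addable cell b of λ/μ, whose label is ≤ h(b) ≤ |μ|.
P : List ℕ → List ℕ → ℕ
P μ λ′ =
  if not (contained μ λ′) then 0
  else if eqList μ λ′ then 1
  else countᵇ (isRPP μ) (assignments (skewCells λ′ μ) (oneTo (size μ)))

-- Formal power series in x₁, x₂, … over ℤ: a monomial is given by its
-- exponent vector (a₁, a₂, …, aₙ) (further exponents 0); a series is its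
-- coefficient function.

Series : Set
Series = List ℕ → ℤ

splits : List ℕ → List (List ℕ × List ℕ)
splits []       = ([] , []) ∷ []
splits (a ∷ as) = concatMap (λ k → map (λ p → (k ∷ proj₁ p , (a ∸ k) ∷ proj₂ p)) (splits as)) (upTo (suc a))

_⋆_ : Series → Series → Series
(F ⋆ G) a = sumℤ (map (λ p → F (proj₁ p) *ℤ G (proj₂ p)) (splits a))

flat : List ℕ → List ℕ
flat = filterᵇ (λ k → 1 ≤ᵇ k)

M : List ℕ → Series
M γ a = if eqList (flat a) γ then + 1 else + 0

-- S(M_α) for the antipode S of QSym, defined by the antipode axiom
-- S ⋆ id = η ε with the coproduct Δ M_α = Σ_{α = βγ} M_β ⊗ M_γ
-- (i.e. Δ f = f(x, y)):  S(M_∅) = 1,  S(M_α) = - Σ_{α = βγ, γ ≠ ∅} S(M_β) M_γ.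
SMF : ℕ → List ℕ → Series
SMF _       []        = M []
SMF zero    (_ ∷ _)   = λ _ → + 0
SMF (suc f) (x ∷ xs)  = λ a → - sumℤ (map (λ k → (SMF f (take k (x ∷ xs)) ⋆ M (drop k (x ∷ xs))) a) (upTo (length (x ∷ xs))))

SM : List ℕ → Series
SM α = SMF (length α) α

-- The (continuous) antipode on quasisymmetric power series:
-- f = Σ_α [x^α]f · M_α  ↦  Σ_α [x^α]f · S(M_α); S(M_α) is homogeneous of
-- degree |α|, so the coefficient of x^a only involves compositions of |a|.
S : Series → Series
S F a = sumℤ (map (λ α → F α *ℤ SM α a) (compositions (sum a)))

sublists : List ℕ → List (List ℕ)
sublists []       = [] ∷ []
sublists (x ∷ xs) = sublists xs ++ map (x ∷_) (sublists xs)

nonemptySubsets : ℕ → List (List ℕ)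
nonemptySubsets n = filterᵇ (λ s → not (null s)) (sublists (oneTo n))

maxL : List ℕ → ℕ
maxL = foldr (λ x m → if m ≤ᵇ x then x else m) 0

minL : List ℕ → ℕ
minL []       = 0
minL (x ∷ xs) = foldr (λ y m → if y ≤ᵇ m then y else m) x xs

isSVT : List (Cell × List ℕ) → Bool
isSVT f = all ok f
  where
  ok : Cell × List ℕ → Bool
  ok ((i , j) , s) =
    atCell f (i , suc j) (λ t → maxL s ≤ᵇ minL t) ∧
    atCell f (suc i , j) (λ t → maxL s <ᵇ minL t)

svtContent : ℕ → List (Cell × List ℕ) → List ℕ
svtContent n f = map (λ r → countᵇ (λ cs → any (λ e → e ≡ᵇ r) (proj₂ cs)) f) (oneTo n)

entries : List (Cell × List ℕ) → ℕ
entries f = sum (map (λ cs → length (proj₂ cs)) f)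

-- coefficient of x^a in G_λ (entries > length a cannot occur in such tableaux)
G : List ℕ → Series
G λ′ a = sumℤ (map (λ T → sign (entries T ∸ size λ′))
           (filterᵇ (λ T → isSVT T ∧ eqList (svtContent (length a) T) a)
             (assignments (cells λ′) (nonemptySubsets (length a)))))

-- j_λ via valued-set tableaux.  A decomposition of the cells into groups of
-- vertically consecutive cells of one column with equal entries is encoded by
-- a bit per cell: true = "in the same group as the cell directly above".

isVST : List (Cell × (ℕ × Bool)) → Bool
isVST f = all ok f
  where
  ok : Cell × (ℕ × Bool) → Bool
  ok ((i , j) , (v , glued)) =
    atCell f (i , suc j) (λ w → v <ᵇ proj₁ w) ∧
    atCell f (suc i , j) (λ w → v ≤ᵇ proj₁ w) ∧
    (if glued
       then (case-row i ∧ atCell f (i ∸ 1 , j) (λ w → proj₁ w ≡ᵇ v))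
       else true)
    where
    case-row : ℕ → Bool
    case-row zero    = false
    case-row (suc _) = true

-- a_r = number of groups with entry r (a group is counted at its top cell)
vstContent : ℕ → List (Cell × (ℕ × Bool)) → List ℕ
vstContent n f = map (λ r → countᵇ (λ cv → (proj₁ (proj₂ cv) ≡ᵇ r) ∧ not (proj₂ (proj₂ cv))) f) (oneTo n)

j : List ℕ → Series
j λ′ a = + countᵇ (λ T → isVST T ∧ eqList (vstContent (length a) T) a)
           (assignments (cells λ′) (concatMap (λ v → (v , false) ∷ (v , true) ∷ []) (oneTo (length a))))

-- j̃_λ = (-1)^{|λ|} j_λ(-x₁, -x₂, …)
jt : List ℕ → Series
jt λ′ a = sign (size λ′ + sum a) *ℤ j λ′ a

{-# OPTIONS --safe #-}
module Submission where

-- For a function f on partitions let (E f)(ν) = Σ_λ e(λ/ν) f(λ), where e counts elegant fillings.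
-- E intertwines the one-letter transfer operator of G with the removal of horizontal strips, so it
-- carries G to the Schur functions; dually, its transpose E^t carries the conjugate Schur functions to j.
-- The antipode maps s_ν to (-1)^{|ν|} s_{ν^t}, as follows from Σ_k (-1)^k h_{n-k} e_k = 0 and the
-- commutation of the strip operators.  E being injective, both parts reduce to the factorisation
-- E^t = R D E^{ct} D, where R counts the plane partitions of a skew shape in which cell (i , j),
-- 0-based, has label at most i + j, D is the diagonal matrix of the signs (-1)^{|λ|} and E^{ct} is E^t
-- conjugated by transposition.  Both R and E^t are products of elementary removals, one for each label,
-- respectively row, and a row-by-row exchange rule transforms one product into the other.

open import Defs
open import Data.Bool.Base using (Bool; true; false; if_then_else_; _∧_; _∨_; not; T)
open import Data.Bool.ListAction using (and; all; any)
open import Data.Bool.Properties using (∧-zeroʳ; ∧-identityʳ; ∧-assoc; ∧-comm; ∨-identityʳ)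
open import Data.Empty using (⊥; ⊥-elim)
open import Data.Integer.Base using (ℤ; +_; -_) renaming (_+_ to _+ℤ_; _*_ to _*ℤ_)
import Data.Integer.Properties as ℤ
open import Data.Integer.Tactic.RingSolver using (solve-∀)
open import Data.List.Base using (List; []; _∷_; _++_; _∷ʳ_; map; concatMap; upTo; applyUpTo; length; take; drop; foldr; filterᵇ; null; replicate; reverse)
import Data.List.Properties as ListP
open import Data.List.Relation.Unary.All using (All; []; _∷_)
open import Data.List.Relation.Unary.Linked using (Linked; []; [-]; _∷_)
open import Data.Maybe.Base using (Maybe; just; nothing)
open import Data.Nat.Base using (ℕ; zero; suc; _+_; _∸_; _≤_; _<_; _≥_; z≤n; s≤s; _≤ᵇ_; _<ᵇ_; _≡ᵇ_; _⊓_; _⊔_)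
open import Data.Nat.ListAction using (sum)
import Data.Nat.Properties as ℕ
open import Data.Nat.Properties using (+-mono-≤; +-monoʳ-≤; +-monoˡ-≤; +-suc; +-∸-assoc; 0∸n≡0; 1+n≢n; 1+n≰n; <-cmp; <-irrefl; <-trans; <-≤-connex; <-≤-trans; <ᵇ⇒<; <⇒<ᵇ; <⇒≢; <⇒≤; <⇒≱; >⇒≢; m+[n∸m]≡n; m+n∸m≡n; m+n∸n≡m; m+n≤o⇒m≤o∸n; m<m+n; m<n⇒m<1+n; m∸n+n≡m; m∸n≡0⇒m≤n; m∸n≤m; m≤m+n; m≤n+m; m≤n+m∸n; m≤n⇒m<n∨m≡n; m≤n⇒m∸n≡0; m≤n⇒m≤1+n; m≤n⇒m⊓n≡m; m≤n⇒m⊔n≡n; m≤n⊔m; m≤o∸n⇒m+n≤o; m≥n⇒m⊓n≡n; m≥n⇒m⊔n≡m; m⊓n≤m; m⊓n≤n; n<1+n; n∸n≡0; n≤1+n; n≮0; suc-injective; ∸-+-assoc; ≡⇒≡ᵇ; ≤-<-connex; ≤-<-trans; ≤-antisym; ≤-pred; ≤-refl; ≤-reflexive; ≤-total; ≤-trans; ≤⇒≤ᵇ; ⊓-glb; ⊓-idem)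
import Data.Nat.Tactic.RingSolver as ℕSolver
open import Data.Product.Base using (_×_; _,_; proj₁; proj₂; ∃)
open import Data.Sum.Base using (_⊎_; inj₁; inj₂)
open import Data.Unit.Base using (⊤; tt)
open import Function.Base using (_∘_; id)
import Algebra.Properties.CommutativeSemigroup ℤ.+-commutativeSemigroup as ℤ+
import Algebra.Properties.CommutativeSemigroup ℤ.*-commutativeSemigroup as ℤ*
import Algebra.Properties.CommutativeSemigroup ℕ.+-commutativeSemigroup as ℕ+
open import Relation.Binary.PropositionalEquality using (_≡_; _≢_; refl; sym; trans; cong; cong₂; subst; module ≡-Reasoning)
open ≡-Reasoning
open import Relation.Nullary using (¬_; yes; no)
open import Relation.Binary.Definitions using (Tri; tri<; tri≈; tri>)

-- Linear functionals and sums

-- Both counts belong to one family. With rows numbered from 0, replacing a label m in row i of an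
-- elegant filling by i + 1 - m turns column strictness into weak decrease, so e(λ/ν) counts plane
-- partitions whose labels in row i are at most i, while R allows i + j at (i , j). The bounds i +
-- (j ∸ p) interpolate: p = 0 gives R, and p = N gives E^t on shapes with at most N columns. Raising
-- p by one amounts to a factor D C D, where C removes cells from the columns after the first p + 1;
-- the product of these C is E^{ct}, and the inner signs cancel in pairs. The sum in (a) is
-- infinite, so all matrices are cut down to lists of N rows of length at most N. The removals only
-- shrink shapes and E keeps the first row and the number of rows, so the box is never left; i + j <
-- N + N inside it, which is why N + N levels suffice. Conjugation, signs and injectivity of E
-- thereby become statements about finite sums. Tableaux are read one letter at a time: the exponent
-- of the current letter is an argument of the functional, and identities between series become
-- identities between operators on shapes.

∑ : {A : Set} → List A → (A → ℤ) → ℤ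
∑ xs f = sumℤ (map f xs)

-- Every operator below is a finite linear combination of point evaluations. These three properties
-- give all interchanges of sums (`linear-∑`, `linear-cs`, `linear-ΣD` and others) without writing
-- out kernels; `respects` stands in for function extensionality.
record Linear {A : Set} (Φ : (A → ℤ) → ℤ) : Set where
  field
    respects : ∀ {f g} → (∀ x → f x ≡ g x) → Φ f ≡ Φ g
    additive : ∀ f g → Φ (λ x → f x +ℤ g x) ≡ Φ f +ℤ Φ g
    scalar   : ∀ c f → Φ (λ x → c *ℤ f x) ≡ c *ℤ Φ f
open Linear public

module _ {A : Set} where

  private variable
    Φ Ψ : (A → ℤ) → ℤ

  linear-eval : ∀ a → Linear {A} (λ f → f a)
  linear-eval a = record { respects = λ e → e a ; additive = λ _ _ → refl ; scalar = λ _ _ → refl }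

  linear-0 : Linear {A} (λ _ → + 0)
  linear-0 = record { respects = λ _ → refl ; additive = λ _ _ → refl ; scalar = λ c _ → sym (ℤ.*-zeroʳ c) }

  linear-+ : Linear Φ → Linear Ψ → Linear (λ f → Φ f +ℤ Ψ f)
  linear-+ {Φ} {Ψ} p q = record
    { respects = λ e → cong₂ _+ℤ_ (respects p e) (respects q e)
    ; additive = λ f g → trans (cong₂ _+ℤ_ (additive p f g) (additive q f g)) (ℤ+.interchange (Φ f) (Φ g) (Ψ f) (Ψ g))
    ; scalar = λ c f → trans (cong₂ _+ℤ_ (scalar p c f) (scalar q c f)) (sym (ℤ.*-distribˡ-+ c (Φ f) (Ψ f))) }

  linear-* : ∀ k → Linear Φ → Linear (λ f → k *ℤ Φ f)
  linear-* {Φ} k p = record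
    { respects = λ e → cong (k *ℤ_) (respects p e)
    ; additive = λ f g → trans (cong (k *ℤ_) (additive p f g)) (ℤ.*-distribˡ-+ k (Φ f) (Φ g))
    ; scalar = λ c f → trans (cong (k *ℤ_) (scalar p c f)) (swap k c (Φ f)) }
    where
    swap : ∀ a b c → a *ℤ (b *ℤ c) ≡ b *ℤ (a *ℤ c)
    swap = solve-∀

  linear-if : ∀ b → Linear Φ → Linear Ψ → Linear (λ f → if b then Φ f else Ψ f)
  linear-if true  p q = p
  linear-if false p q = q

  linear-zero : Linear Φ → Φ (λ _ → + 0) ≡ + 0
  linear-zero p = scalar p (+ 0) (λ _ → + 0)

  linear-neg : Linear Φ → ∀ f → Φ (λ x → - f x) ≡ - Φ f
  linear-neg {Φ} p f = trans (respects p (λ x → sym (ℤ.-1*i≡-i (f x)))) (trans (scalar p (- (+ 1)) f) (ℤ.-1*i≡-i (Φ f)))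

  linear-∑ : {B : Set} → Linear Φ → ∀ (ys : List B) (F : B → A → ℤ) → Φ (λ x → ∑ ys (λ y → F y x)) ≡ ∑ ys (λ y → Φ (F y))
  linear-∑ p []       F = linear-zero p
  linear-∑ {Φ} p (y ∷ ys) F = trans (additive p (F y) _) (cong (Φ (F y) +ℤ_) (linear-∑ p ys F))

  ∑-linear : {B : Set} (ys : List B) {Θ : B → (A → ℤ) → ℤ} → (∀ y → Linear (Θ y)) → Linear (λ f → ∑ ys (λ y → Θ y f))
  ∑-linear []       p = linear-0
  ∑-linear (y ∷ ys) p = linear-+ (p y) (∑-linear ys p)

  linear-∘ : {B : Set} {Θ : B → (A → ℤ) → ℤ} {Ψ : (B → ℤ) → ℤ} → Linear Ψ → (∀ x → Linear (Θ x)) → Linear (λ f → Ψ (λ x → Θ x f))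
  linear-∘ q p = record
    { respects = λ e → respects q (λ x → respects (p x) e)
    ; additive = λ f g → trans (respects q (λ x → additive (p x) f g)) (additive q _ _)
    ; scalar = λ c f → trans (respects q (λ x → scalar (p x) c f)) (scalar q c _) }

  linear-precomp : {B : Set} (h : A → B) → Linear Φ → Linear {B} (λ f → Φ (f ∘ h))
  linear-precomp h p = record { respects = λ e → respects p (λ x → e (h x)) ; additive = λ f g → additive p _ _ ; scalar = λ c f → scalar p c _ }

∑-cong : {A : Set} (xs : List A) {f g : A → ℤ} → (∀ x → f x ≡ g x) → ∑ xs f ≡ ∑ xs g
∑-cong []       e = refl
∑-cong (x ∷ xs) e = cong₂ _+ℤ_ (e x) (∑-cong xs e)

∑-is-linear : {A : Set} (xs : List A) → Linear (∑ xs)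
∑-is-linear xs = ∑-linear xs linear-eval

rng : ℕ → ℕ → (ℕ → ℤ) → ℤ
rng n zero    F = F n
rng n (suc d) F = rng n d F +ℤ F (n + suc d)

-- Σ x^{n+d-r} F r over n ≤ r ≤ n + d, where x acts by raising the exponent argument.
cs : (ℕ → ℕ → ℤ) → ℕ → ℕ → ℕ → ℤ
cs F n zero    e = F n e
cs F n (suc d) e = cs F n d (suc e) +ℤ F (n + suc d) e

rng-linear : {A : Set} {Θ : ℕ → (A → ℤ) → ℤ} → (∀ r → Linear (Θ r)) → ∀ n d → Linear (λ f → rng n d (λ r → Θ r f))
rng-linear p n zero    = p n
rng-linear p n (suc d) = linear-+ (rng-linear p n d) (p _)

linear-rng : {A : Set} {Φ : (A → ℤ) → ℤ} → Linear Φ → ∀ (F : ℕ → A → ℤ) n d → Φ (λ x → rng n d (λ r → F r x)) ≡ rng n d (λ r → Φ (F r))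
linear-rng p F n zero    = refl
linear-rng {Φ = Φ} p F n (suc d) = trans (additive p _ _) (cong (_+ℤ Φ (F (n + suc d))) (linear-rng p F n d))

cs-linear : {A : Set} {Θ : ℕ → ℕ → (A → ℤ) → ℤ} → (∀ r e → Linear (Θ r e)) → ∀ n d e → Linear (λ f → cs (λ r e → Θ r e f) n d e)
cs-linear p n zero    e = p n e
cs-linear p n (suc d) e = linear-+ (cs-linear p n d (suc e)) (p _ e)

linear-cs : {A : Set} {Φ : (A → ℤ) → ℤ} → Linear Φ → ∀ (F : ℕ → ℕ → A → ℤ) n d e → Φ (λ x → cs (λ r e → F r e x) n d e) ≡ cs (λ r e → Φ (F r e)) n d e
linear-cs p F n zero    e = refl
linear-cs {Φ = Φ} p F n (suc d) e = trans (additive p _ _) (cong (_+ℤ Φ (F (n + suc d) e)) (linear-cs p F n d (suc e)))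

rng-cong : ∀ n d {F G} → (∀ r → n ≤ r → r ≤ n + d → F r ≡ G r) → rng n d F ≡ rng n d G
rng-cong n zero    h = h n ≤-refl (m≤m+n n 0)
rng-cong n (suc d) h = cong₂ _+ℤ_ (rng-cong n d (λ r p q → h r p (≤-trans q (+-monoʳ-≤ n (n≤1+n d))))) (h _ (m≤m+n n _) ≤-refl)

cs-cong : ∀ n d {F G} → (∀ r → n ≤ r → r ≤ n + d → ∀ e → F r e ≡ G r e) → ∀ e → cs F n d e ≡ cs G n d e
cs-cong n zero    h e = h n ≤-refl (m≤m+n n 0) e
cs-cong n (suc d) h e = cong₂ _+ℤ_ (cs-cong n d (λ r p q → h r p (≤-trans q (+-monoʳ-≤ n (n≤1+n d)))) (suc e)) (h _ (m≤m+n n _) ≤-refl e)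

nxt : List ℕ → ℕ
nxt []      = 0
nxt (l ∷ _) = l

-- Partitions padded with zeros to a fixed length `L`, so that adding or removing cells never
-- changes the length. The bound on the first row is an index, and a tail inherits the row above it
-- as its bound.
data Box : ℕ → ℕ → List ℕ → Set where
  []  : ∀ {u} → Box 0 u []
  _∷_ : ∀ {L u r ρ} → r ≤ u → Box L r ρ → Box (suc L) u (r ∷ ρ)

Box-nxt : ∀ {L u ρ} → Box L u ρ → nxt ρ ≤ u
Box-nxt []      = z≤n
Box-nxt (p ∷ _) = p

Box-bound : ∀ {L u v ρ} → Box L u ρ → nxt ρ ≤ v → Box L v ρ
Box-bound []      _ = []
Box-bound (_ ∷ b) q = q ∷ b

Box-weaken : ∀ {L u v ρ} → Box L u ρ → u ≤ v → Box L v ρ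
Box-weaken b q = Box-bound b (≤-trans (Box-nxt b) q)

-- The number is the exponent of the current letter x: `f ρ e` is the value of a functional at x^e
-- ρ, and an operator acts on x^e `ls`. A coefficient is taken by choosing `f` supported on one
-- exponent.
Op : Set
Op = (List ℕ → ℕ → ℤ) → List ℕ → ℕ → ℤ

-- Transfer operators and elegant fillings

mk : Bool → ℕ → ℕ → (ℕ → ℤ) → ℕ → ℤ
mk b n r φ e = if b ∧ (n <ᵇ r) then φ e +ℤ - φ (suc e) else φ e

-- op false: removal of a horizontal strip, weighted x^{|λ/ρ|}; op true: the one-letter transfer
-- operator of G, with a further factor 1 - x for every row of ρ whose last cell may carry the letter too.
op : Bool → Op
op b f []       e = f [] e
op b f (l ∷ ls) e = cs (λ r → mk b (nxt ls) r (op b (λ ρ → f (r ∷ ρ)) ls)) (nxt ls) (l ∸ nxt ls) e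

U : List ℕ → ℕ → (List ℕ → ℤ) → ℤ
U []      l f = f []
U (r ∷ ρ) l f = rng r (l ∸ r) (λ t → U ρ t (λ τ → f (t ∷ τ)))

-- The recursion follows the labels i + 1 - m instead of the labels m. Cells with the value 1 are
-- outermost and may lie in every row but the first: `U` adds them last, under the bound `l`. The
-- recursive call on the tail supplies the larger values, which avoid one more row.
E : (List ℕ → ℤ) → List ℕ → ℤ
E f []      = f []
E f (l ∷ ν) = E (λ ρ → U ρ l (λ τ → f (l ∷ τ))) ν

true-T : ∀ {b} → b ≡ true → T b
true-T refl = tt

T-true : ∀ {a} → T a → a ≡ true
T-true {true} _ = refl

<ᵇ-true : ∀ {m n} → m < n → (m <ᵇ n) ≡ true
<ᵇ-true p = T-true (<⇒<ᵇ p)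

<ᵇ-false : ∀ {m n} → n ≤ m → (m <ᵇ n) ≡ false
<ᵇ-false {m} {n} p with m <ᵇ n in eq
... | false = refl
... | true  = ⊥-elim (<⇒≱ (<ᵇ⇒< m n (true-T eq)) p)

mk-refl : ∀ b n φ e → mk b n n φ e ≡ φ e
mk-refl b n φ e rewrite <ᵇ-false (≤-refl {n}) | ∧-zeroʳ b = refl

mk-< : ∀ {n r} φ e → n < r → mk true n r φ e ≡ φ e +ℤ - φ (suc e)
mk-< φ e p rewrite <ᵇ-true p = refl

mk-cong : ∀ b n r {φ ψ} → (∀ e → φ e ≡ ψ e) → ∀ e → mk b n r φ e ≡ mk b n r ψ e
mk-cong b n r h e with b ∧ (n <ᵇ r)
... | true  = cong₂ (λ x y → x +ℤ - y) (h e) (h (suc e))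
... | false = h e

linear-minus : {A : Set} {Φ Ψ : (A → ℤ) → ℤ} → Linear Φ → Linear Ψ → Linear (λ f → Φ f +ℤ - Ψ f)
linear-minus {Φ = Φ} {Ψ} p q = record
  { respects = λ e → cong₂ (λ x y → x +ℤ - y) (respects p e) (respects q e)
  ; additive = λ f g → trans (cong₂ (λ x y → x +ℤ - y) (additive p f g) (additive q f g)) (shuffle (Φ f) (Φ g) (Ψ f) (Ψ g))
  ; scalar = λ c f → trans (cong₂ (λ x y → x +ℤ - y) (scalar p c f) (scalar q c f)) (pull c (Φ f) (Ψ f)) }
  where
  shuffle : ∀ a b c d → (a +ℤ b) +ℤ - (c +ℤ d) ≡ (a +ℤ - c) +ℤ (b +ℤ - d)
  shuffle = solve-∀
  pull : ∀ k a b → k *ℤ a +ℤ - (k *ℤ b) ≡ k *ℤ (a +ℤ - b)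
  pull = solve-∀

mk-linear : {A : Set} {Θ : ℕ → (A → ℤ) → ℤ} → (∀ e → Linear (Θ e)) → ∀ b n r e → Linear (λ f → mk b n r (λ e → Θ e f) e)
mk-linear p b n r e with b ∧ (n <ᵇ r)
... | true  = linear-minus (p e) (p (suc e))
... | false = p e

linear-mk : {A : Set} {Φ : (A → ℤ) → ℤ} → Linear Φ → ∀ b n r (F : ℕ → A → ℤ) e →
  Φ (λ x → mk b n r (λ e → F e x) e) ≡ mk b n r (λ e → Φ (F e)) e
linear-mk {Φ = Φ} p b n r F e with b ∧ (n <ᵇ r)
... | true  = trans (additive p (F e) (λ x → - F (suc e) x)) (cong (Φ (F e) +ℤ_) (linear-neg p (F (suc e))))
... | false = refl

op-linear : ∀ b ls e → Linear {List ℕ × ℕ} (λ f → op b (λ ρ e → f (ρ , e)) ls e)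
op-linear b []       e = linear-eval ([] , e)
op-linear b (l ∷ ls) e =
  cs-linear (λ r → mk-linear (λ e → linear-precomp (λ (ρ , e) → (r ∷ ρ , e)) (op-linear b ls e)) b (nxt ls) r) (nxt ls) (l ∸ nxt ls) e

op-cong : ∀ b {L u ls} → Box L u ls → ∀ {f g} → (∀ {ρ} → Box L u ρ → ∀ e → f ρ e ≡ g ρ e) → ∀ e → op b f ls e ≡ op b g ls e
op-cong b [] h e = h [] e
op-cong b {ls = l ∷ ls} (p ∷ bx) h e =
  cs-cong (nxt ls) (l ∸ nxt ls) (λ r q q′ → mk-cong b (nxt ls) r
    (op-cong b (Box-bound bx q) (λ bρ → h (≤-trans (≤-trans q′ (≤-reflexive (m+[n∸m]≡n (Box-nxt bx)))) p ∷ bρ)))) e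

U-linear : ∀ ρ l → Linear (U ρ l)
U-linear []      l = linear-eval []
U-linear (r ∷ ρ) l = rng-linear (λ t → linear-precomp (t ∷_) (U-linear ρ t)) r (l ∸ r)

U-cong : ∀ {L u ρ} → Box L u ρ → ∀ {f g} → (∀ {τ} → Box L u τ → f τ ≡ g τ) → U ρ u f ≡ U ρ u g
U-cong [] h = h []
U-cong (p ∷ b) h = rng-cong _ _ (λ t q q′ → U-cong (Box-weaken b q) (λ bτ → h (≤-trans q′ (≤-reflexive (m+[n∸m]≡n p)) ∷ bτ)))

E-linear : ∀ ν → Linear (λ f → E f ν)
E-linear []      = linear-eval []
E-linear (l ∷ ν) = linear-∘ (E-linear ν) (λ ρ → linear-precomp (l ∷_) (U-linear ρ l))

E-cong : ∀ {L u ν} → Box L u ν → ∀ {f g} → (∀ {τ} → Box L u τ → f τ ≡ g τ) → E f ν ≡ E g ν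
E-cong [] h = h []
E-cong (p ∷ b) h = E-cong b (λ bρ → U-cong bρ (λ bτ → h (p ∷ bτ)))

-- Every λ contributing to (E f)(ν) has the same first row as ν.
E-cong-head : ∀ {L u ν} → Box L u ν → ∀ {f g} → (∀ {τ} → Box L u τ → nxt τ ≡ nxt ν → f τ ≡ g τ) → E f ν ≡ E g ν
E-cong-head []      h = h [] refl
E-cong-head (p ∷ b) h = E-cong b (λ bρ → U-cong bρ (λ bτ → h (p ∷ bτ) refl))

-- The intertwining of `E` with the transfer operator of G

private
  rng-rest : ℕ → ℕ → (ℕ → ℤ) → ℤ
  rng-rest k zero    F = + 0
  rng-rest k (suc i) F = rng-rest k i F +ℤ F (k + suc i)

  rng-rest-head : ∀ k i F → rng k i F ≡ F k +ℤ rng-rest k i F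
  rng-rest-head k zero    F = sym (ℤ.+-identityʳ (F k))
  rng-rest-head k (suc i) F = trans (cong (_+ℤ F (k + suc i)) (rng-rest-head k i F)) (ℤ.+-assoc (F k) (rng-rest k i F) (F (k + suc i)))

  rng-rest-shift : ∀ k i F → rng-rest k (suc i) F ≡ F (suc k) +ℤ rng-rest (suc k) i F
  rng-rest-shift k zero    F = trans (cong (λ z → + 0 +ℤ F z) (ℕ.+-comm k 1)) (ℤ.+-comm (+ 0) (F (suc k)))
  rng-rest-shift k (suc i) F = trans (cong₂ _+ℤ_ (rng-rest-shift k i F) (cong F (+-suc k (suc i)))) (ℤ.+-assoc (F (suc k)) (rng-rest (suc k) i F) (F (suc k + suc i)))

  head-sum : (ℕ → ℕ → ℤ) → ℕ → ℕ → ℕ → ℤ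
  head-sum Θ k zero    e = Θ k e
  head-sum Θ k (suc i) e = rng k i (λ t → Θ t e +ℤ - Θ t (suc e)) +ℤ Θ (k + suc i) e

  -- Once `r` is fixed, every t < r carries the factor 1 - x and t = r does not; this is the shape
  -- of `head-sum`.
  swap-sums : ∀ (Θ : ℕ → ℕ → ℕ → ℤ) k d e →
    rng k d (λ t → cs (λ r → mk true t r (Θ r t)) t ((k + d) ∸ t) e) ≡ cs (λ r e → head-sum (Θ r) k (r ∸ k) e) k d e
  swap-sums Θ k zero    e rewrite ℕ.+-identityʳ k | n∸n≡0 k = mk-refl true k (Θ k k) e
  swap-sums Θ k (suc d) e = begin
    rng k d (λ t → C t ((k + suc d) ∸ t) e) +ℤ C (k + suc d) ((k + suc d) ∸ (k + suc d)) e
      ≡⟨ cong₂ _+ℤ_ (rng-cong k d (λ t p q → unfold t q)) (trans (cong (λ z → C (k + suc d) z e) (n∸n≡0 (k + suc d))) (mk-refl true (k + suc d) (Θ (k + suc d) (k + suc d)) e)) ⟩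
    rng k d (λ t → C t ((k + d) ∸ t) (suc e) +ℤ (Θ (k + suc d) t e +ℤ - Θ (k + suc d) t (suc e))) +ℤ Θ (k + suc d) (k + suc d) e
      ≡⟨ cong (_+ℤ Θ (k + suc d) (k + suc d) e) (rng-+ k d) ⟩
    (rng k d (λ t → C t ((k + d) ∸ t) (suc e)) +ℤ rng k d (λ t → Θ (k + suc d) t e +ℤ - Θ (k + suc d) t (suc e))) +ℤ Θ (k + suc d) (k + suc d) e
      ≡⟨ ℤ.+-assoc (rng k d (λ t → C t ((k + d) ∸ t) (suc e))) _ _ ⟩
    rng k d (λ t → C t ((k + d) ∸ t) (suc e)) +ℤ head-sum (Θ (k + suc d)) k (suc d) e
      ≡⟨ cong₂ _+ℤ_ (swap-sums Θ k d (suc e)) (cong (λ z → head-sum (Θ (k + suc d)) k z e) (sym (m+n∸m≡n k (suc d)))) ⟩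
    cs (λ r e → head-sum (Θ r) k (r ∸ k) e) k d (suc e) +ℤ head-sum (Θ (k + suc d)) k ((k + suc d) ∸ k) e ∎
    where
    C : ℕ → ℕ → ℕ → ℤ
    C t m e = cs (λ r → mk true t r (Θ r t)) t m e
    rng-+ : ∀ n d {F G} → rng n d (λ t → F t +ℤ G t) ≡ rng n d F +ℤ rng n d G
    rng-+ n d {F} {G} = additive (rng-linear linear-eval n d) F G
    unfold : ∀ t → t ≤ k + d → C t ((k + suc d) ∸ t) e ≡ C t ((k + d) ∸ t) (suc e) +ℤ (Θ (k + suc d) t e +ℤ - Θ (k + suc d) t (suc e))
    unfold t q rewrite +-suc k d | +-∸-assoc 1 q =
      cong (C t ((k + d) ∸ t) (suc e) +ℤ_) (trans
        (cong (λ z → mk true t z (Θ z t) e) (trans (+-suc t _) (cong suc (m+[n∸m]≡n q))))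
        (mk-< (Θ (suc (k + d)) t) e (s≤s q)))

  -- The partial sums Ψ t = `cs B k′ (t ∸ k′)` satisfy Ψ (t + 1) = x Ψ t + B (t + 1). The factors 1
  -- - x therefore telescope, leaving Ψ at the left end and the single terms B t after it.
  telescope : ∀ (B : ℕ → ℕ → ℤ) k′ c i e →
    head-sum (λ t → cs B k′ (t ∸ k′)) (k′ + c) i e ≡ cs B k′ c e +ℤ rng-rest (k′ + c) i (λ t → B t e)
  telescope B k′ c zero    e = trans (cong (λ z → cs B k′ z e) (m+n∸m≡n k′ c)) (sym (ℤ.+-identityʳ _))
  telescope B k′ c (suc i) e = begin
    rng k i (λ t → Ψ t e +ℤ - Ψ t (suc e)) +ℤ Ψ (k + suc i) e
      ≡⟨ cong (rng k i (λ t → Ψ t e +ℤ - Ψ t (suc e)) +ℤ_) (Ψ-suc i) ⟩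
    rng k i (λ t → Ψ t e +ℤ - Ψ t (suc e)) +ℤ (Ψ (k + i) (suc e) +ℤ B (k + suc i) e)
      ≡⟨ sym (ℤ.+-assoc (rng k i (λ t → Ψ t e +ℤ - Ψ t (suc e))) _ _) ⟩
    (rng k i (λ t → Ψ t e +ℤ - Ψ t (suc e)) +ℤ Ψ (k + i) (suc e)) +ℤ B (k + suc i) e
      ≡⟨ cong (_+ℤ B (k + suc i) e) (trans (fold i) (telescope B k′ c i e)) ⟩
    (cs B k′ c e +ℤ rng-rest k i (λ t → B t e)) +ℤ B (k + suc i) e
      ≡⟨ ℤ.+-assoc (cs B k′ c e) _ _ ⟩
    cs B k′ c e +ℤ rng-rest k (suc i) (λ t → B t e) ∎
    where
    k = k′ + c
    Ψ : ℕ → ℕ → ℤ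
    Ψ t = cs B k′ (t ∸ k′)
    Ψ-suc : ∀ i → Ψ (k + suc i) e ≡ Ψ (k + i) (suc e) +ℤ B (k + suc i) e
    Ψ-suc i rewrite +-suc k i | +-∸-assoc 1 (≤-trans (m≤m+n k′ c) (m≤m+n k i)) =
      cong (λ z → Ψ (k + i) (suc e) +ℤ B z e) (trans (+-suc k′ _) (cong suc (m+[n∸m]≡n (≤-trans (m≤m+n k′ c) (m≤m+n k i)))))
    cancel : ∀ a b → (a +ℤ - b) +ℤ b ≡ a
    cancel = solve-∀
    cancel′ : ∀ r a b → (r +ℤ (a +ℤ - b)) +ℤ b ≡ r +ℤ a
    cancel′ = solve-∀
    fold : ∀ i → rng k i (λ t → Ψ t e +ℤ - Ψ t (suc e)) +ℤ Ψ (k + i) (suc e) ≡ head-sum Ψ k i e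
    fold zero rewrite ℕ.+-identityʳ k = cancel (Ψ k e) (Ψ k (suc e))
    fold (suc i) = cancel′ (rng k i (λ t → Ψ t e +ℤ - Ψ t (suc e))) (Ψ (k + suc i) e) (Ψ (k + suc i) (suc e))

  -- Summation by parts: the tails starting at q and at q + 1 differ by B q, so the factors 1 - x
  -- again leave x^{k-q} B q for q up to k = k′ + c, and the bare terms B t beyond.
  telescope′ : ∀ (B : ℕ → ℕ → ℤ) k′ c i e →
    cs (λ q → mk true k′ q (λ e → rng q ((k′ + c + i) ∸ q) (λ t → B t e))) k′ c e ≡ cs B k′ c e +ℤ rng-rest (k′ + c) i (λ t → B t e)
  telescope′ B k′ zero    i e rewrite ℕ.+-identityʳ k′ =
    trans (mk-refl true k′ (λ e → rng k′ ((k′ + i) ∸ k′) (λ t → B t e)) e) (trans (cong (λ z → rng k′ z (λ t → B t e)) (m+n∸m≡n k′ i)) (rng-rest-head k′ i _))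
  telescope′ B k′ (suc c) i e = begin
    C (k′ + suc c + i) (suc e) +ℤ mk true k′ (k′ + suc c) tot e
      ≡⟨ cong₂ _+ℤ_ (trans (cong (λ z → C z (suc e)) r≡) (telescope′ B k′ c (suc i) (suc e))) (mk-< tot e (m<m+n k′ (s≤s z≤n))) ⟩
    (cs B k′ c (suc e) +ℤ rng-rest (k′ + c) (suc i) (λ t → B t (suc e))) +ℤ (tot e +ℤ - tot (suc e))
      ≡⟨ cong₂ (λ x y → (cs B k′ c (suc e) +ℤ x) +ℤ (tot e +ℤ - y)) (rng-rest-shift (k′ + c) i _) (tot-eq (suc e)) ⟩
    (cs B k′ c (suc e) +ℤ (B (suc (k′ + c)) (suc e) +ℤ rng-rest (suc (k′ + c)) i (λ t → B t (suc e)))) +ℤ (tot e +ℤ - (B (k′ + suc c) (suc e) +ℤ rng-rest (k′ + suc c) i (λ t → B t (suc e))))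
      ≡⟨ cong₂ (λ x y → (cs B k′ c (suc e) +ℤ (B x (suc e) +ℤ rng-rest x i (λ t → B t (suc e)))) +ℤ (y +ℤ - (B (k′ + suc c) (suc e) +ℤ rng-rest (k′ + suc c) i (λ t → B t (suc e))))) (sym (+-suc k′ c)) (tot-eq e) ⟩
    (cs B k′ c (suc e) +ℤ X) +ℤ ((B (k′ + suc c) e +ℤ rng-rest (k′ + suc c) i (λ t → B t e)) +ℤ - X)
      ≡⟨ arrange (cs B k′ c (suc e)) X (B (k′ + suc c) e) _ ⟩
    (cs B k′ c (suc e) +ℤ B (k′ + suc c) e) +ℤ rng-rest (k′ + suc c) i (λ t → B t e) ∎
    where
    C : ℕ → ℕ → ℤ
    C r = cs (λ q → mk true k′ q (λ e → rng q (r ∸ q) (λ t → B t e))) k′ c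
    tot : ℕ → ℤ
    tot e = rng (k′ + suc c) ((k′ + suc c + i) ∸ (k′ + suc c)) (λ t → B t e)
    X = B (k′ + suc c) (suc e) +ℤ rng-rest (k′ + suc c) i (λ t → B t (suc e))
    r≡ : k′ + suc c + i ≡ k′ + c + suc i
    r≡ = trans (cong (_+ i) (+-suc k′ c)) (sym (+-suc (k′ + c) i))
    tot-eq : ∀ e → tot e ≡ B (k′ + suc c) e +ℤ rng-rest (k′ + suc c) i (λ t → B t e)
    tot-eq e = trans (cong (λ z → rng (k′ + suc c) z (λ t → B t e)) (m+n∸m≡n (k′ + suc c) i)) (rng-rest-head _ i _)
    arrange : ∀ a x b t → (a +ℤ x) +ℤ ((b +ℤ t) +ℤ - x) ≡ (a +ℤ b) +ℤ t
    arrange = solve-∀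

  -- For each new length `r` of the upper row both sides equal the sum of x^{k-s} B s over k′ ≤ s ≤
  -- k plus the sum of B t over k < t ≤ r. On the left the lower row is enlarged before the strip is
  -- removed, on the right afterwards; meanwhile the factor 1 - x passes from the upper row to the
  -- lower one.
  exchange : ∀ (B : ℕ → ℕ → ℕ → ℤ) {k′ k l} → k′ ≤ k → k ≤ l → ∀ e →
    rng k (l ∸ k) (λ t → cs (λ r → mk true t r (cs (B r) k′ (t ∸ k′))) t (l ∸ t) e)
    ≡ cs (λ r → cs (λ q → mk true k′ q (λ e → rng q (r ∸ q) (λ t → B r t e))) k′ (k ∸ k′)) k (l ∸ k) e
  exchange B {k′} {k} {l} p q e = begin
    rng k (l ∸ k) (λ t → cs (λ r → mk true t r (cs (B r) k′ (t ∸ k′))) t (l ∸ t) e)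
      ≡⟨ cong (λ z → rng k (l ∸ k) (λ t → cs (λ r → mk true t r (cs (B r) k′ (t ∸ k′))) t (z ∸ t) e)) (sym (m+[n∸m]≡n q)) ⟩
    rng k (l ∸ k) (λ t → cs (λ r → mk true t r (cs (B r) k′ (t ∸ k′))) t ((k + (l ∸ k)) ∸ t) e)
      ≡⟨ swap-sums (λ r t → cs (B r) k′ (t ∸ k′)) k (l ∸ k) e ⟩
    cs (λ r e → head-sum (λ t → cs (B r) k′ (t ∸ k′)) k (r ∸ k) e) k (l ∸ k) e
      ≡⟨ cs-cong k (l ∸ k) (λ r p′ _ e → inner r p′ e) e ⟩
    cs (λ r → cs (λ q → mk true k′ q (λ e → rng q (r ∸ q) (λ t → B r t e))) k′ (k ∸ k′)) k (l ∸ k) e ∎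
    where
    inner : ∀ r → k ≤ r → ∀ e → head-sum (λ t → cs (B r) k′ (t ∸ k′)) k (r ∸ k) e ≡ cs (λ q → mk true k′ q (λ e → rng q (r ∸ q) (λ t → B r t e))) k′ (k ∸ k′) e
    inner r p′ e = trans (cong (λ z → head-sum (λ t → cs (B r) k′ (t ∸ k′)) z (r ∸ k) e) (sym k≡))
      (trans (telescope (B r) k′ (k ∸ k′) (r ∸ k) e) (trans (sym (telescope′ (B r) k′ (k ∸ k′) (r ∸ k) e))
        (cong (λ z → cs (λ q → mk true k′ q (λ e → rng q (z ∸ q) (λ t → B r t e))) k′ (k ∸ k′) e) (trans (cong (_+ (r ∸ k)) k≡) (m+[n∸m]≡n p′)))))
      where
      k≡ : k′ + (k ∸ k′) ≡ k
      k≡ = m+[n∸m]≡n p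

-- Each use of `exchange` moves the factor 1 - x down one row, and nothing can absorb the factor of
-- the last row. For a functional supported on shapes with at most `k` rows the last of k + 1 rows
-- must be emptied, and an empty row carries no factor.
VanishesBelow : ℕ → (List ℕ → ℕ → ℤ) → Set
VanishesBelow k f = ∀ ρ e → 0 < at ρ k → f ρ e ≡ + 0

-- By `exchange` every row hands its factor 1 - x to the row below. The first row is left with a
-- plain horizontal strip, the remaining rows with `op true` applied to the enlarged functional.
U-op : ∀ {k l κ} → Box k l κ → ∀ {f} → VanishesBelow k f → ∀ e →
  U κ l (λ ls → op true f (l ∷ ls) e) ≡ cs (λ r → op true (λ σ e → U σ r (λ τ → f (r ∷ τ) e)) κ) (nxt κ) (l ∸ nxt κ) e
U-op {l = l} [] {f} v e = cs-cong 0 l {G = λ r e → f (r ∷ []) e} row e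
  where
  row : ∀ r → 0 ≤ r → r ≤ l → ∀ e → mk true 0 r (f (r ∷ [])) e ≡ f (r ∷ []) e
  row zero    _ _ e = refl
  row (suc r) _ _ e rewrite v (suc r ∷ []) (suc e) (s≤s z≤n) = ℤ.+-identityʳ _
U-op {l = l} {κ = k ∷ κ} (p ∷ b) {f} v e = begin
  rng k (l ∸ k) (λ t → U κ t (λ ls → op true f (l ∷ t ∷ ls) e))
    ≡⟨ rng-cong k (l ∸ k) (λ t q _ → column t q) ⟩
  rng k (l ∸ k) (λ t → cs (λ r → mk true t r (cs (B r) k′ (t ∸ k′))) t (l ∸ t) e)
    ≡⟨ exchange B (Box-nxt b) p e ⟩
  cs (λ r → cs (λ q → mk true k′ q (λ e → rng q (r ∸ q) (λ t → B r t e))) k′ (k ∸ k′)) k (l ∸ k) e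
    ≡⟨ cs-cong k (l ∸ k) (λ r _ _ → cs-cong k′ (k ∸ k′) (λ q _ _ → mk-cong true k′ q (λ e → sym
         (linear-rng (op-linear true κ e) (λ t (σ , e) → U σ t (λ τ → f (r ∷ t ∷ τ) e)) q (r ∸ q))))) e ⟩
  cs (λ r → op true (λ σ e → U σ r (λ τ → f (r ∷ τ) e)) (k ∷ κ)) k (l ∸ k) e ∎
  where
  k′ = nxt κ
  B : ℕ → ℕ → ℕ → ℤ
  B r t e = op true (λ σ e → U σ t (λ τ → f (r ∷ t ∷ τ) e)) κ e
  column : ∀ t → k ≤ t → U κ t (λ ls → op true f (l ∷ t ∷ ls) e) ≡ cs (λ r → mk true t r (cs (B r) k′ (t ∸ k′))) t (l ∸ t) e
  column t q = trans
    (linear-cs (U-linear κ t) (λ r e ls → mk true t r (op true (λ ρ → f (r ∷ ρ)) (t ∷ ls)) e) t (l ∸ t) e)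
    (cs-cong t (l ∸ t) (λ r _ _ e → trans
      (linear-mk (U-linear κ t) true t r (λ e ls → op true (λ ρ → f (r ∷ ρ)) (t ∷ ls) e) e)
      (mk-cong true t r (U-op (Box-weaken b q) (λ ρ → v (r ∷ ρ))) e)) e)

E-op : ∀ {k u ν} → Box (suc k) u ν → ∀ {f} → VanishesBelow k f → ∀ e →
  E (λ ls → op true f ls e) ν ≡ op false (λ ρ e → E (λ ls → f ls e) ρ) ν e
E-op {ν = l ∷ []} (p ∷ []) {f} v e = U-op {l = l} [] v e
E-op {ν = l ∷ n ∷ ν} (p ∷ b@(p′ ∷ _)) {f} v e = begin
  E (λ κ → U κ l (λ ls → op true f (l ∷ ls) e)) (n ∷ ν)
    -- `E` keeps the first row, so `nxt κ` is the constant `n`; the sum can leave `E` only when its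
    -- bounds no longer depend on `κ`.
    ≡⟨ E-cong-head b (λ {κ} bκ q → trans (U-op bκ v e) (cong (λ z → cs (λ r → op true (g r) κ) z (l ∸ z) e) q)) ⟩
  E (λ κ → cs (λ r → op true (g r) κ) n (l ∸ n) e) (n ∷ ν)
    ≡⟨ linear-cs (E-linear (n ∷ ν)) (λ r e κ → op true (g r) κ e) n (l ∸ n) e ⟩
  cs (λ r e → E (λ κ → op true (g r) κ e) (n ∷ ν)) n (l ∸ n) e
    ≡⟨ cs-cong n (l ∸ n) (λ r _ _ e → E-op b (g-vanishes r) e) e ⟩
  cs (λ r e → op false (λ ρ e → E (λ ls → f ls e) (r ∷ ρ)) (n ∷ ν) e) n (l ∸ n) e ∎
  where
  g : ℕ → List ℕ → ℕ → ℤ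
  g r σ e = U σ r (λ τ → f (r ∷ τ) e)
  U-vanishes : ∀ k σ r {h : List ℕ → ℤ} → (∀ ρ → 0 < at ρ k → h ρ ≡ + 0) → 0 < at σ k → U σ r h ≡ + 0
  U-vanishes zero (s ∷ σ) r h0 p = trans (rng-cong s (r ∸ s) (λ t q _ → trans (respects (U-linear σ t) (λ τ → h0 (t ∷ τ) (≤-trans p q))) (linear-zero (U-linear σ t)))) (linear-zero (rng-linear {A = ℕ} linear-eval s (r ∸ s)))
  U-vanishes (suc k) (s ∷ σ) r h0 p = trans (rng-cong s (r ∸ s) (λ t q _ → U-vanishes k σ t (λ τ → h0 (t ∷ τ)) p)) (linear-zero (rng-linear {A = ℕ} linear-eval s (r ∸ s)))
  g-vanishes : ∀ r → VanishesBelow _ (g r)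
  g-vanishes r σ e p = U-vanishes _ σ r (λ τ → v (r ∷ τ) e) p

-- Transposed operators

pre : ℕ → (ℕ → ℤ) → ℤ
pre zero    F = + 0
pre (suc n) F = F n

-- Removal of a vertical strip; u is the new length of the row above.  A removed cell has weight m x;
-- if the cell above it is removed too, the weight is m x + g.  (m , g) = (1 , 0) is the one-letter
-- transfer operator of the conjugate Schur functions, (1 , 1) the one of j.
tr : ℤ → ℤ → ℕ → Op
tr m g u f []       e = f [] e
tr m g u f (l ∷ ls) e =
  if l ≤ᵇ u
  then tr m g l (λ ρ → f (l ∷ ρ)) ls e +ℤ m *ℤ pre l (λ k → tr m g k (λ ρ → f (k ∷ ρ)) ls (suc e))
  else m *ℤ tr m g u (λ ρ → f (u ∷ ρ)) ls (suc e) +ℤ g *ℤ tr m g u (λ ρ → f (u ∷ ρ)) ls e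

-- The transpose of `U`, as `Dn-adjoint` makes precise.
Dn : ℕ → List ℕ → (List ℕ → ℤ) → ℤ
Dn u []       g = g []
Dn u (l ∷ ls) g = rng 0 (u ⊓ l) (λ r → Dn r ls (λ τ → g (r ∷ τ)))

-- The transpose of E on lists of length L.
ET : ℕ → (List ℕ → ℤ) → List ℕ → ℤ
ET (suc L) g (l ∷ ls) = Dn l ls (ET L (λ τ → g (l ∷ τ)))
ET _       g ls       = g ls

pre-linear : {A : Set} {Θ : ℕ → (A → ℤ) → ℤ} → (∀ r → Linear (Θ r)) → ∀ n → Linear (λ f → pre n (λ r → Θ r f))
pre-linear p zero    = linear-0
pre-linear p (suc n) = p n

linear-pre : {A : Set} {Φ : (A → ℤ) → ℤ} → Linear Φ → ∀ (F : ℕ → A → ℤ) n → Φ (λ x → pre n (λ r → F r x)) ≡ pre n (λ r → Φ (F r))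
linear-pre p F zero    = linear-zero p
linear-pre p F (suc n) = refl

pre-cong : ∀ n {F G} → (∀ r → suc r ≡ n → F r ≡ G r) → pre n F ≡ pre n G
pre-cong zero    h = refl
pre-cong (suc n) h = h n refl

tr-linear : ∀ m g u ls e → Linear {List ℕ × ℕ} (λ f → tr m g u (λ ρ e → f (ρ , e)) ls e)
tr-linear m g u []       e = linear-eval ([] , e)
tr-linear m g u (l ∷ ls) e = linear-if (l ≤ᵇ u)
  (linear-+ (row l l e) (linear-* m (pre-linear (λ k → row k k (suc e)) l)))
  (linear-+ (linear-* m (row u u (suc e))) (linear-* g (row u u e)))
  where
  row : ∀ k v e → Linear {List ℕ × ℕ} (λ f → tr m g v (λ ρ e → f (k ∷ ρ , e)) ls e)
  row k v e = linear-precomp (λ (ρ , e) → (k ∷ ρ , e)) (tr-linear m g v ls e)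

Dn-linear : ∀ u ls → Linear (Dn u ls)
Dn-linear u []       = linear-eval []
Dn-linear u (l ∷ ls) = rng-linear (λ r → linear-precomp (r ∷_) (Dn-linear r ls)) 0 (u ⊓ l)

ET-linear : ∀ L ls → Linear (λ g → ET L g ls)
ET-linear zero    ls       = linear-eval ls
ET-linear (suc L) []       = linear-eval []
ET-linear (suc L) (l ∷ ls) = linear-∘ (Dn-linear l ls) (λ τ → linear-precomp (l ∷_) (ET-linear L τ))

Dn-cong : ∀ {L v ls} u → Box L v ls → ∀ {f g} → (∀ {τ} → Box L (u ⊓ v) τ → f τ ≡ g τ) → Dn u ls f ≡ Dn u ls g
Dn-cong u [] h = h []
Dn-cong u (_∷_ {r = l} p b) h = rng-cong 0 (u ⊓ l) (λ r _ q → Dn-cong r b (λ bτ →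
  h (≤-trans q (ℕ.⊓-monoʳ-≤ u p) ∷ Box-weaken bτ (m⊓n≤m r l))))

Dn-bound : ∀ {L u v ls} → Box L u ls → u ≤ v → ∀ g → Dn v ls g ≡ Dn u ls g
Dn-bound [] q g = refl
Dn-bound (_∷_ {r = l} {ρ} p b) q g = cong (λ z → rng 0 z (λ r → Dn r ρ (λ τ → g (r ∷ τ)))) (trans (m≥n⇒m⊓n≡n (≤-trans p q)) (sym (m≥n⇒m⊓n≡n p)))

ET-cong : ∀ {L u ls} → Box L u ls → ∀ {f g} → (∀ {τ} → Box L u τ → f τ ≡ g τ) → ET L f ls ≡ ET L g ls
ET-cong [] h = h []
ET-cong {u = u} (_∷_ {r = l} p b) h = Dn-cong l b (λ bτ → ET-cong (Box-weaken bτ (m⊓n≤m l l)) (λ bρ → h (p ∷ bρ)))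

≤ᵇ-true : ∀ {m n} → m ≤ n → (m ≤ᵇ n) ≡ true
≤ᵇ-true p = T-true (≤⇒≤ᵇ p)

≤ᵇ-false : ∀ {m n} → n < m → (m ≤ᵇ n) ≡ false
≤ᵇ-false {suc m} p = <ᵇ-false (≤-pred p)

tr-free : ∀ m g {l u} ls f e → l ≤ u → tr m g u f (l ∷ ls) e ≡
  tr m g l (λ ρ → f (l ∷ ρ)) ls e +ℤ m *ℤ pre l (λ k → tr m g k (λ ρ → f (k ∷ ρ)) ls (suc e))
tr-free m g ls f e p rewrite ≤ᵇ-true p = refl

tr-forced : ∀ m g u ls f e → tr m g u f (suc u ∷ ls) e ≡
  m *ℤ tr m g u (λ ρ → f (u ∷ ρ)) ls (suc e) +ℤ g *ℤ tr m g u (λ ρ → f (u ∷ ρ)) ls e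
tr-forced m g u ls f e rewrite ≤ᵇ-false (n<1+n u) = refl

op-shift : ∀ b f ls e → op b (λ ρ e → f ρ (suc e)) ls e ≡ op b f ls (suc e)
op-shift b f []       e = refl
op-shift b f (l ∷ ls) e = go (l ∸ nxt ls) e
  where
  row : ∀ r e → mk b (nxt ls) r (op b (λ ρ e → f (r ∷ ρ) (suc e)) ls) e ≡ mk b (nxt ls) r (op b (λ ρ → f (r ∷ ρ)) ls) (suc e)
  row r e with b ∧ (nxt ls <ᵇ r)
  ... | true  = cong₂ (λ x y → x +ℤ - y) (op-shift b (λ ρ → f (r ∷ ρ)) ls e) (op-shift b (λ ρ → f (r ∷ ρ)) ls (suc e))
  ... | false = op-shift b (λ ρ → f (r ∷ ρ)) ls e
  go : ∀ d e → cs (λ r → mk b (nxt ls) r (op b (λ ρ e → f (r ∷ ρ) (suc e)) ls)) (nxt ls) d e ≡ cs (λ r → mk b (nxt ls) r (op b (λ ρ → f (r ∷ ρ)) ls)) (nxt ls) d (suc e)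
  go zero    e = row (nxt ls) e
  go (suc d) e = cong₂ _+ℤ_ (go d (suc e)) (row _ e)

-- Removing a horizontal strip and then, with signs, a vertical strip telescopes to the identity.
signed : ℕ → Op
signed = tr (- (+ 1)) (+ 0)

cs-telescope : ∀ (h : ℕ → ℕ → ℤ) n d e → (∀ k e → suc k ≡ n → h k e ≡ + 0) →
  cs (λ r e → h r e +ℤ - (+ 1) *ℤ pre r (λ k → h k (suc e))) n d e ≡ h (n + d) e
cs-telescope h zero    zero    e z = ℤ.+-identityʳ _
cs-telescope h (suc n) zero    e z rewrite z n (suc e) refl | ℕ.+-identityʳ n = ℤ.+-identityʳ _
cs-telescope h n       (suc d) e z rewrite cs-telescope h n d (suc e) z | +-suc n d = cancel (h (n + d) (suc e)) _
  where
  cancel : ∀ a b → a +ℤ (b +ℤ - (+ 1) *ℤ a) ≡ b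
  cancel = solve-∀

mutual
  strip-row : ∀ v f ls r e → r ≤ v → op false (λ ρ → signed v f (r ∷ ρ)) ls e ≡
    op false (signed r (λ ρ → f (r ∷ ρ))) ls e +ℤ - (+ 1) *ℤ pre r (λ k → op false (signed k (λ ρ → f (k ∷ ρ))) ls (suc e))
  strip-row v f ls r e p = trans
    (respects lin (λ (ρ , e) → tr-free (- (+ 1)) (+ 0) ρ f e p))
    (trans (additive lin (λ (ρ , e) → signed r (λ ρ → f (r ∷ ρ)) ρ e) (λ (ρ , e) → - (+ 1) *ℤ pre r (λ k → signed k (λ ρ → f (k ∷ ρ)) ρ (suc e))))
      (cong (op false (signed r (λ ρ → f (r ∷ ρ))) ls e +ℤ_)
        (trans (scalar lin (- (+ 1)) (λ (ρ , e) → pre r (λ k → signed k (λ ρ → f (k ∷ ρ)) ρ (suc e))))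
          (cong (- (+ 1) *ℤ_) (trans (linear-pre lin (λ k (ρ , e) → signed k (λ ρ → f (k ∷ ρ)) ρ (suc e)) r)
            (pre-cong r (λ k _ → op-shift false (signed k (λ ρ → f (k ∷ ρ))) ls e)))))))
    where
    lin = op-linear false ls e

  -- This is H(x) E(-x) = 1, for the generating functions of the h_k and e_k, acting on shapes. The
  -- summand for a first row `r` is h r - x h (r - 1), so the sum telescopes to h at the full
  -- length; the boundary term h (n - 1), with n the next row, vanishes by `op-signed-forced`.
  op-signed : ∀ {L u v ls} → Box L u ls → u ≤ v → ∀ f e → op false (signed v f) ls e ≡ f ls e
  op-signed [] q f e = refl
  op-signed {v = v} {ls = l ∷ ls} (p ∷ b) q f e = begin
    cs (λ r → op false (λ ρ → signed v f (r ∷ ρ)) ls) n (l ∸ n) e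
      ≡⟨ cs-cong n (l ∸ n) (λ r _ q′ e → strip-row v f ls r e (≤-trans (≤-trans q′ (≤-reflexive n+)) (≤-trans p q))) e ⟩
    cs (λ r e → h r e +ℤ - (+ 1) *ℤ pre r (λ k → h k (suc e))) n (l ∸ n) e
      ≡⟨ cs-telescope h n (l ∸ n) e (λ { k e eq → op-signed-forced (Box-bound b (≤-reflexive (sym eq))) (sym eq) _ e }) ⟩
    h (n + (l ∸ n)) e
      ≡⟨ cong (λ z → h z e) n+ ⟩
    h l e
      ≡⟨ op-signed b ≤-refl _ e ⟩
    f (l ∷ ls) e ∎
    where
    n = nxt ls
    n+ = m+[n∸m]≡n (Box-nxt b)
    h : ℕ → ℕ → ℤ
    h q e = op false (signed q (λ ρ → f (q ∷ ρ))) ls e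

  -- The lengths r ≤ v of the first row telescope to x h v, and the forced choice r = v + 1
  -- contributes -x h v. If the next row is equally long, only the forced choice remains and the
  -- claim passes to that row.
  op-signed-forced : ∀ {L v ls} → Box L (suc v) ls → nxt ls ≡ suc v → ∀ f e → op false (signed v f) ls e ≡ + 0
  op-signed-forced {v = v} {ls = .(suc v) ∷ ls} (p ∷ b) refl f e with m≤n⇒m<n∨m≡n (Box-nxt b)
  ... | inj₂ n≡ rewrite n≡ | n∸n≡0 v = trans (forced-row e) (cong (λ z → - (+ 1) *ℤ z) (op-signed-forced (Box-bound b (≤-reflexive n≡)) n≡ _ (suc e)))
    where
    forced-row : ∀ e → op false (λ ρ → signed v f (suc v ∷ ρ)) ls e ≡ - (+ 1) *ℤ op false (signed v (λ ρ → f (v ∷ ρ))) ls (suc e)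
    forced-row e = trans (respects (op-linear false ls e) (λ (ρ , e) → trans (tr-forced (- (+ 1)) (+ 0) v ρ f e) (ℤ.+-identityʳ _)))
      (trans (scalar (op-linear false ls e) (- (+ 1)) (λ (ρ , e) → signed v (λ ρ → f (v ∷ ρ)) ρ (suc e))) (cong (- (+ 1) *ℤ_) (op-shift false _ ls e)))
  ... | inj₁ (s≤s n≤v) = begin
    cs row n (suc v ∸ n) e
      ≡⟨ cong (λ z → cs row n z e) (+-∸-assoc 1 n≤v) ⟩
    cs row n (v ∸ n) (suc e) +ℤ row (n + suc (v ∸ n)) e
      ≡⟨ cong₂ _+ℤ_ (trans (cs-cong n (v ∸ n) (λ r _ q′ e → strip-row v f ls r e (≤-trans q′ (≤-reflexive n+))) (suc e))
           (trans (cs-telescope h n (v ∸ n) (suc e) (λ { k e eq → op-signed-forced (Box-bound b (≤-reflexive (sym eq))) (sym eq) _ e })) (cong (λ z → h z (suc e)) n+)))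
           (trans (cong (λ z → row z e) (trans (+-suc n _) (cong suc n+))) (forced-row e)) ⟩
    h v (suc e) +ℤ - (+ 1) *ℤ h v (suc e)
      ≡⟨ cancel (h v (suc e)) ⟩
    + 0 ∎
    where
    n = nxt ls
    n+ = m+[n∸m]≡n n≤v
    row h : ℕ → ℕ → ℤ
    row r = op false (λ ρ → signed v f (r ∷ ρ)) ls
    h q e = op false (signed q (λ ρ → f (q ∷ ρ))) ls e
    cancel : ∀ a → a +ℤ - (+ 1) *ℤ a ≡ + 0
    cancel = solve-∀
    forced-row : ∀ e → row (suc v) e ≡ - (+ 1) *ℤ h v (suc e)
    forced-row e = trans (respects (op-linear false ls e) (λ (ρ , e) → trans (tr-forced (- (+ 1)) (+ 0) v ρ f e) (ℤ.+-identityʳ _)))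
      (trans (scalar (op-linear false ls e) (- (+ 1)) (λ (ρ , e) → signed v (λ ρ → f (v ∷ ρ)) ρ (suc e))) (cong (- (+ 1) *ℤ_) (op-shift false _ ls e)))

transferV transferB : ℕ → Op
transferV = tr (+ 1) (+ 0)
transferB = tr (+ 1) (+ 1)

sum< : ℕ → (ℕ → ℤ) → ℤ
sum< zero    F = + 0
sum< (suc n) F = sum< n F +ℤ F n

rng-sum< : ∀ n F → rng 0 n F ≡ sum< (suc n) F
rng-sum< zero    F = sym (ℤ.+-identityˡ (F 0))
rng-sum< (suc n) F = cong (_+ℤ F (suc n)) (rng-sum< n F)

sum<-+ : ∀ n F G → sum< n (λ r → F r +ℤ G r) ≡ sum< n F +ℤ sum< n G
sum<-+ zero    F G = refl
sum<-+ (suc n) F G = trans (cong (_+ℤ (F n +ℤ G n)) (sum<-+ n F G)) (ℤ+.interchange (sum< n F) (sum< n G) (F n) (G n))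

sum<-cong : ∀ n {F G} → (∀ r → r < n → F r ≡ G r) → sum< n F ≡ sum< n G
sum<-cong zero    h = refl
sum<-cong (suc n) h = cong₂ _+ℤ_ (sum<-cong n (λ r p → h r (m≤n⇒m≤1+n p))) (h n ≤-refl)

-- Σ (1+x)^k g(ν) over ν ⊆ λ with ν₀ ≤ u, where k is the number of rows with ν_i < λ_i.
Cn : ℕ → List ℕ → (List ℕ → ℕ → ℤ) → ℕ → ℤ
Cn u []       g e = g [] e
Cn u (l ∷ ls) g e = rng 0 (u ⊓ l) (λ r → let c = Cn r ls (λ τ → g (r ∷ τ)) in if r <ᵇ l then c e +ℤ c (suc e) else c e)

module _ (ls : List ℕ) (g : List ℕ → ℕ → ℤ) where

  private
    single single² : ℕ → ℕ → ℤ
    single r e = Cn r ls (λ τ → g (r ∷ τ)) e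
    single² r e = single r e +ℤ single r (suc e)

  Cn-< : ∀ u l e → u < l → Cn u (l ∷ ls) g e ≡ sum< (suc u) (λ r → single² r e)
  Cn-< u l e p rewrite m≤n⇒m⊓n≡m (<⇒≤ p) = trans (rng-sum< u _) (sum<-cong (suc u) strict)
    where
    strict : ∀ r → r < suc u → (if r <ᵇ l then single² r e else single r e) ≡ single² r e
    strict r q rewrite <ᵇ-true (<-≤-trans q p) = refl

  Cn-≥ : ∀ u l e → l ≤ u → Cn u (l ∷ ls) g e ≡ sum< l (λ r → single² r e) +ℤ single l e
  Cn-≥ u l e p rewrite m≥n⇒m⊓n≡n p = trans (rng-sum< l _) (cong₂ _+ℤ_ (sum<-cong l strict) last)
    where
    strict : ∀ r → r < l → (if r <ᵇ l then single² r e else single r e) ≡ single² r e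
    strict r q rewrite <ᵇ-true q = refl
    last : (if l <ᵇ l then single² l e else single l e) ≡ single l e
    last rewrite <ᵇ-false (≤-refl {l}) = refl

module _ where
  sum<-interleave : ∀ n (A B : ℕ → ℤ) → rng 0 n (λ k → A k +ℤ + 1 *ℤ pre k B) ≡ sum< n (λ k → A k +ℤ B k) +ℤ A n
  sum<-interleave zero    A B = ℤ.+-comm (A 0) (+ 0)
  sum<-interleave (suc n) A B = trans (cong (_+ℤ (A (suc n) +ℤ + 1 *ℤ B n)) (sum<-interleave n A B))
    (arrange (sum< n (λ k → A k +ℤ B k)) (A n) (A (suc n)) (B n))
    where
    arrange : ∀ s a a′ b → (s +ℤ a) +ℤ (a′ +ℤ + 1 *ℤ b) ≡ (s +ℤ (a +ℤ b)) +ℤ a′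
    arrange = solve-∀

  1*+1* : ∀ a b → + 1 *ℤ a +ℤ + 1 *ℤ b ≡ b +ℤ a
  1*+1* = solve-∀

  +1* : ∀ a b → a +ℤ + 1 *ℤ b ≡ a +ℤ b
  +1* = solve-∀

-- Fix the final shape ν. A row with ν_i < λ_i either keeps or loses its last cell to the strip,
-- with weights 1 and x, or is forced with weight x + 1; both cases give 1 + x. A row with ν_i = λ_i
-- gives 1. This is the purpose of the glued weight of `transferB`.
transferB-Dn : ∀ {L r v ls} → r ≤ v → Box L (suc v) ls → ∀ g e →
  transferB v (λ σ e → Dn r σ (λ τ → g τ e)) ls e ≡ Cn r ls g e
transferB-Dn q [] g e = refl
transferB-Dn {L = suc L} {r = r} {v} {ls = l ∷ ls} q (p ∷ b) g e with m≤n⇒m<n∨m≡n p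
... | inj₂ refl = begin
  transferB v f (suc v ∷ ls) e
    ≡⟨ tr-forced (+ 1) (+ 1) v ls f e ⟩
  + 1 *ℤ row v (suc e) +ℤ + 1 *ℤ row v e
    ≡⟨ 1*+1* (row v (suc e)) (row v e) ⟩
  row v e +ℤ row v (suc e)
    ≡⟨ cong₂ _+ℤ_ (part v e b q) (part v (suc e) b q) ⟩
  sum< (suc r) (λ k → single k e) +ℤ sum< (suc r) (λ k → single k (suc e))
    ≡⟨ sym (sum<-+ (suc r) _ _) ⟩
  sum< (suc r) (λ k → single k e +ℤ single k (suc e))
    ≡⟨ sym (Cn-< ls g r (suc v) e (s≤s q)) ⟩
  Cn r (suc v ∷ ls) g e ∎
  where
  f : List ℕ → ℕ → ℤ
  f σ e = Dn r σ (λ τ → g τ e)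
  single row : ℕ → ℕ → ℤ
  single k e = Cn k ls (λ τ → g (k ∷ τ)) e
  row k e = transferB k (λ ρ → f (k ∷ ρ)) ls e
  part : ∀ k e → Box L (suc k) ls → r ≤ k → row k e ≡ sum< (suc r) (λ q → single q e)
  part k e b q rewrite m≤n⇒m⊓n≡m q = trans
    (linear-rng (tr-linear (+ 1) (+ 1) k ls e) (λ q (σ , e) → Dn q σ (λ τ → g (q ∷ τ) e)) 0 r)
    (trans (rng-cong 0 r (λ q′ _ p′ → transferB-Dn (≤-trans p′ q) b (λ τ → g (q′ ∷ τ)) e)) (rng-sum< r _))
... | inj₁ (s≤s l≤v) = trans (tr-free (+ 1) (+ 1) ls f e l≤v) (go l b)
  where
  f : List ℕ → ℕ → ℤ
  f σ e = Dn r σ (λ τ → g τ e)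
  single row : ℕ → ℕ → ℤ
  single k e = Cn k ls (λ τ → g (k ∷ τ)) e
  row k e = transferB k (λ ρ → f (k ∷ ρ)) ls e
  part : ∀ k e → Box L (suc k) ls → row k e ≡ sum< (suc (r ⊓ k)) (λ q → single q e)
  part k e b = trans
    (linear-rng (tr-linear (+ 1) (+ 1) k ls e) (λ q (σ , e) → Dn q σ (λ τ → g (q ∷ τ) e)) 0 (r ⊓ k))
    (trans (rng-cong 0 (r ⊓ k) (λ q′ _ p′ → transferB-Dn (≤-trans p′ (m⊓n≤n r k)) b (λ τ → g (q′ ∷ τ)) e)) (rng-sum< (r ⊓ k) _))
  go : ∀ l → Box L l ls → row l e +ℤ + 1 *ℤ pre l (λ k → row k (suc e)) ≡ Cn r (l ∷ ls) g e
  go zero b = trans (cong₂ _+ℤ_ (trans (part 0 e (Box-weaken b z≤n)) (cong (λ z → sum< (suc z) (λ q → single q e)) (ℕ.⊓-zeroʳ r))) refl)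
    (trans (ℤ.+-identityʳ _) (sym (Cn-≥ ls g r 0 e z≤n)))
  go (suc l) b with ≤-total r l
  ... | inj₁ r≤l = begin
    row (suc l) e +ℤ + 1 *ℤ row l (suc e)
      ≡⟨ +1* (row (suc l) e) (row l (suc e)) ⟩
    row (suc l) e +ℤ row l (suc e)
      ≡⟨ cong₂ _+ℤ_ (trans (part (suc l) e (Box-weaken b (n≤1+n _))) (cong (λ z → sum< (suc z) (λ q → single q e)) (m≤n⇒m⊓n≡m (m≤n⇒m≤1+n r≤l))))
                    (trans (part l (suc e) b) (cong (λ z → sum< (suc z) (λ q → single q (suc e))) (m≤n⇒m⊓n≡m r≤l))) ⟩
    sum< (suc r) (λ q → single q e) +ℤ sum< (suc r) (λ q → single q (suc e))
      ≡⟨ sym (sum<-+ (suc r) _ _) ⟩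
    sum< (suc r) (λ q → single q e +ℤ single q (suc e))
      ≡⟨ sym (Cn-< ls g r (suc l) e (s≤s r≤l)) ⟩
    Cn r (suc l ∷ ls) g e ∎
   
  ... | inj₂ l≤r with m≤n⇒m<n∨m≡n l≤r
  ...   | inj₂ refl = begin
    row (suc l) e +ℤ + 1 *ℤ row l (suc e)
      ≡⟨ +1* (row (suc l) e) (row l (suc e)) ⟩
    row (suc l) e +ℤ row l (suc e)
      ≡⟨ cong₂ _+ℤ_ (trans (part (suc l) e (Box-weaken b (n≤1+n _))) (cong (λ z → sum< (suc z) (λ q → single q e)) (m≤n⇒m⊓n≡m (n≤1+n l))))
                    (trans (part l (suc e) b) (cong (λ z → sum< (suc z) (λ q → single q (suc e))) (⊓-idem l))) ⟩
    sum< (suc l) (λ q → single q e) +ℤ sum< (suc l) (λ q → single q (suc e))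
      ≡⟨ sym (sum<-+ (suc l) _ _) ⟩
    sum< (suc l) (λ q → single q e +ℤ single q (suc e))
      ≡⟨ sym (Cn-< ls g l (suc l) e ≤-refl) ⟩
    Cn l (suc l ∷ ls) g e ∎
   
  ...   | inj₁ l<r = begin
    row (suc l) e +ℤ + 1 *ℤ row l (suc e)
      ≡⟨ +1* (row (suc l) e) (row l (suc e)) ⟩
    row (suc l) e +ℤ row l (suc e)
      ≡⟨ cong₂ _+ℤ_ (trans (part (suc l) e (Box-weaken b (n≤1+n _))) (cong (λ z → sum< (suc z) (λ q → single q e)) (m≥n⇒m⊓n≡n l<r)))
                    (trans (part l (suc e) b) (cong (λ z → sum< (suc z) (λ q → single q (suc e))) (m≥n⇒m⊓n≡n l≤r))) ⟩
    sum< (suc (suc l)) (λ q → single q e) +ℤ sum< (suc l) (λ q → single q (suc e))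
      ≡⟨ arrange (sum< (suc l) (λ q → single q e)) (single (suc l) e) (sum< (suc l) (λ q → single q (suc e))) ⟩
    (sum< (suc l) (λ q → single q e) +ℤ sum< (suc l) (λ q → single q (suc e))) +ℤ single (suc l) e
      ≡⟨ cong (_+ℤ single (suc l) e) (sym (sum<-+ (suc l) _ _)) ⟩
    sum< (suc l) (λ q → single q e +ℤ single q (suc e)) +ℤ single (suc l) e
      ≡⟨ sym (Cn-≥ ls g r (suc l) e l<r) ⟩
    Cn r (suc l ∷ ls) g e ∎
    where
    arrange : ∀ a b c → (a +ℤ b) +ℤ c ≡ (a +ℤ c) +ℤ b
    arrange = solve-∀

private
  A-sum B-sum : (List ℕ → ℕ → ℤ) → List ℕ → ℕ → ℕ → ℤ
  A-sum g ls k e = Dn k ls (λ κ → transferB k (λ τ → g (k ∷ τ)) κ e)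
  B-sum g ls k e = Dn (suc k) ls (λ κ → transferB k (λ τ → g (k ∷ τ)) κ (suc e))

  Dn-free-rows : ∀ n u g ls e → n ≤ u → rng 0 n (λ k → Dn k ls (λ κ → transferB u g (k ∷ κ) e)) ≡
    sum< n (λ k → A-sum g ls k e +ℤ B-sum g ls k e) +ℤ A-sum g ls n e
  Dn-free-rows n u g ls e q = trans (rng-cong 0 n (λ k _ p → free k (≤-trans p q))) (sum<-interleave n (λ k → A-sum g ls k e) (λ k → B-sum g ls k e))
    where
    free : ∀ k → k ≤ u → Dn k ls (λ κ → transferB u g (k ∷ κ) e) ≡ A-sum g ls k e +ℤ + 1 *ℤ pre k (λ k → B-sum g ls k e)
    free k p = trans (respects (Dn-linear k ls) (λ κ → tr-free (+ 1) (+ 1) κ g e p))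
      (trans (additive (Dn-linear k ls) _ _) (cong (A-sum g ls k e +ℤ_) (trans (scalar (Dn-linear k ls) (+ 1) _) (cong (+ 1 *ℤ_) (shifted k)))))
      where
      shifted : ∀ k → Dn k ls (λ κ → pre k (λ k′ → transferB k′ (λ τ → g (k′ ∷ τ)) κ (suc e))) ≡ pre k (λ k → B-sum g ls k e)
      shifted zero    = linear-zero (Dn-linear 0 ls)
      shifted (suc k) = refl

  Dn-forced-row : ∀ u g ls e → Dn (suc u) ls (λ κ → transferB u g (suc u ∷ κ) (suc e)) ≡ B-sum g ls u (suc e) +ℤ B-sum g ls u e
  Dn-forced-row u g ls e = trans (respects (Dn-linear (suc u) ls) (λ κ → trans (tr-forced (+ 1) (+ 1) u κ g (suc e))
    (trans (1*+1* (transferB u (λ τ → g (u ∷ τ)) κ (suc (suc e))) _) (ℤ.+-comm (transferB u (λ τ → g (u ∷ τ)) κ (suc e)) _)))) (additive (Dn-linear (suc u) ls) _ _)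

  Dn-transferB-row : ∀ {l r ls} → l ≤ r →
    (∀ g e → Dn l ls (λ κ → transferB l g κ e) ≡ Cn l ls g e) →
    (∀ k g e → Dn k ls (λ κ → transferB k g κ e) +ℤ Dn (suc k) ls (λ κ → transferB k g κ (suc e)) ≡ Cn k ls g e +ℤ Cn k ls g (suc e)) →
    ∀ g e → Dn r (l ∷ ls) (λ κ → transferB r g κ e) ≡ Cn r (l ∷ ls) g e
  Dn-transferB-row {l} {r} {ls} p ih ih₂ g e = trans
    (trans (cong (λ z → rng 0 z (λ k → Dn k ls (λ κ → transferB r g (k ∷ κ) e))) (m≥n⇒m⊓n≡n p)) (Dn-free-rows l r g ls e p))
    (trans (cong₂ _+ℤ_ (sum<-cong l (λ k _ → ih₂ k (λ τ → g (k ∷ τ)) e)) (ih _ e)) (sym (Cn-≥ ls g r l e p)))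

mutual
  -- In this order 1 + x does not arise row by row: if ν_i = ν_{i-1}, row i can carry an extra cell
  -- only if row i - 1 does. Two such rows give 1 + x (2 + x) = (1 + x)^2, which factors only after
  -- summing over both states of the upper row; hence the mutual induction with `Dn-transferB-pair`.
  Dn-transferB : ∀ {L r ls} → Box L r ls → ∀ g e → Dn r ls (λ κ → transferB r g κ e) ≡ Cn r ls g e
  Dn-transferB [] g e = refl
  Dn-transferB {ls = l ∷ ls} (p ∷ b) g e = Dn-transferB-row {ls = ls} p (Dn-transferB b) (λ k → Dn-transferB-pair k b) g e

  -- The two summands are the contributions of an unmoved and a moved row above λ.
  Dn-transferB-pair : ∀ {L v ls} r → Box L v ls → ∀ g e →
    Dn r ls (λ κ → transferB r g κ e) +ℤ Dn (suc r) ls (λ κ → transferB r g κ (suc e)) ≡ Cn r ls g e +ℤ Cn r ls g (suc e)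
  Dn-transferB-pair r [] g e = refl
  Dn-transferB-pair {ls = l ∷ ls} r (p ∷ b) g e with <-≤-connex r l
  ... | inj₂ l≤r = cong₂ _+ℤ_ (free e) (trans (Dn-bound (l≤r ∷ b) (n≤1+n r) (λ κ → transferB r g κ (suc e))) (free (suc e)))
    where
    free = Dn-transferB-row {ls = ls} l≤r (Dn-transferB b) (λ k → Dn-transferB-pair k b) g
  ... | inj₁ r<l = begin
    rng 0 (r ⊓ l) (row e) +ℤ rng 0 (suc r ⊓ l) (row (suc e))
      ≡⟨ cong₂ (λ x y → rng 0 x (row e) +ℤ rng 0 y (row (suc e))) (m≤n⇒m⊓n≡m (<⇒≤ r<l)) (m≤n⇒m⊓n≡m r<l) ⟩
    rng 0 r (row e) +ℤ (rng 0 r (row (suc e)) +ℤ row (suc e) (suc r))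
      ≡⟨ cong₂ _+ℤ_ (Dn-free-rows r r g ls e ≤-refl) (cong₂ _+ℤ_ (Dn-free-rows r r g ls (suc e) ≤-refl) (Dn-forced-row r g ls e)) ⟩
    (sum< r (J e) +ℤ A e) +ℤ ((sum< r (J (suc e)) +ℤ A (suc e)) +ℤ (B (suc e) +ℤ B e))
      ≡⟨ arrange (sum< r (J e)) (A e) (sum< r (J (suc e))) (A (suc e)) (B (suc e)) (B e) ⟩
    (sum< (suc r) (J e)) +ℤ (sum< (suc r) (J (suc e)))
      ≡⟨ cong₂ _+ℤ_ (close e) (close (suc e)) ⟩
    Cn r (l ∷ ls) g e +ℤ Cn r (l ∷ ls) g (suc e) ∎
    where
    row J : ℕ → ℕ → ℤ
    row e k = Dn k ls (λ κ → transferB r g (k ∷ κ) e)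
    J e k = A-sum g ls k e +ℤ B-sum g ls k e
    A B : ℕ → ℤ
    A = A-sum g ls r
    B = B-sum g ls r
    arrange : ∀ s a s′ a′ b′ b → (s +ℤ a) +ℤ ((s′ +ℤ a′) +ℤ (b′ +ℤ b)) ≡ (s +ℤ (a +ℤ b)) +ℤ (s′ +ℤ (a′ +ℤ b′))
    arrange = solve-∀
    close : ∀ e → sum< (suc r) (J e) ≡ Cn r (l ∷ ls) g e
    close e = trans (sum<-cong (suc r) (λ k _ → Dn-transferB-pair k b (λ τ → g (k ∷ τ)) e)) (sym (Cn-< ls g r l e r<l))

-- transferB, except that a forced first row is not glued to the row above.
transfer′ : ℕ → Op
transfer′ u g []      e = g [] e
transfer′ u g (k ∷ κ) e = if k ≤ᵇ u then transferB u g (k ∷ κ) e else transferB u (λ τ → g (u ∷ τ)) κ (suc e)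

transfer′-free : ∀ {k u} g κ e → k ≤ u → transfer′ u g (k ∷ κ) e ≡ transferB u g (k ∷ κ) e
transfer′-free g κ e p rewrite ≤ᵇ-true p = refl

transfer′-forced : ∀ u g κ e → transfer′ u g (suc u ∷ κ) e ≡ transferB u (λ τ → g (u ∷ τ)) κ (suc e)
transfer′-forced u g κ e rewrite ≤ᵇ-false (n<1+n u) = refl

Dn-transfer′-free : ∀ {L u ls} → Box L u ls → ∀ g e → Dn u ls (λ κ → transfer′ u g κ e) ≡ Cn u ls g e
Dn-transfer′-free {u = u} b g e = trans (Dn-cong u b (λ bτ → free (Box-weaken bτ (m⊓n≤m u u)))) (Dn-transferB b g e)
  where
  free : ∀ {L κ} → Box L u κ → transfer′ u g κ e ≡ transferB u g κ e
  free [] = refl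
  free (p ∷ b) rewrite ≤ᵇ-true p = refl

Dn-transfer′ : ∀ {L u ls} → Box L (suc u) ls → ∀ g e → Dn (suc u) ls (λ κ → transfer′ u g κ e) ≡ Cn u ls g e
Dn-transfer′ [] g e = refl
Dn-transfer′ {u = u} {l ∷ ls} (p ∷ b) g e with m≤n⇒m<n∨m≡n p
... | inj₁ (s≤s l≤u) = trans (Dn-bound (l≤u ∷ b) (n≤1+n u) (λ κ → transfer′ u g κ e)) (Dn-transfer′-free (l≤u ∷ b) g e)
... | inj₂ refl = begin
  rng 0 (u ⊓ u) row′ +ℤ row′ (suc (u ⊓ u))
    ≡⟨ cong (λ z → rng 0 z row′ +ℤ row′ (suc z)) (⊓-idem u) ⟩
  rng 0 u row′ +ℤ row′ (suc u)
    ≡⟨ cong₂ _+ℤ_ (trans (rng-cong 0 u (λ k _ q → free k q)) (Dn-free-rows u u g ls e ≤-refl)) forced ⟩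
  (sum< u (λ k → A-sum g ls k e +ℤ B-sum g ls k e) +ℤ A-sum g ls u e) +ℤ B-sum g ls u e
    ≡⟨ ℤ.+-assoc (sum< u (λ k → A-sum g ls k e +ℤ B-sum g ls k e)) _ _ ⟩
  sum< (suc u) (λ k → A-sum g ls k e +ℤ B-sum g ls k e)
    ≡⟨ sum<-cong (suc u) (λ k _ → Dn-transferB-pair k b (λ τ → g (k ∷ τ)) e) ⟩
  _
    ≡⟨ sym (Cn-< ls g u (suc u) e ≤-refl) ⟩
  Cn u (suc u ∷ ls) g e ∎
  where
  row′ : ℕ → ℤ
  row′ k = Dn k ls (λ κ → transfer′ u g (k ∷ κ) e)
  free : ∀ k → k ≤ u → row′ k ≡ Dn k ls (λ κ → transferB u g (k ∷ κ) e)
  free k q rewrite ≤ᵇ-true q = refl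
  forced : row′ (suc u) ≡ B-sum g ls u e
  forced rewrite ≤ᵇ-false (n<1+n u) = refl

-- `ET` keeps the first row, so a forced first row still contributes x alone, while the rows below
-- acquire the weights of `transferB`; `transfer′` records this exception and makes the induction go
-- through. The two orders of removal are compared through `Cn`.
ET-transferV′ : ∀ {L u κ} → Box L (suc u) κ → ∀ f e →
  ET L (λ ν → transferV u f ν e) κ ≡ transfer′ u (λ ν e → ET L (λ τ → f τ e) ν) κ e
ET-transferV′ [] f e = refl
ET-transferV′ {L = suc L} {u} {k ∷ κ} (p ∷ b) f e with m≤n⇒m<n∨m≡n p
... | inj₂ refl = begin
  Dn (suc u) κ (ET L (λ ν → transferV u f (suc u ∷ ν) e))
    ≡⟨ respects (Dn-linear (suc u) κ) (λ τ → respects (ET-linear L τ) (λ ν → trans (tr-forced (+ 1) (+ 0) u ν f e) (trans (ℤ.+-identityʳ _) (ℤ.*-identityˡ _)))) ⟩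
  Dn (suc u) κ (ET L (λ ν → transferV u (λ ρ → f (u ∷ ρ)) ν (suc e)))
    ≡⟨ Dn-cong (suc u) b (λ bτ → ET-transferV′ (Box-weaken bτ (m⊓n≤m _ _)) (λ ρ → f (u ∷ ρ)) (suc e)) ⟩
  Dn (suc u) κ (λ τ → transfer′ u (λ ν e → ET L (λ τ → f (u ∷ τ) e) ν) τ (suc e))
    ≡⟨ Dn-transfer′ b _ (suc e) ⟩
  Cn u κ (λ ν e → ET L (λ τ → f (u ∷ τ) e) ν) (suc e)
    ≡⟨ sym (transferB-Dn ≤-refl b _ (suc e)) ⟩
  transferB u (λ σ e → Dn u σ (ET L (λ τ → f (u ∷ τ) e))) κ (suc e)
    ≡⟨ sym (transfer′-forced u (λ ν e → ET (suc L) (λ τ → f τ e) ν) κ e) ⟩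
  transfer′ u (λ ν e → ET (suc L) (λ τ → f τ e) ν) (suc u ∷ κ) e ∎
 
... | inj₁ (s≤s k≤u) = begin
  Dn k κ (ET L (λ ν → transferV u f (k ∷ ν) e))
    ≡⟨ respects lin (λ ν → tr-free (+ 1) (+ 0) ν f e k≤u) ⟩
  Dn k κ (ET L (λ ν → transferV k (λ ρ → f (k ∷ ρ)) ν e +ℤ + 1 *ℤ pre k (λ k → transferV k (λ ρ → f (k ∷ ρ)) ν (suc e))))
    ≡⟨ trans (additive lin _ _) (cong (Dn k κ (ET L (λ ν → transferV k (λ ρ → f (k ∷ ρ)) ν e)) +ℤ_) (scalar lin (+ 1) _)) ⟩
  Dn k κ (ET L (λ ν → transferV k (λ ρ → f (k ∷ ρ)) ν e)) +ℤ + 1 *ℤ Dn k κ (ET L (λ ν → pre k (λ k → transferV k (λ ρ → f (k ∷ ρ)) ν (suc e))))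
    ≡⟨ cong₂ (λ x y → x +ℤ + 1 *ℤ y) same (moved k b) ⟩
  transferB k (h k) κ e +ℤ + 1 *ℤ pre k (λ k → transferB k (h k) κ (suc e))
    ≡⟨ sym (trans (transfer′-free (λ ν e → ET (suc L) (λ τ → f τ e) ν) κ e k≤u) (tr-free (+ 1) (+ 1) κ (λ ν e → ET (suc L) (λ τ → f τ e) ν) e k≤u)) ⟩
  transfer′ u (λ ν e → ET (suc L) (λ τ → f τ e) ν) (k ∷ κ) e ∎
  where
  h : ℕ → List ℕ → ℕ → ℤ
  h k σ e = Dn k σ (ET L (λ τ → f (k ∷ τ) e))
  lin : Linear (λ g → Dn k κ (ET L g))
  lin = linear-∘ (Dn-linear k κ) (ET-linear L)
  same : Dn k κ (ET L (λ ν → transferV k (λ ρ → f (k ∷ ρ)) ν e)) ≡ transferB k (h k) κ e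
  same = trans (Dn-cong k b (λ bτ → ET-transferV′ (Box-weaken bτ (≤-trans (m⊓n≤m _ _) (n≤1+n k))) (λ ρ → f (k ∷ ρ)) e))
    (trans (Dn-transfer′-free b _ e) (sym (transferB-Dn ≤-refl (Box-weaken b (n≤1+n k)) _ e)))
  moved : ∀ k → Box L k κ → Dn k κ (ET L (λ ν → pre k (λ k → transferV k (λ ρ → f (k ∷ ρ)) ν (suc e)))) ≡ pre k (λ k → transferB k (h k) κ (suc e))
  moved zero    b = trans (respects (Dn-linear 0 κ) (λ τ → linear-zero (ET-linear L τ))) (linear-zero (Dn-linear 0 κ))
  moved (suc k) b = trans (Dn-cong (suc k) b (λ bτ → ET-transferV′ (Box-weaken bτ (m⊓n≤m _ _)) (λ ρ → f (k ∷ ρ)) (suc e)))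
    (trans (Dn-transfer′ b _ (suc e)) (sym (transferB-Dn ≤-refl b _ (suc e))))

ET-transferV : ∀ {L u κ} → Box L u κ → ∀ f e →
  ET L (λ ν → transferV u f ν e) κ ≡ transferB u (λ ν e → ET L (λ τ → f τ e) ν) κ e
ET-transferV {u = u} b f e = trans (ET-transferV′ (Box-weaken b (n≤1+n u)) f e) (free b)
  where
  free : ∀ {L κ g} → Box L u κ → transfer′ u g κ e ≡ transferB u g κ e
  free [] = refl
  free (p ∷ b) rewrite ≤ᵇ-true p = refl

-- Booleans and guarded finite sums

T⇒≡ : ∀ {a b} → (T a → T b) → (T b → T a) → a ≡ b
T⇒≡ {true}  {true}  f g = refl
T⇒≡ {false} {false} f g = refl
T⇒≡ {true}  {false} f g = ⊥-elim (f tt)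
T⇒≡ {false} {true}  f g = ⊥-elim (g tt)

∧-T : ∀ {a b} → T a → T b → T (a ∧ b)
∧-T {true} p q = q

∧-Tˡ : ∀ a {b} → T (a ∧ b) → T a
∧-Tˡ true p = tt

∧-Tʳ : ∀ a {b} → T (a ∧ b) → T b
∧-Tʳ true p = p

∧-interchange : ∀ a b c d → (a ∧ b) ∧ (c ∧ d) ≡ (a ∧ c) ∧ (b ∧ d)
∧-interchange false b     c     d = refl
∧-interchange true  true  c     d = refl
∧-interchange true  false true  d = refl
∧-interchange true  false false d = refl

¬T-false : ∀ {a} → ¬ T a → a ≡ false
¬T-false {false} _ = refl
¬T-false {true}  n = ⊥-elim (n tt)

≤ᵇ-elim : ∀ m n → T (m ≤ᵇ n) → m ≤ n
≤ᵇ-elim = ℕ.≤ᵇ⇒≤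

≤ᵇ-intro : ∀ {m n} → m ≤ n → T (m ≤ᵇ n)
≤ᵇ-intro = ≤⇒≤ᵇ

when : Bool → ℤ → ℤ
when b x = if b then x else + 0

when-cong : ∀ b {x y} → (T b → x ≡ y) → when b x ≡ when b y
when-cong true  h = h tt
when-cong false h = refl

when-∧ : ∀ a b x → when a (when b x) ≡ when (a ∧ b) x
when-∧ true  b x = refl
when-∧ false b x = refl

when-0 : ∀ b → when b (+ 0) ≡ + 0
when-0 true  = refl
when-0 false = refl

linear-when : {A : Set} {Φ : (A → ℤ) → ℤ} → Linear Φ → ∀ b (F : A → ℤ) → Φ (λ x → when b (F x)) ≡ when b (Φ F)
linear-when p true  F = refl
linear-when p false F = linear-zero p

when-linear : {A : Set} {Φ : (A → ℤ) → ℤ} → ∀ b → Linear Φ → Linear (λ f → when b (Φ f))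
when-linear b p = linear-if b p linear-0

sum<-linear : {A : Set} {Θ : ℕ → (A → ℤ) → ℤ} → (∀ r → Linear (Θ r)) → ∀ n → Linear (λ f → sum< n (λ r → Θ r f))
sum<-linear p zero    = linear-0
sum<-linear p (suc n) = linear-+ (sum<-linear p n) (p n)

linear-sum< : {A : Set} {Φ : (A → ℤ) → ℤ} → Linear Φ → ∀ (F : ℕ → A → ℤ) n → Φ (λ x → sum< n (λ r → F r x)) ≡ sum< n (λ r → Φ (F r))
linear-sum<         p F zero    = linear-zero p
linear-sum< {Φ = Φ} p F (suc n) = trans (additive p _ _) (cong (_+ℤ Φ (F n)) (linear-sum< p F n))

sum<-zero : ∀ n {F} → (∀ r → r < n → F r ≡ + 0) → sum< n F ≡ + 0
sum<-zero zero    h = refl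
sum<-zero (suc n) h = cong₂ _+ℤ_ (sum<-zero n (λ r p → h r (m≤n⇒m≤1+n p))) (h n ≤-refl)

sum<-split : ∀ m n F → sum< (m + n) F ≡ sum< m F +ℤ sum< n (λ i → F (m + i))
sum<-split m zero    F rewrite ℕ.+-identityʳ m = sym (ℤ.+-identityʳ _)
sum<-split m (suc n) F rewrite +-suc m n = trans (cong (_+ℤ F (m + n)) (sum<-split m n F)) (ℤ.+-assoc (sum< m F) _ _)

sum<-head : ∀ n F → sum< (suc n) F ≡ F 0 +ℤ sum< n (λ i → F (suc i))
sum<-head n F = trans (sum<-split 1 n F) (cong (_+ℤ sum< n (λ i → F (suc i))) (ℤ.+-identityˡ (F 0)))

sum<-reflect : ∀ n F → sum< (suc n) F ≡ sum< (suc n) (λ i → F (n ∸ i))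
sum<-reflect zero    F = refl
sum<-reflect (suc n) F = trans (ℤ.+-comm (sum< (suc n) F) (F (suc n)))
  (trans (cong (F (suc n) +ℤ_) (sum<-reflect n F)) (sym (sum<-head (suc n) (λ i → F (suc n ∸ i)))))

sum<-window : ∀ {l m t} → m ≤ t → t ≤ l → ∀ (X : ℕ → ℤ) → sum< (suc l) (λ r → when ((m ≤ᵇ r) ∧ (r ≤ᵇ t)) (X r)) ≡ sum< (suc (t ∸ m)) (λ i → X (m + i))
sum<-window {l} {m} {t} p q X = begin
  sum< (suc l) F
    ≡⟨ cong (λ z → sum< z F) (sym size≡) ⟩
  sum< ((m + suc (t ∸ m)) + (l ∸ t)) F
    ≡⟨ sum<-split (m + suc (t ∸ m)) (l ∸ t) F ⟩
  sum< (m + suc (t ∸ m)) F +ℤ sum< (l ∸ t) (λ i → F ((m + suc (t ∸ m)) + i))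
    ≡⟨ cong₂ _+ℤ_ (sum<-split m (suc (t ∸ m)) F) (sum<-zero (l ∸ t) (λ i _ → above i)) ⟩
  (sum< m F +ℤ sum< (suc (t ∸ m)) (λ i → F (m + i))) +ℤ + 0
    ≡⟨ trans (ℤ.+-identityʳ _) (trans (cong (_+ℤ sum< (suc (t ∸ m)) (λ i → F (m + i))) (sum<-zero m below)) (ℤ.+-identityˡ _)) ⟩
  sum< (suc (t ∸ m)) (λ i → F (m + i))
    ≡⟨ sum<-cong (suc (t ∸ m)) inside ⟩
  sum< (suc (t ∸ m)) (λ i → X (m + i)) ∎
  where
  F : ℕ → ℤ
  F r = when ((m ≤ᵇ r) ∧ (r ≤ᵇ t)) (X r)
  m+ : m + suc (t ∸ m) ≡ suc t
  m+ = trans (+-suc m _) (cong suc (m+[n∸m]≡n p))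
  size≡ : (m + suc (t ∸ m)) + (l ∸ t) ≡ suc l
  size≡ = trans (cong (_+ (l ∸ t)) m+) (cong suc (m+[n∸m]≡n q))
  below : ∀ r → r < m → F r ≡ + 0
  below r q rewrite ≤ᵇ-false q = refl
  above : ∀ i → F ((m + suc (t ∸ m)) + i) ≡ + 0
  above i rewrite m+ | ≤ᵇ-false (m≤m+n (suc t) i) | ∧-zeroʳ (m ≤ᵇ suc (t + i)) = refl
  inside : ∀ i → i < suc (t ∸ m) → F (m + i) ≡ X (m + i)
  inside i (s≤s r) rewrite ≤ᵇ-true (m≤m+n m i) | ≤ᵇ-true (≤-trans (+-monoʳ-≤ m r) (≤-reflexive (m+[n∸m]≡n p))) = refl

-- Commutation of the horizontal strip operators

cs-sum< : ∀ F {n l} → n ≤ l → ∀ e → cs F n (l ∸ n) e ≡ sum< (suc l) (λ r → when (n ≤ᵇ r) (F r (e + (l ∸ r))))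
cs-sum< F {n} {l} p e = trans (go (l ∸ n) e) (cong (λ z → sum< (suc z) (λ r → when (n ≤ᵇ r) (F r (e + (z ∸ r))))) (m+[n∸m]≡n p))
  where
  go : ∀ d e → cs F n d e ≡ sum< (suc (n + d)) (λ r → when (n ≤ᵇ r) (F r (e + ((n + d) ∸ r))))
  go zero e rewrite ℕ.+-identityʳ n | ≤ᵇ-true (≤-refl {n}) | n∸n≡0 n | ℕ.+-identityʳ e =
    sym (trans (cong (_+ℤ F n e) (sum<-zero n below)) (ℤ.+-identityˡ _))
    where
    below : ∀ r → r < n → when (n ≤ᵇ r) (F r (e + (n ∸ r))) ≡ + 0
    below r q rewrite ≤ᵇ-false q = refl
  go (suc d) e rewrite +-suc n d = cong₂ _+ℤ_
    (trans (go d (suc e)) (sum<-cong (suc (n + d)) (λ r q → cong (λ z → when (n ≤ᵇ r) (F r z))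
      (trans (sym (+-suc e _)) (cong (λ z → e + z) (sym (+-∸-assoc 1 (≤-pred q))))))))
    last
    where
    last : F (suc (n + d)) e ≡ when (n ≤ᵇ suc (n + d)) (F (suc (n + d)) (e + (n + d ∸ (n + d))))
    last rewrite ≤ᵇ-true (m≤n⇒m≤1+n (m≤m+n n d)) | n∸n≡0 (n + d) | ℕ.+-identityʳ e = refl

op-sum< : ∀ b {L u l ls} → Box L u (l ∷ ls) → ∀ f e → op b f (l ∷ ls) e ≡
  sum< (suc l) (λ r → when (nxt ls ≤ᵇ r) (mk b (nxt ls) r (op b (λ ρ → f (r ∷ ρ)) ls) (e + (l ∸ r))))
op-sum< b (_ ∷ bx) f e = cs-sum< _ (Box-nxt bx) e

-- The composite of two horizontal strip removals, in weights x and y, through shapes ρ with ρ₀ ≤ u.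
Kop : ℕ → (List ℕ → ℕ → ℕ → ℤ) → List ℕ → ℕ → ℕ → ℤ
Kop u f []       e d = f [] e d
Kop u f (l ∷ ls) e d = sum< (suc l) (λ r → when ((nxt ls ≤ᵇ r) ∧ (r ≤ᵇ u))
  (sum< (suc r) (λ q → Kop q (λ σ → f (q ∷ σ)) ls (e + (l ∸ r)) (d + (r ∸ q)))))

Kop-op : ∀ {L v ls} → Box L v ls → ∀ u f e d →
  Kop u f ls e d ≡ op false (λ ρ e → when (nxt ρ ≤ᵇ u) (op false (λ σ d → f σ e d) ρ d)) ls e
Kop-op [] u f e d = refl
Kop-op {ls = l ∷ ls} (p ∷ b) u f e d = trans (sum<-cong (suc l) row) (sym (op-sum< false (p ∷ b) (λ ρ e → when (nxt ρ ≤ᵇ u) (op false (λ σ d → f σ e d) ρ d)) e))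
  where
  n = nxt ls
  inner : ∀ r q e′ → op false (λ ρ e → when (nxt ρ ≤ᵇ q) (op false (λ σ d → f (q ∷ σ) e d) ρ (d + (r ∸ q)))) ls e′ ≡ Kop q (λ σ → f (q ∷ σ)) ls e′ (d + (r ∸ q))
  inner r q e′ = sym (Kop-op b q (λ σ → f (q ∷ σ)) e′ (d + (r ∸ q)))
  row : ∀ r → r < suc l → when ((n ≤ᵇ r) ∧ (r ≤ᵇ u)) (sum< (suc r) (λ q → Kop q (λ σ → f (q ∷ σ)) ls (e + (l ∸ r)) (d + (r ∸ q))))
    ≡ when (n ≤ᵇ r) (mk false n r (op false (λ ρ e → when (r ≤ᵇ u) (op false (λ σ d → f σ e d) (r ∷ ρ) d)) ls) (e + (l ∸ r)))
  row r q = trans (sym (when-∧ (n ≤ᵇ r) (r ≤ᵇ u) _)) (when-cong (n ≤ᵇ r) (λ n≤r →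
    sym (trans (linear-when lin (r ≤ᵇ u) (λ (ρ , e) → op false (λ σ d → f σ e d) (r ∷ ρ) d)) (cong (when (r ≤ᵇ u))
      (trans (op-cong false (Box-bound b (≤ᵇ-elim n r n≤r)) (λ bρ e → op-sum< false (≤-refl ∷ bρ) (λ σ d → f σ e d) d) (e + (l ∸ r)))
        (trans (linear-sum< lin (λ q (ρ , e) → when (nxt ρ ≤ᵇ q) (op false (λ σ d → f (q ∷ σ) e d) ρ (d + (r ∸ q)))) (suc r))
          (sum<-cong (suc r) (λ q _ → inner r q (e + (l ∸ r))))))))))
    where
    lin = op-linear false ls (e + (l ∸ r))

sum<-swap : ∀ m n (F : ℕ → ℕ → ℤ) → sum< m (λ r → sum< n (λ q → F r q)) ≡ sum< n (λ q → sum< m (λ r → F r q))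
sum<-swap m n F = linear-sum< (sum<-linear {A = ℕ} linear-eval m) (λ q r → F r q) n

∸-⊔ : ∀ n q → (n ⊔ q) ∸ q ≡ n ∸ q
∸-⊔ n q with ≤-total n q
... | inj₁ p = trans (cong (_∸ q) (m≤n⇒m⊔n≡n p)) (trans (n∸n≡0 q) (sym (m≤n⇒m∸n≡0 p)))
... | inj₂ p = cong (_∸ q) (m≥n⇒m⊔n≡m p)

Kop-columns : ∀ l ls u f e d → Kop u f (l ∷ ls) e d ≡
  sum< (suc l) (λ q → sum< (suc l) (λ r → when ((nxt ls ⊔ q ≤ᵇ r) ∧ (r ≤ᵇ u ⊓ l)) (Kop q (λ σ → f (q ∷ σ)) ls (e + (l ∸ r)) (d + (r ∸ q)))))
Kop-columns l ls u f e d = trans (sum<-cong (suc l) row) (sum<-swap (suc l) (suc l) _)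
  where
  n = nxt ls
  X : ℕ → ℕ → ℤ
  X r q = Kop q (λ σ → f (q ∷ σ)) ls (e + (l ∸ r)) (d + (r ∸ q))
  bool : ∀ r q → r ≤ l → ((n ≤ᵇ r) ∧ (r ≤ᵇ u)) ∧ (q ≤ᵇ r) ≡ (n ⊔ q ≤ᵇ r) ∧ (r ≤ᵇ u ⊓ l)
  bool r q r≤l = T⇒≡
    (λ t → let nr = ∧-Tˡ (n ≤ᵇ r) (∧-Tˡ ((n ≤ᵇ r) ∧ (r ≤ᵇ u)) t); ru = ∧-Tʳ (n ≤ᵇ r) (∧-Tˡ ((n ≤ᵇ r) ∧ (r ≤ᵇ u)) t); qr = ∧-Tʳ ((n ≤ᵇ r) ∧ (r ≤ᵇ u)) t in
      ∧-T (≤ᵇ-intro (ℕ.⊔-lub (≤ᵇ-elim n r nr) (≤ᵇ-elim q r qr))) (≤ᵇ-intro (⊓-glb (≤ᵇ-elim r u ru) r≤l)))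
    (λ t → let nq = ≤ᵇ-elim (n ⊔ q) r (∧-Tˡ (n ⊔ q ≤ᵇ r) t); ru = ≤ᵇ-elim r (u ⊓ l) (∧-Tʳ (n ⊔ q ≤ᵇ r) t) in
      ∧-T {(n ≤ᵇ r) ∧ (r ≤ᵇ u)} (∧-T (≤ᵇ-intro (≤-trans (ℕ.m≤m⊔n n q) nq)) (≤ᵇ-intro (≤-trans ru (m⊓n≤m u l)))) (≤ᵇ-intro (≤-trans (m≤n⊔m n q) nq)))
  row : ∀ r → r < suc l → when ((n ≤ᵇ r) ∧ (r ≤ᵇ u)) (sum< (suc r) (X r)) ≡ sum< (suc l) (λ q → when ((n ⊔ q ≤ᵇ r) ∧ (r ≤ᵇ u ⊓ l)) (X r q))
  row r (s≤s p) = trans (cong (when ((n ≤ᵇ r) ∧ (r ≤ᵇ u))) extend)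
    (trans (linear-sum< {A = ⊤} {Φ = λ g → when ((n ≤ᵇ r) ∧ (r ≤ᵇ u)) (g tt)} (when-linear ((n ≤ᵇ r) ∧ (r ≤ᵇ u)) (linear-eval tt)) (λ q x → when (q ≤ᵇ r) (X r q)) (suc l) )
      (sum<-cong (suc l) (λ q _ → trans (when-∧ ((n ≤ᵇ r) ∧ (r ≤ᵇ u)) (q ≤ᵇ r) _) (cong (λ z → when z (X r q)) (bool r q p)))))
    where
    extend : sum< (suc r) (X r) ≡ sum< (suc l) (λ q → when (q ≤ᵇ r) (X r q))
    extend = sym (sum<-window {l} {0} {r} z≤n p (X r))

-- The Bender-Knuth involution in terms of weights: for given old and final lengths of a row the
-- middle length runs over an interval, and reversing the interval exchanges the two exponents up to
-- constants. The constants come from columns that meet both strips. A row longer than the final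
-- length `u` of the row above loses its cells beyond `u` to the first strip, and the row above
-- loses the same columns to the second; this is the offset `nxt ls ∸ u`.
Kop-sym : ∀ {L v ls} → Box L v ls → ∀ u f e d →
  Kop u f ls e (d + (nxt ls ∸ u)) ≡ Kop u (λ σ e d → f σ d e) ls d (e + (nxt ls ∸ u))
Kop-sym [] u f e d rewrite 0∸n≡0 u | ℕ.+-identityʳ d | ℕ.+-identityʳ e = refl
Kop-sym {ls = l ∷ ls} (p ∷ b) u f e d = trans (Kop-columns l ls u f e (d + c))
  (trans (sum<-cong (suc l) (λ q _ → column q)) (sym (Kop-columns l ls u (λ σ e d → f σ d e) d (e + c))))
  where
  n = nxt ls
  c = l ∸ u
  t = u ⊓ l
  X X′ : ℕ → ℕ → ℤ
  X  q r = Kop q (λ σ → f (q ∷ σ)) ls (e + (l ∸ r)) (d + c + (r ∸ q))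
  X′ q r = Kop q (λ σ e d → f (q ∷ σ) d e) ls (d + (l ∸ r)) (e + c + (r ∸ q))
  column : ∀ q → sum< (suc l) (λ r → when ((n ⊔ q ≤ᵇ r) ∧ (r ≤ᵇ t)) (X q r)) ≡ sum< (suc l) (λ r → when ((n ⊔ q ≤ᵇ r) ∧ (r ≤ᵇ t)) (X′ q r))
  column q with <-≤-connex t (n ⊔ q)
  ... | inj₁ t<m = trans (sum<-zero (suc l) (λ r _ → empty (X q) r)) (sym (sum<-zero (suc l) (λ r _ → empty (X′ q) r)))
    where
    empty : ∀ (Z : ℕ → ℤ) r → when ((n ⊔ q ≤ᵇ r) ∧ (r ≤ᵇ t)) (Z r) ≡ + 0
    empty Z r = cong (λ z → when z (Z r)) (¬T-false (λ x → <⇒≱ t<m (≤-trans (≤ᵇ-elim (n ⊔ q) r (∧-Tˡ (n ⊔ q ≤ᵇ r) x)) (≤ᵇ-elim r t (∧-Tʳ (n ⊔ q ≤ᵇ r) x)))))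
  ... | inj₂ m≤t = trans (sum<-window m≤t (m⊓n≤n u l) (X q)) (trans (sum<-cong (suc (t ∸ m)) (λ i i< → pointwise i (≤-pred i<)))
    (trans (sym (sum<-reflect (t ∸ m) (λ i → X′ q (m + i)))) (sym (sum<-window m≤t (m⊓n≤n u l) (X′ q)))))
    where
    m = n ⊔ q
    s = t ∸ m
    -- With i + j = s one has l = c + (m + (i + j)).
    l∸ : ∀ {i j} → i + j ≡ s → l ∸ (m + i) ≡ c + j
    l∸ {i} {j} eq = trans (cong (_∸ (m + i)) (sym total)) (m+n∸m≡n (m + i) (c + j))
      where
      total : (m + i) + (c + j) ≡ l
      total = begin
        (m + i) + (c + j) ≡⟨ solveℕ m i c j ⟩
        (m + (i + j)) + c ≡⟨ cong (λ z → m + z + c) eq ⟩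
        (m + s) + c       ≡⟨ cong (_+ c) (m+[n∸m]≡n m≤t) ⟩
        t + c             ≡⟨ ℕ.m⊓n+n∸m≡n u l ⟩
        l ∎
        where
        solveℕ : ∀ m i c j → (m + i) + (c + j) ≡ (m + (i + j)) + c
        solveℕ = ℕSolver.solve-∀
    r∸q : ∀ i → (m + i) ∸ q ≡ i + (n ∸ q)
    r∸q i = trans (cong (_∸ q) (ℕ.+-comm m i)) (trans (+-∸-assoc i (m≤n⊔m n q)) (cong (λ z → i + z) (∸-⊔ n q)))
    pointwise : ∀ i → i ≤ s → X q (m + i) ≡ X′ q (m + (s ∸ i))
    pointwise i i≤s = begin
      X q (m + i)
        ≡⟨ cong₂ (Kop q (λ σ → f (q ∷ σ)) ls) (cong (λ z → e + z) (l∸ (m+[n∸m]≡n i≤s)))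
             (trans (cong (λ z → d + c + z) (r∸q i)) (sym (ℕ.+-assoc (d + c) i (n ∸ q)))) ⟩
      Kop q (λ σ → f (q ∷ σ)) ls (e + (c + (s ∸ i))) ((d + c + i) + (n ∸ q))
        ≡⟨ Kop-sym b q (λ σ → f (q ∷ σ)) (e + (c + (s ∸ i))) (d + c + i) ⟩
      Kop q (λ σ e d → f (q ∷ σ) d e) ls (d + c + i) (e + (c + (s ∸ i)) + (n ∸ q))
        ≡⟨ sym (cong₂ (Kop q (λ σ e d → f (q ∷ σ) d e) ls) (trans (cong (λ z → d + z) (l∸ (m∸n+n≡m i≤s))) (sym (ℕ.+-assoc d c i)))
             (trans (cong (λ z → e + c + z) (r∸q (s ∸ i))) (solveℕ e c (s ∸ i) (n ∸ q)))) ⟩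
      X′ q (m + (s ∸ i)) ∎
      where
      solveℕ : ∀ e c j k → e + c + (j + k) ≡ e + (c + j) + k
      solveℕ = ℕSolver.solve-∀

op-comm : ∀ {L v ls} → Box L v ls → ∀ f e d →
  op false (λ ρ e → op false (λ σ d → f σ e d) ρ d) ls e ≡ op false (λ ρ d → op false (λ σ e → f σ e d) ρ e) ls d
op-comm {v = v} {ls} b f e d = begin
  op false (λ ρ e → op false (λ σ d → f σ e d) ρ d) ls e
    ≡⟨ unrestrict (λ ρ e → op false (λ σ d → f σ e d) ρ d) e ⟩
  op false (λ ρ e → when (nxt ρ ≤ᵇ v) (op false (λ σ d → f σ e d) ρ d)) ls e
    ≡⟨ sym (Kop-op b v f e d) ⟩
  Kop v f ls e d
    ≡⟨ cong (Kop v f ls e) (sym (offset d)) ⟩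
  Kop v f ls e (d + (nxt ls ∸ v))
    ≡⟨ Kop-sym b v f e d ⟩
  Kop v (λ σ e d → f σ d e) ls d (e + (nxt ls ∸ v))
    ≡⟨ cong (Kop v (λ σ e d → f σ d e) ls d) (offset e) ⟩
  Kop v (λ σ e d → f σ d e) ls d e
    ≡⟨ Kop-op b v (λ σ e d → f σ d e) d e ⟩
  op false (λ ρ d → when (nxt ρ ≤ᵇ v) (op false (λ σ e → f σ e d) ρ e)) ls d
    ≡⟨ sym (unrestrict (λ ρ d → op false (λ σ e → f σ e d) ρ e) d) ⟩
  op false (λ ρ d → op false (λ σ e → f σ e d) ρ e) ls d ∎
  where
  offset : ∀ d → d + (nxt ls ∸ v) ≡ d
  offset d rewrite m≤n⇒m∸n≡0 (Box-nxt b) = ℕ.+-identityʳ d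
  unrestrict : ∀ g e → op false g ls e ≡ op false (λ ρ e → when (nxt ρ ≤ᵇ v) (g ρ e)) ls e
  unrestrict g e = op-cong false b (λ {ρ} bρ e → cong (λ z → when z (g ρ e)) (sym (≤ᵇ-true (Box-nxt bρ)))) e

-- Sums over partitions, and conjugation

ΣD : ℕ → ℕ → (List ℕ → ℤ) → ℤ
ΣD zero    u f = f []
ΣD (suc L) u f = sum< (suc u) (λ r → ΣD L r (λ ρ → f (r ∷ ρ)))

ΣD-linear : ∀ L u → Linear (ΣD L u)
ΣD-linear zero    u = linear-eval []
ΣD-linear (suc L) u = sum<-linear (λ r → linear-precomp (r ∷_) (ΣD-linear L r)) (suc u)

ΣD-cong : ∀ L u {f g} → (∀ {ρ} → Box L u ρ → f ρ ≡ g ρ) → ΣD L u f ≡ ΣD L u g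
ΣD-cong zero    u h = h []
ΣD-cong (suc L) u h = sum<-cong (suc u) (λ r p → ΣD-cong L r (λ b → h (≤-pred p ∷ b)))

ΣD-zero : ∀ L u {f} → (∀ {ρ} → Box L u ρ → f ρ ≡ + 0) → ΣD L u f ≡ + 0
ΣD-zero L u h = trans (ΣD-cong L u h) (linear-zero (ΣD-linear L u))

linear-ΣD : {A : Set} {Φ : (A → ℤ) → ℤ} → Linear Φ → ∀ L u (F : List ℕ → A → ℤ) → Φ (λ x → ΣD L u (λ ρ → F ρ x)) ≡ ΣD L u (λ ρ → Φ (F ρ))
linear-ΣD p zero    u F = refl
linear-ΣD p (suc L) u F = trans (linear-sum< p (λ r x → ΣD L r (λ ρ → F (r ∷ ρ) x)) (suc u))
  (sum<-cong (suc u) (λ r _ → linear-ΣD p L r (λ ρ → F (r ∷ ρ))))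

ΣD-swap : ∀ L u K v (F : List ℕ → List ℕ → ℤ) → ΣD L u (λ ρ → ΣD K v (λ σ → F ρ σ)) ≡ ΣD K v (λ σ → ΣD L u (λ ρ → F ρ σ))
ΣD-swap L u K v F = linear-ΣD (ΣD-linear L u) K v (λ σ ρ → F ρ σ)

≡ᵇ-elim : ∀ m n → T (m ≡ᵇ n) → m ≡ n
≡ᵇ-elim = ℕ.≡ᵇ⇒≡

≡ᵇ-refl : ∀ n → (n ≡ᵇ n) ≡ true
≡ᵇ-refl n = T-true (≡⇒≡ᵇ n n refl)

≡ᵇ-false : ∀ {m n} → m ≢ n → (m ≡ᵇ n) ≡ false
≡ᵇ-false {m} {n} p = ¬T-false (λ t → p (≡ᵇ-elim m n t))

eqList-elim : ∀ xs ys → T (eqList xs ys) → xs ≡ ys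
eqList-elim []       []       _ = refl
eqList-elim (x ∷ xs) (y ∷ ys) t = cong₂ _∷_ (≡ᵇ-elim x y (∧-Tˡ (x ≡ᵇ y) t)) (eqList-elim xs ys (∧-Tʳ (x ≡ᵇ y) t))

eqList-refl : ∀ xs → eqList xs xs ≡ true
eqList-refl []       = refl
eqList-refl (x ∷ xs) rewrite ≡ᵇ-refl x = eqList-refl xs

eqList-intro : ∀ {xs ys} → xs ≡ ys → T (eqList xs ys)
eqList-intro {xs} refl = true-T (eqList-refl xs)

eqList-false : ∀ {xs ys} → xs ≢ ys → eqList xs ys ≡ false
eqList-false {xs} {ys} p = ¬T-false (λ t → p (eqList-elim xs ys t))

eqList-sym : ∀ xs ys → eqList xs ys ≡ eqList ys xs
eqList-sym xs ys = T⇒≡ (flip xs ys) (flip ys xs)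
  where
  flip : ∀ xs ys → T (eqList xs ys) → T (eqList ys xs)
  flip xs ys t rewrite eqList-elim xs ys t = true-T (eqList-refl ys)

sum<-δ : ∀ {n w} → w < n → ∀ (F : ℕ → ℤ) → sum< n (λ r → when (w ≡ᵇ r) (F r)) ≡ F w
sum<-δ {suc n} {w} p F with m≤n⇒m<n∨m≡n (≤-pred p)
... | inj₁ w<n rewrite ≡ᵇ-false (<⇒≢ w<n) = trans (ℤ.+-identityʳ _) (sum<-δ w<n F)
... | inj₂ refl rewrite ≡ᵇ-refl w = trans (cong (_+ℤ F w) (sum<-zero w other)) (ℤ.+-identityˡ _)
  where
  other : ∀ r → r < w → when (w ≡ᵇ r) (F r) ≡ + 0
  other r q rewrite ≡ᵇ-false (>⇒≢ q) = refl

ΣD-δ : ∀ {L u w} → Box L u w → ∀ f → ΣD L u (λ ρ → when (eqList w ρ) (f ρ)) ≡ f w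
ΣD-δ [] f = refl
ΣD-δ {suc L} {u} {w ∷ ws} (p ∷ b) f = trans
  (sum<-cong (suc u) (λ r _ → trans (ΣD-cong L r (λ {ρ} _ → sym (when-∧ (w ≡ᵇ r) (eqList ws ρ) (f (r ∷ ρ)))))
    (linear-when (ΣD-linear L r) (w ≡ᵇ r) (λ ρ → when (eqList ws ρ) (f (r ∷ ρ))))))
  (trans (sum<-δ (s≤s p) (λ r → ΣD L r (λ ρ → when (eqList ws ρ) (f (r ∷ ρ))))) (ΣD-δ b (λ ρ → f (w ∷ ρ))))

at-Box : ∀ {L u ρ} → Box L u ρ → ∀ i → at ρ i ≤ u
at-Box []      i       = z≤n
at-Box (p ∷ b) zero    = p
at-Box (p ∷ b) (suc i) = ≤-trans (at-Box b i) p

at-beyond : ∀ {L u ρ} → Box L u ρ → ∀ i → L ≤ i → at ρ i ≡ 0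
at-beyond []      i       q       = refl
at-beyond (p ∷ b) (suc i) (s≤s q) = at-beyond b i q

Box-ext : ∀ {L u v ρ σ} → Box L u ρ → Box L v σ → (∀ i → i < L → at ρ i ≡ at σ i) → ρ ≡ σ
Box-ext []      []      h = refl
Box-ext (_ ∷ b) (_ ∷ c) h = cong₂ _∷_ (h 0 (s≤s z≤n)) (Box-ext b c (λ i p → h (suc i) (s≤s p)))

col : List ℕ → ℕ → ℕ
col ls j = countᵇ (λ r → j <ᵇ r) ls

col-∷ : ∀ l ls j → col (l ∷ ls) j ≡ (if j <ᵇ l then 1 else 0) + col ls j
col-∷ l ls j with j <ᵇ l
... | true  = refl
... | false = refl

col-zero : ∀ {L u ρ} → Box L u ρ → ∀ j → u ≤ j → col ρ j ≡ 0
col-zero [] j q = refl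
col-zero (_∷_ {r = l} p b) j q rewrite <ᵇ-false (≤-trans p q) = col-zero b j (≤-trans p q)

col-to : ∀ {L u ρ} → Box L u ρ → ∀ i j → i < col ρ j → j < at ρ i
col-to (_∷_ {r = l} p b) i j q with <-≤-connex j l
col-to (_∷_ {r = l} p b) zero    j q | inj₁ j<l = j<l
col-to (_∷_ {r = l} p b) (suc i) j q | inj₁ j<l rewrite <ᵇ-true j<l = col-to b i j (≤-pred q)
col-to (_∷_ {r = l} p b) i       j q | inj₂ l≤j rewrite <ᵇ-false l≤j | col-zero b j l≤j with () ← q

col-from : ∀ {L u ρ} → Box L u ρ → ∀ i j → j < at ρ i → i < col ρ j
col-from (_∷_ {r = l} p b) zero j q rewrite <ᵇ-true q = s≤s z≤n
col-from (_∷_ {r = l} p b) (suc i) j q rewrite <ᵇ-true (<-≤-trans q (at-Box b i)) = s≤s (col-from b i j q)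

col-≤ : ∀ {L u ρ} → Box L u ρ → ∀ j → col ρ j ≤ L
col-≤ [] j = z≤n
col-≤ (_∷_ {r = l} {ρ} p b) j rewrite col-∷ l ρ j with j <ᵇ l
... | true  = s≤s (col-≤ b j)
... | false = m≤n⇒m≤1+n (col-≤ b j)

col-anti : ∀ {L u ρ} → Box L u ρ → ∀ {j k} → j ≤ k → col ρ k ≤ col ρ j
col-anti [] q = z≤n
col-anti (_∷_ {r = l} {ρ} p b) {j} {k} q rewrite col-∷ l ρ j | col-∷ l ρ k with <-≤-connex k l
... | inj₁ k<l rewrite <ᵇ-true k<l | <ᵇ-true (≤-<-trans q k<l) = s≤s (col-anti b q)
... | inj₂ l≤k rewrite <ᵇ-false l≤k | col-zero b k l≤k = z≤n

τ : ℕ → List ℕ → List ℕ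
τ N ls = applyUpTo (col ls) N

at-applyUpTo : ∀ f n i → i < n → at (applyUpTo f n) i ≡ f i
at-applyUpTo f (suc n) zero    p       = refl
at-applyUpTo f (suc n) (suc i) (s≤s p) = at-applyUpTo (f ∘ suc) n i p

Box-applyUpTo : ∀ f n u → f 0 ≤ u → (∀ i → f (suc i) ≤ f i) → Box n u (applyUpTo f n)
Box-applyUpTo f zero    u p h = []
Box-applyUpTo f (suc n) u p h = p ∷ Box-applyUpTo (f ∘ suc) n (f 0) (h 0) (h ∘ suc)

Box-τ : ∀ {N ρ} → Box N N ρ → Box N N (τ N ρ)
Box-τ {N} {ρ} b = Box-applyUpTo (col ρ) N N (col-≤ b 0) (λ i → col-anti b (n≤1+n i))

τ-to : ∀ {N ρ} → Box N N ρ → ∀ {i j} → j < at (τ N ρ) i → i < at ρ j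
τ-to {N} {ρ} b {i} {j} p with <-≤-connex i N
... | inj₁ i<N = col-to b j i (<-≤-trans p (≤-reflexive (at-applyUpTo (col ρ) N i i<N)))
... | inj₂ N≤i = ⊥-elim (<⇒≱ p (≤-trans (≤-reflexive (at-beyond (Box-τ b) i N≤i)) z≤n))

τ-from : ∀ {N ρ} → Box N N ρ → ∀ {i j} → i < at ρ j → j < at (τ N ρ) i
τ-from {N} {ρ} b {i} {j} p = <-≤-trans (col-from b j i p) (≤-reflexive (sym (at-applyUpTo (col ρ) N i (<-≤-trans p (at-Box b j)))))

-- Row lengths are compared through the column indices below them, so that every fact on `τ` reduces
-- to the cell equivalence given by `τ-to` and `τ-from`.
≤-ext : ∀ {a b} → (∀ {j} → j < a → j < b) → a ≤ b
≤-ext {zero}  h = z≤n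
≤-ext {suc a} h = h ≤-refl

τ-involutive : ∀ {N ρ} → Box N N ρ → τ N (τ N ρ) ≡ ρ
τ-involutive {N} {ρ} b = Box-ext (Box-τ (Box-τ b)) b (λ i _ → ≤-antisym
  (≤-ext (λ p → τ-to b (τ-to (Box-τ b) p))) (≤-ext (λ p → τ-from (Box-τ b) (τ-from b p))))

sum-applyUpTo-+ : ∀ n f g → sum (applyUpTo (λ i → f i + g i) n) ≡ sum (applyUpTo f n) + sum (applyUpTo g n)
sum-applyUpTo-+ zero    f g = refl
sum-applyUpTo-+ (suc n) f g = trans (cong (λ z → f 0 + g 0 + z) (sum-applyUpTo-+ n (f ∘ suc) (g ∘ suc)))
  (ℕ+.interchange (f 0) (g 0) (sum (applyUpTo (f ∘ suc) n)) (sum (applyUpTo (g ∘ suc) n)))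

applyUpTo-cong : ∀ {A : Set} n {f g : ℕ → A} → (∀ i → i < n → f i ≡ g i) → applyUpTo f n ≡ applyUpTo g n
applyUpTo-cong zero    h = refl
applyUpTo-cong (suc n) h = cong₂ _∷_ (h 0 (s≤s z≤n)) (applyUpTo-cong n (λ i p → h (suc i) (s≤s p)))

sum-<ᵇ : ∀ n l → l ≤ n → sum (applyUpTo (λ j → if j <ᵇ l then 1 else 0) n) ≡ l
sum-<ᵇ zero    zero    p       = refl
sum-<ᵇ (suc n) zero    p       = sum-<ᵇ n zero z≤n
sum-<ᵇ (suc n) (suc l) (s≤s p) = cong suc (sum-<ᵇ n l p)

sum-col : ∀ {L u ρ} → Box L u ρ → ∀ N → u ≤ N → sum (applyUpTo (col ρ) N) ≡ sum ρ
sum-col [] N q = trans (sum-applyUpTo-0 N) refl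
  where
  sum-applyUpTo-0 : ∀ N → sum (applyUpTo (λ _ → 0) N) ≡ 0
  sum-applyUpTo-0 zero    = refl
  sum-applyUpTo-0 (suc N) = sum-applyUpTo-0 N
sum-col (_∷_ {r = l} {ρ} p b) N q = begin
  sum (applyUpTo (col (l ∷ ρ)) N)
    ≡⟨ cong sum (applyUpTo-cong N (λ j _ → col-∷ l ρ j)) ⟩
  sum (applyUpTo (λ j → (if j <ᵇ l then 1 else 0) + col ρ j) N)
    ≡⟨ sum-applyUpTo-+ N _ (col ρ) ⟩
  sum (applyUpTo (λ j → if j <ᵇ l then 1 else 0) N) + sum (applyUpTo (col ρ) N)
    ≡⟨ cong₂ _+_ (sum-<ᵇ N l (≤-trans p q)) (sum-col b N (≤-trans p q)) ⟩
  l + sum ρ ∎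
 

sum-τ : ∀ {N ρ} → Box N N ρ → sum (τ N ρ) ≡ sum ρ
sum-τ {N} b = sum-col b N ≤-refl

-- A change of variables by the involution `τ`: insert a delta function, swap the two sums, and move
-- `τ` to the other argument of the delta.
ΣD-τ : ∀ N f → ΣD N N (λ ρ → f (τ N ρ)) ≡ ΣD N N f
ΣD-τ N f = begin
  ΣD N N (λ ρ → f (τ N ρ))
    ≡⟨ ΣD-cong N N (λ b → sym (ΣD-δ (Box-τ b) f)) ⟩
  ΣD N N (λ ρ → ΣD N N (λ σ → when (eqList (τ N ρ) σ) (f σ)))
    ≡⟨ ΣD-swap N N N N _ ⟩
  ΣD N N (λ σ → ΣD N N (λ ρ → when (eqList (τ N ρ) σ) (f σ)))
    ≡⟨ ΣD-cong N N (λ {σ} bσ → trans (ΣD-cong N N (λ {ρ} bρ → cong (λ z → when z (f σ)) (adjoint bρ bσ))) (ΣD-δ (Box-τ bσ) (λ _ → f σ))) ⟩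
  ΣD N N f ∎
  where
  flip : ∀ {ρ σ} → Box N N ρ → T (eqList (τ N ρ) σ) → T (eqList (τ N σ) ρ)
  flip {ρ} {σ} b t rewrite sym (eqList-elim (τ N ρ) σ t) | τ-involutive b = true-T (eqList-refl ρ)
  adjoint : ∀ {ρ σ} → Box N N ρ → Box N N σ → eqList (τ N ρ) σ ≡ eqList (τ N σ) ρ
  adjoint b c = T⇒≡ (flip b) (flip c)

-- Strip kernels and the convolution of horizontal with signed vertical strips

hs vs : List ℕ → List ℕ → Bool
hs []       []      = true
hs (l ∷ ls) (r ∷ ρ) = ((nxt ls ≤ᵇ r) ∧ (r ≤ᵇ l)) ∧ hs ls ρ
hs _        _       = false
vs []       []      = true
vs (l ∷ ls) (r ∷ ρ) = ((r ≤ᵇ l) ∧ (l ≤ᵇ suc r)) ∧ vs ls ρ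
vs _        _       = false

hs-to : ∀ ls ρ → T (hs ls ρ) → ∀ i → (at ls (suc i) ≤ at ρ i) × (at ρ i ≤ at ls i)
hs-to []       []      t i = z≤n , z≤n
hs-to (l ∷ ls) (r ∷ ρ) t zero = subst (_≤ r) (nxt-at ls) (≤ᵇ-elim (nxt ls) r (∧-Tˡ (nxt ls ≤ᵇ r) h)) , ≤ᵇ-elim r l (∧-Tʳ (nxt ls ≤ᵇ r) h)
  where
  h = ∧-Tˡ ((nxt ls ≤ᵇ r) ∧ (r ≤ᵇ l)) t
  nxt-at : ∀ ls → nxt ls ≡ at ls 0
  nxt-at []      = refl
  nxt-at (_ ∷ _) = refl
hs-to (l ∷ ls) (r ∷ ρ) t (suc i) = hs-to ls ρ (∧-Tʳ ((nxt ls ≤ᵇ r) ∧ (r ≤ᵇ l)) t) i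

hs-from : ∀ {L u v ls ρ} → Box L u ls → Box L v ρ → (∀ i → (at ls (suc i) ≤ at ρ i) × (at ρ i ≤ at ls i)) → T (hs ls ρ)
hs-from []      []      h = tt
hs-from (_∷_ {r = l} {ls} _ b) (_∷_ {r = r} _ c) h =
  ∧-T (∧-T (≤ᵇ-intro (subst (_≤ r) (sym (nxt-at ls)) (proj₁ (h 0)))) (≤ᵇ-intro (proj₂ (h 0)))) (hs-from b c (h ∘ suc))
  where
  nxt-at : ∀ ls → nxt ls ≡ at ls 0
  nxt-at []      = refl
  nxt-at (_ ∷ _) = refl

vs-to : ∀ ls ρ → T (vs ls ρ) → ∀ i → (at ρ i ≤ at ls i) × (at ls i ≤ suc (at ρ i))
vs-to []       []      t i = z≤n , z≤n
vs-to (l ∷ ls) (r ∷ ρ) t zero = ≤ᵇ-elim r l (∧-Tˡ (r ≤ᵇ l) h) , ≤ᵇ-elim l (suc r) (∧-Tʳ (r ≤ᵇ l) h)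
  where h = ∧-Tˡ ((r ≤ᵇ l) ∧ (l ≤ᵇ suc r)) t
vs-to (l ∷ ls) (r ∷ ρ) t (suc i) = vs-to ls ρ (∧-Tʳ ((r ≤ᵇ l) ∧ (l ≤ᵇ suc r)) t) i

vs-from : ∀ {L u v ls ρ} → Box L u ls → Box L v ρ → (∀ i → (at ρ i ≤ at ls i) × (at ls i ≤ suc (at ρ i))) → T (vs ls ρ)
vs-from [] [] h = tt
vs-from (_∷_ {r = l} _ b) (_∷_ {r = r} _ c) h = ∧-T (∧-T (≤ᵇ-intro (proj₁ (h 0))) (≤ᵇ-intro {l} {suc r} (proj₂ (h 0)))) (vs-from b c (h ∘ suc))

hs-τ : ∀ {N ls ρ} → Box N N ls → Box N N ρ → hs (τ N ls) (τ N ρ) ≡ vs ls ρ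
hs-τ {N} {ls} {ρ} b c = T⇒≡
  (λ t → let h = hs-to (τ N ls) (τ N ρ) t in vs-from b c (λ i →
    ≤-ext (λ p → τ-to b (<-≤-trans (τ-from c p) (proj₂ (h _)))) ,
    ≤-ext (λ { {zero} p → s≤s z≤n ; {suc j} p → s≤s (τ-to c (<-≤-trans (τ-from b p) (proj₁ (h _)))) })))
  (λ t → let h = vs-to ls ρ t in hs-from (Box-τ b) (Box-τ c) (λ i →
    ≤-ext (λ p → τ-from c (≤-pred (<-≤-trans (τ-to b p) (proj₂ (h _))))) ,
    ≤-ext (λ p → τ-from b (<-≤-trans (τ-to c p) (proj₁ (h _))))))

at-mono-sum : ∀ {L u v ls ρ} → Box L u ls → Box L v ρ → (∀ i → at ρ i ≤ at ls i) → sum ρ ≤ sum ls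
at-mono-sum []      []      h = z≤n
at-mono-sum (_ ∷ b) (_ ∷ c) h = +-mono-≤ (h 0) (at-mono-sum b c (h ∘ suc))

sub-+ : ∀ {a b c d} → b ≤ a → d ≤ c → (a + c) ∸ (b + d) ≡ (a ∸ b) + (c ∸ d)
sub-+ {a} {b} {c} {d} p q = begin
  (a + c) ∸ (b + d)                         ≡⟨ cong₂ (λ x y → (x + y) ∸ (b + d)) (sym (m∸n+n≡m p)) (sym (m∸n+n≡m q)) ⟩
  ((a ∸ b) + b + ((c ∸ d) + d)) ∸ (b + d)   ≡⟨ cong (_∸ (b + d)) (ℕ+.interchange (a ∸ b) b (c ∸ d) d) ⟩
  ((a ∸ b) + (c ∸ d)) + (b + d) ∸ (b + d)   ≡⟨ m+n∸n≡m _ (b + d) ⟩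
  (a ∸ b) + (c ∸ d) ∎

op-kernel : ∀ {L u ls} → Box L u ls → ∀ f e → op false f ls e ≡ ΣD L u (λ ρ → when (hs ls ρ) (f ρ (e + (sum ls ∸ sum ρ))))
op-kernel [] f e = cong (f []) (sym (ℕ.+-identityʳ e))
op-kernel {suc L} {u} {l ∷ ls} (p ∷ b) f e = begin
  op false f (l ∷ ls) e
    ≡⟨ op-sum< false (p ∷ b) f e ⟩
  sum< (suc l) (λ r → when (n ≤ᵇ r) (op false (λ ρ → f (r ∷ ρ)) ls (e + (l ∸ r))))
    ≡⟨ sum<-cong (suc l) (λ r q → when-cong (n ≤ᵇ r) (λ t → trans (op-kernel (Box-bound b (≤ᵇ-elim n r t)) _ _) (ΣD-cong L r (λ {ρ} bρ → when-cong (hs ls ρ) (λ h →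
         cong (f (r ∷ ρ)) (trans (ℕ.+-assoc e _ _) (cong (λ z → e + z) (sym (sub-+ (≤-pred q) (at-mono-sum b bρ (λ i → proj₂ (hs-to ls ρ h i)))))))))))) ⟩
  sum< (suc l) (λ r → when (n ≤ᵇ r) (ΣD L r (λ ρ → when (hs ls ρ) (f (r ∷ ρ) (e + (l + sum ls ∸ (r + sum ρ)))))))
    ≡⟨ sym (sum<-window z≤n p (λ r → when (n ≤ᵇ r) (ΣD L r (λ ρ → when (hs ls ρ) (f (r ∷ ρ) (e + (l + sum ls ∸ (r + sum ρ)))))))) ⟩
  sum< (suc u) (λ r → when (r ≤ᵇ l) (when (n ≤ᵇ r) (ΣD L r (λ ρ → when (hs ls ρ) (f (r ∷ ρ) (e + (l + sum ls ∸ (r + sum ρ))))))))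
    ≡⟨ sum<-cong (suc u) (λ r _ → trans (when-∧ (r ≤ᵇ l) (n ≤ᵇ r) _) (trans (cong (λ z → when z (ΣD L r (λ ρ → when (hs ls ρ) (f (r ∷ ρ) (e + (l + sum ls ∸ (r + sum ρ))))))) (∧-comm (r ≤ᵇ l) (n ≤ᵇ r)))
         (trans (sym (linear-when (ΣD-linear L r) ((n ≤ᵇ r) ∧ (r ≤ᵇ l)) (λ ρ → when (hs ls ρ) (f (r ∷ ρ) (e + (l + sum ls ∸ (r + sum ρ)))))))
           (ΣD-cong L r (λ {ρ} _ → when-∧ ((n ≤ᵇ r) ∧ (r ≤ᵇ l)) (hs ls ρ) _))))) ⟩
  ΣD (suc L) u (λ ρ → when (hs (l ∷ ls) ρ) (f ρ (e + (l + sum ls ∸ sum ρ)))) ∎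
  where
  n = nxt ls

transferV-kernel : ∀ {L u ls} → Box L (suc u) ls → ∀ f e → transferV u f ls e ≡ ΣD L u (λ ρ → when (vs ls ρ) (f ρ (e + (sum ls ∸ sum ρ))))
transferV-kernel [] f e = cong (f []) (sym (ℕ.+-identityʳ e))
transferV-kernel {suc L} {u} {l ∷ ls} (p ∷ b) f e = trans (rows (m≤n⇒m<n∨m≡n p)) (sum<-cong (suc u) (λ r _ →
  trans (sym (linear-when (ΣD-linear L r) ((r ≤ᵇ l) ∧ (l ≤ᵇ suc r)) (λ ρ → when (vs ls ρ) (f (r ∷ ρ) (e + (l + sum ls ∸ (r + sum ρ)))))))
    (ΣD-cong L r (λ {ρ} _ → when-∧ ((r ≤ᵇ l) ∧ (l ≤ᵇ suc r)) (vs ls ρ) _))))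
  where
  X : ℕ → ℤ
  X r = ΣD L r (λ ρ → when (vs ls ρ) (f (r ∷ ρ) (e + (l + sum ls ∸ (r + sum ρ)))))
  row : ∀ r e′ → Box L (suc r) ls → r ≤ l → e′ ≡ e + (l ∸ r) → transferV r (λ ρ → f (r ∷ ρ)) ls e′ ≡ X r
  row r e′ b q refl = trans (transferV-kernel b (λ ρ → f (r ∷ ρ)) e′) (ΣD-cong L r (λ {ρ} bρ → when-cong (vs ls ρ) (λ h →
    cong (f (r ∷ ρ)) (trans (ℕ.+-assoc e _ _) (cong (λ z → e + z) (sym (sub-+ q (at-mono-sum b bρ (λ i → proj₁ (vs-to ls ρ h i))))))))))
  Sum : ℤ
  Sum = sum< (suc u) (λ r → when ((r ≤ᵇ l) ∧ (l ≤ᵇ suc r)) (X r))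
  flip : Sum ≡ sum< (suc u) (λ r → when ((l ∸ 1 ≤ᵇ r) ∧ (r ≤ᵇ l)) (X r))
  flip = sum<-cong (suc u) (λ r _ → cong (λ z → when z (X r)) (trans (∧-comm (r ≤ᵇ l) (l ≤ᵇ suc r)) (cong (_∧ (r ≤ᵇ l)) (pred-≤ l r))))
    where
    pred-≤ : ∀ l r → (l ≤ᵇ suc r) ≡ (l ∸ 1 ≤ᵇ r)
    pred-≤ zero    r = refl
    pred-≤ (suc l) r = T⇒≡ {suc l ≤ᵇ suc r} {l ≤ᵇ r} (λ t → ≤ᵇ-intro (≤-pred (≤ᵇ-elim (suc l) (suc r) t))) (λ t → ≤ᵇ-intro (s≤s (≤ᵇ-elim l r t)))
  free : ∀ l → l ≤ u → Box L l ls → (∀ r e′ → Box L (suc r) ls → r ≤ l → e′ ≡ e + (l ∸ r) → transferV r (λ ρ → f (r ∷ ρ)) ls e′ ≡ X r) →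
    transferV u f (l ∷ ls) e ≡ sum< (suc u) (λ r → when ((l ∸ 1 ≤ᵇ r) ∧ (r ≤ᵇ l)) (X r))
  free l q b row = begin
    transferV u f (l ∷ ls) e
      ≡⟨ tr-free (+ 1) (+ 0) ls f e q ⟩
    transferV l (λ ρ → f (l ∷ ρ)) ls e +ℤ + 1 *ℤ pre l (λ k → transferV k (λ ρ → f (k ∷ ρ)) ls (suc e))
      ≡⟨ cong₂ _+ℤ_ (row l e (Box-weaken b (n≤1+n l)) ≤-refl (sym (trans (cong (λ z → e + z) (n∸n≡0 l)) (ℕ.+-identityʳ e))))
           (cong (λ z → + 1 *ℤ z) (pre-cong l (λ { k refl → row k (suc e) b (n≤1+n k) (sym (trans (cong (λ z → e + z) (m+n∸n≡m 1 k)) (ℕ.+-comm e 1))) }))) ⟩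
    X l +ℤ + 1 *ℤ pre l X
      ≡⟨ two-terms l ⟩
    sum< (suc (l ∸ (l ∸ 1))) (λ i → X ((l ∸ 1) + i))
      ≡⟨ sym (sum<-window (m∸n≤m l 1) q X) ⟩
    sum< (suc u) (λ r → when ((l ∸ 1 ≤ᵇ r) ∧ (r ≤ᵇ l)) (X r)) ∎
    where
    two-terms : ∀ l → X l +ℤ + 1 *ℤ pre l X ≡ sum< (suc (l ∸ (l ∸ 1))) (λ i → X ((l ∸ 1) + i))
    two-terms zero = ℤ.+-comm (X 0) (+ 0)
    two-terms (suc l) rewrite m+n∸n≡m 1 l | ℕ.+-identityʳ l | ℕ.+-comm l 1 = swap (X (suc l)) (X l)
      where
      swap : ∀ a b → a +ℤ + 1 *ℤ b ≡ (+ 0 +ℤ b) +ℤ a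
      swap = solve-∀
  rows : (l < suc u) ⊎ (l ≡ suc u) → transferV u f (l ∷ ls) e ≡ Sum
  rows (inj₁ q) = trans (free l (≤-pred q) b row) (sym flip)
  rows (inj₂ refl) = begin
    transferV u f (suc u ∷ ls) e
      ≡⟨ trans (tr-forced (+ 1) (+ 0) u ls f e) (trans (ℤ.+-identityʳ _) (ℤ.*-identityˡ _)) ⟩
    transferV u (λ ρ → f (u ∷ ρ)) ls (suc e)
      ≡⟨ row u (suc e) b (n≤1+n u) (sym (trans (cong (λ z → e + z) (m+n∸n≡m 1 u)) (ℕ.+-comm e 1))) ⟩
    X u
      ≡⟨ sym (trans (cong₂ (λ y z → sum< (suc y) (λ i → X (z + i))) (n∸n≡0 u) refl) (trans (ℤ.+-identityˡ _) (cong X (ℕ.+-identityʳ u)))) ⟩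
    sum< (suc (u ∸ u)) (λ i → X (u + i))
      ≡⟨ sym (sum<-window {u} {u} {u} ≤-refl ≤-refl X) ⟩
    sum< (suc u) (λ r → when ((u ≤ᵇ r) ∧ (r ≤ᵇ u)) (X r))
      ≡⟨ sum<-cong (suc u) (λ r q → cong (λ z → when ((u ≤ᵇ r) ∧ z) (X r)) (trans (≤ᵇ-true (≤-pred q)) (sym (≤ᵇ-true (m≤n⇒m≤1+n (≤-pred q)))))) ⟩
    sum< (suc u) (λ r → when ((u ≤ᵇ r) ∧ (r ≤ᵇ suc u)) (X r))
      ≡⟨ sym flip ⟩
    Sum ∎

-- With `g` read as a functional on Schur functions, this is `g` after the adjoint of multiplication
-- by h_m; `Vc` is the analogue for e_m.
Hc : ℕ → (List ℕ → ℤ) → List ℕ → ℤ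
Hc m g ls = op false (λ ρ e → when (e ≡ᵇ m) (g ρ)) ls 0

Vc : ℕ → ℕ → (List ℕ → ℤ) → List ℕ → ℤ
Vc N m g ls = transferV N (λ ρ e → when (e ≡ᵇ m) (g ρ)) ls 0

Vc-τ : ∀ {N ls} → Box N N ls → ∀ m g → Vc N m g ls ≡ Hc m (λ ρ → g (τ N ρ)) (τ N ls)
Vc-τ {N} {ls} b m g = begin
  Vc N m g ls
    ≡⟨ transferV-kernel (Box-weaken b (n≤1+n N)) _ 0 ⟩
  ΣD N N (λ ρ → when (vs ls ρ) (when (sum ls ∸ sum ρ ≡ᵇ m) (g ρ)))
    ≡⟨ ΣD-cong N N (λ {ρ} c → sym (cong₂ when (hs-τ b c) (cong₂ (λ x y → when (x ≡ᵇ m) (g y)) (cong₂ _∸_ (sum-τ b) (sum-τ c)) (τ-involutive c)))) ⟩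
  ΣD N N (λ ρ → when (hs (τ N ls) (τ N ρ)) (when (sum (τ N ls) ∸ sum (τ N ρ) ≡ᵇ m) (g (τ N (τ N ρ)))))
    ≡⟨ ΣD-τ N (λ ρ → when (hs (τ N ls) ρ) (when (sum (τ N ls) ∸ sum ρ ≡ᵇ m) (g (τ N ρ)))) ⟩
  ΣD N N (λ ρ → when (hs (τ N ls) ρ) (when (sum (τ N ls) ∸ sum ρ ≡ᵇ m) (g (τ N ρ))))
    ≡⟨ sym (op-kernel (Box-τ b) _ 0) ⟩
  Hc m (λ ρ → g (τ N ρ)) (τ N ls) ∎
 

when-comm : ∀ a b x → when a (when b x) ≡ when b (when a x)
when-comm true  b x = refl
when-comm false b x = sym (when-0 b)

sign-suc : ∀ n → sign (suc n) ≡ - sign n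
sign-suc zero          = refl
sign-suc (suc zero)    = refl
sign-suc (suc (suc n)) = sign-suc n

sign-+ : ∀ m n → sign (m + n) ≡ sign m *ℤ sign n
sign-+ zero    n = sym (ℤ.*-identityˡ (sign n))
sign-+ (suc m) n rewrite sign-suc (m + n) | sign-suc m | sign-+ m n = ℤ.neg-distribˡ-* (sign m) (sign n)

sign-square : ∀ n → sign n *ℤ sign n ≡ + 1
sign-square zero          = refl
sign-square (suc zero)    = refl
sign-square (suc (suc n)) = sign-square n

sign-cancel : ∀ n x → sign n *ℤ (sign n *ℤ x) ≡ x
sign-cancel n x = trans (sym (ℤ.*-assoc (sign n) (sign n) x)) (trans (cong (_*ℤ x) (sign-square n)) (ℤ.*-identityˡ x))

sgn : List ℕ → ℤ
sgn ls = sign (sum ls)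

when-* : ∀ b c x → when b (c *ℤ x) ≡ c *ℤ when b x
when-* true  c x = refl
when-* false c x = sym (ℤ.*-zeroʳ c)

-- Every removed cell carries a factor -1 and their number is the difference of the two sizes, so
-- the signs of the sizes before and after absorb all of them.
signed-transferV : ∀ {L u ls} → Box L (suc u) ls → ∀ f e → signed u f ls e ≡ sgn ls *ℤ transferV u (λ ρ e → sgn ρ *ℤ f ρ e) ls e
signed-transferV [] f e = sym (trans (ℤ.*-identityˡ _) (ℤ.*-identityˡ _))
signed-transferV {u = u} {l ∷ ls} (p ∷ b) f e = rows (m≤n⇒m<n∨m≡n p)
  where
  V : ℕ → ℕ → ℤ
  V k e = transferV k (λ ρ e → sgn ρ *ℤ f (k ∷ ρ) e) ls e
  scale : ∀ k e → transferV k (λ ρ e → sgn (k ∷ ρ) *ℤ f (k ∷ ρ) e) ls e ≡ sign k *ℤ V k e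
  scale k e = trans (respects (tr-linear (+ 1) (+ 0) k ls e) (λ (ρ , e) → trans (cong (_*ℤ f (k ∷ ρ) e) (sign-+ k (sum ρ))) (ℤ.*-assoc (sign k) (sgn ρ) _)))
    (scalar (tr-linear (+ 1) (+ 0) k ls e) (sign k) (λ (ρ , e) → sgn ρ *ℤ f (k ∷ ρ) e))
  same : ∀ k x → sgn ls *ℤ x ≡ sgn (k ∷ ls) *ℤ (sign k *ℤ x)
  same k x = trans (cong (sgn ls *ℤ_) (sym (sign-cancel k x))) (trans (swap (sgn ls) (sign k) (sign k *ℤ x)) (cong (_*ℤ (sign k *ℤ x)) (sym (sign-+ k (sum ls)))))
    where
    swap : ∀ a b c → a *ℤ (b *ℤ c) ≡ (b *ℤ a) *ℤ c
    swap = solve-∀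
  moved : ∀ k x → - (+ 1) *ℤ (sgn ls *ℤ x) ≡ sgn (suc k ∷ ls) *ℤ (+ 1 *ℤ (sign k *ℤ x))
  moved k x = trans (cong (- (+ 1) *ℤ_) (same k x)) (trans (neg (sgn (k ∷ ls)) (sign k *ℤ x)) (cong (_*ℤ (+ 1 *ℤ (sign k *ℤ x))) (sym (sign-suc (k + sum ls)))))
    where
    neg : ∀ a b → - (+ 1) *ℤ (a *ℤ b) ≡ (- a) *ℤ (+ 1 *ℤ b)
    neg = solve-∀
  rows : (l < suc u) ⊎ (l ≡ suc u) → signed u f (l ∷ ls) e ≡ sgn (l ∷ ls) *ℤ transferV u (λ ρ e → sgn ρ *ℤ f ρ e) (l ∷ ls) e
  rows (inj₁ q) = begin
    signed u f (l ∷ ls) e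
      ≡⟨ tr-free (- (+ 1)) (+ 0) ls f e (≤-pred q) ⟩
    signed l (λ ρ → f (l ∷ ρ)) ls e +ℤ - (+ 1) *ℤ pre l (λ k → signed k (λ ρ → f (k ∷ ρ)) ls (suc e))
      ≡⟨ cong₂ _+ℤ_ (trans (signed-transferV (Box-weaken b (n≤1+n l)) (λ ρ → f (l ∷ ρ)) e) (trans (same l (V l e)) (cong (sgn (l ∷ ls) *ℤ_) (sym (scale l e))))) (second l b) ⟩
    sgn (l ∷ ls) *ℤ transferV l (λ ρ e → sgn (l ∷ ρ) *ℤ f (l ∷ ρ) e) ls e +ℤ sgn (l ∷ ls) *ℤ (+ 1 *ℤ pre l (λ k → transferV k (λ ρ e → sgn (k ∷ ρ) *ℤ f (k ∷ ρ) e) ls (suc e)))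
      ≡⟨ sym (trans (cong (sgn (l ∷ ls) *ℤ_) (tr-free (+ 1) (+ 0) ls (λ ρ e → sgn ρ *ℤ f ρ e) e (≤-pred q))) (ℤ.*-distribˡ-+ (sgn (l ∷ ls)) _ _)) ⟩
    sgn (l ∷ ls) *ℤ transferV u (λ ρ e → sgn ρ *ℤ f ρ e) (l ∷ ls) e ∎
    where
    second : ∀ l → Box _ l ls → - (+ 1) *ℤ pre l (λ k → signed k (λ ρ → f (k ∷ ρ)) ls (suc e)) ≡
      sgn (l ∷ ls) *ℤ (+ 1 *ℤ pre l (λ k → transferV k (λ ρ e → sgn (k ∷ ρ) *ℤ f (k ∷ ρ) e) ls (suc e)))
    second zero    b = sym (ℤ.*-zeroʳ (sgn (0 ∷ ls)))
    second (suc k) b = trans (cong (- (+ 1) *ℤ_) (signed-transferV b (λ ρ → f (k ∷ ρ)) (suc e)))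
      (trans (moved k (V k (suc e))) (cong (λ z → sgn (suc k ∷ ls) *ℤ (+ 1 *ℤ z)) (sym (scale k (suc e)))))
  rows (inj₂ refl) = begin
    signed u f (suc u ∷ ls) e
      ≡⟨ trans (tr-forced (- (+ 1)) (+ 0) u ls f e) (ℤ.+-identityʳ _) ⟩
    - (+ 1) *ℤ signed u (λ ρ → f (u ∷ ρ)) ls (suc e)
      ≡⟨ trans (cong (- (+ 1) *ℤ_) (signed-transferV b (λ ρ → f (u ∷ ρ)) (suc e))) (moved u (V u (suc e))) ⟩
    sgn (suc u ∷ ls) *ℤ (+ 1 *ℤ (sign u *ℤ V u (suc e)))
      ≡⟨ cong (sgn (suc u ∷ ls) *ℤ_) (sym (trans (tr-forced (+ 1) (+ 0) u ls (λ ρ e → sgn ρ *ℤ f ρ e) e) (trans (ℤ.+-identityʳ _) (cong (+ 1 *ℤ_) (scale u (suc e)))))) ⟩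
    sgn (suc u ∷ ls) *ℤ transferV u (λ ρ e → sgn ρ *ℤ f ρ e) (suc u ∷ ls) e ∎

Hc-linear : ∀ m ls → Linear (λ g → Hc m g ls)
Hc-linear m ls = linear-∘ (op-linear false ls 0) (λ (ρ , e) → when-linear (e ≡ᵇ m) (linear-eval ρ))

Hc-cong : ∀ {L u ls} → Box L u ls → ∀ m {f g} → (∀ {ρ} → Box L u ρ → f ρ ≡ g ρ) → Hc m f ls ≡ Hc m g ls
Hc-cong b m h = op-cong false b (λ bρ e → cong (when (e ≡ᵇ m)) (h bρ)) 0

Hc-comm : ∀ {L u ls} → Box L u ls → ∀ a b g → Hc a (Hc b g) ls ≡ Hc b (Hc a g) ls
Hc-comm {ls = ls} bx a b g = begin
  op false (λ ρ e → when (e ≡ᵇ a) (op false (λ σ d → when (d ≡ᵇ b) (g σ)) ρ 0)) ls 0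
    ≡⟨ respects (op-linear false ls 0) (λ (ρ , e) → sym (linear-when (op-linear false ρ 0) (e ≡ᵇ a) (λ (σ , d) → when (d ≡ᵇ b) (g σ)))) ⟩
  op false (λ ρ e → op false (λ σ d → when (e ≡ᵇ a) (when (d ≡ᵇ b) (g σ))) ρ 0) ls 0
    ≡⟨ op-comm bx (λ σ e d → when (e ≡ᵇ a) (when (d ≡ᵇ b) (g σ))) 0 0 ⟩
  op false (λ ρ d → op false (λ σ e → when (e ≡ᵇ a) (when (d ≡ᵇ b) (g σ))) ρ 0) ls 0
    ≡⟨ respects (op-linear false ls 0) (λ (ρ , d) → trans (respects (op-linear false ρ 0) (λ (σ , e) → trans (when-∧ (e ≡ᵇ a) (d ≡ᵇ b) (g σ))
         (trans (cong (λ z → when z (g σ)) (∧-comm (e ≡ᵇ a) (d ≡ᵇ b))) (sym (when-∧ (d ≡ᵇ b) (e ≡ᵇ a) (g σ))))))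
         (linear-when (op-linear false ρ 0) (d ≡ᵇ b) (λ (σ , e) → when (e ≡ᵇ a) (g σ)))) ⟩
  op false (λ ρ d → when (d ≡ᵇ b) (op false (λ σ e → when (e ≡ᵇ a) (g σ)) ρ 0)) ls 0 ∎
 

-- The relation Σ (-1)^k h_{m-k} e_k = 0 for m > 0, as operators on shapes, with (-1)^k expressed by
-- signs of sizes. It is `op-signed` restricted to total exponent m: after e cells in the horizontal
-- strip, m - e remain for the vertical one.
HV-convolution : ∀ {N ls} → Box N N ls → ∀ m g →
  sum< (suc m) (λ k → Hc (m ∸ k) (λ ρ → sgn ρ *ℤ Vc N k g ρ) ls) ≡ when (0 ≡ᵇ m) (sgn ls *ℤ g ls)
HV-convolution {N} {ls} b m g = begin
  sum< (suc m) (λ k → op false (λ ρ e → when (e ≡ᵇ m ∸ k) (φ k ρ)) ls 0)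
    ≡⟨ sym (linear-sum< (op-linear false ls 0) (λ k (ρ , e) → when (e ≡ᵇ m ∸ k) (φ k ρ)) (suc m)) ⟩
  op false (λ ρ e → sum< (suc m) (λ k → when (e ≡ᵇ m ∸ k) (φ k ρ))) ls 0
    ≡⟨ op-cong false b (λ bρ e → pointwise bρ e) 0 ⟩
  op false (signed N f) ls 0
    ≡⟨ op-signed b ≤-refl f 0 ⟩
  f ls 0 ∎
  where
  φ : ℕ → List ℕ → ℤ
  φ k ρ = sgn ρ *ℤ Vc N k g ρ
  f : List ℕ → ℕ → ℤ
  f ρ e = when (e ≡ᵇ m) (sgn ρ *ℤ g ρ)
  select : ∀ ρ e → sum< (suc m) (λ k → when (e ≡ᵇ m ∸ k) (φ k ρ)) ≡ when (e ≤ᵇ m) (φ (m ∸ e) ρ)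
  select ρ e = trans (sum<-reflect m (λ k → when (e ≡ᵇ m ∸ k) (φ k ρ)))
    (trans (sum<-cong (suc m) (λ i q → cong (λ z → when (e ≡ᵇ z) (φ (m ∸ i) ρ)) (ℕ.m∸[m∸n]≡n (≤-pred q)))) (pick (≤-<-connex e m)))
    where
    pick : (e ≤ m) ⊎ (m < e) → sum< (suc m) (λ i → when (e ≡ᵇ i) (φ (m ∸ i) ρ)) ≡ when (e ≤ᵇ m) (φ (m ∸ e) ρ)
    pick (inj₁ q) rewrite ≤ᵇ-true q = sum<-δ (s≤s q) (λ i → φ (m ∸ i) ρ)
    pick (inj₂ q) rewrite ≤ᵇ-false q = sum<-zero (suc m) (λ i p → cong (λ z → when z (φ (m ∸ i) ρ)) (≡ᵇ-false (>⇒≢ (≤-<-trans (≤-pred p) q))))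
  shift : ∀ e d → (e + d ≡ᵇ m) ≡ (e ≤ᵇ m) ∧ (d ≡ᵇ m ∸ e)
  shift e d = T⇒≡
    (λ t → let eq = ≡ᵇ-elim (e + d) m t in ∧-T (≤ᵇ-intro (subst (e ≤_) eq (m≤m+n e d)))
      (≡⇒≡ᵇ d (m ∸ e) (trans (sym (m+n∸m≡n e d)) (cong (_∸ e) eq))))
    (λ t → ≡⇒≡ᵇ (e + d) m (trans (cong (λ z → e + z) (≡ᵇ-elim d (m ∸ e) (∧-Tʳ (e ≤ᵇ m) t))) (m+[n∸m]≡n (≤ᵇ-elim e m (∧-Tˡ (e ≤ᵇ m) t)))))
  transferV-select : ∀ {ρ} → Box N N ρ → ∀ e → transferV N (λ σ e → when (e ≡ᵇ m) (g σ)) ρ e ≡ when (e ≤ᵇ m) (Vc N (m ∸ e) g ρ)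
  transferV-select {ρ} bρ e = begin
    transferV N (λ σ e → when (e ≡ᵇ m) (g σ)) ρ e
      ≡⟨ transferV-kernel bρ′ _ e ⟩
    ΣD N N (λ σ → when (vs ρ σ) (when (e + (sum ρ ∸ sum σ) ≡ᵇ m) (g σ)))
      ≡⟨ ΣD-cong N N (λ {σ} _ → trans (cong (λ z → when (vs ρ σ) (when z (g σ))) (shift e (sum ρ ∸ sum σ))) (trans (cong (when (vs ρ σ)) (sym (when-∧ (e ≤ᵇ m) _ (g σ))))
           (when-comm (vs ρ σ) (e ≤ᵇ m) _))) ⟩
    ΣD N N (λ σ → when (e ≤ᵇ m) (when (vs ρ σ) (when (sum ρ ∸ sum σ ≡ᵇ m ∸ e) (g σ))))
      ≡⟨ linear-when (ΣD-linear N N) (e ≤ᵇ m) _ ⟩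
    when (e ≤ᵇ m) (ΣD N N (λ σ → when (vs ρ σ) (when (sum ρ ∸ sum σ ≡ᵇ m ∸ e) (g σ))))
      ≡⟨ cong (when (e ≤ᵇ m)) (sym (transferV-kernel bρ′ _ 0)) ⟩
    when (e ≤ᵇ m) (Vc N (m ∸ e) g ρ) ∎
    where bρ′ = Box-weaken bρ (n≤1+n N)
  pointwise : ∀ {ρ} → Box N N ρ → ∀ e → sum< (suc m) (λ k → when (e ≡ᵇ m ∸ k) (φ k ρ)) ≡ signed N f ρ e
  pointwise {ρ} bρ e = trans (select ρ e) (sym (begin
    signed N f ρ e
      ≡⟨ signed-transferV (Box-weaken bρ (n≤1+n N)) f e ⟩
    sgn ρ *ℤ transferV N (λ σ e → sgn σ *ℤ f σ e) ρ e
      ≡⟨ cong (sgn ρ *ℤ_) (respects (tr-linear (+ 1) (+ 0) N ρ e) (λ (σ , e) → trans (sym (when-* (e ≡ᵇ m) (sgn σ) _)) (cong (when (e ≡ᵇ m)) (sign-cancel (sum σ) (g σ))))) ⟩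
    sgn ρ *ℤ transferV N (λ σ e → when (e ≡ᵇ m) (g σ)) ρ e
      ≡⟨ cong (sgn ρ *ℤ_) (transferV-select bρ e) ⟩
    sgn ρ *ℤ when (e ≤ᵇ m) (Vc N (m ∸ e) g ρ)
      ≡⟨ sym (when-* (e ≤ᵇ m) (sgn ρ) _) ⟩
    when (e ≤ᵇ m) (φ (m ∸ e) ρ) ∎))

-- Schur functions by iterated strip removal

δ∅ : List ℕ → ℤ
δ∅ ls = when (sum ls ≡ᵇ 0) (+ 1)

HH : List ℕ → (List ℕ → ℤ) → List ℕ → ℤ
HH []       g = g
HH (a ∷ as) g = HH as (Hc a g)

-- The coefficient of x^a in the Schur function of the shape to which it is applied; the strip of
-- the last letter is removed first.
schur : List ℕ → List ℕ → ℤ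
schur a = HH a δ∅

VV : ℕ → List ℕ → (List ℕ → ℤ) → List ℕ → ℤ
VV N []       g = g
VV N (a ∷ as) g = VV N as (Vc N a g)

-- The letters come in the opposite order, so that in `splits-convolution` the vertical strip of the
-- first letter stands directly inside the horizontal strip of the first letter. Since the strip
-- operators commute, the order does not affect the value (`schurReversed-τ`).
schurReversed : ℕ → List ℕ → List ℕ → ℤ
schurReversed N []       = δ∅
schurReversed N (a ∷ as) = Vc N a (schurReversed N as)

HH-linear : ∀ as ls → Linear (λ g → HH as g ls)
HH-linear []       ls = linear-eval ls
HH-linear (a ∷ as) ls = linear-∘ (HH-linear as ls) (Hc-linear a)

HH-cong : ∀ as {L u ls} → Box L u ls → ∀ {f g} → (∀ {ρ} → Box L u ρ → f ρ ≡ g ρ) → HH as f ls ≡ HH as g ls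
HH-cong []       b h = h b
HH-cong (a ∷ as) b h = HH-cong as b (λ bρ → Hc-cong bρ a h)

HH-Hc : ∀ as a {L u ls} → Box L u ls → ∀ g → HH as (Hc a g) ls ≡ Hc a (HH as g) ls
HH-Hc []        a b g = refl
HH-Hc (a′ ∷ as) a b g = trans (HH-cong as b (λ bρ → Hc-comm bρ a′ a g)) (HH-Hc as a b (Hc a′ g))

VV-τ : ∀ {N} as {ls} → Box N N ls → ∀ g → VV N as g ls ≡ HH as (λ ρ → g (τ N ρ)) (τ N ls)
VV-τ {N} []       b g = cong g (sym (τ-involutive b))
VV-τ {N} (a ∷ as) b g = trans (VV-τ as b (Vc N a g)) (HH-cong as (Box-τ b) (λ {ρ} bρ →
  trans (Vc-τ (Box-τ bρ) a g) (cong (Hc a (λ ρ → g (τ N ρ))) (τ-involutive bρ))))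

δ∅-τ : ∀ {N ls} → Box N N ls → δ∅ (τ N ls) ≡ δ∅ ls
δ∅-τ b = cong (λ z → when (z ≡ᵇ 0) (+ 1)) (sum-τ b)

VV-schur : ∀ {N} as {ls} → Box N N ls → VV N as δ∅ ls ≡ schur as (τ N ls)
VV-schur as b = trans (VV-τ as b δ∅) (HH-cong as (Box-τ b) δ∅-τ)

schurReversed-τ : ∀ {N} as {ls} → Box N N ls → schurReversed N as ls ≡ schur as (τ N ls)
schurReversed-τ {N} []       b = sym (δ∅-τ b)
schurReversed-τ {N} (a ∷ as) b = trans (Vc-τ b a (schurReversed N as))
  (trans (Hc-cong (Box-τ b) a (λ {ρ} bρ → trans (schurReversed-τ as (Box-τ bρ)) (cong (schur as) (τ-involutive bρ)))) (sym (HH-Hc as a (Box-τ b) δ∅)))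

-- Compositions and the antipode

∑-++ : {A : Set} (xs ys : List A) (F : A → ℤ) → ∑ (xs ++ ys) F ≡ ∑ xs F +ℤ ∑ ys F
∑-++ []       ys F = sym (ℤ.+-identityˡ _)
∑-++ (x ∷ xs) ys F = trans (cong (F x +ℤ_) (∑-++ xs ys F)) (sym (ℤ.+-assoc (F x) _ _))

∑-map : {A B : Set} (h : A → B) (xs : List A) (F : B → ℤ) → ∑ (map h xs) F ≡ ∑ xs (F ∘ h)
∑-map h []       F = refl
∑-map h (x ∷ xs) F = cong (F (h x) +ℤ_) (∑-map h xs F)

∑-concatMap : {A B : Set} (h : A → List B) (xs : List A) (F : B → ℤ) → ∑ (concatMap h xs) F ≡ ∑ xs (λ x → ∑ (h x) F)
∑-concatMap h []       F = refl
∑-concatMap h (x ∷ xs) F = trans (∑-++ (h x) (concatMap h xs) F) (cong (∑ (h x) F +ℤ_) (∑-concatMap h xs F))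

∑-filter : {A : Set} (p : A → Bool) (xs : List A) (F : A → ℤ) → ∑ (filterᵇ p xs) F ≡ ∑ xs (λ x → when (p x) (F x))
∑-filter p []       F = refl
∑-filter p (x ∷ xs) F with p x
... | true  = cong (F x +ℤ_) (∑-filter p xs F)
... | false = trans (∑-filter p xs F) (sym (ℤ.+-identityˡ _))

∑-applyUpTo : {A : Set} (h : ℕ → A) (n : ℕ) (F : A → ℤ) → ∑ (applyUpTo h n) F ≡ sum< n (F ∘ h)
∑-applyUpTo h zero    F = refl
∑-applyUpTo h (suc n) F = trans (cong (F (h 0) +ℤ_) (∑-applyUpTo (h ∘ suc) n F)) (sym (sum<-head n (F ∘ h)))

∑-upTo : ∀ n (F : ℕ → ℤ) → ∑ (upTo n) F ≡ sum< n F
∑-upTo = ∑-applyUpTo id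

∑-swap : {A B : Set} (xs : List A) (ys : List B) (F : A → B → ℤ) → ∑ xs (λ x → ∑ ys (F x)) ≡ ∑ ys (λ y → ∑ xs (λ x → F x y))
∑-swap xs ys F = linear-∑ (∑-is-linear xs) ys (λ y x → F x y)

∑-compsF-step : ∀ f m F → ∑ (compsF (suc f) (suc m)) F ≡ sum< (suc m) (λ k → ∑ (compsF f (m ∸ k)) (λ α → F (suc k ∷ α)))
∑-compsF-step f m F = trans (∑-concatMap (λ k → map (suc k ∷_) (compsF f (m ∸ k))) (upTo (suc m)) F) (trans (∑-upTo (suc m) _)
  (sum<-cong (suc m) (λ k _ → ∑-map (suc k ∷_) (compsF f (m ∸ k)) F)))

∑-compsF-fuel : ∀ f g m F → m ≤ f → m ≤ g → ∑ (compsF f m) F ≡ ∑ (compsF g m) F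
∑-compsF-fuel zero    zero    zero    F p q = refl
∑-compsF-fuel zero    (suc g) zero    F p q = refl
∑-compsF-fuel (suc f) zero    zero    F p q = refl
∑-compsF-fuel (suc f) (suc g) zero    F p q = refl
∑-compsF-fuel (suc f) (suc g) (suc m) F (s≤s p) (s≤s q) = trans (∑-compsF-step f m F) (trans
  (sum<-cong (suc m) (λ k _ → ∑-compsF-fuel f g (m ∸ k) _ (≤-trans (m∸n≤m m k) p) (≤-trans (m∸n≤m m k) q)))
  (sym (∑-compsF-step g m F)))

∑-compositions : ∀ m F → ∑ (compositions (suc m)) F ≡ sum< (suc m) (λ k → ∑ (compositions (m ∸ k)) (λ α → F (suc k ∷ α)))
∑-compositions m F = trans (∑-compsF-step m m F) (sum<-cong (suc m) (λ k _ → ∑-compsF-fuel m (m ∸ k) (m ∸ k) _ (m∸n≤m m k) ≤-refl))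

∑-compositions-cong : ∀ n {F G} → (∀ α → All (1 ≤_) α → sum α ≡ n → F α ≡ G α) → ∑ (compositions n) F ≡ ∑ (compositions n) G
∑-compositions-cong n = go n n ≤-refl
  where
  go : ∀ b n → n ≤ b → ∀ {F G} → (∀ α → All (1 ≤_) α → sum α ≡ n → F α ≡ G α) → ∑ (compositions n) F ≡ ∑ (compositions n) G
  go b       zero    p h = cong (_+ℤ + 0) (h [] [] refl)
  go (suc b) (suc m) (s≤s p) h = trans (∑-compositions m _) (trans (sum<-cong (suc m) (λ k q → go b (m ∸ k) (≤-trans (m∸n≤m m k) p)
    (λ α pos s → h (suc k ∷ α) (s≤s z≤n ∷ pos) (cong suc (trans (cong (λ z → k + z) s) (m+[n∸m]≡n (≤-pred q))))))) (sym (∑-compositions m _)))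

∑-compositions-δ : ∀ γ → All (1 ≤_) γ → ∀ n (F : List ℕ → ℤ) → ∑ (compositions n) (λ α → when (eqList γ α) (F α)) ≡ when (sum γ ≡ᵇ n) (F γ)
∑-compositions-δ []           []        zero    F = ℤ.+-identityʳ (F [])
∑-compositions-δ []           []        (suc m) F = trans (∑-compositions m _) (sum<-zero (suc m) (λ k _ → linear-zero (∑-is-linear (compositions (m ∸ k)))))
∑-compositions-δ (suc x ∷ γ) (_ ∷ pos) zero    F = refl
∑-compositions-δ (suc x ∷ γ) (_ ∷ pos) (suc m) F = begin
  ∑ (compositions (suc m)) (λ α → when (eqList (suc x ∷ γ) α) (F α))
    ≡⟨ ∑-compositions m _ ⟩
  sum< (suc m) (λ k → ∑ (compositions (m ∸ k)) (λ α → when ((x ≡ᵇ k) ∧ eqList γ α) (F (suc k ∷ α))))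
    ≡⟨ sum<-cong (suc m) (λ k _ → trans (∑-cong (compositions (m ∸ k)) (λ α → sym (when-∧ (x ≡ᵇ k) (eqList γ α) _)))
         (trans (linear-when (∑-is-linear (compositions (m ∸ k))) (x ≡ᵇ k) _) (cong (when (x ≡ᵇ k)) (∑-compositions-δ γ pos (m ∸ k) (λ α → F (suc k ∷ α)))))) ⟩
  sum< (suc m) (λ k → when (x ≡ᵇ k) (when (sum γ ≡ᵇ m ∸ k) (F (suc k ∷ γ))))
    ≡⟨ pick (≤-<-connex x m) ⟩
  when (x + sum γ ≡ᵇ m) (F (suc x ∷ γ)) ∎
  where
  pick : (x ≤ m) ⊎ (m < x) → sum< (suc m) (λ k → when (x ≡ᵇ k) (when (sum γ ≡ᵇ m ∸ k) (F (suc k ∷ γ)))) ≡ when (x + sum γ ≡ᵇ m) (F (suc x ∷ γ))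
  pick (inj₁ p) = trans (sum<-δ (s≤s p) (λ k → when (sum γ ≡ᵇ m ∸ k) (F (suc k ∷ γ)))) (cong (λ z → when z (F (suc x ∷ γ))) (T⇒≡
    (λ t → ≡⇒≡ᵇ (x + sum γ) m (trans (cong (λ z → x + z) (≡ᵇ-elim (sum γ) (m ∸ x) t)) (m+[n∸m]≡n p)))
    (λ t → ≡⇒≡ᵇ (sum γ) (m ∸ x) (trans (sym (m+n∸m≡n x (sum γ))) (cong (_∸ x) (≡ᵇ-elim (x + sum γ) m t))))))
  pick (inj₂ p) = trans (sum<-zero (suc m) (λ k q → cong (λ z → when z (when (sum γ ≡ᵇ m ∸ k) (F (suc k ∷ γ)))) (≡ᵇ-false (>⇒≢ (≤-<-trans (≤-pred q) p)))))
    (cong (λ z → when z (F (suc x ∷ γ))) (sym (≡ᵇ-false {x + sum γ} {m} (>⇒≢ (<-≤-trans p (m≤m+n x (sum γ)))))))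

-- Cutting off a final segment `γ` is a bijection onto the compositions of n - |γ|. The cuts k <
-- `length α` leave a nonempty right part, which is why `γ` has positive size.
∑-deconcatenations : ∀ γ → All (1 ≤_) γ → 0 < sum γ → ∀ n (g : List ℕ → ℤ) →
  ∑ (compositions n) (λ α → sum< (length α) (λ k → when (eqList γ (drop k α)) (g (take k α)))) ≡ when (sum γ ≤ᵇ n) (∑ (compositions (n ∸ sum γ)) g)
∑-deconcatenations γ pos γ>0 n = go n n ≤-refl
  where
  D : ℕ → (List ℕ → ℤ) → ℤ
  D n g = ∑ (compositions n) (λ α → sum< (length α) (λ k → when (eqList γ (drop k α)) (g (take k α))))
  go : ∀ b n → n ≤ b → ∀ g → D n g ≡ when (sum γ ≤ᵇ n) (∑ (compositions (n ∸ sum γ)) g)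
  go b zero _ g rewrite ≤ᵇ-false γ>0 = refl
  go (suc b) (suc m) (s≤s m≤b) g = begin
    D (suc m) g
      ≡⟨ ∑-compositions m _ ⟩
    sum< (suc m) (λ x → ∑ (compositions (m ∸ x)) (λ α → sum< (suc (length α)) (λ k → when (eqList γ (drop k (suc x ∷ α))) (g (take k (suc x ∷ α))))))
      ≡⟨ sum<-cong (suc m) (λ x _ → trans (∑-cong (compositions (m ∸ x)) (λ α → sum<-head (length α) _)) (additive (∑-is-linear (compositions (m ∸ x))) _ _)) ⟩
    sum< (suc m) (λ x → ∑ (compositions (m ∸ x)) (λ α → when (eqList γ (suc x ∷ α)) (g [])) +ℤ D (m ∸ x) (λ β → g (suc x ∷ β)))
      ≡⟨ sum<-+ (suc m) _ _ ⟩
    sum< (suc m) (λ x → ∑ (compositions (m ∸ x)) (λ α → when (eqList γ (suc x ∷ α)) (g []))) +ℤ sum< (suc m) (λ x → D (m ∸ x) (λ β → g (suc x ∷ β)))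
      ≡⟨ cong₂ _+ℤ_ (trans (sym (∑-compositions m (λ α → when (eqList γ α) (g [])))) (∑-compositions-δ γ pos (suc m) (λ _ → g [])))
           (sum<-cong (suc m) (λ x _ → go b (m ∸ x) (≤-trans (m∸n≤m m x) m≤b) (λ β → g (suc x ∷ β)))) ⟩
    when (sum γ ≡ᵇ suc m) (g []) +ℤ sum< (suc m) (λ x → when (sum γ ≤ᵇ m ∸ x) (∑ (compositions (m ∸ x ∸ sum γ)) (λ β → g (suc x ∷ β))))
      ≡⟨ close (<-cmp (sum γ) (suc m)) ⟩
    when (sum γ ≤ᵇ suc m) (∑ (compositions (suc m ∸ sum γ)) g) ∎
    where
    X : ℕ → ℤ
    X x = when (sum γ ≤ᵇ m ∸ x) (∑ (compositions (m ∸ x ∸ sum γ)) (λ β → g (suc x ∷ β)))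
    none : m < sum γ → sum< (suc m) X ≡ + 0
    none q = sum<-zero (suc m) (λ x _ → cong (λ z → when z (∑ (compositions (m ∸ x ∸ sum γ)) (λ β → g (suc x ∷ β)))) (≤ᵇ-false (≤-<-trans (m∸n≤m m x) q)))
    close : Tri (sum γ < suc m) (sum γ ≡ suc m) (suc m < sum γ) → when (sum γ ≡ᵇ suc m) (g []) +ℤ sum< (suc m) X ≡ when (sum γ ≤ᵇ suc m) (∑ (compositions (suc m ∸ sum γ)) g)
    close (tri> _ _ q) rewrite ≡ᵇ-false (>⇒≢ q) | ≤ᵇ-false q = trans (ℤ.+-identityˡ _) (none (<-trans ≤-refl q))
    close (tri≈ _ eq _) rewrite none (≤-reflexive (sym eq)) | eq | ≡ᵇ-refl m | ≤ᵇ-true (≤-refl {suc m}) | n∸n≡0 m = refl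
    close (tri< (s≤s q) _ _) rewrite ≡ᵇ-false (<⇒≢ (s≤s q)) | ≤ᵇ-true (m≤n⇒m≤1+n q) | +-∸-assoc 1 q = trans (ℤ.+-identityˡ _) (begin
      sum< (suc m) X
        ≡⟨ sum<-cong (suc m) (λ x p → cong₂ (λ y z → when y (∑ (compositions z) (λ β → g (suc x ∷ β)))) (inside x (≤-pred p)) (trans (∸-+-assoc m x (sum γ)) (trans (cong (m ∸_) (ℕ.+-comm x (sum γ))) (sym (∸-+-assoc m (sum γ) x))))) ⟩
      sum< (suc m) (λ x → when (x ≤ᵇ m ∸ sum γ) (∑ (compositions (m ∸ sum γ ∸ x)) (λ β → g (suc x ∷ β))))
        ≡⟨ sum<-window z≤n (m∸n≤m m (sum γ)) (λ x → ∑ (compositions (m ∸ sum γ ∸ x)) (λ β → g (suc x ∷ β))) ⟩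
      sum< (suc (m ∸ sum γ)) (λ x → ∑ (compositions (m ∸ sum γ ∸ x)) (λ β → g (suc x ∷ β)))
        ≡⟨ sym (∑-compositions (m ∸ sum γ) g) ⟩
      ∑ (compositions (suc (m ∸ sum γ))) g ∎)
      where
      inside : ∀ x → x ≤ m → (sum γ ≤ᵇ m ∸ x) ≡ (x ≤ᵇ m ∸ sum γ)
      inside x x≤m = T⇒≡
        (λ t → ≤ᵇ-intro (m+n≤o⇒m≤o∸n x (subst (_≤ m) (ℕ.+-comm (sum γ) x) (m≤o∸n⇒m+n≤o (sum γ) x≤m (≤ᵇ-elim (sum γ) (m ∸ x) t)))))
        (λ t → ≤ᵇ-intro (m+n≤o⇒m≤o∸n (sum γ) (subst (_≤ m) (ℕ.+-comm x (sum γ)) (m≤o∸n⇒m+n≤o x q (≤ᵇ-elim x (m ∸ sum γ) t)))))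

SMF-fuel : ∀ f g α → length α ≤ f → length α ≤ g → ∀ a → SMF f α a ≡ SMF g α a
SMF-fuel zero    zero    []      p q a = refl
SMF-fuel zero    (suc g) []      p q a = refl
SMF-fuel (suc f) zero    []      p q a = refl
SMF-fuel (suc f) (suc g) []      p q a = refl
SMF-fuel (suc f) (suc g) (x ∷ α) (s≤s p) (s≤s q) a = cong -_ (trans (∑-upTo (suc (length α)) _) (trans
  (sum<-cong (suc (length α)) (λ k k< → ∑-cong (splits a) (λ s → cong (_*ℤ M (drop k (x ∷ α)) (proj₂ s))
    (SMF-fuel f g (take k (x ∷ α)) (≤-trans (take-≤ k (≤-pred k<)) p) (≤-trans (take-≤ k (≤-pred k<)) q) (proj₁ s)))))
  (sym (∑-upTo (suc (length α)) _))))
  where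
  take-≤ : ∀ k → k ≤ length α → length (take k (x ∷ α)) ≤ length α
  take-≤ k k≤ = ≤-trans (≤-reflexive (ListP.length-take k (x ∷ α))) (≤-trans (m⊓n≤m k _) k≤)

SM-recursion : ∀ x α a → SM (x ∷ α) a ≡
  - sum< (suc (length α)) (λ k → ∑ (splits a) (λ s → SM (take k (x ∷ α)) (proj₁ s) *ℤ M (drop k (x ∷ α)) (proj₂ s)))
SM-recursion x α a = cong -_ (trans (∑-upTo (suc (length α)) _) (sum<-cong (suc (length α)) (λ k k< → ∑-cong (splits a) (λ s →
  cong (_*ℤ M (drop k (x ∷ α)) (proj₂ s)) (SMF-fuel (length α) (length (take k (x ∷ α))) (take k (x ∷ α)) (take-≤ k (≤-pred k<)) ≤-refl (proj₁ s))))))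
  where
  take-≤ : ∀ k → k ≤ length α → length (take k (x ∷ α)) ≤ length α
  take-≤ k k≤ = ≤-trans (≤-reflexive (ListP.length-take k (x ∷ α))) (≤-trans (m⊓n≤m k _) k≤)

∑-splits : ∀ a as (F : List ℕ × List ℕ → ℤ) → ∑ (splits (a ∷ as)) F ≡ sum< (suc a) (λ k → ∑ (splits as) (λ p → F (k ∷ proj₁ p , (a ∸ k) ∷ proj₂ p)))
∑-splits a as F = trans (∑-concatMap (λ k → map (λ p → (k ∷ proj₁ p , (a ∸ k) ∷ proj₂ p)) (splits as)) (upTo (suc a)) F) (trans (∑-upTo (suc a) _) (sum<-cong (suc a) (λ k _ → ∑-map _ (splits as) F)))

∑-splits-cong : ∀ a {F G : List ℕ × List ℕ → ℤ} → (∀ b c → sum b + sum c ≡ sum a → F (b , c) ≡ G (b , c)) → ∑ (splits a) F ≡ ∑ (splits a) G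
∑-splits-cong []       h = cong (_+ℤ + 0) (h [] [] refl)
∑-splits-cong (a ∷ as) h = trans (∑-splits a as _) (trans (sum<-cong (suc a) (λ k k< → ∑-splits-cong as (λ b c eq → h (k ∷ b) ((a ∸ k) ∷ c)
  (trans (ℕ+.interchange k (sum b) (a ∸ k) (sum c)) (cong₂ _+_ (m+[n∸m]≡n (≤-pred k<)) eq))))) (sym (∑-splits a as _)))

flat-pos : ∀ c → All (1 ≤_) (flat c)
flat-pos []          = []
flat-pos (zero  ∷ c) = flat-pos c
flat-pos (suc x ∷ c) = s≤s z≤n ∷ flat-pos c

sum-flat : ∀ c → sum (flat c) ≡ sum c
sum-flat []          = refl
sum-flat (zero  ∷ c) = sum-flat c
sum-flat (suc x ∷ c) = cong (λ z → suc x + z) (sum-flat c)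

flat-zero : ∀ c → sum c ≡ 0 → flat c ≡ []
flat-zero []         p = refl
flat-zero (zero ∷ c) p = flat-zero c p

S-cong : ∀ {F G} a → (∀ α → All (1 ≤_) α → sum α ≡ sum a → F α ≡ G α) → S F a ≡ S G a
S-cong a h = ∑-compositions-cong (sum a) (λ α pos eq → cong (_*ℤ SM α a) (h α pos eq))

S-linear : ∀ a → Linear (λ F → S F a)
S-linear a = record
  { respects = λ h → ∑-cong cs′ (λ α → cong (_*ℤ SM α a) (h α))
  ; additive = λ F G → trans (∑-cong cs′ (λ α → ℤ.*-distribʳ-+ (SM α a) (F α) (G α))) (additive (∑-is-linear cs′) _ _)
  ; scalar = λ c F → trans (∑-cong cs′ (λ α → ℤ.*-assoc c (F α) (SM α a))) (scalar (∑-is-linear cs′) c _) }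
  where cs′ = compositions (sum a)

linear-S : {A : Set} {Φ : (A → ℤ) → ℤ} → Linear Φ → ∀ (F : List ℕ → A → ℤ) a → S (λ α → Φ (F α)) a ≡ Φ (λ x → S (λ α → F α x) a)
linear-S {Φ = Φ} p F a = sym (trans (linear-∑ p (compositions (sum a)) (λ α x → F α x *ℤ SM α a))
  (∑-cong (compositions (sum a)) (λ α → trans (respects p (λ x → ℤ.*-comm (F α x) (SM α a))) (trans (scalar p (SM α a) (F α)) (ℤ.*-comm (SM α a) (Φ (F α)))))))

-- The antipode axiom solved for S F, for whole series. M_γ has coefficient 1 at `c` exactly when γ
-- = `flat c`, so the sum over right tensor factors collapses to one γ for each splitting of `a`;
-- what remains is S of the series that appends `flat c` to its argument. Only splittings with a
-- smaller left degree occur, so the recursion determines S.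
S-recursion : ∀ F a → S F a ≡ when (sum a ≡ᵇ 0) (F []) +ℤ
  - ∑ (splits a) (λ s → when (not (sum (proj₂ s) ≡ᵇ 0)) (S (λ β → F (β ++ flat (proj₂ s))) (proj₁ s)))
S-recursion F a = go (sum a) refl
  where
  R : List ℕ → List ℕ → ℤ
  R b c = when (not (sum c ≡ᵇ 0)) (S (λ β → F (β ++ flat c)) b)
  go : ∀ n → sum a ≡ n → S F a ≡ when (sum a ≡ᵇ 0) (F []) +ℤ - ∑ (splits a) (λ s → R (proj₁ s) (proj₂ s))
  go zero eq rewrite eq = begin
    F [] *ℤ M [] a +ℤ + 0
      ≡⟨ cong (λ z → F [] *ℤ (if eqList z [] then + 1 else + 0) +ℤ + 0) (flat-zero a eq) ⟩
    F [] *ℤ + 1 +ℤ + 0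
      ≡⟨ cong (_+ℤ + 0) (ℤ.*-identityʳ (F [])) ⟩
    F [] +ℤ - (+ 0)
      ≡⟨ cong (λ z → F [] +ℤ - z) (sym (trans (∑-splits-cong a (λ b c e → cong (λ z → when (not (z ≡ᵇ 0)) (S (λ β → F (β ++ flat c)) b)) (ℕ.m+n≡0⇒n≡0 (sum b) (trans e eq)))) (linear-zero (∑-is-linear (splits a))))) ⟩
    F [] +ℤ - ∑ (splits a) (λ s → R (proj₁ s) (proj₂ s)) ∎
  go (suc m) eq rewrite eq = begin
    ∑ (compositions (suc m)) (λ α → F α *ℤ SM α a)
      ≡⟨ ∑-compositions-cong (suc m) (λ { (x ∷ α) _ _ → expand x α }) ⟩
    ∑ (compositions (suc m)) (λ α → - sum< (length α) (λ k → ∑ (splits a) (λ s → Z α k (proj₁ s) (proj₂ s))))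
      ≡⟨ linear-neg lin _ ⟩
    - ∑ (compositions (suc m)) (λ α → sum< (length α) (λ k → ∑ (splits a) (λ s → Z α k (proj₁ s) (proj₂ s))))
      ≡⟨ cong -_ (trans (∑-cong (compositions (suc m)) (λ α → sym (linear-sum<′ α))) (∑-swap (compositions (suc m)) (splits a) _)) ⟩
    - ∑ (splits a) (λ s → ∑ (compositions (suc m)) (λ α → sum< (length α) (λ k → Z α k (proj₁ s) (proj₂ s))))
      ≡⟨ cong -_ (∑-splits-cong a (λ b c e → term b c (trans e eq))) ⟩
    - ∑ (splits a) (λ s → R (proj₁ s) (proj₂ s))
      ≡⟨ sym (ℤ.+-identityˡ _) ⟩
    + 0 +ℤ - ∑ (splits a) (λ s → R (proj₁ s) (proj₂ s)) ∎
    where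
    lin = ∑-is-linear (compositions (suc m))
    Z : List ℕ → ℕ → List ℕ → List ℕ → ℤ
    Z α k b c = when (eqList (flat c) (drop k α)) (F (take k α ++ drop k α) *ℤ SM (take k α) b)
    linear-sum<′ : ∀ α → ∑ (splits a) (λ s → sum< (length α) (λ k → Z α k (proj₁ s) (proj₂ s))) ≡ sum< (length α) (λ k → ∑ (splits a) (λ s → Z α k (proj₁ s) (proj₂ s)))
    linear-sum<′ α = linear-sum< (∑-is-linear (splits a)) (λ k s → Z α k (proj₁ s) (proj₂ s)) (length α)
    expand : ∀ x α → F (x ∷ α) *ℤ SM (x ∷ α) a ≡ - sum< (suc (length α)) (λ k → ∑ (splits a) (λ s → Z (x ∷ α) k (proj₁ s) (proj₂ s)))
    expand x α = trans (cong (F (x ∷ α) *ℤ_) (SM-recursion x α a)) (trans (sym (ℤ.neg-distribʳ-* (F (x ∷ α)) _)) (cong -_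
      (trans (sym (scalar (sum<-linear {A = ℕ} linear-eval (suc (length α))) (F (x ∷ α)) _)) (sum<-cong (suc (length α)) (λ k _ →
        trans (sym (scalar (∑-is-linear (splits a)) (F (x ∷ α)) _)) (∑-cong (splits a) (λ s → one (proj₁ s) (proj₂ s) k)))))))
      where
      one : ∀ b c k → F (x ∷ α) *ℤ (SM (take k (x ∷ α)) b *ℤ M (drop k (x ∷ α)) c) ≡ Z (x ∷ α) k b c
      one b c k rewrite ListP.take++drop≡id k (x ∷ α) with eqList (flat c) (drop k (x ∷ α))
      ... | true  = cong (F (x ∷ α) *ℤ_) (ℤ.*-identityʳ _)
      ... | false = trans (cong (F (x ∷ α) *ℤ_) (ℤ.*-zeroʳ (SM (take k (x ∷ α)) b))) (ℤ.*-zeroʳ (F (x ∷ α)))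
    term : ∀ b c → sum b + sum c ≡ suc m → ∑ (compositions (suc m)) (λ α → sum< (length α) (λ k → Z α k b c)) ≡ R b c
    term b c e with sum c in sc
    ... | zero = trans (∑-cong (compositions (suc m)) (λ α → sum<-zero (length α) (λ k k< → cong (λ z → when z (F (take k α ++ drop k α) *ℤ SM (take k α) b)) (empty α k k<)))) (linear-zero lin)
      where
      empty : ∀ α k → k < length α → eqList (flat c) (drop k α) ≡ false
      empty α k k< rewrite flat-zero c sc = nonempty α k k<
        where
        nonempty : ∀ α k → k < length α → eqList [] (drop k α) ≡ false
        nonempty (x ∷ α) zero    p       = refl
        nonempty (x ∷ α) (suc k) (s≤s p) = nonempty α k p
    ... | suc s = begin
      ∑ (compositions (suc m)) (λ α → sum< (length α) (λ k → Z α k b c))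
        ≡⟨ ∑-cong (compositions (suc m)) (λ α → sum<-cong (length α) (λ k _ → when-cong (eqList (flat c) (drop k α)) (λ t → cong (λ z → F (take k α ++ z) *ℤ SM (take k α) b) (sym (eqList-elim (flat c) (drop k α) t))))) ⟩
      ∑ (compositions (suc m)) (λ α → sum< (length α) (λ k → when (eqList (flat c) (drop k α)) (F (take k α ++ flat c) *ℤ SM (take k α) b)))
        ≡⟨ ∑-deconcatenations (flat c) (flat-pos c) (subst (0 <_) (sym sf) (s≤s z≤n)) (suc m) (λ β → F (β ++ flat c) *ℤ SM β b) ⟩
      when (sum (flat c) ≤ᵇ suc m) (∑ (compositions (suc m ∸ sum (flat c))) (λ β → F (β ++ flat c) *ℤ SM β b))
        ≡⟨ cong₂ (λ y z → when y (∑ (compositions z) (λ β → F (β ++ flat c) *ℤ SM β b)))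
             (≤ᵇ-true (subst₂′ (trans (cong (λ z → sum b + z) sf) e))) (trans (cong (_∸ sum (flat c)) (sym (trans (cong (λ z → sum b + z) sf) e))) (m+n∸n≡m (sum b) (sum (flat c)))) ⟩
      ∑ (compositions (sum b)) (λ β → F (β ++ flat c) *ℤ SM β b) ∎
      where
      sf : sum (flat c) ≡ suc s
      sf = trans (sum-flat c) sc
      subst₂′ : sum b + sum (flat c) ≡ suc m → sum (flat c) ≤ suc m
      subst₂′ q = subst (sum (flat c) ≤_) q (m≤n+m _ (sum b))

HH-++ : ∀ β γ g ls → HH (β ++ γ) g ls ≡ HH γ (HH β g) ls
HH-++ []      γ g ls = refl
HH-++ (b ∷ β) γ g ls = HH-++ β γ (Hc b g) ls

Hc-zero : ∀ {L u ls} → Box L u ls → ∀ g → Hc 0 g ls ≡ g ls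
Hc-zero {L} {u} {ls} b g = trans (op-kernel b _ 0) (trans (ΣD-cong L u (λ c → same c)) (ΣD-δ b g))
  where
  at-sum : ∀ {L u v ls ρ} → Box L u ls → Box L v ρ → (∀ i → at ρ i ≤ at ls i) → sum ls ≤ sum ρ → ls ≡ ρ
  at-sum [] [] h p = refl
  at-sum {ls = l ∷ ls} {r ∷ ρ} (_ ∷ b) (_ ∷ c) h p = cong₂ _∷_ (≤-antisym l≤r (h 0)) (at-sum b c (h ∘ suc) (ℕ.+-cancelˡ-≤ r _ _ (≤-trans (+-monoˡ-≤ (sum ls) (h 0)) p)))
    where
    l≤r : l ≤ r
    l≤r = ℕ.+-cancelʳ-≤ (sum ρ) l r (≤-trans (+-monoʳ-≤ l (at-mono-sum b c (h ∘ suc))) p)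
  hs-refl : ∀ {L u ls} → Box L u ls → T (hs ls ls)
  hs-refl [] = tt
  hs-refl {ls = l ∷ _} (p ∷ b) = ∧-T (∧-T (≤ᵇ-intro (Box-nxt b)) (≤ᵇ-intro (≤-refl {l}))) (hs-refl b)
  same : ∀ {ρ} → Box L u ρ → when (hs ls ρ) (when (sum ls ∸ sum ρ ≡ᵇ 0) (g ρ)) ≡ when (eqList ls ρ) (g ρ)
  same {ρ} c = trans (when-∧ (hs ls ρ) (sum ls ∸ sum ρ ≡ᵇ 0) (g ρ)) (cong (λ z → when z (g ρ)) (T⇒≡
    (λ t → subst (λ z → T (eqList ls z)) (at-sum b c (λ i → proj₂ (hs-to ls ρ (∧-Tˡ (hs ls ρ) t) i)) (m∸n≡0⇒m≤n (≡ᵇ-elim _ 0 (∧-Tʳ (hs ls ρ) t)))) (true-T (eqList-refl ls)))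
    (λ t → subst (λ z → T (hs ls z ∧ (sum ls ∸ sum z ≡ᵇ 0))) (eqList-elim ls ρ t) (∧-T (hs-refl b) (subst (λ z → T (z ≡ᵇ 0)) (sym (n∸n≡0 (sum ls))) tt)))))

-- A letter of exponent 0 removes nothing; this is the quasisymmetry of the Schur functions.
HH-flat : ∀ c {L u ls} → Box L u ls → ∀ g → HH (flat c) g ls ≡ HH c g ls
HH-flat []          b g = refl
HH-flat (zero  ∷ c) b g = trans (HH-flat c b g) (HH-cong c b (λ bρ → sym (Hc-zero bρ g)))
HH-flat (suc x ∷ c) b g = HH-flat c b (Hc (suc x) g)

HH-zeros : ∀ c {L u ls} → Box L u ls → sum c ≡ 0 → ∀ g → HH c g ls ≡ g ls
HH-zeros []         b p g = refl
HH-zeros (zero ∷ c) b p g = trans (HH-zeros c b p (Hc 0 g)) (Hc-zero b g)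

-- The convolution of the expected antipode with the identity, one letter at a time: the sum over
-- the splittings of the first exponent collapses by `HV-convolution` and survives only if that
-- exponent is 0.
splits-convolution : ∀ {N} a {ls} → Box N N ls →
  ∑ (splits a) (λ s → HH (proj₂ s) (λ ρ → sgn ρ *ℤ schurReversed N (proj₁ s) ρ) ls) ≡ when (sum a ≡ᵇ 0) (δ∅ ls)
splits-convolution []       {ls} b = trans (ℤ.+-identityʳ _) (even (sum ls))
  where
  even : ∀ n → sign n *ℤ when (n ≡ᵇ 0) (+ 1) ≡ when (n ≡ᵇ 0) (+ 1)
  even zero    = refl
  even (suc n) = ℤ.*-zeroʳ (sign (suc n))
splits-convolution {N} (a ∷ as) {ls} b = begin
  ∑ (splits (a ∷ as)) (λ s → HH (proj₂ s) (λ ρ → sgn ρ *ℤ schurReversed N (proj₁ s) ρ) ls)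
    ≡⟨ trans (∑-splits a as _) (sym (linear-sum< (∑-is-linear (splits as)) _ (suc a))) ⟩
  ∑ (splits as) (λ s → sum< (suc a) (λ k → HH (proj₂ s) (Hc (a ∸ k) (λ ρ → sgn ρ *ℤ Vc N k (schurReversed N (proj₁ s)) ρ)) ls))
    ≡⟨ ∑-cong (splits as) (λ s → trans (sym (linear-sum< (HH-linear (proj₂ s) ls) _ (suc a))) (trans (HH-cong (proj₂ s) b (λ bρ → HV-convolution bρ a (schurReversed N (proj₁ s))))
         (linear-when (HH-linear (proj₂ s) ls) (0 ≡ᵇ a) _))) ⟩
  ∑ (splits as) (λ s → when (0 ≡ᵇ a) (HH (proj₂ s) (λ ρ → sgn ρ *ℤ schurReversed N (proj₁ s) ρ) ls))
    ≡⟨ trans (linear-when (∑-is-linear (splits as)) (0 ≡ᵇ a) _) (cong (when (0 ≡ᵇ a)) (splits-convolution as b)) ⟩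
  when (0 ≡ᵇ a) (when (sum as ≡ᵇ 0) (δ∅ ls))
    ≡⟨ join a ⟩
  when (a + sum as ≡ᵇ 0) (δ∅ ls) ∎
  where
  join : ∀ a → when (0 ≡ᵇ a) (when (sum as ≡ᵇ 0) (δ∅ ls)) ≡ when (a + sum as ≡ᵇ 0) (δ∅ ls)
  join zero    = refl
  join (suc a) = refl

∑-splits-zero : ∀ a (Φ : List ℕ → ℤ) → ∑ (splits a) (λ s → when (sum (proj₂ s) ≡ᵇ 0) (Φ (proj₁ s))) ≡ Φ a
∑-splits-zero []       Φ = ℤ.+-identityʳ _
∑-splits-zero (a ∷ as) Φ = begin
  ∑ (splits (a ∷ as)) (λ s → when (sum (proj₂ s) ≡ᵇ 0) (Φ (proj₁ s)))
    ≡⟨ ∑-splits a as _ ⟩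
  sum< (suc a) (λ k → ∑ (splits as) (λ s → when ((a ∸ k) + sum (proj₂ s) ≡ᵇ 0) (Φ (k ∷ proj₁ s))))
    ≡⟨ sum<-cong (suc a) (λ k k< → row k (≤-pred k<)) ⟩
  sum< (suc a) (λ k → when (a ≡ᵇ k) (∑ (splits as) (λ s → when (sum (proj₂ s) ≡ᵇ 0) (Φ (k ∷ proj₁ s)))))
    ≡⟨ sum<-δ ≤-refl (λ k → ∑ (splits as) (λ s → when (sum (proj₂ s) ≡ᵇ 0) (Φ (k ∷ proj₁ s)))) ⟩
  ∑ (splits as) (λ s → when (sum (proj₂ s) ≡ᵇ 0) (Φ (a ∷ proj₁ s)))
    ≡⟨ ∑-splits-zero as (λ b → Φ (a ∷ b)) ⟩
  Φ (a ∷ as) ∎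
  where
  row : ∀ k → k ≤ a → ∑ (splits as) (λ s → when ((a ∸ k) + sum (proj₂ s) ≡ᵇ 0) (Φ (k ∷ proj₁ s))) ≡ when (a ≡ᵇ k) (∑ (splits as) (λ s → when (sum (proj₂ s) ≡ᵇ 0) (Φ (k ∷ proj₁ s))))
  row k k≤a with a ∸ k in eq
  ... | zero  rewrite ≤-antisym (m∸n≡0⇒m≤n eq) k≤a | ≡ᵇ-refl k = refl
  ... | suc d = trans (linear-zero (∑-is-linear (splits as))) (cong (λ z → when z (∑ (splits as) (λ s → when (sum (proj₂ s) ≡ᵇ 0) (Φ (k ∷ proj₁ s))))) (sym (≡ᵇ-false {a} {k} (λ { refl → absurd (trans (sym eq) (n∸n≡0 a)) }))))
    where
    absurd : ∀ {d} → suc d ≡ 0 → ⊥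
    absurd ()

-- By induction on the degree of `a`, comparing `S-recursion` with `splits-convolution`: the
-- splittings with a trivial second part yield the claimed value, the others cancel. Linearity moves
-- S inside `HH c`, where the induction hypothesis applies to the shapes left after the letters of
-- `c`.
S-schur : ∀ {N ls} → Box N N ls → ∀ a → S (λ α → schur α ls) a ≡ sgn ls *ℤ schur a (τ N ls)
S-schur {N} {ls} b a = trans (go (sum a) a ≤-refl b) (cong (sgn ls *ℤ_) (schurReversed-τ a b))
  where
  go : ∀ n a → sum a ≤ n → ∀ {ls} → Box N N ls → S (λ α → schur α ls) a ≡ sgn ls *ℤ schurReversed N a ls
  go n a a≤n {ls} b = begin
    S (λ α → schur α ls) a
      ≡⟨ S-recursion (λ α → schur α ls) a ⟩
    when (sum a ≡ᵇ 0) (δ∅ ls) +ℤ - ∑ (splits a) (λ s → when (not (sum (proj₂ s) ≡ᵇ 0)) (S (λ β → schur (β ++ flat (proj₂ s)) ls) (proj₁ s)))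
      ≡⟨ cong (λ z → when (sum a ≡ᵇ 0) (δ∅ ls) +ℤ - z) (∑-splits-cong a (λ x c e → when-cong (not (sum c ≡ᵇ 0)) (λ t → step x c e t))) ⟩
    when (sum a ≡ᵇ 0) (δ∅ ls) +ℤ - ∑ (splits a) (λ s → when (not (sum (proj₂ s) ≡ᵇ 0)) (X (proj₁ s) (proj₂ s)))
      ≡⟨ cong₂ (λ y z → y +ℤ - z) (sym (splits-convolution a b)) refl ⟩
    ∑ (splits a) (λ s → X (proj₁ s) (proj₂ s)) +ℤ - ∑ (splits a) (λ s → when (not (sum (proj₂ s) ≡ᵇ 0)) (X (proj₁ s) (proj₂ s)))
      ≡⟨ cong (_+ℤ - ∑ (splits a) (λ s → when (not (sum (proj₂ s) ≡ᵇ 0)) (X (proj₁ s) (proj₂ s)))) (trans (∑-cong (splits a) (λ s → partition (sum (proj₂ s) ≡ᵇ 0) _)) (additive (∑-is-linear (splits a)) _ _)) ⟩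
    (∑ (splits a) (λ s → when (sum (proj₂ s) ≡ᵇ 0) (X (proj₁ s) (proj₂ s))) +ℤ rest) +ℤ - rest
      ≡⟨ cancel _ rest ⟩
    ∑ (splits a) (λ s → when (sum (proj₂ s) ≡ᵇ 0) (X (proj₁ s) (proj₂ s)))
      ≡⟨ trans (∑-cong (splits a) (λ s → when-cong (sum (proj₂ s) ≡ᵇ 0) (λ t → HH-zeros (proj₂ s) b (≡ᵇ-elim _ 0 t) _))) (∑-splits-zero a (λ x → sgn ls *ℤ schurReversed N x ls)) ⟩
    sgn ls *ℤ schurReversed N a ls ∎
    where
    X : List ℕ → List ℕ → ℤ
    X x c = HH c (λ ρ → sgn ρ *ℤ schurReversed N x ρ) ls
    rest = ∑ (splits a) (λ s → when (not (sum (proj₂ s) ≡ᵇ 0)) (X (proj₁ s) (proj₂ s)))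
    partition : ∀ b x → x ≡ when b x +ℤ when (not b) x
    partition true  x = sym (ℤ.+-identityʳ x)
    partition false x = sym (ℤ.+-identityˡ x)
    cancel : ∀ x y → (x +ℤ y) +ℤ - y ≡ x
    cancel = solve-∀
    smaller : ∀ n x c → x + c ≡ sum a → T (not (c ≡ᵇ 0)) → sum a ≤ n → ∃ λ m → (suc m ≡ n) × (x ≤ m)
    smaller n x (suc c) e t p with n | ≤-trans (≤-reflexive (trans (sym (+-suc x c)) e)) p
    ... | suc m | s≤s q = m , refl , ≤-trans (m≤m+n x c) q
    step : ∀ x c → sum x + sum c ≡ sum a → T (not (sum c ≡ᵇ 0)) → S (λ β → schur (β ++ flat c) ls) x ≡ X x c
    step x c e t = begin
      S (λ β → schur (β ++ flat c) ls) x
        ≡⟨ S-cong x (λ β _ _ → trans (HH-++ β (flat c) δ∅ ls) (HH-flat c b (schur β))) ⟩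
      S (λ β → HH c (schur β) ls) x
        ≡⟨ linear-S (HH-linear c ls) schur x ⟩
      HH c (λ ρ → S (λ β → schur β ρ) x) ls
        ≡⟨ HH-cong c b (λ bρ → recurse (smaller n (sum x) (sum c) e t a≤n) bρ) ⟩
      X x c ∎
      where
      recurse : (∃ λ m → (suc m ≡ n) × (sum x ≤ m)) → ∀ {ρ} → Box N N ρ → S (λ β → schur β ρ) x ≡ sgn ρ *ℤ schurReversed N x ρ
      recurse (m , refl , x≤m) bρ = go m x x≤m bρ

-- Removals with bounded labels

-- Row kernels: K i l r says that row i may shrink from length l to length r.
Kernel : Set
Kernel = ℕ → ℕ → ℕ → Bool

ker : Kernel → List ℕ → List ℕ → Bool
ker K []       []      = true
ker K (l ∷ ls) (r ∷ ρ) = K 0 l r ∧ ker (K ∘ suc) ls ρ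
ker K _        _       = false

-- In row i exactly the cells of column at least t i are removable.
beyond : (ℕ → ℕ) → Kernel
beyond t i l r = (r ≡ᵇ l) ∨ ((t i ≤ᵇ r) ∧ (r ≤ᵇ l))

-- In row i exactly the cells of column j with p ≤ j < w i are removable.
window : ℕ → (ℕ → ℕ) → Kernel
window p w i l r = (r ≡ᵇ l) ∨ (((p ≤ᵇ r) ∧ (r ≤ᵇ l)) ∧ (l ≤ᵇ w i))

removal : ℕ → Kernel → (List ℕ → ℤ) → List ℕ → ℤ
removal N K g ls = ΣD N N (λ ρ → when (ker K ls ρ) (g ρ))

removal-cong : ∀ N K ls {f g} → (∀ {ρ} → Box N N ρ → f ρ ≡ g ρ) → removal N K f ls ≡ removal N K g ls
removal-cong N K ls h = ΣD-cong N N (λ {ρ} b → cong (when (ker K ls ρ)) (h b))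

∨-elim : ∀ a b → T (a ∨ b) → T a ⊎ T b
∨-elim true  b t = inj₁ tt
∨-elim false b t = inj₂ t

∨-introˡ : ∀ {a b} → T a → T (a ∨ b)
∨-introˡ {true} t = tt

∨-introʳ : ∀ a {b} → T b → T (a ∨ b)
∨-introʳ true  t = tt
∨-introʳ false t = t

≡ᵇ-intro : ∀ {m n} → m ≡ n → T (m ≡ᵇ n)
≡ᵇ-intro {m} {n} = ≡⇒≡ᵇ m n

beyond-elim : ∀ t i l r → T (beyond t i l r) → (r ≡ l) ⊎ ((t i ≤ r) × (r ≤ l))
beyond-elim t i l r x with ∨-elim (r ≡ᵇ l) _ x
... | inj₁ e = inj₁ (≡ᵇ-elim r l e)
... | inj₂ y = inj₂ (≤ᵇ-elim (t i) r (∧-Tˡ (t i ≤ᵇ r) y) , ≤ᵇ-elim r l (∧-Tʳ (t i ≤ᵇ r) y))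

beyond-≡ : ∀ t i {l r} → r ≡ l → T (beyond t i l r)
beyond-≡ t i e = ∨-introˡ (≡ᵇ-intro e)

beyond-≤ : ∀ t i {l r} → t i ≤ r → r ≤ l → T (beyond t i l r)
beyond-≤ t i {l} {r} p q = ∨-introʳ (r ≡ᵇ l) (∧-T (≤ᵇ-intro p) (≤ᵇ-intro q))

window-elim : ∀ p w i l r → T (window p w i l r) → (r ≡ l) ⊎ ((p ≤ r) × (r ≤ l) × (l ≤ w i))
window-elim p w i l r x with ∨-elim (r ≡ᵇ l) _ x
... | inj₁ e = inj₁ (≡ᵇ-elim r l e)
... | inj₂ y = inj₂ (≤ᵇ-elim p r (∧-Tˡ (p ≤ᵇ r) z) , ≤ᵇ-elim r l (∧-Tʳ (p ≤ᵇ r) z) , ≤ᵇ-elim l (w i) (∧-Tʳ ((p ≤ᵇ r) ∧ (r ≤ᵇ l)) y))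
  where z = ∧-Tˡ ((p ≤ᵇ r) ∧ (r ≤ᵇ l)) y

window-≡ : ∀ p w i {l r} → r ≡ l → T (window p w i l r)
window-≡ p w i e = ∨-introˡ (≡ᵇ-intro e)

window-≤ : ∀ p w i {l r} → p ≤ r → r ≤ l → l ≤ w i → T (window p w i l r)
window-≤ p w i {l} {r} x y z = ∨-introʳ (r ≡ᵇ l) (∧-T (∧-T (≤ᵇ-intro x) (≤ᵇ-intro y)) (≤ᵇ-intro z))

beyond-⊆ : ∀ t i l r → T (beyond t i l r) → r ≤ l
beyond-⊆ t i l r x with beyond-elim t i l r x
... | inj₁ refl    = ≤-refl
... | inj₂ (_ , q) = q

window-⊆ : ∀ p w i l r → T (window p w i l r) → r ≤ l
window-⊆ p w i l r x with window-elim p w i l r x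
... | inj₁ refl        = ≤-refl
... | inj₂ (_ , q , _) = q

ker-at : ∀ K ls ρ → T (ker K ls ρ) → ∀ i → i < length ρ → T (K i (at ls i) (at ρ i))
ker-at K (l ∷ ls) (r ∷ ρ) t zero    p       = ∧-Tˡ (K 0 l r) t
ker-at K (l ∷ ls) (r ∷ ρ) t (suc i) (s≤s p) = ker-at (K ∘ suc) ls ρ (∧-Tʳ (K 0 l r) t) i p

ker-from : ∀ K {L u v ls ρ} → Box L u ls → Box L v ρ → (∀ i → i < L → T (K i (at ls i) (at ρ i))) → T (ker K ls ρ)
ker-from K []      []      h = tt
ker-from K (_ ∷ b) (_ ∷ c) h = ∧-T (h 0 (s≤s z≤n)) (ker-from (K ∘ suc) b c (λ i p → h (suc i) (s≤s p)))

-- If the rows need not decrease, a sum of products factors over the rows. `ΣD-ΣA` permits the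
-- change whenever the summand vanishes outside partitions.
ΣA : ℕ → ℕ → (List ℕ → ℤ) → ℤ
ΣA zero    u f = f []
ΣA (suc L) u f = sum< (suc u) (λ r → ΣA L u (λ ρ → f (r ∷ ρ)))

ΣA-linear : ∀ L u → Linear (ΣA L u)
ΣA-linear zero    u = linear-eval []
ΣA-linear (suc L) u = sum<-linear (λ r → linear-precomp (r ∷_) (ΣA-linear L u)) (suc u)

ΣA-zero : ∀ L u {f} → (∀ ρ → length ρ ≡ L → f ρ ≡ + 0) → ΣA L u f ≡ + 0
ΣA-zero zero    u h = h [] refl
ΣA-zero (suc L) u h = sum<-zero (suc u) (λ r _ → ΣA-zero L u (λ ρ e → h (r ∷ ρ) (cong suc e)))

ΣD-ΣA : ∀ L {r u} → r ≤ u → ∀ g → (∀ ρ → length ρ ≡ L → Box L r ρ ⊎ (g ρ ≡ + 0)) → ΣD L r g ≡ ΣA L u g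
ΣD-ΣA zero    p g h = refl
ΣD-ΣA (suc L) {r} {u} p g h = sym (begin
  sum< (suc u) X
    ≡⟨ cong (λ z → sum< (suc z) X) (sym (m+[n∸m]≡n p)) ⟩
  sum< (suc r + (u ∸ r)) X
    ≡⟨ trans (sum<-split (suc r) (u ∸ r) X) (trans (cong (sum< (suc r) X +ℤ_) (sum<-zero (u ∸ r) (λ i _ → ΣA-zero L u (λ ρ e → above i ρ (h (suc r + i ∷ ρ) (cong suc e)))))) (ℤ.+-identityʳ _)) ⟩
  sum< (suc r) X
    ≡⟨ sum<-cong (suc r) (λ q q< → sym (ΣD-ΣA L (≤-trans (≤-pred q<) p) (λ ρ → g (q ∷ ρ)) (λ ρ e → tail q ρ (h (q ∷ ρ) (cong suc e))))) ⟩
  ΣD (suc L) r g ∎)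
  where
  X : ℕ → ℤ
  X q = ΣA L u (λ ρ → g (q ∷ ρ))
  above : ∀ i ρ → Box (suc L) r (suc r + i ∷ ρ) ⊎ (g (suc r + i ∷ ρ) ≡ + 0) → g (suc r + i ∷ ρ) ≡ + 0
  above i ρ (inj₁ (q ∷ _)) = ⊥-elim (<⇒≱ (m≤m+n (suc r) i) q)
  above i ρ (inj₂ z)       = z
  tail : ∀ q ρ → Box (suc L) r (q ∷ ρ) ⊎ (g (q ∷ ρ) ≡ + 0) → Box L q ρ ⊎ (g (q ∷ ρ) ≡ + 0)
  tail q ρ (inj₁ (_ ∷ b)) = inj₁ b
  tail q ρ (inj₂ z)       = inj₂ z

rows³ : (ℕ → ℕ → ℕ → ℕ → ℤ) → List ℕ → List ℕ → List ℕ → ℤ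
rows³ x (l ∷ ls) (r ∷ ρ) (s ∷ σ) = x 0 l r s *ℤ rows³ (x ∘ suc) ls ρ σ
rows³ x _        _       _       = + 1

-- With independent rows the sum of the products is the product of the row sums, so one row can be
-- compared at a time.
ΣA-rows³ : ∀ u x y {L v w ls σ} → Box L v ls → Box L w σ → v ≤ u → w ≤ u →
  (∀ i l s → l ≤ u → s ≤ u → sum< (suc u) (λ r → x i l r s) ≡ sum< (suc u) (λ r → y i l r s)) →
  ΣA L u (λ ρ → rows³ x ls ρ σ) ≡ ΣA L u (λ ρ → rows³ y ls ρ σ)
ΣA-rows³ u x y [] [] p q h = refl
ΣA-rows³ u x y {suc L} {ls = l ∷ ls} {s ∷ σ} (l≤ ∷ b) (s≤ ∷ c) p q h = begin
  sum< (suc u) (λ r → ΣA L u (λ ρ → x 0 l r s *ℤ rows³ (x ∘ suc) ls ρ σ))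
    ≡⟨ sum<-cong (suc u) (λ r _ → scalar (ΣA-linear L u) (x 0 l r s) _) ⟩
  sum< (suc u) (λ r → x 0 l r s *ℤ X)
    ≡⟨ factor (λ r → x 0 l r s) X ⟩
  sum< (suc u) (λ r → x 0 l r s) *ℤ X
    ≡⟨ cong₂ _*ℤ_ (h 0 l s (≤-trans l≤ p) (≤-trans s≤ q)) (ΣA-rows³ u (x ∘ suc) (y ∘ suc) b c (≤-trans l≤ p) (≤-trans s≤ q) (h ∘ suc)) ⟩
  sum< (suc u) (λ r → y 0 l r s) *ℤ Y′
    ≡⟨ sym (factor (λ r → y 0 l r s) Y′) ⟩
  sum< (suc u) (λ r → y 0 l r s *ℤ Y′)
    ≡⟨ sum<-cong (suc u) (λ r _ → sym (scalar (ΣA-linear L u) (y 0 l r s) _)) ⟩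
  sum< (suc u) (λ r → ΣA L u (λ ρ → y 0 l r s *ℤ rows³ (y ∘ suc) ls ρ σ)) ∎
  where
  X = ΣA L u (λ ρ → rows³ (x ∘ suc) ls ρ σ)
  Y′ = ΣA L u (λ ρ → rows³ (y ∘ suc) ls ρ σ)
  factor : ∀ F Z → sum< (suc u) (λ r → F r *ℤ Z) ≡ sum< (suc u) F *ℤ Z
  factor F Z = trans (sum<-cong (suc u) (λ r _ → ℤ.*-comm (F r) Z)) (trans (scalar (sum<-linear {A = ℕ} linear-eval (suc u)) Z F) (ℤ.*-comm Z _))

sum<-single : ∀ {n w} F → w < n → (∀ r → r < n → r ≢ w → F r ≡ + 0) → sum< n F ≡ F w
sum<-single {n} {w} F p h = trans (sum<-cong n (λ r r< → pick r r< (ℕ._≟_ r w))) (sum<-δ p F)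
  where
  pick : ∀ r → r < n → Relation.Nullary.Dec (r ≡ w) → F r ≡ when (w ≡ᵇ r) (F r)
  pick r r< (yes refl) rewrite ≡ᵇ-refl r = refl
  pick r r< (no ne) rewrite ≡ᵇ-false {w} {r} (λ e → ne (sym e)) = h r r< ne

sum<-pair : ∀ {n w} F → suc w < n → F w +ℤ F (suc w) ≡ + 0 → (∀ r → r < n → r ≢ w → r ≢ suc w → F r ≡ + 0) → sum< n F ≡ + 0
sum<-pair {n} {w} F p z h = begin
  sum< n F
    ≡⟨ sum<-cong n (λ r r< → pick r r< (ℕ._≟_ r w) (ℕ._≟_ r (suc w))) ⟩
  sum< n (λ r → when (w ≡ᵇ r) (F r) +ℤ when (suc w ≡ᵇ r) (F r))
    ≡⟨ trans (sum<-+ n _ _) (cong₂ _+ℤ_ (sum<-δ (<-trans ≤-refl p) F) (sum<-δ p F)) ⟩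
  F w +ℤ F (suc w)
    ≡⟨ z ⟩
  + 0 ∎
  where
  pick : ∀ r → r < n → Relation.Nullary.Dec (r ≡ w) → Relation.Nullary.Dec (r ≡ suc w) → F r ≡ when (w ≡ᵇ r) (F r) +ℤ when (suc w ≡ᵇ r) (F r)
  pick r r< (yes refl) _ rewrite ≡ᵇ-refl r | ≡ᵇ-false {suc r} {r} (λ e → 1+n≢n e) = sym (ℤ.+-identityʳ (F r))
  pick r r< (no ne) (yes refl) rewrite ≡ᵇ-false {w} {suc w} (λ e → 1+n≢n (sym e)) | ≡ᵇ-refl w = sym (ℤ.+-identityˡ (F r))
  pick r r< (no ne) (no ne′) rewrite ≡ᵇ-false {w} {r} (λ e → ne (sym e)) | ≡ᵇ-false {suc w} {r} (λ e → ne′ (sym e)) = h r r< ne ne′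

when₂ : Bool → Bool → ℤ → ℤ
when₂ a b x = when a (when b x)

when₂-true : ∀ {a b} x → T a → T b → when₂ a b x ≡ x
when₂-true {true} {true} x _ _ = refl

when₂-false : ∀ a b x → (T a → T b → ⊥) → when₂ a b x ≡ + 0
when₂-false true  true  x h = ⊥-elim (h tt tt)
when₂-false true  false x h = refl
when₂-false false b     x h = refl

sign-alternate : ∀ n x → sign n *ℤ x +ℤ sign (suc n) *ℤ x ≡ + 0
sign-alternate n x rewrite sign-suc n = cancel (sign n) x
  where
  cancel : ∀ a b → a *ℤ b +ℤ (- a) *ℤ b ≡ + 0
  cancel = solve-∀

-- The row-wise form of: removing cells of label bound ≥ k and then, with signs, cells of the window
-- equals removing, with signs, the window one level lower and then cells of bound ≥ k.
module RowExchange (t′ t w w′ : ℕ → ℕ) (p i u : ℕ) where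

  left right : ℕ → ℕ → ℕ → ℤ
  left  l s r = when₂ (beyond t′ i l r) (window p w i r s) (sign r *ℤ sign s)
  right l s r = when₂ (window p w′ i l r) (beyond t i r s) (sign l *ℤ sign r)

  private
    by-left : ∀ {l s r} → r ≡ s → T (beyond t′ i l r) → left l s r ≡ + 1
    by-left {l} {s} refl a = trans (when₂-true (sign s *ℤ sign s) a (window-≡ p w i {s} refl)) (sign-square s)

    by-right : ∀ {l s r} → r ≡ l → T (beyond t i r s) → right l s r ≡ + 1
    by-right {l} {s} refl a = trans (when₂-true (sign l *ℤ sign l) (window-≡ p w′ i {l} refl) a) (sign-square l)

    left-0 : ∀ l s r → (T (beyond t′ i l r) → T (window p w i r s) → ⊥) → left l s r ≡ + 0
    left-0 l s r = when₂-false (beyond t′ i l r) (window p w i r s) _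

    right-0 : ∀ l s r → (T (window p w′ i l r) → T (beyond t i r s) → ⊥) → right l s r ≡ + 0
    right-0 l s r = when₂-false (window p w′ i l r) (beyond t i r s) _

    outside : ∀ {l s} → l < s → sum< (suc u) (left l s) ≡ sum< (suc u) (right l s)
    outside {l} {s} l<s = trans
      (sum<-zero (suc u) (λ r _ → left-0 l s r (λ a b → <⇒≱ l<s (≤-trans (window-⊆ p w i r s b) (beyond-⊆ t′ i l r a)))))
      (sym (sum<-zero (suc u) (λ r _ → right-0 l s r (λ a b → <⇒≱ l<s (≤-trans (beyond-⊆ t i r s b) (window-⊆ p w′ i l r a))))))

    equal : ∀ {s} → s ≤ u → sum< (suc u) (left s s) ≡ sum< (suc u) (right s s)
    equal {s} q = trans
      (trans (sum<-single (left s s) (s≤s q) (λ r _ ne → left-0 s s r (λ a b → ne (≤-antisym (beyond-⊆ t′ i s r a) (window-⊆ p w i r s b))))) (by-left refl (beyond-≡ t′ i {s} refl)))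
      (sym (trans (sum<-single (right s s) (s≤s q) (λ r _ ne → right-0 s s r (λ a b → ne (≤-antisym (window-⊆ p w′ i s r a) (beyond-⊆ t i r s b))))) (by-right refl (beyond-≡ t i {s} refl))))

  exchange-low : t′ i ≡ 0 → t i ≡ 0 → w i ≡ p → w′ i ≡ p → ∀ l s → l ≤ u → s ≤ u → sum< (suc u) (left l s) ≡ sum< (suc u) (right l s)
  exchange-low t′0 t0 wp w′p l s l≤u s≤u with <-≤-connex l s
  ... | inj₁ l<s = outside l<s
  ... | inj₂ s≤l = trans
    (trans (sum<-single (left l s) (s≤s s≤u) (λ r _ ne → left-0 l s r (λ a b → ne (sym (no-window w wp r s b))))) (by-left refl (beyond-≤ t′ i (≤-trans (≤-reflexive t′0) z≤n) s≤l)))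
    (sym (trans (sum<-single (right l s) (s≤s l≤u) (λ r _ ne → right-0 l s r (λ a b → ne (no-window w′ w′p l r a)))) (by-right refl (beyond-≤ t i (≤-trans (≤-reflexive t0) z≤n) s≤l))))
    where
    no-window : ∀ w → w i ≡ p → ∀ l r → T (window p w i l r) → r ≡ l
    no-window w e l r x with window-elim p w i l r x
    ... | inj₁ eq = eq
    ... | inj₂ (a , b , c) = ≤-antisym b (≤-trans c (≤-trans (≤-reflexive e) a))

  -- Cases by the final length s < l. For s > η the window is idle and one term survives on each
  -- side. For s = η, and for p ≤ s < η < l, the left side has exactly the middle lengths η and η +
  -- 1, of opposite signs, and the right side has none. For p ≤ s < l ≤ η the outer removal is idle
  -- and both sides have one term, with the same sign. For s < p there is none.
  exchange-high : ∀ η → p ≤ η → t′ i ≡ η → t i ≡ suc η → w i ≡ suc η → w′ i ≡ η → ∀ l s → l ≤ u → s ≤ u → sum< (suc u) (left l s) ≡ sum< (suc u) (right l s)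
  exchange-high η p≤η e₁ e₂ e₃ e₄ l s l≤u s≤u with <-cmp s l
  ... | tri> _ _ l<s = outside l<s
  ... | tri≈ _ refl _ = equal s≤u
  ... | tri< s<l _ _ with <-cmp s η
  ...   | tri> _ _ η<s = trans
    (trans (sum<-single (left l s) (s≤s s≤u) (λ r _ ne → left-0 l s r (λ a b → not-left r ne (window-elim p w i r s b))))
      (by-left refl (beyond-≤ t′ i (subst (_≤ s) (sym e₁) (<⇒≤ η<s)) (<⇒≤ s<l))))
    (sym (trans (sum<-single (right l s) (s≤s l≤u) (λ r _ ne → right-0 l s r (λ a b → not-right r ne (window-elim p w′ i l r a))))
      (by-right refl (beyond-≤ t i (subst (_≤ s) (sym e₂) η<s) (<⇒≤ s<l)))))
    where
    not-left : ∀ r → r ≢ s → (s ≡ r) ⊎ ((p ≤ s) × (s ≤ r) × (r ≤ w i)) → ⊥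
    not-left r ne (inj₁ e) = ne (sym e)
    not-left r ne (inj₂ (_ , b , c)) = ne (≤-antisym (≤-trans c (≤-trans (≤-reflexive e₃) η<s)) b)
    not-right : ∀ r → r ≢ l → (r ≡ l) ⊎ ((p ≤ r) × (r ≤ l) × (l ≤ w′ i)) → ⊥
    not-right r ne (inj₁ e) = ne e
    not-right r ne (inj₂ (_ , _ , c)) = <⇒≱ (<-trans η<s s<l) (≤-trans c (≤-reflexive e₄))
  ...   | tri≈ _ refl _ = trans
    (sum<-pair (left l s) (s≤s (≤-trans s<l l≤u))
      (trans (cong₂ _+ℤ_ (when₂-true (sign s *ℤ sign s) (beyond-≤ t′ i (≤-reflexive e₁) (<⇒≤ s<l)) (window-≡ p w i {s} refl))
                         (when₂-true (sign (suc s) *ℤ sign s) (beyond-≤ t′ i (≤-trans (≤-reflexive e₁) (n≤1+n s)) s<l) (window-≤ p w i p≤η (n≤1+n s) (≤-reflexive (sym e₃)))))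
        (sign-alternate s (sign s)))
      (λ r _ ne ne′ → left-0 l s r (λ a b → not-left r ne ne′ (window-elim p w i r s b))))
    (sym (sum<-zero (suc u) (λ r _ → right-0 l s r (λ a b → not-right r (window-elim p w′ i l r a) (beyond-elim t i r s b)))))
    where
    not-left : ∀ r → r ≢ s → r ≢ suc s → (s ≡ r) ⊎ ((p ≤ s) × (s ≤ r) × (r ≤ w i)) → ⊥
    not-left r ne ne′ (inj₁ e) = ne (sym e)
    not-left r ne ne′ (inj₂ (_ , b , c)) with m≤n⇒m<n∨m≡n b
    ... | inj₂ e = ne (sym e)
    ... | inj₁ x = ne′ (≤-antisym (≤-trans c (≤-reflexive e₃)) x)
    not-right : ∀ r → (r ≡ l) ⊎ ((p ≤ r) × (r ≤ l) × (l ≤ w′ i)) → (s ≡ r) ⊎ ((t i ≤ s) × (s ≤ r)) → ⊥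
    not-right r _ (inj₂ (b , _)) = <⇒≱ (≤-reflexive (sym e₂)) b
    not-right r (inj₁ e) (inj₁ e′) = <⇒≢ s<l (trans e′ e)
    not-right r (inj₂ (_ , _ , c)) (inj₁ e′) = <⇒≱ s<l (≤-trans c (≤-reflexive e₄))
  ...   | tri< s<η _ _ with ≤-<-connex p s
  ...     | inj₂ s<p = trans
    (sum<-zero (suc u) (λ r _ → left-0 l s r (λ a b → not-left r (beyond-elim t′ i l r a) (window-elim p w i r s b))))
    (sym (sum<-zero (suc u) (λ r _ → right-0 l s r (λ a b → not-right r (window-elim p w′ i l r a) (beyond-elim t i r s b)))))
    where
    not-left : ∀ r → (r ≡ l) ⊎ ((t′ i ≤ r) × (r ≤ l)) → (s ≡ r) ⊎ ((p ≤ s) × (s ≤ r) × (r ≤ w i)) → ⊥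
    not-left r _ (inj₂ (b , _)) = <⇒≱ s<p b
    not-left r (inj₁ e) (inj₁ e′) = <⇒≢ s<l (trans e′ e)
    not-left r (inj₂ (a , _)) (inj₁ refl) = <⇒≱ s<η (≤-trans (≤-reflexive (sym e₁)) a)
    not-right : ∀ r → (r ≡ l) ⊎ ((p ≤ r) × (r ≤ l) × (l ≤ w′ i)) → (s ≡ r) ⊎ ((t i ≤ s) × (s ≤ r)) → ⊥
    not-right r _ (inj₂ (b , _)) = <⇒≱ (<-trans s<η (≤-reflexive (sym e₂))) b
    not-right r (inj₁ e) (inj₁ e′) = <⇒≢ s<l (trans e′ e)
    not-right r (inj₂ (a , _)) (inj₁ refl) = <⇒≱ s<p a
  ...     | inj₁ p≤s with ≤-<-connex l η
  ...       | inj₂ η<l = trans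
    (sum<-pair (left l s) (s≤s (≤-trans η<l l≤u))
      (trans (cong₂ _+ℤ_ (when₂-true (sign η *ℤ sign s) (beyond-≤ t′ i (≤-reflexive e₁) (<⇒≤ η<l)) (window-≤ p w i p≤s (<⇒≤ s<η) (≤-trans (n≤1+n η) (≤-reflexive (sym e₃)))))
                         (when₂-true (sign (suc η) *ℤ sign s) (beyond-≤ t′ i (≤-trans (≤-reflexive e₁) (n≤1+n η)) η<l) (window-≤ p w i p≤s (≤-trans (<⇒≤ s<η) (n≤1+n η)) (≤-reflexive (sym e₃)))))
        (sign-alternate η (sign s)))
      (λ r _ ne ne′ → left-0 l s r (λ a b → not-left r ne ne′ (beyond-elim t′ i l r a) (window-elim p w i r s b))))
    (sym (sum<-zero (suc u) (λ r _ → right-0 l s r (λ a b → not-right r (window-elim p w′ i l r a) (beyond-elim t i r s b)))))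
    where
    squeeze : ∀ {r} → r ≢ η → r ≢ suc η → η ≤ r → r ≤ suc η → ⊥
    squeeze ne ne′ x y with m≤n⇒m<n∨m≡n x
    ... | inj₁ z = ne′ (≤-antisym y z)
    ... | inj₂ e = ne (sym e)
    not-left : ∀ r → r ≢ η → r ≢ suc η → (r ≡ l) ⊎ ((t′ i ≤ r) × (r ≤ l)) → (s ≡ r) ⊎ ((p ≤ s) × (s ≤ r) × (r ≤ w i)) → ⊥
    not-left r ne ne′ (inj₁ e) (inj₁ e′) = <⇒≢ s<l (trans e′ e)
    not-left r ne ne′ (inj₁ refl) (inj₂ (_ , _ , c)) = squeeze ne ne′ (<⇒≤ η<l) (≤-trans c (≤-reflexive e₃))
    not-left r ne ne′ (inj₂ (a , _)) (inj₁ refl) = <⇒≱ s<η (≤-trans (≤-reflexive (sym e₁)) a)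
    not-left r ne ne′ (inj₂ (a , _)) (inj₂ (_ , _ , c)) = squeeze ne ne′ (≤-trans (≤-reflexive (sym e₁)) a) (≤-trans c (≤-reflexive e₃))
    not-right : ∀ r → (r ≡ l) ⊎ ((p ≤ r) × (r ≤ l) × (l ≤ w′ i)) → (s ≡ r) ⊎ ((t i ≤ s) × (s ≤ r)) → ⊥
    not-right r _ (inj₂ (b , _)) = <⇒≱ (<-trans s<η (≤-reflexive (sym e₂))) b
    not-right r (inj₁ e) (inj₁ e′) = <⇒≢ s<l (trans e′ e)
    not-right r (inj₂ (_ , _ , c)) (inj₁ e′) = <⇒≱ η<l (≤-trans c (≤-reflexive e₄))
  ...       | inj₁ l≤η = trans
    (trans (sum<-single (left l s) (s≤s l≤u) (λ r _ ne → left-0 l s r (λ a b → not-left r ne (beyond-elim t′ i l r a))))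
      (when₂-true (sign l *ℤ sign s) (beyond-≡ t′ i {l} refl) (window-≤ p w i p≤s (<⇒≤ s<l) (≤-trans l≤η (≤-trans (n≤1+n η) (≤-reflexive (sym e₃)))))))
    (sym (trans (sum<-single (right l s) (s≤s s≤u) (λ r _ ne → right-0 l s r (λ a b → not-right r ne (beyond-elim t i r s b))))
      (when₂-true (sign l *ℤ sign s) (window-≤ p w′ i p≤s (<⇒≤ s<l) (≤-trans l≤η (≤-reflexive (sym e₄)))) (beyond-≡ t i {s} refl))))
    where
    not-left : ∀ r → r ≢ l → (r ≡ l) ⊎ ((t′ i ≤ r) × (r ≤ l)) → ⊥
    not-left r ne (inj₁ e) = ne e
    not-left r ne (inj₂ (a , b)) = ne (≤-antisym b (≤-trans l≤η (≤-trans (≤-reflexive (sym e₁)) a)))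
    not-right : ∀ r → r ≢ s → (s ≡ r) ⊎ ((t i ≤ s) × (s ≤ r)) → ⊥
    not-right r ne (inj₁ e) = ne (sym e)
    not-right r ne (inj₂ (a , _)) = <⇒≱ (<-trans s<η (≤-reflexive (sym e₂))) a

-- Row i of the region {(i , j) : i + (j ∸ p) ≥ k} starts at column threshold p k i.
threshold : ℕ → ℕ → ℕ → ℕ
threshold p k i = if k ≤ᵇ i then 0 else p + (k ∸ i)

limit : ℕ → ℕ → ℕ → ℕ
limit p k i = p + (k ∸ i)

threshold-≥ : ∀ p {k i} → k ≤ i → threshold p k i ≡ 0
threshold-≥ p q rewrite ≤ᵇ-true q = refl

threshold-< : ∀ p {k i} → i < k → threshold p k i ≡ p + (k ∸ i)
threshold-< p q rewrite ≤ᵇ-false q = refl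

limit-≥ : ∀ p {k i} → k ≤ i → limit p k i ≡ p
limit-≥ p q = trans (cong (λ z → p + z) (m≤n⇒m∸n≡0 q)) (ℕ.+-identityʳ p)

limit-suc : ∀ p k {i} → i ≤ k → limit p (suc k) i ≡ suc (limit p k i)
limit-suc p k {i} q = trans (cong (λ z → p + z) (+-∸-assoc 1 q)) (+-suc p _)

-- In a row i ≤ k the four bounds are η, η + 1, η + 1, η with η = p + 1 + (k - i). In the rows i > k
-- the removals are unrestricted and both windows are empty.
exchange-rows : ∀ p k i u l s → l ≤ u → s ≤ u →
  sum< (suc u) (λ r → when₂ (beyond (threshold p (suc k)) i l r) (window (suc p) (limit (suc p) (suc k)) i r s) (sign r *ℤ sign s)) ≡
  sum< (suc u) (λ r → when₂ (window (suc p) (limit (suc p) k) i l r) (beyond (threshold (suc p) (suc k)) i r s) (sign l *ℤ sign r))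
exchange-rows p k i u l s l≤ s≤ with ≤-<-connex (suc k) i
... | inj₁ q = RowExchange.exchange-low (threshold p (suc k)) (threshold (suc p) (suc k)) (limit (suc p) (suc k)) (limit (suc p) k) (suc p) i u
  (threshold-≥ p q) (threshold-≥ (suc p) q) (limit-≥ (suc p) q) (limit-≥ (suc p) (<⇒≤ q)) l s l≤ s≤
... | inj₂ (s≤s q) = RowExchange.exchange-high (threshold p (suc k)) (threshold (suc p) (suc k)) (limit (suc p) (suc k)) (limit (suc p) k) (suc p) i u
  (limit (suc p) k i) (m≤m+n (suc p) _)
  (trans (threshold-< p (s≤s q)) (limit-suc p k q))
  (trans (threshold-< (suc p) (s≤s q)) (limit-suc (suc p) k q))
  (limit-suc (suc p) k q) refl l s l≤ s≤

Box-length : ∀ {L u ρ} → Box L u ρ → length ρ ≡ L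
Box-length []      = refl
Box-length (_ ∷ b) = cong suc (Box-length b)

Box-from-at : ∀ L {u} ρ → length ρ ≡ L → at ρ 0 ≤ u → (∀ i → suc i < L → at ρ (suc i) ≤ at ρ i) → Box L u ρ
Box-from-at zero          []      e p h = []
Box-from-at (suc zero)    (r ∷ []) e p h = p ∷ []
Box-from-at (suc (suc L)) (r ∷ r′ ∷ ρ) e p h = p ∷ Box-from-at (suc L) (r′ ∷ ρ) (suc-injective e) (h 0 (s≤s (s≤s z≤n))) (λ i q → h (suc i) (s≤s q))

at-anti : ∀ {L u ρ} → Box L u ρ → ∀ i → at ρ (suc i) ≤ at ρ i
at-anti []            i       = z≤n
at-anti (_ ∷ [])      zero    = z≤n
at-anti (_ ∷ q ∷ _)   zero    = q
at-anti (_ ∷ b)       (suc i) = at-anti b i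

-- The intermediate shapes selected by the two sides of the exchange are automatically partitions.
module _ (p k : ℕ) {N : ℕ} {ls σ ρ : List ℕ} (bl : Box N N ls) (bσ : Box N N σ) (len : length ρ ≡ N) where

  private
    η : ℕ → ℕ
    η i = limit (suc p) k i

    to-Box : (∀ i → i < N → at ρ i ≤ at ls i) → (∀ i → suc i < N → at ρ (suc i) ≤ at ρ i) → Box N N ρ
    to-Box sub h = Box-from-at N ρ len (≤-trans (bound N {ls} {ρ} bl len sub) (at-Box bl 0)) h
      where
      bound : ∀ N {ls ρ} → Box N N ls → length ρ ≡ N → (∀ i → i < N → at ρ i ≤ at ls i) → at ρ 0 ≤ at ls 0
      bound zero    {ρ = []} b e h = z≤n
      bound (suc N) b e h = h 0 (s≤s z≤n)

  exchange-left-Box : T (ker (beyond (threshold p (suc k))) ls ρ) → T (ker (window (suc p) (limit (suc p) (suc k))) ρ σ) → Box N N ρ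
  exchange-left-Box a b = to-Box (λ i q → beyond-⊆ (threshold p (suc k)) i (at ls i) (at ρ i) (A i q)) decreasing
    where
    A : ∀ i → i < N → T (beyond (threshold p (suc k)) i (at ls i) (at ρ i))
    A i q = ker-at _ ls ρ a i (subst (i <_) (sym len) q)
    B : ∀ i → i < N → T (window (suc p) (limit (suc p) (suc k)) i (at ρ i) (at σ i))
    B i q = ker-at _ ρ σ b i (subst (i <_) (sym (Box-length bσ)) q)
    decreasing : ∀ i → suc i < N → at ρ (suc i) ≤ at ρ i
    decreasing i q = go (window-elim (suc p) (limit (suc p) (suc k)) (suc i) (at ρ (suc i)) (at σ (suc i)) (B (suc i) q))
      where
      q′ = <-trans (n<1+n i) q
      s≤r = window-⊆ (suc p) (limit (suc p) (suc k)) i (at ρ i) (at σ i) (B i q′)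
      small : at ρ (suc i) ≤ η i → (at ρ i ≡ at ls i) ⊎ ((threshold p (suc k) i ≤ at ρ i) × (at ρ i ≤ at ls i)) → i ≤ k → at ρ (suc i) ≤ at ρ i
      small h (inj₁ e) _ = ≤-trans (beyond-⊆ (threshold p (suc k)) (suc i) (at ls (suc i)) (at ρ (suc i)) (A (suc i) q)) (≤-trans (at-anti bl i) (≤-reflexive (sym e)))
      small h (inj₂ (x , _)) i≤k = ≤-trans h (≤-trans (≤-reflexive (sym (trans (threshold-< p (s≤s i≤k)) (limit-suc p k i≤k)))) x)
      go : (at σ (suc i) ≡ at ρ (suc i)) ⊎ ((suc p ≤ at σ (suc i)) × (at σ (suc i) ≤ at ρ (suc i)) × (at ρ (suc i) ≤ limit (suc p) (suc k) (suc i))) → at ρ (suc i) ≤ at ρ i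
      go (inj₁ e) = ≤-trans (≤-reflexive (sym e)) (≤-trans (at-anti bσ i) s≤r)
      go (inj₂ (x , y , z)) with ≤-<-connex (suc k) i
      ... | inj₂ (s≤s i≤k) = small z (beyond-elim (threshold p (suc k)) i (at ls i) (at ρ i) (A i q′)) i≤k
      ... | inj₁ k<i = ≤-trans z (≤-trans (≤-reflexive (limit-≥ (suc p) (≤-trans k<i (n≤1+n i)))) (≤-trans x (≤-trans (at-anti bσ i) s≤r)))

  exchange-right-Box : T (ker (window (suc p) (limit (suc p) k)) ls ρ) → T (ker (beyond (threshold (suc p) (suc k))) ρ σ) → Box N N ρ
  exchange-right-Box a b = to-Box (λ i q → window-⊆ (suc p) (limit (suc p) k) i (at ls i) (at ρ i) (A i q)) decreasing
    where
    A : ∀ i → i < N → T (window (suc p) (limit (suc p) k) i (at ls i) (at ρ i))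
    A i q = ker-at _ ls ρ a i (subst (i <_) (sym len) q)
    B : ∀ i → i < N → T (beyond (threshold (suc p) (suc k)) i (at ρ i) (at σ i))
    B i q = ker-at _ ρ σ b i (subst (i <_) (sym (Box-length bσ)) q)
    decreasing : ∀ i → suc i < N → at ρ (suc i) ≤ at ρ i
    decreasing i q = go (window-elim (suc p) (limit (suc p) k) i (at ls i) (at ρ i) (A i q′))
      where
      q′ = <-trans (n<1+n i) q
      r₁≤l = ≤-trans (window-⊆ (suc p) (limit (suc p) k) (suc i) (at ls (suc i)) (at ρ (suc i)) (A (suc i) q)) (at-anti bl i)
      go : (at ρ i ≡ at ls i) ⊎ ((suc p ≤ at ρ i) × (at ρ i ≤ at ls i) × (at ls i ≤ η i)) → at ρ (suc i) ≤ at ρ i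
      go (inj₁ e) = ≤-trans r₁≤l (≤-reflexive (sym e))
      go (inj₂ (x , y , z)) with ≤-<-connex k i
      ... | inj₁ k≤i = ≤-trans r₁≤l (≤-trans z (≤-trans (≤-reflexive (limit-≥ (suc p) k≤i)) x))
      ... | inj₂ i<k with beyond-elim (threshold (suc p) (suc k)) (suc i) (at ρ (suc i)) (at σ (suc i)) (B (suc i) q)
      ...   | inj₁ e = ≤-trans (≤-reflexive (sym e)) (≤-trans (at-anti bσ i) (beyond-⊆ (threshold (suc p) (suc k)) i (at ρ i) (at σ i) (B i q′)))
      ...   | inj₂ (t≤ , _) = ≤-trans r₁≤l (≤-trans z (≤-trans (≤-reflexive (sym (threshold-< (suc p) (s≤s i<k))))
               (≤-trans t≤ (≤-trans (at-anti bσ i) (beyond-⊆ (threshold (suc p) (suc k)) i (at ρ i) (at σ i) (B i q′))))))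

rows³-left : ∀ K K′ ls ρ σ → length ls ≡ length ρ → length σ ≡ length ρ →
  when₂ (ker K ls ρ) (ker K′ ρ σ) (sgn ρ *ℤ sgn σ) ≡ rows³ (λ i l r s → when₂ (K i l r) (K′ i r s) (sign r *ℤ sign s)) ls ρ σ
rows³-left K K′ [] [] [] _ _ = refl
rows³-left K K′ (l ∷ ls) (r ∷ ρ) (s ∷ σ) e e′ =
  trans (split (K 0 l r) (K′ 0 r s) (ker (K ∘ suc) ls ρ) (ker (K′ ∘ suc) ρ σ))
    (cong (when₂ (K 0 l r) (K′ 0 r s) (sign r *ℤ sign s) *ℤ_) (rows³-left (K ∘ suc) (K′ ∘ suc) ls ρ σ (suc-injective e) (suc-injective e′)))
  where
  split : ∀ a b c d → when₂ (a ∧ c) (b ∧ d) (sgn (r ∷ ρ) *ℤ sgn (s ∷ σ)) ≡ when₂ a b (sign r *ℤ sign s) *ℤ when₂ c d (sgn ρ *ℤ sgn σ)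
  split true  true  true  true  = trans (cong₂ _*ℤ_ (sign-+ r (sum ρ)) (sign-+ s (sum σ))) (ℤ*.interchange (sign r) (sgn ρ) (sign s) (sgn σ))
  split true  true  true  false = sym (ℤ.*-zeroʳ (sign r *ℤ sign s))
  split true  true  false d     = sym (ℤ.*-zeroʳ (sign r *ℤ sign s))
  split true  false true  d     = refl
  split true  false false d     = refl
  split false b     c     d     = refl

rows³-right : ∀ K K′ ls ρ σ → length ls ≡ length ρ → length σ ≡ length ρ →
  when₂ (ker K ls ρ) (ker K′ ρ σ) (sgn ls *ℤ sgn ρ) ≡ rows³ (λ i l r s → when₂ (K i l r) (K′ i r s) (sign l *ℤ sign r)) ls ρ σ
rows³-right K K′ [] [] [] _ _ = refl
rows³-right K K′ (l ∷ ls) (r ∷ ρ) (s ∷ σ) e e′ =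
  trans (split (K 0 l r) (K′ 0 r s) (ker (K ∘ suc) ls ρ) (ker (K′ ∘ suc) ρ σ))
    (cong (when₂ (K 0 l r) (K′ 0 r s) (sign l *ℤ sign r) *ℤ_) (rows³-right (K ∘ suc) (K′ ∘ suc) ls ρ σ (suc-injective e) (suc-injective e′)))
  where
  split : ∀ a b c d → when₂ (a ∧ c) (b ∧ d) (sgn (l ∷ ls) *ℤ sgn (r ∷ ρ)) ≡ when₂ a b (sign l *ℤ sign r) *ℤ when₂ c d (sgn ls *ℤ sgn ρ)
  split true  true  true  true  = trans (cong₂ _*ℤ_ (sign-+ l (sum ls)) (sign-+ r (sum ρ))) (ℤ*.interchange (sign l) (sgn ls) (sign r) (sgn ρ))
  split true  true  true  false = sym (ℤ.*-zeroʳ (sign l *ℤ sign r))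
  split true  true  false d     = sym (ℤ.*-zeroʳ (sign l *ℤ sign r))
  split true  false true  d     = refl
  split true  false false d     = refl
  split false b     c     d     = refl

-- Both middle sums are supported on partitions, so they may run over all sequences of rows, where
-- the identity holds row by row.
exchange-kernel : ∀ p k {N ls σ} → Box N N ls → Box N N σ →
  ΣD N N (λ ρ → when₂ (ker (beyond (threshold p (suc k))) ls ρ) (ker (window (suc p) (limit (suc p) (suc k))) ρ σ) (sgn ρ *ℤ sgn σ)) ≡
  ΣD N N (λ ρ → when₂ (ker (window (suc p) (limit (suc p) k)) ls ρ) (ker (beyond (threshold (suc p) (suc k))) ρ σ) (sgn ls *ℤ sgn ρ))
exchange-kernel p k {N} {ls} {σ} bl bσ = begin
  ΣD N N (λ ρ → when₂ (ker K₁ ls ρ) (ker K₂ ρ σ) (sgn ρ *ℤ sgn σ))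
    ≡⟨ ΣD-ΣA N ≤-refl _ (λ ρ e → support (ker K₁ ls ρ) (ker K₂ ρ σ) _ (exchange-left-Box p k bl bσ e)) ⟩
  ΣA N N (λ ρ → when₂ (ker K₁ ls ρ) (ker K₂ ρ σ) (sgn ρ *ℤ sgn σ))
    ≡⟨ ΣA-cong N N (λ ρ e → rows³-left K₁ K₂ ls ρ σ (trans (Box-length bl) (sym e)) (trans (Box-length bσ) (sym e))) ⟩
  ΣA N N (λ ρ → rows³ (λ i l r s → when₂ (K₁ i l r) (K₂ i r s) (sign r *ℤ sign s)) ls ρ σ)
    ≡⟨ ΣA-rows³ N _ _ bl bσ ≤-refl ≤-refl (λ i l s → exchange-rows p k i N l s) ⟩
  ΣA N N (λ ρ → rows³ (λ i l r s → when₂ (K₃ i l r) (K₄ i r s) (sign l *ℤ sign r)) ls ρ σ)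
    ≡⟨ sym (ΣA-cong N N (λ ρ e → rows³-right K₃ K₄ ls ρ σ (trans (Box-length bl) (sym e)) (trans (Box-length bσ) (sym e)))) ⟩
  ΣA N N (λ ρ → when₂ (ker K₃ ls ρ) (ker K₄ ρ σ) (sgn ls *ℤ sgn ρ))
    ≡⟨ sym (ΣD-ΣA N ≤-refl _ (λ ρ e → support (ker K₃ ls ρ) (ker K₄ ρ σ) _ (exchange-right-Box p k bl bσ e))) ⟩
  ΣD N N (λ ρ → when₂ (ker K₃ ls ρ) (ker K₄ ρ σ) (sgn ls *ℤ sgn ρ)) ∎
  where
  K₁ = beyond (threshold p (suc k))
  K₂ = window (suc p) (limit (suc p) (suc k))
  K₃ = window (suc p) (limit (suc p) k)
  K₄ = beyond (threshold (suc p) (suc k))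
  ΣA-cong : ∀ L u {f g} → (∀ ρ → length ρ ≡ L → f ρ ≡ g ρ) → ΣA L u f ≡ ΣA L u g
  ΣA-cong zero    u h = h [] refl
  ΣA-cong (suc L) u h = sum<-cong (suc u) (λ r _ → ΣA-cong L u (λ ρ e → h (r ∷ ρ) (cong suc e)))
  support : ∀ {ρ} a b x → (T a → T b → Box N N ρ) → Box N N ρ ⊎ (when₂ a b x ≡ + 0)
  support true  true  x h = inj₁ (h tt tt)
  support true  false x h = inj₂ refl
  support false b     x h = inj₂ refl

-- An interpolation between the identity (`k` = 0) and the signed column removal (`k` ≥ N + N): a
-- row may be cut back, at most to length `p`, only if its length does not exceed `limit p k i`.
signedWindow : ℕ → ℕ → ℕ → (List ℕ → ℤ) → List ℕ → ℤ
signedWindow N p k g ls = sgn ls *ℤ removal N (window p (limit p k)) (λ ρ → sgn ρ *ℤ g ρ) ls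

removal-exchange : ∀ p k {N ls} → Box N N ls → ∀ g →
  removal N (beyond (threshold p (suc k))) (signedWindow N (suc p) (suc k) g) ls ≡ signedWindow N (suc p) k (removal N (beyond (threshold (suc p) (suc k))) g) ls
removal-exchange p k {N} {ls} bl g = begin
  ΣD N N (λ ρ → when (ker K₁ ls ρ) (sgn ρ *ℤ ΣD N N (λ σ → when (ker K₂ ρ σ) (sgn σ *ℤ g σ))))
    ≡⟨ ΣD-cong N N (λ {ρ} _ → trans (cong (when (ker K₁ ls ρ)) (sym (scalar (ΣD-linear N N) (sgn ρ) _)))
         (trans (sym (linear-when (ΣD-linear N N) (ker K₁ ls ρ) _)) (ΣD-cong N N (λ {σ} _ → assoc₁ (ker K₁ ls ρ) (ker K₂ ρ σ) (sgn ρ) (sgn σ) (g σ))))) ⟩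
  ΣD N N (λ ρ → ΣD N N (λ σ → g σ *ℤ when₂ (ker K₁ ls ρ) (ker K₂ ρ σ) (sgn ρ *ℤ sgn σ)))
    ≡⟨ trans (ΣD-swap N N N N _) (ΣD-cong N N (λ {σ} bσ → trans (scalar (ΣD-linear N N) (g σ) _)
         (trans (cong (g σ *ℤ_) (exchange-kernel p k bl bσ)) (sym (scalar (ΣD-linear N N) (g σ) _))))) ⟩
  ΣD N N (λ σ → ΣD N N (λ ρ → g σ *ℤ when₂ (ker K₃ ls ρ) (ker K₄ ρ σ) (sgn ls *ℤ sgn ρ)))
    ≡⟨ ΣD-swap N N N N _ ⟩
  ΣD N N (λ ρ → ΣD N N (λ σ → g σ *ℤ when₂ (ker K₃ ls ρ) (ker K₄ ρ σ) (sgn ls *ℤ sgn ρ)))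
    ≡⟨ sym (trans (sym (scalar (ΣD-linear N N) (sgn ls) _)) (ΣD-cong N N (λ {ρ} _ → trans (cong (λ z → sgn ls *ℤ when (ker K₃ ls ρ) z) (sym (scalar (ΣD-linear N N) (sgn ρ) _)))
         (trans (cong (sgn ls *ℤ_) (sym (linear-when (ΣD-linear N N) (ker K₃ ls ρ) _))) (trans (sym (scalar (ΣD-linear N N) (sgn ls) _))
           (ΣD-cong N N (λ {σ} _ → assoc₂ (ker K₃ ls ρ) (ker K₄ ρ σ) (sgn ls) (sgn ρ) (g σ)))))))) ⟩
  sgn ls *ℤ ΣD N N (λ ρ → when (ker K₃ ls ρ) (sgn ρ *ℤ ΣD N N (λ σ → when (ker K₄ ρ σ) (g σ)))) ∎
  where
  K₁ = beyond (threshold p (suc k))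
  K₂ = window (suc p) (limit (suc p) (suc k))
  K₃ = window (suc p) (limit (suc p) k)
  K₄ = beyond (threshold (suc p) (suc k))
  rotate : ∀ a b c → a *ℤ (b *ℤ c) ≡ c *ℤ (a *ℤ b)
  rotate = solve-∀
  assoc₁ : ∀ a b x y z → when a (x *ℤ when b (y *ℤ z)) ≡ z *ℤ when₂ a b (x *ℤ y)
  assoc₁ true  true  x y z = rotate x y z
  assoc₁ true  false x y z = trans (ℤ.*-zeroʳ x) (sym (ℤ.*-zeroʳ z))
  assoc₁ false b     x y z = sym (ℤ.*-zeroʳ z)
  assoc₂ : ∀ a b x y z → x *ℤ when a (y *ℤ when b z) ≡ z *ℤ when₂ a b (x *ℤ y)
  assoc₂ true  true  x y z = rotate x y z
  assoc₂ true  false x y z = trans (cong (x *ℤ_) (ℤ.*-zeroʳ y)) (trans (ℤ.*-zeroʳ x) (sym (ℤ.*-zeroʳ z)))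
  assoc₂ false b     x y z = trans (ℤ.*-zeroʳ x) (sym (ℤ.*-zeroʳ z))

-- Successive removals at levels k, …, k + n - 1: transposed counting of plane partitions
-- with labels ≥ k in which cell (i , j) has label at most i + (j ∸ p).
chain : ℕ → ℕ → ℕ → ℕ → (List ℕ → ℤ) → List ℕ → ℤ
chain N p k zero    g = g
chain N p k (suc n) g = removal N (beyond (threshold p k)) (chain N p (suc k) n g)

-- The window loses one level at each of the `n` removals it passes, and each of these removals
-- turns its offset p into p + 1.
chain-exchange : ∀ p k n {N ls} → Box N N ls → ∀ g →
  chain N p (suc k) n (signedWindow N (suc p) (k + n) g) ls ≡ signedWindow N (suc p) k (chain N (suc p) (suc k) n g) ls
chain-exchange p k zero    b g rewrite ℕ.+-identityʳ k = refl
chain-exchange p k (suc n) {N} {ls} b g = trans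
  (removal-cong N (beyond (threshold p (suc k))) ls (λ {ρ} bρ → trans (cong (λ z → chain N p (suc (suc k)) n (signedWindow N (suc p) z g) ρ) (+-suc k n)) (chain-exchange p (suc k) n bρ g)))
  (removal-exchange p k b (chain N (suc p) (suc (suc k)) n g))

-- In terms of cells, the kernel asks for containment and for the survival of all cells in front of
-- the threshold. In this form conjugation merely swaps the coordinates.
beyond-ker-to : ∀ t ls ρ → length ls ≡ length ρ → T (ker (beyond t) ls ρ) → (∀ i → at ρ i ≤ at ls i) × (∀ i j → j < t i → j < at ls i → j < at ρ i)
beyond-ker-to t []       []      e x = (λ i → z≤n) , (λ i j _ q → q)
beyond-ker-to t (l ∷ ls) (r ∷ ρ) e x with beyond-ker-to (t ∘ suc) ls ρ (suc-injective e) (∧-Tʳ (beyond t 0 l r) x)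
... | sub , keep = (λ { zero → beyond-⊆ t 0 l r h ; (suc i) → sub i }) , (λ { zero j p q → first j p q (beyond-elim t 0 l r h) ; (suc i) j p q → keep i j p q })
  where
  h = ∧-Tˡ (beyond t 0 l r) x
  first : ∀ j → j < t 0 → j < l → (r ≡ l) ⊎ ((t 0 ≤ r) × (r ≤ l)) → j < r
  first j p q (inj₁ e)       = <-≤-trans q (≤-reflexive (sym e))
  first j p q (inj₂ (a , _)) = <-≤-trans p a

beyond-ker-from : ∀ t {L u v ls ρ} → Box L u ls → Box L v ρ → (∀ i → at ρ i ≤ at ls i) → (∀ i j → j < t i → j < at ls i → j < at ρ i) → T (ker (beyond t) ls ρ)
beyond-ker-from t {ls = ls} {ρ} b c sub keep = ker-from (beyond t) b c (λ i _ → row i)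
  where
  row : ∀ i → T (beyond t i (at ls i) (at ρ i))
  row i with ≤-<-connex (t i) (at ρ i)
  ... | inj₁ p = beyond-≤ t i p (sub i)
  ... | inj₂ p = beyond-≡ t i (≤-antisym (sub i) (≤-ext (λ {j} q → shrink j q (<-≤-connex j (at ρ i)))))
    where
    shrink : ∀ j → j < at ls i → (j < at ρ i) ⊎ (at ρ i ≤ j) → j < at ρ i
    shrink j q (inj₁ r) = r
    shrink j q (inj₂ r) = ⊥-elim (<-irrefl refl (keep i (at ρ i) p (≤-<-trans r q)))

beyond-ker-τ : ∀ t t′ {N ls ρ} → (∀ {i j} → i < N → j < N → (j < t i → i < t′ j) × (i < t′ j → j < t i)) →
  Box N N ls → Box N N ρ → ker (beyond t) ls ρ ≡ ker (beyond t′) (τ N ls) (τ N ρ)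
beyond-ker-τ t t′ {N} {ls} {ρ} h b c = T⇒≡
  (λ x → let (sub , keep) = beyond-ker-to t ls ρ (trans (Box-length b) (sym (Box-length c))) x in
    beyond-ker-from t′ (Box-τ b) (Box-τ c) (λ i → ≤-ext (λ q → τ-from b (<-≤-trans (τ-to c q) (sub _))))
      (λ i j p q → let i<ls = τ-to b q in τ-from c (keep j i (proj₂ (h (in-row i<ls) (<-≤-trans i<ls (at-Box b j))) p) i<ls)))
  (λ x → let (sub , keep) = beyond-ker-to t′ (τ N ls) (τ N ρ) (trans (Box-length (Box-τ b)) (sym (Box-length (Box-τ c)))) x in
    beyond-ker-from t b c (λ i → ≤-ext (λ q → τ-to b (<-≤-trans (τ-from c q) (sub _))))
      (λ i j p q → τ-to c (keep j i (proj₁ (h (in-row q) (<-≤-trans q (at-Box b i))) p) (τ-from b q))))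
  where
  in-row : ∀ {i j} → j < at ls i → i < N
  in-row {i} q with <-≤-connex i N
  ... | inj₁ p = p
  ... | inj₂ p = ⊥-elim (<⇒≱ q (≤-trans (≤-reflexive (at-beyond b i p)) z≤n))

removal-τ : ∀ t t′ {N ls} → (∀ {i j} → i < N → j < N → (j < t i → i < t′ j) × (i < t′ j → j < t i)) →
  Box N N ls → ∀ g → removal N (beyond t) g ls ≡ removal N (beyond t′) (λ ρ → g (τ N ρ)) (τ N ls)
removal-τ t t′ {N} {ls} h b g = trans
  (ΣD-cong N N (λ {ρ} c → cong₂ when (beyond-ker-τ t t′ h b c) (cong g (sym (τ-involutive c)))))
  (ΣD-τ N (λ ρ → when (ker (beyond t′) (τ N ls) ρ) (g (τ N ρ))))

ker-cong : ∀ K K′ {L u v ls ρ} → Box L u ls → Box L v ρ → (∀ i → i < L → ∀ l r → l ≤ u → r ≤ v → K i l r ≡ K′ i l r) → ker K ls ρ ≡ ker K′ ls ρ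
ker-cong K K′ []      []      h = refl
ker-cong K K′ (p ∷ b) (q ∷ c) h = cong₂ _∧_ (h 0 (s≤s z≤n) _ _ p q) (ker-cong (K ∘ suc) (K′ ∘ suc) b c (λ i x l r y z → h (suc i) (s≤s x) l r (≤-trans y p) (≤-trans z q)))

removal-kernel-cong : ∀ K K′ {N ls} → Box N N ls → (∀ i → i < N → ∀ l r → l ≤ N → r ≤ N → K i l r ≡ K′ i l r) → ∀ g → removal N K g ls ≡ removal N K′ g ls
removal-kernel-cong K K′ {N} {ls} b h g = ΣD-cong N N (λ {ρ} c → cong (λ z → when z (g ρ)) (ker-cong K K′ b c h))

removal-trivial : ∀ K {N ls} → Box N N ls → (∀ i → i < N → ∀ l r → l ≤ N → r ≤ N → K i l r ≡ (r ≡ᵇ l)) → ∀ g → removal N K g ls ≡ g ls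
removal-trivial K {N} {ls} b h g = trans (ΣD-cong N N (λ {ρ} c → cong (λ z → when z (g ρ)) (trans (ker-cong K (λ _ l r → r ≡ᵇ l) b c h) (diag ls ρ (trans (Box-length b) (sym (Box-length c))))))) (ΣD-δ b g)
  where
  diag : ∀ ls ρ → length ls ≡ length ρ → ker (λ _ l r → r ≡ᵇ l) ls ρ ≡ eqList ls ρ
  diag []       []      e = refl
  diag (l ∷ ls) (r ∷ ρ) e = cong₂ _∧_ (T⇒≡ (λ t → ≡ᵇ-intro (sym (≡ᵇ-elim r l t))) (λ t → ≡ᵇ-intro (sym (≡ᵇ-elim l r t)))) (diag ls ρ (suc-injective e))

signedWindow-0 : ∀ p {N ls} → Box N N ls → ∀ g → signedWindow N p 0 g ls ≡ g ls
signedWindow-0 p {N} {ls} b g = trans (cong (sgn ls *ℤ_) (removal-trivial (window p (limit p 0)) b (λ i _ l r _ _ → T⇒≡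
  (λ t → ≡ᵇ-intro (empty i l r (window-elim p (limit p 0) i l r t))) (λ t → window-≡ p (limit p 0) i (≡ᵇ-elim r l t))) (λ ρ → sgn ρ *ℤ g ρ)))
  (sign-cancel (sum ls) (g ls))
  where
  empty : ∀ i l r → (r ≡ l) ⊎ ((p ≤ r) × (r ≤ l) × (l ≤ limit p 0 i)) → r ≡ l
  empty i l r (inj₁ e) = e
  empty i l r (inj₂ (a , b , c)) = ≤-antisym b (≤-trans c (≤-trans (≤-reflexive (limit-≥ p {0} {i} z≤n)) a))

columns : ℕ → ℕ → ℕ
columns k _ = k

signedWindow-∞ : ∀ p k {N ls} → N + N ≤ k → Box N N ls → ∀ g → signedWindow N p k g ls ≡ sgn ls *ℤ removal N (beyond (columns p)) (λ ρ → sgn ρ *ℤ g ρ) ls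
signedWindow-∞ p k {N} {ls} q b g = cong (sgn ls *ℤ_) (removal-kernel-cong (window p (limit p k)) (beyond (columns p)) b (λ i i< l r l≤ _ → T⇒≡
  (λ t → to {i} (window-elim p (limit p k) i l r t))
  (λ t → from i i< l≤ (beyond-elim (columns p) i l r t))) (λ ρ → sgn ρ *ℤ g ρ))
  where
  to : ∀ {i l r} → (r ≡ l) ⊎ ((p ≤ r) × (r ≤ l) × (l ≤ limit p k i)) → T (beyond (columns p) i l r)
  to {i} (inj₁ e) = beyond-≡ (columns p) i e
  to {i} (inj₂ (x , y , _)) = beyond-≤ (columns p) i x y
  from : ∀ i → i < N → ∀ {l r} → l ≤ N → (r ≡ l) ⊎ ((p ≤ r) × (r ≤ l)) → T (window p (limit p k) i l r)
  from i i< l≤ (inj₁ e) = window-≡ p (limit p k) i e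
  from i i< l≤ (inj₂ (x , y)) = window-≤ p (limit p k) i x y (≤-trans l≤ (≤-trans (m+n≤o⇒m≤o∸n N (≤-trans (+-monoʳ-≤ N (<⇒≤ i<)) q)) (m≤n+m (k ∸ i) p)))

chain-cong : ∀ N p k n {ls f g} → Box N N ls → (∀ {ρ} → Box N N ρ → f ρ ≡ g ρ) → chain N p k n f ls ≡ chain N p k n g ls
chain-cong N p k zero    b h = h b
chain-cong N p k (suc n) {ls} b h = removal-cong N (beyond (threshold p k)) ls (λ c → chain-cong N p (suc k) n c h)

columnChain : ℕ → ℕ → ℕ → (List ℕ → ℤ) → List ℕ → ℤ
columnChain N p zero    g = g
columnChain N p (suc n) g = removal N (beyond (columns p)) (columnChain N (suc p) n g)

-- Every column factor lowers the label bound from i + (j ∸ p) to i + (j ∸ (p + 1)).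
chain-columnChain : ∀ N p n {ls} → Box N N ls → ∀ g →
  chain N p 1 (N + N) (λ ρ → sgn ρ *ℤ columnChain N (suc p) n (λ σ → sgn σ *ℤ g σ) ρ) ls ≡ chain N (p + n) 1 (N + N) g ls
chain-columnChain N p zero    {ls} b g rewrite ℕ.+-identityʳ p = chain-cong N p 1 (N + N) b (λ {ρ} _ → sign-cancel (sum ρ) (g ρ))
chain-columnChain N p (suc n) {ls} b g = begin
  chain N p 1 (N + N) (λ ρ → sgn ρ *ℤ removal N (beyond (columns (suc p))) X ρ) ls
    ≡⟨ chain-cong N p 1 (N + N) b (λ {ρ} c → trans (cong (sgn ρ *ℤ_) (removal-cong N (beyond (columns (suc p))) ρ (λ {σ} _ → sym (sign-cancel (sum σ) (X σ))))) (sym (signedWindow-∞ (suc p) (N + N) ≤-refl c (λ σ → sgn σ *ℤ X σ)))) ⟩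
  chain N p 1 (N + N) (signedWindow N (suc p) (N + N) (λ σ → sgn σ *ℤ X σ)) ls
    -- The window enters at level N + N, where it is no restriction inside the box, and leaves at
    -- level 0, where it is the identity.
    ≡⟨ chain-exchange p 0 (N + N) b (λ σ → sgn σ *ℤ X σ) ⟩
  signedWindow N (suc p) 0 (chain N (suc p) 1 (N + N) (λ σ → sgn σ *ℤ X σ)) ls
    ≡⟨ signedWindow-0 (suc p) b _ ⟩
  chain N (suc p) 1 (N + N) (λ σ → sgn σ *ℤ X σ) ls
    ≡⟨ chain-columnChain N (suc p) n b g ⟩
  chain N (suc p + n) 1 (N + N) g ls
    ≡⟨ cong (λ z → chain N z 1 (N + N) g ls) (sym (+-suc p n)) ⟩
  chain N (p + suc n) 1 (N + N) g ls ∎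
  where
  X : List ℕ → ℤ
  X = columnChain N (suc (suc p)) n (λ σ → sgn σ *ℤ g σ)

-- The transpose of `E` as a product of row removals, and the factorisation

rowsFrom : ℕ → (List ℕ → ℤ) → List ℕ → ℤ
rowsFrom zero    g ls       = Dn (nxt ls) ls g
rowsFrom (suc k) g []       = g []
rowsFrom (suc k) g (l ∷ ls) = rowsFrom k (λ ρ → g (l ∷ ρ)) ls

rowChain : ℕ → ℕ → (List ℕ → ℤ) → List ℕ → ℤ
rowChain k zero    g = g
rowChain k (suc n) g = rowsFrom k (rowChain (suc k) n g)

rowChain-∷ : ∀ k n g l ls → rowChain (suc k) n g (l ∷ ls) ≡ rowChain k n (λ ρ → g (l ∷ ρ)) ls
rowChain-∷ k zero    g l ls = refl
rowChain-∷ k (suc n) g l ls = rowsFrom-cong k (λ ρ → rowChain-∷ (suc k) n g l ρ) ls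
  where
  rowsFrom-cong : ∀ k {f g} → (∀ ρ → f ρ ≡ g ρ) → ∀ ls → rowsFrom k f ls ≡ rowsFrom k g ls
  rowsFrom-cong zero    h ls       = respects (Dn-linear (nxt ls) ls) h
  rowsFrom-cong (suc k) h []       = h []
  rowsFrom-cong (suc k) h (l ∷ ls) = rowsFrom-cong k (λ ρ → h (l ∷ ρ)) ls

ET-rowChain : ∀ {L u n ls} → Box L u ls → L ≤ n → ∀ g → ET L g ls ≡ rowChain 1 n g ls
ET-rowChain {n = n} [] q g = empty 0 n
  where
  empty : ∀ k n → g [] ≡ rowChain (suc k) n g []
  empty k zero    = refl
  empty k (suc n) = empty (suc k) n
ET-rowChain {suc L} {n = suc n} {l ∷ ls} (p ∷ b) (s≤s q) g = trans (Dn-bound-nxt b) (Dn-cong (nxt ls) b (λ {ρ} c → trans (ET-rowChain c q (λ τ → g (l ∷ τ))) (sym (rowChain-∷ 1 n g l ρ))))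
  where
  Dn-bound-nxt : ∀ {f} → Box L l ls → Dn l ls f ≡ Dn (nxt ls) ls f
  Dn-bound-nxt c = Dn-bound (Box-bound c ≤-refl) (Box-nxt c) _

Dn-kernel : ∀ {L u ls} r → Box L u ls → ∀ g → Dn r ls g ≡ ΣD L r (λ ρ → when (ker (beyond (λ _ → 0)) ls ρ) (g ρ))
Dn-kernel r [] g = refl
Dn-kernel {suc L} {ls = l ∷ ls} r (p ∷ b) g = begin
  rng 0 (r ⊓ l) (λ q → Dn q ls (λ τ → g (q ∷ τ)))
    ≡⟨ trans (rng-sum< (r ⊓ l) _) (sum<-cong (suc (r ⊓ l)) (λ q _ → Dn-kernel q b (λ τ → g (q ∷ τ)))) ⟩
  sum< (suc (r ⊓ l)) (λ q → ΣD L q (λ ρ → when (ker (beyond (λ _ → 0)) ls ρ) (g (q ∷ ρ))))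
    ≡⟨ sym (sum<-window {r} {0} {r ⊓ l} z≤n (m⊓n≤m r l) _) ⟩
  sum< (suc r) (λ q → when (q ≤ᵇ r ⊓ l) (ΣD L q (λ ρ → when (ker (beyond (λ _ → 0)) ls ρ) (g (q ∷ ρ)))))
    ≡⟨ sum<-cong (suc r) (λ q q< → trans (cong (λ z → when z _) (bool q (≤-pred q<))) (trans (sym (linear-when (ΣD-linear L q) (beyond (λ _ → 0) 0 l q) _))
         (ΣD-cong L q (λ {ρ} _ → when-∧ (beyond (λ _ → 0) 0 l q) (ker (beyond (λ _ → 0)) ls ρ) (g (q ∷ ρ)))))) ⟩
  ΣD (suc L) r (λ ρ → when (ker (beyond (λ _ → 0)) (l ∷ ls) ρ) (g ρ)) ∎
  where
  bool : ∀ q → q ≤ r → (q ≤ᵇ r ⊓ l) ≡ beyond (λ _ → 0) 0 l q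
  bool q q≤r = T⇒≡ (λ t → beyond-≤ (λ _ → 0) 0 z≤n (≤-trans (≤ᵇ-elim q (r ⊓ l) t) (m⊓n≤n r l)))
    (λ t → ≤ᵇ-intro (⊓-glb q≤r (beyond-⊆ (λ _ → 0) 0 l q t)))

-- The threshold `suc N` exceeds every row of the box and so marks a row in which nothing is
-- removable.
rows≥ : ℕ → ℕ → ℕ → ℕ
rows≥ N k i = if k ≤ᵇ i then 0 else suc N

rowsFrom-removal : ∀ {L u N} k {ls} → Box L u ls → u ≤ N → ∀ g → rowsFrom k g ls ≡ ΣD L u (λ ρ → when (ker (beyond (rows≥ N k)) ls ρ) (g ρ))
rowsFrom-removal zero    b q g = trans (sym (Dn-bound (Box-bound b ≤-refl) (Box-nxt b) g)) (Dn-kernel _ b g)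
rowsFrom-removal (suc k) [] q g = refl
rowsFrom-removal {suc L} {u} {N} (suc k) {l ∷ ls} (p ∷ b) q g = begin
  rowsFrom k (λ ρ → g (l ∷ ρ)) ls
    ≡⟨ rowsFrom-removal k b (≤-trans p q) (λ ρ → g (l ∷ ρ)) ⟩
  ΣD L l (λ ρ → when (ker (beyond (rows≥ N k)) ls ρ) (g (l ∷ ρ)))
    ≡⟨ ΣD-cong L l (λ {ρ} c → cong (λ z → when z (g (l ∷ ρ))) (ker-cong (beyond (rows≥ N k)) (beyond (rows≥ N (suc k) ∘ suc)) b c (λ i _ x r _ _ → cong (λ z → (r ≡ᵇ x) ∨ ((z ≤ᵇ r) ∧ (r ≤ᵇ x))) (shift k i)))) ⟩
  ΣD L l (λ ρ → when (ker (beyond (rows≥ N (suc k) ∘ suc)) ls ρ) (g (l ∷ ρ)))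
    ≡⟨ sym (sum<-δ (s≤s p) (λ r → ΣD L r (λ ρ → when (ker (beyond (rows≥ N (suc k) ∘ suc)) ls ρ) (g (r ∷ ρ))))) ⟩
  sum< (suc u) (λ r → when (l ≡ᵇ r) (ΣD L r (λ ρ → when (ker (beyond (rows≥ N (suc k) ∘ suc)) ls ρ) (g (r ∷ ρ)))))
    ≡⟨ sum<-cong (suc u) (λ r r< → trans (cong (λ z → when z _) (bool r (≤-trans (≤-pred r<) q))) (trans (sym (linear-when (ΣD-linear L r) (beyond (rows≥ N (suc k)) 0 l r) _))
         (ΣD-cong L r (λ {ρ} _ → when-∧ (beyond (rows≥ N (suc k)) 0 l r) (ker (beyond (rows≥ N (suc k) ∘ suc)) ls ρ) (g (r ∷ ρ)))))) ⟩
  ΣD (suc L) u (λ ρ → when (ker (beyond (rows≥ N (suc k))) (l ∷ ls) ρ) (g ρ)) ∎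
  where
  shift : ∀ k i → rows≥ N k i ≡ rows≥ N (suc k) (suc i)
  shift zero    i = refl
  shift (suc k) i = refl
  bool : ∀ r → r ≤ N → (l ≡ᵇ r) ≡ beyond (rows≥ N (suc k)) 0 l r
  bool r r≤N = T⇒≡ (λ t → beyond-≡ (rows≥ N (suc k)) 0 (sym (≡ᵇ-elim l r t))) (λ t → ≡ᵇ-intro (back (beyond-elim (rows≥ N (suc k)) 0 l r t)))
    where
    back : (r ≡ l) ⊎ ((suc N ≤ r) × (r ≤ l)) → l ≡ r
    back (inj₁ e) = sym e
    back (inj₂ (x , _)) = ⊥-elim (<⇒≱ x r≤N)

-- For p = N the bound i + (j ∸ p) is i throughout the box, which is the bound on the labels i + 1 -
-- m of an elegant filling. The levels from N on remove nothing, whence the freedom in `n`.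
ET-chain : ∀ {N n ls} → Box N N ls → N ≤ n → ∀ g → ET N g ls ≡ chain N N 1 n g ls
ET-chain {N} {n} b q g = trans (ET-rowChain b q g) (go 1 n b)
  where
  go : ∀ k n {ls} → Box N N ls → rowChain k n g ls ≡ chain N N k n g ls
  go k zero    b = refl
  go k (suc n) {ls} b = trans (rowsFrom-removal k b ≤-refl _) (trans
    (removal-kernel-cong (beyond (rows≥ N k)) (beyond (threshold N k)) b (λ i _ l r l≤ r≤ → same i l r l≤ r≤) _)
    (removal-cong N (beyond (threshold N k)) ls (go (suc k) n)))
    where
    same : ∀ i l r → l ≤ N → r ≤ N → beyond (rows≥ N k) i l r ≡ beyond (threshold N k) i l r
    same i l r l≤ r≤ with ≤-<-connex k i
    ... | inj₁ p rewrite ≤ᵇ-true p = refl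
    ... | inj₂ p rewrite ≤ᵇ-false p = cong (λ z → (r ≡ᵇ l) ∨ (z ∧ (r ≤ᵇ l))) (trans (≤ᵇ-false (s≤s r≤)) (sym (≤ᵇ-false (≤-<-trans r≤ (m<m+n N (ℕ.m<n⇒0<n∸m p))))))

-- Conjugation turns removal from the columns ≥ k into removal from the rows ≥ k, and the product of
-- the latter is `ET`.
columnChain-ET : ∀ {N ls} → Box N N ls → ∀ g → columnChain N 1 N g ls ≡ ET N (λ ρ → g (τ N ρ)) (τ N ls)
columnChain-ET {N} b g = trans (go 1 N b) (sym (ET-rowChain (Box-τ b) ≤-refl _))
  where
  rows-columns : ∀ k {i j} → i < N → j < N → (j < columns k i → i < rows≥ N k j) × (i < rows≥ N k j → j < columns k i)
  rows-columns k {i} {j} i< j< with ≤-<-connex k j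
  ... | inj₁ p rewrite ≤ᵇ-true p = (λ q → ⊥-elim (<⇒≱ q p)) , (λ ())
  ... | inj₂ p rewrite ≤ᵇ-false p = (λ _ → m<n⇒m<1+n i<) , (λ _ → p)
  go : ∀ k n {ls} → Box N N ls → columnChain N k n g ls ≡ rowChain k n (λ ρ → g (τ N ρ)) (τ N ls)
  go k zero    b = cong g (sym (τ-involutive b))
  go k (suc n) {ls} b = trans (removal-τ (columns k) (rows≥ N k) (rows-columns k) b _)
    (trans (removal-cong N (beyond (rows≥ N k)) (τ N ls) (λ c → trans (go (suc k) n (Box-τ c)) (cong (rowChain (suc k) n _) (τ-involutive c))))
      (sym (rowsFrom-removal k (Box-τ b) ≤-refl _)))

-- The transposed count R; i + j < N + N for every cell of the box, so no label exceeds the last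
-- level.
RT : ℕ → (List ℕ → ℤ) → List ℕ → ℤ
RT N = chain N 0 1 (N + N)

-- `chain-columnChain` from p = 0 to p = N, its two ends read as R and E^t and its column factors as
-- E^{ct}. Conjugation preserves the size, so the signs may be taken before or after it.
ET-factorisation : ∀ {N ls} → Box N N ls → ∀ g →
  RT N (λ ρ → sgn ρ *ℤ ET N (λ σ → sgn σ *ℤ g (τ N σ)) (τ N ρ)) ls ≡ ET N g ls
ET-factorisation {N} b g = trans
  (chain-cong N 0 1 (N + N) b (λ {ρ} c → cong (sgn ρ *ℤ_) (trans (ET-cong (Box-τ c) (λ {σ} d → cong (λ z → sign z *ℤ g (τ N σ)) (sym (sum-τ d)))) (sym (columnChain-ET c (λ σ → sgn σ *ℤ g σ))))))
  (trans (chain-columnChain N 0 N b g) (sym (ET-chain b (m≤m+n N N) g)))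

-- The bound i + j is symmetric in the two coordinates, level by level.
RT-τ : ∀ {N ls} → Box N N ls → ∀ g → RT N g ls ≡ RT N (λ ρ → g (τ N ρ)) (τ N ls)
RT-τ {N} b g = go 1 (N + N) b
  where
  thr : ∀ k i → threshold 0 k i ≡ k ∸ i
  thr k i with ≤-<-connex k i
  ... | inj₁ p rewrite ≤ᵇ-true p = sym (m≤n⇒m∸n≡0 p)
  ... | inj₂ p rewrite ≤ᵇ-false p = refl
  inside : ∀ k i {j} → j < k ∸ i → i < k
  inside k i q with ≤-<-connex k i
  ... | inj₁ p = ⊥-elim (<⇒≱ q (≤-trans (≤-reflexive (m≤n⇒m∸n≡0 p)) z≤n))
  ... | inj₂ p = p
  half : ∀ k i j → j < threshold 0 k i → i < threshold 0 k j
  half k i j q rewrite thr k i | thr k j = m+n≤o⇒m≤o∸n (suc i) (≤-trans (≤-reflexive (trans (cong suc (ℕ.+-comm i j)) refl)) (m≤o∸n⇒m+n≤o (suc j) (<⇒≤ (inside k i q)) q))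
  go : ∀ k n {ls} → Box N N ls → chain N 0 k n g ls ≡ chain N 0 k n (λ ρ → g (τ N ρ)) (τ N ls)
  go k zero    b = cong g (sym (τ-involutive b))
  go k (suc n) {ls} b = trans (removal-τ (threshold 0 k) (threshold 0 k) (λ {i} {j} _ _ → half k i j , half k j i) b _)
    (removal-cong N (beyond (threshold 0 k)) (τ N ls) (λ c → trans (go (suc k) n (Box-τ c)) (cong (chain N 0 (suc k) n _) (τ-involutive c))))

-- Adjointness and injectivity of `E`

rng-split : ∀ n d F → rng n d F ≡ sum< (suc d) (λ i → F (n + i))
rng-split n zero    F = sym (trans (ℤ.+-identityˡ _) (cong F (ℕ.+-identityʳ n)))
rng-split n (suc d) F = cong (_+ℤ F (n + suc d)) (rng-split n d F)

rng-window : ∀ {q t} → q ≤ t → ∀ F → rng q (t ∸ q) F ≡ sum< (suc t) (λ l → when (q ≤ᵇ l) (F l))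
rng-window {q} {t} p F = trans (rng-split q (t ∸ q) F) (trans (sym (sum<-window p ≤-refl F))
  (sum<-cong (suc t) (λ l l< → cong (λ z → when z (F l)) (trans (cong ((q ≤ᵇ l) ∧_) (≤ᵇ-true (≤-pred l<))) (∧-identityʳ (q ≤ᵇ l))))))

rng-head : ∀ {q t} → q < t → ∀ F → rng q (t ∸ q) F ≡ F q +ℤ rng (suc q) (t ∸ suc q) F
rng-head {q} {t} p F = begin
  rng q (t ∸ q) F
    ≡⟨ cong (λ z → rng q z F) (trans (cong (_∸ q) (sym (m+[n∸m]≡n p))) (trans (cong (λ z → z ∸ q) (sym (+-suc q (t ∸ suc q)))) (m+n∸m≡n q _))) ⟩
  rng q (suc (t ∸ suc q)) F
    ≡⟨ trans (rng-split q (suc (t ∸ suc q)) F) (sum<-head (suc (t ∸ suc q)) (λ i → F (q + i))) ⟩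
  F (q + 0) +ℤ sum< (suc (t ∸ suc q)) (λ i → F (q + suc i))
    ≡⟨ cong₂ _+ℤ_ (cong F (ℕ.+-identityʳ q)) (trans (sum<-cong (suc (t ∸ suc q)) (λ i _ → cong F (+-suc q i))) (sym (rng-split (suc q) (t ∸ suc q) F))) ⟩
  F q +ℤ rng (suc q) (t ∸ suc q) F ∎
 

Dn-adjoint : ∀ L {r t} → r ≤ t → ∀ g f → ΣD L t (λ ls → Dn r ls g *ℤ f ls) ≡ ΣD L r (λ ρ → g ρ *ℤ U ρ t f)
Dn-adjoint zero    p g f = refl
Dn-adjoint (suc L) {r} {t} p g f = begin
  sum< (suc t) (λ l → ΣD L l (λ ls → rng 0 (r ⊓ l) (λ q → Dn q ls (λ τ → g (q ∷ τ))) *ℤ f (l ∷ ls)))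
    ≡⟨ sum<-cong (suc t) (λ l _ → trans (ΣD-cong L l (λ {ls} _ → linear-rng′ (f (l ∷ ls)) (λ q → Dn q ls (λ τ → g (q ∷ τ))) (r ⊓ l)))
         (trans (linear-sum< (ΣD-linear L l) _ (suc (r ⊓ l))) (sum<-cong (suc (r ⊓ l)) (λ q q< → Dn-adjoint L (≤-trans (≤-pred q<) (m⊓n≤n r l)) (λ τ → g (q ∷ τ)) (λ τ → f (l ∷ τ)))))) ⟩
  sum< (suc t) (λ l → sum< (suc (r ⊓ l)) (λ q → Z q l))
    ≡⟨ sum<-cong (suc t) (λ l _ → trans (sym (sum<-window {r} {0} {r ⊓ l} z≤n (m⊓n≤m r l) (λ q → Z q l))) (sum<-cong (suc r) (λ q q< → cong (λ z → when z (Z q l)) (bool q l (≤-pred q<))))) ⟩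
  sum< (suc t) (λ l → sum< (suc r) (λ q → when (q ≤ᵇ l) (Z q l)))
    ≡⟨ sum<-swap (suc t) (suc r) _ ⟩
  sum< (suc r) (λ q → sum< (suc t) (λ l → when (q ≤ᵇ l) (Z q l)))
    ≡⟨ sum<-cong (suc r) (λ q q< → sym (rng-window (≤-trans (≤-pred q<) p) (Z q))) ⟩
  sum< (suc r) (λ q → rng q (t ∸ q) (Z q))
    ≡⟨ sum<-cong (suc r) (λ q _ → sym (trans (ΣD-cong L q (λ {ρ} _ → linear-rng (linear-*′ (g (q ∷ ρ))) (λ l _ → U ρ l (λ τ → f (l ∷ τ))) q (t ∸ q))) (linear-rng (ΣD-linear L q) (λ l ρ → g (q ∷ ρ) *ℤ U ρ l (λ τ → f (l ∷ τ))) q (t ∸ q)))) ⟩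
  sum< (suc r) (λ q → ΣD L q (λ ρ → g (q ∷ ρ) *ℤ rng q (t ∸ q) (λ l → U ρ l (λ τ → f (l ∷ τ))))) ∎
  where
  Z : ℕ → ℕ → ℤ
  Z q l = ΣD L q (λ ρ → g (q ∷ ρ) *ℤ U ρ l (λ τ → f (l ∷ τ)))
  linear-*′ : ∀ c → Linear {⊤} (λ h → c *ℤ h tt)
  linear-*′ c = linear-* c (linear-eval tt)
  linear-rng′ : ∀ c F n → rng 0 n F *ℤ c ≡ sum< (suc n) (λ q → F q *ℤ c)
  linear-rng′ c F n = trans (ℤ.*-comm _ c) (trans (linear-rng (linear-*′ c) (λ q _ → F q) 0 n) (trans (rng-sum< n _) (sum<-cong (suc n) (λ q _ → ℤ.*-comm c (F q)))))
  bool : ∀ q l → q ≤ r → (q ≤ᵇ r ⊓ l) ≡ (q ≤ᵇ l)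
  bool q l q≤r = T⇒≡ (λ x → ≤ᵇ-intro (≤-trans (≤ᵇ-elim q (r ⊓ l) x) (m⊓n≤n r l))) (λ x → ≤ᵇ-intro (⊓-glb q≤r (≤ᵇ-elim q l x)))

ET-adjoint : ∀ L u g f → ΣD L u (λ ls → ET L g ls *ℤ f ls) ≡ ΣD L u (λ ν → g ν *ℤ E f ν)
ET-adjoint zero    u g f = refl
ET-adjoint (suc L) u g f = sum<-cong (suc u) (λ l _ → trans
  (Dn-adjoint L (≤-refl {l}) (ET L (λ τ → g (l ∷ τ))) (λ τ → f (l ∷ τ)))
  (ET-adjoint L l (λ τ → g (l ∷ τ)) (λ ρ → U ρ l (λ τ → f (l ∷ τ)))))

δ : List ℕ → List ℕ → ℤ
δ ν ρ = when (eqList ν ρ) (+ 1)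

ΣD-δ* : ∀ {L u w} → Box L u w → ∀ f → ΣD L u (λ ρ → δ w ρ *ℤ f ρ) ≡ f w
ΣD-δ* {L} {u} {w} b f = trans (ΣD-cong L u (λ {ρ} _ → unit (eqList w ρ) (f ρ))) (ΣD-δ b f)
  where
  unit : ∀ b x → when b (+ 1) *ℤ x ≡ when b x
  unit true  x = ℤ.*-identityˡ x
  unit false x = refl

E-expand : ∀ {N ν} → Box N N ν → ∀ f → E f ν ≡ ΣD N N (λ ls → ET N (δ ν) ls *ℤ f ls)
E-expand {N} {ν} b f = sym (trans (ET-adjoint N N (δ ν) f) (ΣD-δ* b (E f)))

-- Unitriangularity through differences: the values of `U` at r ∷ ρ and at (r + 1) ∷ ρ differ by the
-- terms whose first row is exactly r, which isolates one row after another.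
U-injective : ∀ L {l f} → (∀ {ρ} → Box L l ρ → U ρ l f ≡ + 0) → ∀ {ls} → Box L l ls → f ls ≡ + 0
U-injective zero    h [] = h []
U-injective (suc L) {l} {f} h {r ∷ ls} (p ∷ b) = U-injective L (λ c → diagonal c (m≤n⇒m<n∨m≡n p)) b
  where
  diagonal : ∀ {ρ} → Box L r ρ → (r < l) ⊎ (r ≡ l) → U ρ r (λ τ → f (r ∷ τ)) ≡ + 0
  diagonal {ρ} c (inj₂ refl) = trans (cong (λ z → rng r z (λ t → U ρ t (λ τ → f (t ∷ τ)))) (sym (n∸n≡0 r))) (h (p ∷ c))
  diagonal {ρ} c (inj₁ q) = trans (sym (trans (cong (U ρ r (λ τ → f (r ∷ τ)) +ℤ_) (h (q ∷ Box-weaken c (n≤1+n r)))) (ℤ.+-identityʳ _)))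
    (trans (sym (rng-head q (λ t → U ρ t (λ τ → f (t ∷ τ))))) (h (p ∷ c)))

E-injective : ∀ L {u f} → (∀ {ν} → Box L u ν → E f ν ≡ + 0) → ∀ {ls} → Box L u ls → f ls ≡ + 0
E-injective zero    h [] = h []
E-injective (suc L) {u} {f} h {l ∷ ls} (p ∷ b) = U-injective L (λ c → E-injective L (λ d → h (p ∷ d)) c) b

-- Iterated transfer operators of G and of j

Ac : ℕ → (List ℕ → ℤ) → List ℕ → ℤ
Ac m g ls = op true (λ ρ e → when (e ≡ᵇ m) (g ρ)) ls 0

AA : List ℕ → (List ℕ → ℤ) → List ℕ → ℤ
AA []       g = g
AA (a ∷ as) g = AA as (Ac a g)

op-vanishes : ∀ b k {f} → VanishesBelow k f → VanishesBelow (suc k) (op b f)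
op-vanishes b k {f} v (l ∷ ls) e p = trans
  (cs-cong (nxt ls) (l ∸ nxt ls) {G = λ _ _ → + 0} (λ r q _ e → trans (mk-cong b (nxt ls) r {ψ = λ _ → + 0} (λ e → row k ls v p r q e) e) (mk-zero b (nxt ls) r e)) e)
  (linear-zero (cs-linear {A = ℕ} (λ _ _ → linear-0) (nxt ls) (l ∸ nxt ls) e))
  where
  mk-zero : ∀ b n r e → mk b n r (λ _ → + 0) e ≡ + 0
  mk-zero b n r e with b ∧ (n <ᵇ r)
  ... | true  = refl
  ... | false = refl
  row : ∀ k ls → VanishesBelow k f → 0 < at ls k → ∀ r → nxt ls ≤ r → ∀ e → op b (λ ρ → f (r ∷ ρ)) ls e ≡ + 0
  row zero (n ∷ ls) v p r q e = trans (respects (op-linear b (n ∷ ls) e) (λ (ρ , e) → v (r ∷ ρ) e (<-≤-trans p q))) (linear-zero (op-linear b (n ∷ ls) e))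
  row (suc k) ls v p r q e = op-vanishes b k (λ ρ → v (r ∷ ρ)) ls e p

-- `t` bounds the number of rows in the support of `g`, and each letter raises it by at most one
-- (`op-vanishes`). The support condition of `E-op` requires the last of the N rows to be still
-- empty before a letter is read, hence the bound on t + `length as`.
E-AA : ∀ as t {N} g → (∀ k → t ≤ k → VanishesBelow k (λ ρ _ → g ρ)) → t + length as ≤ N → ∀ {u ν} → Box N u ν → E (AA as g) ν ≡ HH as (E g) ν
E-AA []       t         g v p       b = refl
E-AA (a ∷ as) t {zero}  g v p       b = ⊥-elim (n≮0 (≤-trans (≤-reflexive (sym (+-suc t (length as)))) p))
E-AA (a ∷ as) t {suc N} g v p {u} {ν} b = trans
  (E-AA as (suc t) (Ac a g) (λ { (suc k) (s≤s q) ρ _ z → op-vanishes true k (λ σ e z → trans (cong (when (e ≡ᵇ a)) (v k q σ 0 z)) (when-0 (e ≡ᵇ a))) ρ 0 z }) (≤-trans (≤-reflexive (sym (+-suc t (length as)))) p) b)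
  (HH-cong as b (λ {ρ} c → trans (E-op c {λ ρ e → when (e ≡ᵇ a) (g ρ)} (λ σ e z → trans (cong (when (e ≡ᵇ a)) (v N t≤N σ 0 z)) (when-0 (e ≡ᵇ a))) 0)
    (respects (op-linear false ρ 0) (λ (σ , e) → linear-when (E-linear σ) (e ≡ᵇ a) g))))
  where
  t≤N : t ≤ N
  t≤N = ≤-pred (≤-trans (s≤s (m≤m+n t (length as))) (≤-trans (≤-reflexive (sym (+-suc t (length as)))) p))

δ∅-vanishes : ∀ k → VanishesBelow k (λ ρ _ → δ∅ ρ)
δ∅-vanishes k ρ _ p = positive (sum ρ) (<-≤-trans p (at-sum k ρ))
  where
  at-sum : ∀ k ρ → at ρ k ≤ sum ρ
  at-sum k       []      = z≤n
  at-sum zero    (r ∷ ρ) = m≤m+n r (sum ρ)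
  at-sum (suc k) (r ∷ ρ) = ≤-trans (at-sum k ρ) (m≤n+m (sum ρ) r)
  positive : ∀ n → 0 < n → when (n ≡ᵇ 0) (+ 1) ≡ + 0
  positive (suc n) _ = refl

E-δ∅ : ∀ {L u ν} → Box L u ν → E δ∅ ν ≡ δ∅ ν
E-δ∅ [] = refl
E-δ∅ {ν = zero ∷ ν} (p ∷ b) = trans (E-cong b U-δ∅) (E-δ∅ b)
  where
  U-δ∅ : ∀ {L ρ} → Box L 0 ρ → U ρ 0 δ∅ ≡ δ∅ ρ
  U-δ∅ []         = refl
  U-δ∅ (z≤n ∷ b) = U-δ∅ b
E-δ∅ {ν = suc l ∷ ν} (p ∷ b) = trans (respects (E-linear ν) (λ ρ → linear-zero (U-linear ρ (suc l)))) (linear-zero (E-linear ν))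

grothendieck : List ℕ → List ℕ → ℤ
grothendieck a = AA a δ∅

E-grothendieck : ∀ a {N u ν} → length a ≤ N → Box N u ν → E (grothendieck a) ν ≡ schur a ν
E-grothendieck a p b = trans (E-AA a 0 δ∅ (λ k _ → δ∅-vanishes k) p b) (HH-cong a b E-δ∅)

Bc : ℕ → ℕ → (List ℕ → ℤ) → List ℕ → ℤ
Bc N m g ls = transferB N (λ ρ e → when (e ≡ᵇ m) (g ρ)) ls 0

BB : ℕ → List ℕ → (List ℕ → ℤ) → List ℕ → ℤ
BB N []       g = g
BB N (a ∷ as) g = BB N as (Bc N a g)

tr-cong : ∀ m g u {L ls} → Box L (suc u) ls → ∀ {f h} → (∀ {ρ} → Box L u ρ → ∀ e → f ρ e ≡ h ρ e) → ∀ e → tr m g u f ls e ≡ tr m g u h ls e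
tr-cong m g u [] x e = x [] e
tr-cong m g u {ls = l ∷ ls} (p ∷ b) {f} {h} x e with m≤n⇒m<n∨m≡n p
... | inj₁ (s≤s q) = trans (tr-free m g ls f e q) (trans (cong₂ (λ y z → y +ℤ m *ℤ z)
    (tr-cong m g l (Box-weaken b (n≤1+n l)) (λ c → x (q ∷ c)) e) (pre-cong l (λ { k refl → tr-cong m g k b (λ c → x (≤-trans (n≤1+n k) q ∷ c)) (suc e) })))
  (sym (tr-free m g ls h e q)))
... | inj₂ refl = trans (tr-forced m g u ls f e) (trans (cong₂ (λ y z → m *ℤ y +ℤ g *ℤ z)
    (tr-cong m g u b (λ c → x (≤-refl ∷ c)) (suc e)) (tr-cong m g u b (λ c → x (≤-refl ∷ c)) e))
  (sym (tr-forced m g u ls h e)))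

Bc-cong : ∀ {N ls} → Box N N ls → ∀ m {f g} → (∀ {ρ} → Box N N ρ → f ρ ≡ g ρ) → Bc N m f ls ≡ Bc N m g ls
Bc-cong {N} b m h = tr-cong (+ 1) (+ 1) N (Box-weaken b (n≤1+n N)) (λ c e → cong (when (e ≡ᵇ m)) (h c)) 0

BB-cong : ∀ {N} as {ls} → Box N N ls → ∀ {f g} → (∀ {ρ} → Box N N ρ → f ρ ≡ g ρ) → BB N as f ls ≡ BB N as g ls
BB-cong []       b h = h b
BB-cong (a ∷ as) b h = BB-cong as b (λ c → Bc-cong c a h)

BB-ET : ∀ {N} as g {ls} → Box N N ls → BB N as (ET N g) ls ≡ ET N (VV N as g) ls
BB-ET []           g b = refl
BB-ET {N} (a ∷ as) g b = trans
  (BB-cong as b (λ {ρ} c → sym (trans (ET-transferV c (λ σ e → when (e ≡ᵇ a) (g σ)) 0) (respects (tr-linear (+ 1) (+ 1) N ρ 0) (λ (σ , e) → linear-when (ET-linear N σ) (e ≡ᵇ a) g)))))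
  (BB-ET as (Vc N a g) b)

ET-δ∅ : ∀ {L u ls} → Box L u ls → ET L δ∅ ls ≡ δ∅ ls
ET-δ∅ [] = refl
ET-δ∅ {suc L} {ls = zero ∷ ls} (p ∷ b) = trans (Dn-cong 0 b (λ c → ET-δ∅ c)) (Dn-0 b)
  where
  Dn-0 : ∀ {L ls} → Box L 0 ls → Dn 0 ls δ∅ ≡ δ∅ ls
  Dn-0 []        = refl
  Dn-0 (z≤n ∷ b) = Dn-0 b
ET-δ∅ {suc L} {ls = suc l ∷ ls} (p ∷ b) = trans (respects (Dn-linear (suc l) ls) (λ τ → linear-zero (ET-linear L τ))) (linear-zero (Dn-linear (suc l) ls))

dualGrothendieck : ℕ → List ℕ → List ℕ → ℤ
dualGrothendieck N a = BB N a δ∅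

dualGrothendieck-ET : ∀ {N} a {ls} → Box N N ls → dualGrothendieck N a ls ≡ ET N (VV N a δ∅) ls
dualGrothendieck-ET {N} a b = trans (BB-cong a b (λ c → sym (ET-δ∅ c))) (BB-ET a δ∅ b)

-- Fillings of diagrams

atM : {V : Set} → Maybe V → (V → Bool) → Bool
atM (just v) p = p v
atM nothing  p = true

atCell-atM : {V : Set} (f : List (Cell × V)) (c : Cell) (p : V → Bool) → atCell f c p ≡ atM (lookupCell c f) p
atCell-atM f c p with lookupCell c f
... | just v  = refl
... | nothing = refl

rowAt : {V : Set} → ℕ → List V → ℕ → Maybe V
rowAt zero    []      j       = nothing
rowAt zero    (v ∷ w) zero    = just v
rowAt zero    (v ∷ w) (suc j) = rowAt zero w j
rowAt (suc o) w       zero    = nothing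
rowAt (suc o) w       (suc j) = rowAt o w j

rowAt-+ : {V : Set} (o : ℕ) (w : List V) (c : ℕ) → rowAt o w (o + c) ≡ rowAt 0 w c
rowAt-+ zero    w c = refl
rowAt-+ (suc o) w c = rowAt-+ o w c

-- A filling given by rows; each row starts at a column offset.
Rows : Set → Set
Rows V = List (ℕ × List V)

flatRow : {V : Set} → ℕ → ℕ → List V → List (Cell × V)
flatRow i j []      = []
flatRow i j (v ∷ w) = ((i , j) , v) ∷ flatRow i (suc j) w

flatten : {V : Set} → ℕ → Rows V → List (Cell × V)
flatten i []             = []
flatten i ((o , w) ∷ rs) = flatRow i o w ++ flatten (suc i) rs

cellAt : {V : Set} → Rows V → ℕ → ℕ → Maybe V
cellAt []             d       j = nothing
cellAt ((o , w) ∷ rs) zero    j = rowAt o w j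
cellAt ((o , w) ∷ rs) (suc d) j = cellAt rs d j

module _ {V : Set} where

  eqCell-false-row : ∀ {i k} j l → i ≢ k → eqCell (i , j) (k , l) ≡ false
  eqCell-false-row {i} {k} j l ne rewrite ≡ᵇ-false {i} {k} ne = refl

  lookup-other-row : ∀ {i k} j o (w : List V) rest → i ≢ k → lookupCell (i , j) (flatRow k o w ++ rest) ≡ lookupCell (i , j) rest
  lookup-other-row         j o []      rest ne = refl
  lookup-other-row {i} {k} j o (v ∷ w) rest ne rewrite eqCell-false-row {i} {k} j o ne = lookup-other-row j (suc o) w rest ne

  lookup-below : ∀ {i k} j (rs : Rows V) → i < k → lookupCell (i , j) (flatten k rs) ≡ nothing
  lookup-below j []             p = refl
  lookup-below j ((o , w) ∷ rs) p = trans (lookup-other-row j o w _ (<⇒≢ p)) (lookup-below j rs (m<n⇒m<1+n p))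

  lookup-row : ∀ i o (w : List V) rest j → (∀ j → lookupCell (i , j) rest ≡ nothing) → lookupCell (i , j) (flatRow i o w ++ rest) ≡ rowAt o w j
  lookup-row i o []      rest j h = trans (h j) (sym (empty o j))
    where
    empty : ∀ o j → rowAt {V} o [] j ≡ nothing
    empty zero    j       = refl
    empty (suc o) zero    = refl
    empty (suc o) (suc j) = empty o j
  lookup-row i o (v ∷ w) rest j h rewrite ≡ᵇ-refl i with <-cmp j o
  ... | tri< p _ _ rewrite ≡ᵇ-false (<⇒≢ p) = trans (lookup-row i (suc o) w rest j h) (before j o p)
    where
    before : ∀ j o → j < o → rowAt (suc o) w j ≡ rowAt o (v ∷ w) j
    before zero    (suc o) p       = refl
    before (suc j) (suc o) (s≤s p) = before j o p
  ... | tri≈ _ refl _ rewrite ≡ᵇ-refl j = sym (trans (cong (rowAt j (v ∷ w)) (sym (ℕ.+-identityʳ j))) (rowAt-+ j (v ∷ w) 0))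
  ... | tri> _ _ p rewrite ≡ᵇ-false (>⇒≢ p) = trans (lookup-row i (suc o) w rest j h) (after o j p)
    where
    after : ∀ o j → o < j → rowAt (suc o) w j ≡ rowAt o (v ∷ w) j
    after zero    (suc j) p       = refl
    after (suc o) (suc j) (s≤s p) = after o j p

  lookup-flatten : ∀ i (rs : Rows V) d j → lookupCell (i + d , j) (flatten i rs) ≡ cellAt rs d j
  lookup-flatten i []             d    j = refl
  lookup-flatten i ((o , w) ∷ rs) zero j rewrite ℕ.+-identityʳ i = lookup-row i o w (flatten (suc i) rs) j (λ j → lookup-below j rs ≤-refl)
  lookup-flatten i ((o , w) ∷ rs) (suc d) j = trans (lookup-other-row j o w _ (λ e → <⇒≢ (m<m+n i (s≤s z≤n)) (sym e)))
    (trans (cong (λ z → lookupCell (z , j) (flatten (suc i) rs)) (+-suc i d)) (lookup-flatten (suc i) rs d j))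

all-++ : {A : Set} (p : A → Bool) (xs ys : List A) → all p (xs ++ ys) ≡ all p xs ∧ all p ys
all-++ p []       ys = refl
all-++ p (x ∷ xs) ys = trans (cong (p x ∧_) (all-++ p xs ys)) (sym (∧-assoc (p x) (all p xs) (all p ys)))

all-cong : {A : Set} {p q : A → Bool} → (∀ x → p x ≡ q x) → ∀ xs → all p xs ≡ all q xs
all-cong h []       = refl
all-cong h (x ∷ xs) = cong₂ _∧_ (h x) (all-cong h xs)

head? : {V : Set} → List V → Maybe V
head? []      = nothing
head? (v ∷ _) = just v

-- The local conditions shared by the three kinds of fillings: `right` and `down` compare
-- neighbours, and `own` sees the position and the cell above. In the top row `i ∸ 1` is the row
-- itself, so the look-up returns an entry of that row where nothing lies above; `own-top` makes row
-- 0 blind to it.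
module Check {V : Set} (right down : V → V → Bool) (own : ℕ → ℕ → Maybe V → V → Bool) (own-top : ∀ j m v → own 0 j m v ≡ own 0 j nothing v) where

  ok : List (Cell × V) → Cell × V → Bool
  ok f ((i , j) , v) = atCell f (i , suc j) (right v) ∧ (atCell f (suc i , j) (down v) ∧ own i j (lookupCell (i ∸ 1 , j) f) v)

  checkRow : ℕ → ℕ → List V → (ℕ → Maybe V) → (ℕ → Maybe V) → Bool
  checkRow i j []      above below = true
  checkRow i j (v ∷ w) above below = (atM (head? w) (right v) ∧ (atM (below j) (down v) ∧ own i j (above j) v)) ∧ checkRow i (suc j) w above below

  check : ℕ → (ℕ → Maybe V) → Rows V → Bool
  check i above []             = true
  check i above ((o , w) ∷ rs) = checkRow i o w above (cellAt rs 0) ∧ check (suc i) (rowAt o w) rs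

  all-ok-row : ∀ f i j w above below → (∀ c → lookupCell (i , j + c) f ≡ rowAt 0 w c) → (∀ c → lookupCell (suc i , c) f ≡ below c) →
    (∀ c v → own i c (lookupCell (i ∸ 1 , c) f) v ≡ own i c (above c) v) → all (ok f) (flatRow i j w) ≡ checkRow i j w above below
  all-ok-row f i j []      above below h₁ h₂ h₃ = refl
  all-ok-row f i j (v ∷ w) above below h₁ h₂ h₃ = cong₂ _∧_
    (cong₂ _∧_ (trans (atCell-atM f (i , suc j) (right v)) (cong (λ z → atM z (right v)) next)) (cong₂ _∧_ (trans (atCell-atM f (suc i , j) (down v)) (cong (λ z → atM z (down v)) (h₂ j))) (h₃ j v)))
    (all-ok-row f i (suc j) w above below (λ c → trans (cong (λ z → lookupCell (i , z) f) (sym (+-suc j c))) (h₁ (suc c))) h₂ h₃)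
    where
    rowAt-head : ∀ w → rowAt 0 w 0 ≡ head? w
    rowAt-head []      = refl
    rowAt-head (_ ∷ _) = refl
    next : lookupCell (i , suc j) f ≡ head? w
    next = trans (cong (λ z → lookupCell (i , z) f) (ℕ.+-comm 1 j)) (trans (h₁ 1) (rowAt-head w))

  all-ok-rows : ∀ f i above rs → (∀ d c → lookupCell (i + d , c) f ≡ cellAt rs d c) →
    (∀ c v → own i c (lookupCell (i ∸ 1 , c) f) v ≡ own i c (above c) v) → all (ok f) (flatten i rs) ≡ check i above rs
  all-ok-rows f i above []             h h₃ = refl
  all-ok-rows f i above ((o , w) ∷ rs) h h₃ = trans (all-++ (ok f) (flatRow i o w) _) (cong₂ _∧_
    (all-ok-row f i o w above (cellAt rs 0) (λ c → trans (this (o + c)) (rowAt-+ o w c))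
      (λ c → trans (cong (λ z → lookupCell (z , c) f) (ℕ.+-comm 1 i)) (h 1 c)) h₃)
    (all-ok-rows f (suc i) (rowAt o w) rs (λ d c → trans (cong (λ z → lookupCell (z , c) f) (sym (+-suc i d))) (h (suc d) c)) (λ c v → cong (λ z → own (suc i) c z v) (this c))))
    where
    this : ∀ c → lookupCell (i , c) f ≡ rowAt o w c
    this c = trans (cong (λ z → lookupCell (z , c) f) (sym (ℕ.+-identityʳ i))) (h 0 c)

  all-ok : ∀ rs → all (ok (flatten 0 rs)) (flatten 0 rs) ≡ check 0 (λ _ → nothing) rs
  all-ok rs = all-ok-rows (flatten 0 rs) 0 (λ _ → nothing) rs (lookup-flatten 0 rs) (λ c v → own-top c _ v)

sumW : {V : Set} → ℕ → List V → (List V → ℤ) → ℤ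
sumW zero    vs F = F []
sumW (suc l) vs F = ∑ vs (λ v → sumW l vs (λ w → F (v ∷ w)))

sumT : {V : Set} → List ℕ → List V → (List (List V) → ℤ) → ℤ
sumT []       vs F = F []
sumT (l ∷ ls) vs F = sumW l vs (λ w → sumT ls vs (λ t → F (w ∷ t)))

rowCells : ℕ → ℕ → ℕ → List Cell
rowCells i j zero    = []
rowCells i j (suc l) = (i , j) ∷ rowCells i (suc j) l

cellsFrom : ℕ → List ℕ → List ℕ → List Cell
cellsFrom i os       []       = []
cellsFrom i []       (l ∷ ls) = rowCells i 0 l ++ cellsFrom (suc i) [] ls
cellsFrom i (o ∷ os) (l ∷ ls) = rowCells i o l ++ cellsFrom (suc i) os ls

offsets : {V : Set} → List ℕ → List (List V) → Rows V
offsets os       []      = []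
offsets []       (w ∷ t) = (0 , w) ∷ offsets [] t
offsets (o ∷ os) (w ∷ t) = (o , w) ∷ offsets os t

module _ {V : Set} (vs : List V) where

  sumW-linear : ∀ l → Linear (sumW l vs)
  sumW-linear zero    = linear-eval []
  sumW-linear (suc l) = ∑-linear vs (λ v → linear-precomp (v ∷_) (sumW-linear l))

  sumT-linear : ∀ ls → Linear (sumT ls vs)
  sumT-linear []       = linear-eval []
  sumT-linear (l ∷ ls) = linear-∘ (sumW-linear l) (λ w → linear-precomp (w ∷_) (sumT-linear ls))

  linear-sumW : {A : Set} {Φ : (A → ℤ) → ℤ} → Linear Φ → ∀ l (F : List V → A → ℤ) → Φ (λ x → sumW l vs (λ w → F w x)) ≡ sumW l vs (λ w → Φ (F w))
  linear-sumW p zero    F = refl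
  linear-sumW p (suc l) F = trans (linear-∑ p vs _) (∑-cong vs (λ v → linear-sumW p l (λ w → F (v ∷ w))))

  ∑-assignments-∷ : {X : Set} (x : X) (xs : List X) (F : List (X × V) → ℤ) → ∑ (assignments (x ∷ xs) vs) F ≡ ∑ vs (λ v → ∑ (assignments xs vs) (λ f → F ((x , v) ∷ f)))
  ∑-assignments-∷ x xs F = trans (∑-concatMap (λ v → map ((x , v) ∷_) (assignments xs vs)) vs F) (∑-cong vs (λ v → ∑-map ((x , v) ∷_) (assignments xs vs) F))

  ∑-assignments-++ : {X : Set} (xs ys : List X) (F : List (X × V) → ℤ) → ∑ (assignments (xs ++ ys) vs) F ≡ ∑ (assignments xs vs) (λ f → ∑ (assignments ys vs) (λ g → F (f ++ g)))
  ∑-assignments-++ []       ys F = sym (ℤ.+-identityʳ _)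
  ∑-assignments-++ (x ∷ xs) ys F = trans (∑-assignments-∷ x (xs ++ ys) F) (trans (∑-cong vs (λ v → ∑-assignments-++ xs ys (λ f → F ((x , v) ∷ f))))
    (sym (∑-assignments-∷ x xs _)))

  ∑-assignments-row : ∀ i j l F → ∑ (assignments (rowCells i j l) vs) F ≡ sumW l vs (λ w → F (flatRow i j w))
  ∑-assignments-row i j zero    F = ℤ.+-identityʳ _
  ∑-assignments-row i j (suc l) F = trans (∑-assignments-∷ (i , j) (rowCells i (suc j) l) F) (∑-cong vs (λ v → ∑-assignments-row i (suc j) l (λ f → F (((i , j) , v) ∷ f))))

  ∑-assignments-cells : ∀ i os ls F → ∑ (assignments (cellsFrom i os ls) vs) F ≡ sumT ls vs (λ t → F (flatten i (offsets os t)))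
  ∑-assignments-cells i []       []       F = ℤ.+-identityʳ _
  ∑-assignments-cells i (o ∷ os) []       F = ℤ.+-identityʳ _
  ∑-assignments-cells i []       (l ∷ ls) F = trans (∑-assignments-++ (rowCells i 0 l) _ F) (trans (∑-assignments-row i 0 l _)
    (respects (sumW-linear l) (λ w → ∑-assignments-cells (suc i) [] ls _)))
  ∑-assignments-cells i (o ∷ os) (l ∷ ls) F = trans (∑-assignments-++ (rowCells i o l) _ F) (trans (∑-assignments-row i o l _)
    (respects (sumW-linear l) (λ w → ∑-assignments-cells (suc i) os ls _)))

rowCells-upTo : ∀ i j l → map (i ,_) (applyUpTo (λ x → j + x) l) ≡ rowCells i j l
rowCells-upTo i j zero    = refl
rowCells-upTo i j (suc l) = cong₂ _∷_ (cong (i ,_) (ℕ.+-identityʳ j))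
  (trans (cong (map (i ,_)) (applyUpTo-cong l (λ x _ → +-suc j x))) (rowCells-upTo i (suc j) l))

cells-cellsFrom : ∀ ls → cells ls ≡ cellsFrom 0 [] ls
cells-cellsFrom ls = go ls 0 id (λ _ → refl)
  where
  go : ∀ ls′ k (h : ℕ → ℕ) {F : ℕ → List Cell} → (∀ i → F (h i) ≡ map (k + i ,_) (upTo (at ls′ i))) → concatMap F (applyUpTo h (length ls′)) ≡ cellsFrom k [] ls′
  go []        k h eq = refl
  go (l ∷ ls′) k h eq = cong₂ _++_ (trans (eq 0) (trans (cong (λ z → map (z ,_) (upTo l)) (ℕ.+-identityʳ k)) (rowCells-upTo k 0 l)))
    (go ls′ (suc k) (h ∘ suc) (λ i → trans (eq (suc i)) (cong (λ z → map (z ,_) (upTo (at ls′ i))) (+-suc k i))))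

linked : {V : Set} → (V → V → Bool) → List V → Bool
linked R []      = true
linked R (v ∷ w) = atM (head? w) (R v) ∧ linked R w

zipAll : {V : Set} → (V → V → Bool) → List V → List V → Bool
zipAll D (v ∷ w) (v′ ∷ w′) = D v v′ ∧ zipAll D w w′
zipAll D _       _         = true

zipAll-[] : {V : Set} (D : V → V → Bool) (w : List V) → zipAll D w [] ≡ true
zipAll-[] D []      = refl
zipAll-[] D (_ ∷ _) = refl

headRow : {V : Set} → List (List V) → List V
headRow []      = []
headRow (w ∷ _) = w

-- The local conditions, row by row: R within a row, D and O between a row and the next, P i in row i.
structured : {V : Set} (R D O : V → V → Bool) (P : ℕ → V → Bool) → ℕ → List V → List (List V) → Bool
structured R D O P i w₀ []      = true
structured R D O P i w₀ (w ∷ t) = (linked R w ∧ (zipAll D w (headRow t) ∧ (all (P i) w ∧ zipAll O w₀ w))) ∧ structured R D O P (suc i) w t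

module _ {V : Set} (R D O : V → V → Bool) (P : ℕ → V → Bool) (own : ℕ → ℕ → Maybe V → V → Bool) (own-top : ∀ j m v → own 0 j m v ≡ own 0 j nothing v) where

  open Check R D own own-top

  checkRow-structured : ∀ i j w w₀ w₂ {above below} → (∀ c → above (j + c) ≡ rowAt 0 w₀ c) → (∀ c → below (j + c) ≡ rowAt 0 w₂ c) →
    (∀ j c v → own i j (rowAt 0 w₀ c) v ≡ P i v ∧ atM (rowAt 0 w₀ c) (λ u → O u v)) →
    checkRow i j w above below ≡ linked R w ∧ (zipAll D w w₂ ∧ (all (P i) w ∧ zipAll O w₀ w))
  checkRow-structured i j []      []       w₂ ha hb ho = refl
  checkRow-structured i j []      (_ ∷ _)  w₂ ha hb ho = refl
  checkRow-structured i j (v ∷ w) w₀ w₂ {above} {below} ha hb ho = trans (cong₂ (λ x y → (atM (head? w) (R v) ∧ x) ∧ y)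
      (cong₂ _∧_ (cong (λ z → atM z (D v)) (trans (cong below (sym (ℕ.+-identityʳ j))) (hb 0))) (trans (cong (λ z → own i j z v) (trans (cong above (sym (ℕ.+-identityʳ j))) (ha 0))) (ho j 0 v)))
      (checkRow-structured i (suc j) w (drop 1 w₀) (drop 1 w₂) (λ c → trans (cong above (sym (+-suc j c))) (trans (ha (suc c)) (tail w₀ c))) (λ c → trans (cong below (sym (+-suc j c))) (trans (hb (suc c)) (tail w₂ c)))
        (λ j c v → subst (λ m → own i j m v ≡ P i v ∧ atM m (λ u → O u v)) (tail w₀ c) (ho j (suc c) v))))
    (trans (shuffle (atM (head? w) (R v)) (atM (rowAt 0 w₂ 0) (D v)) (P i v) (atM (rowAt 0 w₀ 0) (λ u → O u v)) (linked R w) (zipAll D w (drop 1 w₂)) (all (P i) w) (zipAll O (drop 1 w₀) w))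
      (cong₂ (λ x y → linked R (v ∷ w) ∧ (x ∧ (all (P i) (v ∷ w) ∧ y))) (zip₁ D v w w₂) (zip₂ O v w w₀)))
    where
    tail : ∀ (w : List V) c → rowAt 0 w (suc c) ≡ rowAt 0 (drop 1 w) c
    tail []      c = refl
    tail (_ ∷ _) c = refl
    zip₁ : ∀ D v w w₂ → atM (rowAt 0 w₂ 0) (D v) ∧ zipAll D w (drop 1 w₂) ≡ zipAll D (v ∷ w) w₂
    zip₁ D v []      []       = refl
    zip₁ D v (_ ∷ _) []       = refl
    zip₁ D v w       (_ ∷ w₂) = refl
    zip₂ : ∀ O v w w₀ → atM (rowAt 0 w₀ 0) (λ u → O u v) ∧ zipAll O (drop 1 w₀) w ≡ zipAll O w₀ (v ∷ w)
    zip₂ O v w []       = refl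
    zip₂ O v w (_ ∷ w₀) = refl
    shuffle : ∀ a b c d a′ b′ c′ d′ → (a ∧ (b ∧ (c ∧ d))) ∧ (a′ ∧ (b′ ∧ (c′ ∧ d′))) ≡ (a ∧ a′) ∧ ((b ∧ b′) ∧ ((c ∧ c′) ∧ (d ∧ d′)))
    shuffle false b     c     d     a′    b′    c′    d′ = refl
    shuffle true  false c     d     a′    b′    c′    d′ = sym (∧-zeroʳ a′)
    shuffle true  true  false d     a′    b′    c′    d′ = sym (trans (cong (a′ ∧_) (∧-zeroʳ b′)) (∧-zeroʳ a′))
    shuffle true  true  true  false a′    b′    c′    d′ = sym (trans (cong (λ z → a′ ∧ (b′ ∧ z)) (∧-zeroʳ c′)) (trans (cong (a′ ∧_) (∧-zeroʳ b′)) (∧-zeroʳ a′)))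
    shuffle true  true  true  true  a′    b′    c′    d′ = refl

  check-structured : ∀ i w₀ t {above} → (∀ c → above c ≡ rowAt 0 w₀ c) →
    (∀ j c v → own i j (rowAt 0 w₀ c) v ≡ P i v ∧ atM (rowAt 0 w₀ c) (λ u → O u v)) →
    (∀ i j m v → own (suc i) j m v ≡ P (suc i) v ∧ atM m (λ u → O u v)) →
    check i above (offsets [] t) ≡ structured R D O P i w₀ t
  check-structured i w₀ []      ha ho ho′ = refl
  check-structured i w₀ (w ∷ t) ha ho ho′ = cong₂ _∧_ (checkRow-structured i 0 w w₀ (headRow t) ha (next t) ho) (check-structured (suc i) w t (λ _ → refl) (λ j c v → ho′ i j _ v) ho′)
    where
    next : ∀ t c → cellAt (offsets [] t) 0 c ≡ rowAt 0 (headRow t) c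
    next []      c = refl
    next (_ ∷ _) c = refl

countᵇ-++ : {A : Set} (p : A → Bool) (xs ys : List A) → countᵇ p (xs ++ ys) ≡ countᵇ p xs + countᵇ p ys
countᵇ-++ p []       ys = refl
countᵇ-++ p (x ∷ xs) ys with p x
... | true  = cong suc (countᵇ-++ p xs ys)
... | false = countᵇ-++ p xs ys

countᵇ-∷ : {A : Set} (p : A → Bool) (x : A) (xs : List A) → countᵇ p (x ∷ xs) ≡ (if p x then 1 else 0) + countᵇ p xs
countᵇ-∷ p x xs with p x
... | true  = refl
... | false = refl

countT : {V : Set} → (V → Bool) → List (List V) → ℕ
countT q t = sum (map (countᵇ q) t)

countᵇ-flatRow : {V : Set} (q : V → Bool) (i j : ℕ) (w : List V) → countᵇ (λ cv → q (proj₂ cv)) (flatRow i j w) ≡ countᵇ q w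
countᵇ-flatRow q i j []      = refl
countᵇ-flatRow q i j (v ∷ w) with q v
... | true  = cong suc (countᵇ-flatRow q i (suc j) w)
... | false = countᵇ-flatRow q i (suc j) w

countᵇ-flatten : {V : Set} (q : V → Bool) (i : ℕ) (t : List (List V)) → countᵇ (λ cv → q (proj₂ cv)) (flatten i (offsets [] t)) ≡ countT q t
countᵇ-flatten q i []      = refl
countᵇ-flatten q i (w ∷ t) = trans (countᵇ-++ _ (flatRow i 0 w) _) (cong₂ _+_ (countᵇ-flatRow q i 0 w) (countᵇ-flatten q (suc i) t))

entriesT : List (List (List ℕ)) → ℕ
entriesT t = sum (map (λ w → sum (map length w)) t)

entries-++ : ∀ f g → entries (f ++ g) ≡ entries f + entries g
entries-++ []       g = refl
entries-++ (x ∷ f) g = trans (cong (λ z → length (proj₂ x) + z) (entries-++ f g)) (sym (ℕ.+-assoc (length (proj₂ x)) _ _))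

entries-flatten : ∀ i t → entries (flatten i (offsets [] t)) ≡ entriesT t
entries-flatten i []      = refl
entries-flatten i (w ∷ t) = trans (entries-++ (flatRow i 0 w) _) (cong₂ _+_ (entries-row i 0 w) (entries-flatten (suc i) t))
  where
  entries-row : ∀ i j w → entries (flatRow i j w) ≡ sum (map length w)
  entries-row i j []      = refl
  entries-row i j (s ∷ w) = cong (λ z → length s + z) (entries-row i (suc j) w)

-- Set-valued tableaux and the transfer operator of G

maxmin≤ maxmin< : List ℕ → List ℕ → Bool
maxmin≤ s t = maxL s ≤ᵇ minL t
maxmin< s t = maxL s <ᵇ minL t

svt : List (List (List ℕ)) → Bool
svt []      = true
svt (w ∷ t) = (linked maxmin≤ w ∧ zipAll maxmin< w (headRow t)) ∧ svt t

has : ℕ → List ℕ → Bool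
has r s = any (λ e → e ≡ᵇ r) s

contentT : ℕ → List (List (List ℕ)) → List ℕ
contentT n t = map (λ r → countT (has r) t) (oneTo n)

zipAll-true : {V : Set} (w w′ : List V) → zipAll (λ _ _ → true) w w′ ≡ true
zipAll-true []      w′       = refl
zipAll-true (_ ∷ w) []       = refl
zipAll-true (_ ∷ w) (_ ∷ w′) = zipAll-true w w′

all-true : {V : Set} (w : List V) → all (λ _ → true) w ≡ true
all-true []      = refl
all-true (_ ∷ w) = all-true w

isSVT-svt : ∀ t → isSVT (flatten 0 (offsets [] t)) ≡ svt t
isSVT-svt t = trans (all-cong (λ ((i , j) , s) → cong (atCell f (i , suc j) (maxmin≤ s) ∧_) (sym (∧-identityʳ (atCell f (suc i , j) (maxmin< s))))) f)
  (trans (Check.all-ok maxmin≤ maxmin< (λ _ _ _ _ → true) (λ _ _ _ → refl) (offsets [] t))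
    (trans (check-structured maxmin≤ maxmin< (λ _ _ → true) (λ _ _ → true) (λ _ _ _ _ → true) (λ _ _ _ → refl) 0 [] t (λ _ → refl) (λ j c v → sym (atM-true (rowAt 0 [] c))) (λ i j m v → sym (atM-true m)))
      (drop-trivial 0 [] t)))
  where
  f = flatten 0 (offsets [] t)
  atM-true : ∀ m → atM m (λ (_ : List ℕ) → true) ≡ true
  atM-true (just _) = refl
  atM-true nothing  = refl
  drop-trivial : ∀ i w₀ t → structured maxmin≤ maxmin< (λ _ _ → true) (λ _ _ → true) i w₀ t ≡ svt t
  drop-trivial i w₀ []      = refl
  drop-trivial i w₀ (w ∷ t) = cong₂ _∧_ (cong (linked maxmin≤ w ∧_) (trans (cong₂ (λ x y → zipAll maxmin< w (headRow t) ∧ (x ∧ y)) (all-true w) (zipAll-true w₀ w)) (∧-identityʳ _))) (drop-trivial (suc i) w t)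

svtWeight : ℕ → List ℕ → ℕ → List (List (List ℕ)) → ℤ
svtWeight n a size′ t = when (svt t ∧ eqList (contentT n t) a) (sign (entriesT t ∸ size′))

G-sumT : ∀ ls a → G ls a ≡ sumT ls (nonemptySubsets (length a)) (svtWeight (length a) a (sum ls))
G-sumT ls a = begin
  G ls a
    ≡⟨ ∑-filter (λ T → isSVT T ∧ eqList (svtContent n T) a) (assignments (cells ls) vs₀) (λ T → sign (entries T ∸ sum ls)) ⟩
  ∑ (assignments (cells ls) vs₀) F
    ≡⟨ cong (λ z → ∑ (assignments z vs₀) F) (cells-cellsFrom ls) ⟩
  ∑ (assignments (cellsFrom 0 [] ls) vs₀) F
    ≡⟨ ∑-assignments-cells vs₀ 0 [] ls F ⟩
  sumT ls vs₀ (λ t → F (flatten 0 (offsets [] t)))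
    ≡⟨ respects (sumT-linear vs₀ ls) (λ t → cong₂ when (cong₂ _∧_ (isSVT-svt t) (cong (λ z → eqList z a) (ListP.map-cong (λ r → countᵇ-flatten (has r) 0 t) (oneTo n)))) (cong (λ z → sign (z ∸ sum ls)) (entries-flatten 0 t))) ⟩
  sumT ls vs₀ (svtWeight n a (sum ls)) ∎
  where
  n = length a
  vs₀ = nonemptySubsets n
  F : List (Cell × List ℕ) → ℤ
  F T = when (isSVT T ∧ eqList (svtContent n T) a) (sign (entries T ∸ sum ls))

record Letters (n : ℕ) (s : List ℕ) : Set where
  constructor letters
  field
    nonempty : null s ≡ false
    bounded  : All (_≤ n) s
open Letters public

∑-cong-All : {A : Set} {P : A → Set} {xs : List A} → All P xs → ∀ {f g : A → ℤ} → (∀ {x} → P x → f x ≡ g x) → ∑ xs f ≡ ∑ xs g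
∑-cong-All []       h = refl
∑-cong-All (p ∷ ps) h = cong₂ _+ℤ_ (h p) (∑-cong-All ps h)

sumW-cong : {V : Set} {P : V → Set} {vs : List V} → All P vs → ∀ l {F H : List V → ℤ} → (∀ {w} → All P w → length w ≡ l → F w ≡ H w) → sumW l vs F ≡ sumW l vs H
sumW-cong ps zero    h = h [] refl
sumW-cong ps (suc l) h = ∑-cong-All ps (λ p → sumW-cong ps l (λ q e → h (p ∷ q) (cong suc e)))

applyUpTo-∷ʳ : ∀ {A : Set} (f : ℕ → A) n → applyUpTo f (suc n) ≡ applyUpTo f n ∷ʳ f n
applyUpTo-∷ʳ f zero    = refl
applyUpTo-∷ʳ f (suc n) = cong (f 0 ∷_) (applyUpTo-∷ʳ (f ∘ suc) n)

oneTo-suc : ∀ n → oneTo (suc n) ≡ oneTo n ∷ʳ suc n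
oneTo-suc n = trans (cong (map suc) (applyUpTo-∷ʳ id n)) (ListP.map-++ suc (upTo n) (n ∷ []))

∑-sublists-∷ʳ : ∀ xs y (F : List ℕ → ℤ) → ∑ (sublists (xs ∷ʳ y)) F ≡ ∑ (sublists xs) (λ s → F s +ℤ F (s ∷ʳ y))
∑-sublists-∷ʳ []       y F = sym (ℤ.+-assoc (F []) (F (y ∷ [])) (+ 0))
∑-sublists-∷ʳ (x ∷ xs) y F = trans (∑-++ (sublists (xs ∷ʳ y)) _ F) (trans (cong₂ _+ℤ_ (∑-sublists-∷ʳ xs y F)
    (trans (∑-map (x ∷_) (sublists (xs ∷ʳ y)) F) (trans (∑-sublists-∷ʳ xs y (λ s → F (x ∷ s))) (sym (∑-map (x ∷_) (sublists xs) _)))))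
  (sym (∑-++ (sublists xs) (map (x ∷_) (sublists xs)) _)))

-- Every set without n + 1 is paired with its extension by n + 1; of the pair of the empty set only
-- {n + 1} is nonempty.
∑-nonemptySubsets-suc : ∀ n (F : List ℕ → ℤ) → ∑ (nonemptySubsets (suc n)) F ≡ ∑ (nonemptySubsets n) (λ s → F s +ℤ F (s ∷ʳ suc n)) +ℤ F (suc n ∷ [])
∑-nonemptySubsets-suc n F = begin
  ∑ (nonemptySubsets (suc n)) F
    ≡⟨ ∑-filter (λ s → not (null s)) (sublists (oneTo (suc n))) F ⟩
  ∑ (sublists (oneTo (suc n))) F₀
    ≡⟨ trans (cong (λ z → ∑ (sublists z) F₀) (oneTo-suc n)) (∑-sublists-∷ʳ (oneTo n) (suc n) F₀) ⟩
  ∑ (sublists (oneTo n)) (λ s → F₀ s +ℤ F₀ (s ∷ʳ suc n))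
    ≡⟨ empty-first (oneTo n) ⟩
  ∑ (sublists (oneTo n)) (λ s → when (not (null s)) (F s +ℤ F (s ∷ʳ suc n))) +ℤ F (suc n ∷ [])
    ≡⟨ cong (_+ℤ F (suc n ∷ [])) (sym (∑-filter (λ s → not (null s)) (sublists (oneTo n)) _)) ⟩
  ∑ (nonemptySubsets n) (λ s → F s +ℤ F (s ∷ʳ suc n)) +ℤ F (suc n ∷ []) ∎
  where
  F₀ : List ℕ → ℤ
  F₀ s = when (not (null s)) (F s)
  H H′ : List ℕ → ℤ
  H s = F₀ s +ℤ F₀ (s ∷ʳ suc n)
  H′ s = when (not (null s)) (F s +ℤ F (s ∷ʳ suc n))
  shuffle : ∀ a b c → (a +ℤ c) +ℤ b ≡ (a +ℤ b) +ℤ c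
  shuffle = solve-∀
  empty-first : ∀ xs → ∑ (sublists xs) (λ s → F₀ s +ℤ F₀ (s ∷ʳ suc n)) ≡ ∑ (sublists xs) (λ s → when (not (null s)) (F s +ℤ F (s ∷ʳ suc n))) +ℤ F (suc n ∷ [])
  empty-first [] = trans (ℤ.+-identityʳ _) (trans (ℤ.+-identityˡ _) (sym (ℤ.+-identityˡ (F (suc n ∷ [])))))
  empty-first (x ∷ xs) = trans (∑-++ (sublists xs) _ _) (trans (cong₂ _+ℤ_ (empty-first xs) (trans (∑-map (x ∷_) (sublists xs) H) (sym (∑-map (x ∷_) (sublists xs) H′))))
    (trans (shuffle (∑ (sublists xs) H′) (∑ (map (x ∷_) (sublists xs)) H′) (F (suc n ∷ []))) (cong (_+ℤ F (suc n ∷ [])) (sym (∑-++ (sublists xs) (map (x ∷_) (sublists xs)) _)))))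

All-applyUpTo : {P : ℕ → Set} (f : ℕ → ℕ) (n : ℕ) → (∀ i → i < n → P (f i)) → All P (applyUpTo f n)
All-applyUpTo f zero    h = []
All-applyUpTo f (suc n) h = h 0 (s≤s z≤n) ∷ All-applyUpTo (f ∘ suc) n (λ i p → h (suc i) (s≤s p))

oneTo-bounded : ∀ n → All (λ k → 1 ≤ k × k ≤ n) (oneTo n)
oneTo-bounded n = subst (All _) (sym (ListP.map-upTo suc n)) (All-applyUpTo suc n (λ i p → s≤s z≤n , p))

All-++ : {A : Set} {P : A → Set} {xs ys : List A} → All P xs → All P ys → All P (xs ++ ys)
All-++ []       q = q
All-++ (p ∷ ps) q = p ∷ All-++ ps q

All-map : {A B : Set} {P : A → Set} {Q : B → Set} (h : A → B) {xs : List A} → (∀ {x} → P x → Q (h x)) → All P xs → All Q (map h xs)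
All-map h q []       = []
All-map h q (p ∷ ps) = q p ∷ All-map h q ps

All-filter : {A : Set} {P : A → Set} (b : A → Bool) {xs : List A} → All P xs → All (λ x → P x × (b x ≡ true)) (filterᵇ b xs)
All-filter b [] = []
All-filter b {x ∷ xs} (p ∷ ps) with b x in eq
... | true  = (p , eq) ∷ All-filter b ps
... | false = All-filter b ps

nonemptySubsets-letters : ∀ n → All (Letters n) (nonemptySubsets n)
nonemptySubsets-letters n = mapAll (All-filter (λ s → not (null s)) (sublists-bounded (oneTo-bounded n)))
  where
  sublists-bounded : ∀ {xs} → All (λ k → 1 ≤ k × k ≤ n) xs → All (All (_≤ n)) (sublists xs)
  sublists-bounded []       = [] ∷ []
  sublists-bounded ((_ , p) ∷ ps) = All-++ (sublists-bounded ps) (All-map (_ ∷_) (p ∷_) (sublists-bounded ps))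
  mapAll : ∀ {xs} → All (λ s → All (_≤ n) s × (not (null s) ≡ true)) xs → All (Letters n) xs
  mapAll []             = []
  mapAll ((p , q) ∷ ps) = letters (flip q) p ∷ mapAll ps
    where
    flip : ∀ {b} → not b ≡ true → b ≡ false
    flip {false} _ = refl

maxL-bounded : ∀ {n s} → All (_≤ n) s → maxL s ≤ n
maxL-bounded []       = z≤n
maxL-bounded {s = x ∷ s} (p ∷ ps) with maxL s ≤ᵇ x
... | true  = p
... | false = maxL-bounded ps

maxL-∷ʳ : ∀ {n s} → All (_≤ n) s → maxL (s ∷ʳ suc n) ≡ suc n
maxL-∷ʳ []       = refl
maxL-∷ʳ {n} {x ∷ s} (p ∷ ps) rewrite maxL-∷ʳ ps | ≤ᵇ-false (s≤s p) = refl

minL-bounded : ∀ {n s} → Letters n s → minL s ≤ n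
minL-bounded {n} {x ∷ s} (letters _ (p ∷ ps)) = go s p ps
  where
  go : ∀ s → x ≤ n → All (_≤ n) s → foldr (λ y m → if y ≤ᵇ m then y else m) x s ≤ n
  go []      p []       = p
  go (y ∷ s) p (q ∷ qs) with y ≤ᵇ foldr (λ y m → if y ≤ᵇ m then y else m) x s
  ... | true  = q
  ... | false = go s p qs

minL-∷ʳ : ∀ {n s} → Letters n s → minL (s ∷ʳ suc n) ≡ minL s
minL-∷ʳ {n} {x ∷ s} (letters _ (p ∷ ps)) = trans (ListP.foldr-++ (λ y m → if y ≤ᵇ m then y else m) x s (suc n ∷ [])) (cong (λ z → foldr (λ y m → if y ≤ᵇ m then y else m) z s) top)
  where
  top : (if suc n ≤ᵇ x then suc n else x) ≡ x
  top rewrite ≤ᵇ-false (s≤s p) = refl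

-- The row with entries w in letters ≤ n, the letter n + 1 being added to the last cell if b, and k further cells {n + 1}.
extend : ℕ → List (List ℕ) → Bool → ℕ → List (List ℕ)
extend n []          b     k = replicate k (suc n ∷ [])
extend n (s ∷ [])    true  k = (s ∷ʳ suc n) ∷ replicate k (suc n ∷ [])
extend n (s ∷ [])    false k = s ∷ replicate k (suc n ∷ [])
extend n (s ∷ t ∷ w) b     k = s ∷ extend n (t ∷ w) b k

-- After a set with maximum n + 1 a row can only continue with copies of {n + 1}.
sumW-top : ∀ n l (F : List (List ℕ) → ℤ) s → maxL s ≡ suc n → sumW l (nonemptySubsets (suc n)) (λ w → when (atM (head? w) (maxmin≤ s) ∧ linked maxmin≤ w) (F w)) ≡ F (replicate l (suc n ∷ []))
sumW-top n zero    F s eq = refl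
sumW-top n (suc l) F s eq = begin
  ∑ (nonemptySubsets (suc n)) (λ v → sumW l vs′ (λ w → when (maxmin≤ s v ∧ (atM (head? w) (maxmin≤ v) ∧ linked maxmin≤ w)) (F (v ∷ w))))
    ≡⟨ ∑-nonemptySubsets-suc n _ ⟩
  ∑ (nonemptySubsets n) (λ v → X v +ℤ X (v ∷ʳ suc n)) +ℤ X (suc n ∷ [])
    ≡⟨ cong (_+ℤ X (suc n ∷ [])) (trans (∑-cong-All (nonemptySubsets-letters n) (λ p → cong₂ _+ℤ_ (zero-term _ (≤-trans (minL-bounded p) ≤-refl)) (zero-term _ (≤-trans (≤-reflexive (minL-∷ʳ p)) (minL-bounded p))))) (linear-zero (∑-is-linear (nonemptySubsets n)))) ⟩
  + 0 +ℤ X (suc n ∷ [])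
    ≡⟨ trans (ℤ.+-identityˡ _) (trans (respects (sumW-linear vs′ l) (λ w → cong (λ z → when (z ∧ (atM (head? w) (maxmin≤ (suc n ∷ [])) ∧ linked maxmin≤ w)) (F ((suc n ∷ []) ∷ w))) (≤ᵇ-true (≤-reflexive eq))))
         (sumW-top n l (λ w → F ((suc n ∷ []) ∷ w)) (suc n ∷ []) refl)) ⟩
  F (replicate (suc l) (suc n ∷ [])) ∎
  where
  vs′ = nonemptySubsets (suc n)
  X : List ℕ → ℤ
  X v = sumW l vs′ (λ w → when (maxmin≤ s v ∧ (atM (head? w) (maxmin≤ v) ∧ linked maxmin≤ w)) (F (v ∷ w)))
  zero-term : ∀ v → minL v ≤ n → X v ≡ + 0
  zero-term v q = trans (respects (sumW-linear vs′ l) (λ w → cong (λ z → when (z ∧ (atM (head? w) (maxmin≤ v) ∧ linked maxmin≤ w)) (F (v ∷ w))) (≤ᵇ-false (subst (minL v <_) (sym eq) (s≤s q))))) (linear-zero (sumW-linear vs′ l))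

-- The letter n + 1 fills a final run of cells {n + 1} and may also occur in the last cell before
-- the run; `0 <ᵇ r` says that such a cell exists.
sumW-extend : ∀ n l (F : List (List ℕ) → ℤ) → sumW l (nonemptySubsets (suc n)) (λ w → when (linked maxmin≤ w) (F w)) ≡
  sum< (suc l) (λ r → sumW r (nonemptySubsets n) (λ w → when (linked maxmin≤ w) (F (extend n w false (l ∸ r)) +ℤ when (0 <ᵇ r) (F (extend n w true (l ∸ r))))))
sumW-extend n zero F = sym (trans (ℤ.+-identityˡ _) (ℤ.+-identityʳ _))
sumW-extend n (suc l) F = begin
  ∑ us′ (λ v → sumW l us′ (λ w → when (atM (head? w) (maxmin≤ v) ∧ linked maxmin≤ w) (F (v ∷ w))))
    ≡⟨ ∑-nonemptySubsets-suc n _ ⟩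
  ∑ us (λ s → X s +ℤ X (s ∷ʳ suc n)) +ℤ X (suc n ∷ [])
    ≡⟨ cong₂ _+ℤ_ (∑-cong-All (nonemptySubsets-letters n) (λ {s} p → cong₂ _+ℤ_ (unmarked s p) (sumW-top n l (λ w → F ((s ∷ʳ suc n) ∷ w)) (s ∷ʳ suc n) (maxL-∷ʳ (bounded p))))) (sumW-top n l (λ w → F ((suc n ∷ []) ∷ w)) (suc n ∷ []) refl) ⟩
  ∑ us (λ s → sum< (suc l) (λ r → Z s r) +ℤ F ((s ∷ʳ suc n) ∷ replicate l (suc n ∷ []))) +ℤ F (replicate (suc l) (suc n ∷ []))
    ≡⟨ cong (_+ℤ F (replicate (suc l) (suc n ∷ []))) (∑-cong-All (nonemptySubsets-letters n) (λ {s} p → regroup s)) ⟩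
  ∑ us (λ s → sum< (suc l) (λ r → Z′ s r)) +ℤ F (replicate (suc l) (suc n ∷ []))
    ≡⟨ cong (_+ℤ F (replicate (suc l) (suc n ∷ []))) (linear-sum< (∑-is-linear us) (λ r s → Z′ s r) (suc l)) ⟩
  sum< (suc l) (λ r → ∑ us (λ s → Z′ s r)) +ℤ F (replicate (suc l) (suc n ∷ []))
    ≡⟨ ℤ.+-comm _ (F (replicate (suc l) (suc n ∷ []))) ⟩
  F (replicate (suc l) (suc n ∷ [])) +ℤ sum< (suc l) (λ r → ∑ us (λ s → Z′ s r))
    ≡⟨ cong (_+ℤ sum< (suc l) (λ r → ∑ us (λ s → Z′ s r))) (sym (ℤ.+-identityʳ (F (replicate (suc l) (suc n ∷ []))))) ⟩
  Y′ 0 +ℤ sum< (suc l) (λ r → Y′ (suc r))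
    ≡⟨ sym (sum<-head (suc l) Y′) ⟩
  sum< (suc (suc l)) Y′ ∎
  where
  us = nonemptySubsets n
  us′ = nonemptySubsets (suc n)
  top = suc n ∷ []
  X : List ℕ → ℤ
  X v = sumW l us′ (λ w → when (atM (head? w) (maxmin≤ v) ∧ linked maxmin≤ w) (F (v ∷ w)))
  Y′ : ℕ → ℤ
  Y′ r = sumW r us (λ w → when (linked maxmin≤ w) (F (extend n w false (suc l ∸ r)) +ℤ when (0 <ᵇ r) (F (extend n w true (suc l ∸ r)))))
  Z Z′ : List ℕ → ℕ → ℤ
  Z s r = sumW r us (λ w → when (linked maxmin≤ (s ∷ w)) (F (s ∷ extend n w false (l ∸ r)) +ℤ when (0 <ᵇ r) (F (s ∷ extend n w true (l ∸ r)))))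
  Z′ s r = sumW r us (λ w → when (linked maxmin≤ (s ∷ w)) (F (extend n (s ∷ w) false (l ∸ r)) +ℤ F (extend n (s ∷ w) true (l ∸ r))))
  head-extend : ∀ s → Letters n s → ∀ {w} → All (Letters n) w → ∀ b k → atM (head? (extend n w b k)) (maxmin≤ s) ≡ atM (head? w) (maxmin≤ s)
  head-extend s p []             b     zero    = refl
  head-extend s p []             b     (suc k) = ≤ᵇ-true (m≤n⇒m≤1+n (maxL-bounded (bounded p)))
  head-extend s p (q ∷ [])       true  k       = cong (maxL s ≤ᵇ_) (minL-∷ʳ q)
  head-extend s p (q ∷ [])       false k       = refl
  head-extend s p (q ∷ q′ ∷ qs)  b     k       = refl
  unmarked : ∀ s → Letters n s → X s ≡ sum< (suc l) (λ r → Z s r)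
  unmarked s p = begin
    X s
      ≡⟨ respects (sumW-linear us′ l) (λ w → trans (cong (λ z → when z (F (s ∷ w))) (∧-comm (atM (head? w) (maxmin≤ s)) (linked maxmin≤ w))) (sym (when-∧ (linked maxmin≤ w) (atM (head? w) (maxmin≤ s)) (F (s ∷ w))))) ⟩
    sumW l us′ (λ w → when (linked maxmin≤ w) (when (atM (head? w) (maxmin≤ s)) (F (s ∷ w))))
      ≡⟨ sumW-extend n l (λ w → when (atM (head? w) (maxmin≤ s)) (F (s ∷ w))) ⟩
    sum< (suc l) (λ r → sumW r us (λ w → when (linked maxmin≤ w) (when (atM (head? (extend n w false (l ∸ r))) (maxmin≤ s)) (F (s ∷ extend n w false (l ∸ r)))
      +ℤ when (0 <ᵇ r) (when (atM (head? (extend n w true (l ∸ r))) (maxmin≤ s)) (F (s ∷ extend n w true (l ∸ r)))))))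
      ≡⟨ sum<-cong (suc l) (λ r _ → sumW-cong (nonemptySubsets-letters n) r (λ {w} q _ → trans
           (cong₂ (λ x y → when (linked maxmin≤ w) (when x (F (s ∷ extend n w false (l ∸ r))) +ℤ when (0 <ᵇ r) (when y (F (s ∷ extend n w true (l ∸ r)))))) (head-extend s p q false (l ∸ r)) (head-extend s p q true (l ∸ r)))
           (collect (linked maxmin≤ w) (atM (head? w) (maxmin≤ s)) (0 <ᵇ r) _ _))) ⟩
    sum< (suc l) (λ r → Z s r) ∎
    where
    collect : ∀ a b c x y → when a (when b x +ℤ when c (when b y)) ≡ when (b ∧ a) (x +ℤ when c y)
    collect true  true  c     x y = refl
    collect true  false true  x y = refl
    collect true  false false x y = refl
    collect false true  c     x y = refl
    collect false false c     x y = refl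
  regroup : ∀ s → sum< (suc l) (λ r → Z s r) +ℤ F ((s ∷ʳ suc n) ∷ replicate l top) ≡ sum< (suc l) (λ r → Z′ s r)
  regroup s = begin
    sum< (suc l) (Z s) +ℤ F ((s ∷ʳ suc n) ∷ replicate l top)
      ≡⟨ cong (_+ℤ F ((s ∷ʳ suc n) ∷ replicate l top)) (sum<-head l (Z s)) ⟩
    (Z s 0 +ℤ sum< l (λ r → Z s (suc r))) +ℤ F ((s ∷ʳ suc n) ∷ replicate l top)
      ≡⟨ arrange (F (s ∷ replicate l top)) _ _ ⟩
    (F (s ∷ replicate l top) +ℤ F ((s ∷ʳ suc n) ∷ replicate l top)) +ℤ sum< l (λ r → Z s (suc r))
      ≡⟨ cong (_+ℤ_ (F (s ∷ replicate l top) +ℤ F ((s ∷ʳ suc n) ∷ replicate l top))) (sum<-cong l (λ r _ → sumW-cong (nonemptySubsets-letters n) (suc r) (λ {w} _ e → long r w e))) ⟩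
    Z′ s 0 +ℤ sum< l (λ r → Z′ s (suc r))
      ≡⟨ sym (sum<-head l (Z′ s)) ⟩
    sum< (suc l) (Z′ s) ∎
    where
    long : ∀ r w → length w ≡ suc r → when (linked maxmin≤ (s ∷ w)) (F (s ∷ extend n w false (l ∸ suc r)) +ℤ F (s ∷ extend n w true (l ∸ suc r)))
      ≡ when (linked maxmin≤ (s ∷ w)) (F (extend n (s ∷ w) false (l ∸ suc r)) +ℤ F (extend n (s ∷ w) true (l ∸ suc r)))
    long r (t ∷ w) e = refl
    arrange : ∀ a b c → ((a +ℤ + 0) +ℤ b) +ℤ c ≡ (a +ℤ c) +ℤ b
    arrange = solve-∀

-- The triple (w , b , k) stands for the row `extend n w b k`.
ERow : Set
ERow = List (List ℕ) × Bool × ℕ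

b2n : Bool → ℕ
b2n b = if b then 1 else 0

old : List ERow → List (List (List ℕ))
old = map proj₁

new : ℕ → List ERow → List (List (List ℕ))
new n = map (λ (w , b , k) → extend n w b k)

marks bits : List ERow → ℕ
marks x = sum (map (λ (w , b , k) → b2n b + k) x)
bits x  = sum (map (λ (w , b , k) → b2n b) x)

sumX : ℕ → List ℕ → (List ERow → ℤ) → ℤ
sumX n []       Ψ = Ψ []
sumX n (l ∷ ls) Ψ = sum< (suc l) (λ r → sumW r (nonemptySubsets n) (λ w →
  sumX n ls (λ x → Ψ ((w , false , l ∸ r) ∷ x)) +ℤ when (0 <ᵇ r) (sumX n ls (λ x → Ψ ((w , true , l ∸ r) ∷ x)))))

data Extended (n : ℕ) : List ℕ → List ERow → Set where
  []  : Extended n [] []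
  row : ∀ {l ls w b k x} → All (Letters n) w → length w + k ≡ l → (b ≡ true → 0 < length w) → Extended n ls x → Extended n (l ∷ ls) ((w , b , k) ∷ x)

sumX-linear : ∀ n ls → Linear (sumX n ls)
sumX-linear n []       = linear-eval []
sumX-linear n (l ∷ ls) = sum<-linear (λ r → linear-∘ (sumW-linear (nonemptySubsets n) r) (body r)) (suc l)
  where
  body : ∀ r w → Linear (λ Ψ → sumX n ls (λ x → Ψ ((w , false , l ∸ r) ∷ x)) +ℤ when (0 <ᵇ r) (sumX n ls (λ x → Ψ ((w , true , l ∸ r) ∷ x))))
  body r w = linear-+ (linear-precomp (_ ∷_) (sumX-linear n ls)) (when-linear (0 <ᵇ r) (linear-precomp (_ ∷_) (sumX-linear n ls)))

sumX-cong : ∀ n ls {Ψ Ψ′} → (∀ {x} → Extended n ls x → Ψ x ≡ Ψ′ x) → sumX n ls Ψ ≡ sumX n ls Ψ′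
sumX-cong n []       h = h []
sumX-cong n (l ∷ ls) h = sum<-cong (suc l) (λ r r< → sumW-cong (nonemptySubsets-letters n) r (λ {w} p e → cong₂ _+ℤ_
  (sumX-cong n ls (λ v → h (row p (fits {w} e r<) (λ ()) v)))
  (when-cong (0 <ᵇ r) (λ t → sumX-cong n ls (λ v → h (row p (fits {w} e r<) (λ _ → subst (0 <_) (sym e) (<ᵇ⇒< 0 r t)) v))))))
  where
  fits : ∀ {w : List (List ℕ)} {r} → length w ≡ r → r < suc l → length w + (l ∸ r) ≡ l
  fits refl r< = m+[n∸m]≡n (≤-pred r<)

allLinked cols : List (List (List ℕ)) → Bool
allLinked []      = true
allLinked (w ∷ t) = linked maxmin≤ w ∧ allLinked t
cols []      = true
cols (w ∷ t) = zipAll maxmin< w (headRow t) ∧ cols t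

svt-split : ∀ t → svt t ≡ allLinked t ∧ cols t
svt-split []      = refl
svt-split (w ∷ t) = trans (cong ((linked maxmin≤ w ∧ zipAll maxmin< w (headRow t)) ∧_) (svt-split t)) (∧-interchange (linked maxmin≤ w) _ _ _)

sumT-extend : ∀ n ls (Φ : List (List (List ℕ)) → ℤ) → sumT ls (nonemptySubsets (suc n)) (λ t → when (allLinked t) (Φ t)) ≡ sumX n ls (λ x → when (allLinked (old x)) (Φ (new n x)))
sumT-extend n []       Φ = refl
sumT-extend n (l ∷ ls) Φ = begin
  sumW l us′ (λ w → sumT ls us′ (λ t → when (linked maxmin≤ w ∧ allLinked t) (Φ (w ∷ t))))
    ≡⟨ respects (sumW-linear us′ l) (λ w → trans (trans (respects (sumT-linear us′ ls) (λ t → sym (when-∧ (linked maxmin≤ w) (allLinked t) _))) (linear-when (sumT-linear us′ ls) (linked maxmin≤ w) _))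
         (cong (when (linked maxmin≤ w)) (sumT-extend n ls (λ t → Φ (w ∷ t))))) ⟩
  sumW l us′ (λ w → when (linked maxmin≤ w) (Θ w))
    ≡⟨ sumW-extend n l Θ ⟩
  sum< (suc l) (λ r → sumW r us (λ w → when (linked maxmin≤ w) (Θ (extend n w false (l ∸ r)) +ℤ when (0 <ᵇ r) (Θ (extend n w true (l ∸ r))))))
    ≡⟨ sum<-cong (suc l) (λ r _ → respects (sumW-linear us r) (λ w → trans (spread (linked maxmin≤ w) (0 <ᵇ r) _ _) (cong₂ (λ x y → x +ℤ when (0 <ᵇ r) y) (inside w false (l ∸ r)) (inside w true (l ∸ r))))) ⟩
  sumX n (l ∷ ls) (λ x → when (allLinked (old x)) (Φ (new n x))) ∎
  where
  us = nonemptySubsets n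
  us′ = nonemptySubsets (suc n)
  Θ : List (List ℕ) → ℤ
  Θ w = sumX n ls (λ x → when (allLinked (old x)) (Φ (w ∷ new n x)))
  spread : ∀ a c x y → when a (x +ℤ when c y) ≡ when a x +ℤ when c (when a y)
  spread true  c x y = refl
  spread false c x y = sym (trans (ℤ.+-identityˡ _) (when-0 c))
  inside : ∀ w b k → when (linked maxmin≤ w) (Θ (extend n w b k)) ≡ sumX n ls (λ x → when (linked maxmin≤ w ∧ allLinked (old x)) (Φ (extend n w b k ∷ new n x)))
  inside w b k = trans (sym (linear-when (sumX-linear n ls) (linked maxmin≤ w) _)) (respects (sumX-linear n ls) (λ x → when-∧ (linked maxmin≤ w) (allLinked (old x)) _))

-- Since n + 1 is the largest letter, no cell may lie below a cell containing it. The next row thus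
-- ends below the old cells, and strictly before the last of them if that cell is marked: the
-- horizontal strip condition and the condition for the factor 1 - x.
interlaced : List ℕ → List ERow → Bool
interlaced (l ∷ ls) ((w , b , k) ∷ x) = ((nxt ls ≤ᵇ length w) ∧ (if b then nxt ls <ᵇ length w else true)) ∧ interlaced ls x
interlaced _        _                 = true

-- The two terms of the factor 1 - x are the two states of the last old cell of a row; the marked
-- state costs a sign and one power of x, and the signs multiply to `sign (bits x)`.
op-sumX : ∀ {L u ls} → Box L u ls → ∀ n (Ψ : List (List (List ℕ)) → ℕ → ℤ) e →
  op true (λ ρ e → sumT ρ (nonemptySubsets n) (λ t → Ψ t e)) ls e ≡ sumX n ls (λ x → when (interlaced ls x) (sign (bits x) *ℤ Ψ (old x) (e + marks x)))
op-sumX [] n Ψ e = trans (cong (Ψ []) (sym (ℕ.+-identityʳ e))) (sym (ℤ.*-identityˡ _))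
op-sumX {ls = l ∷ ls} (p ∷ b) n Ψ e = trans (op-sum< true (p ∷ b) (λ ρ e → sumT ρ (nonemptySubsets n) (λ t → Ψ t e)) e) (sum<-cong (suc l) (λ r r< → begin
    when (m ≤ᵇ r) (mk true m r (op true (λ ρ e → sumW r us (λ w → sumT ρ us (λ t → Ψ (w ∷ t) e))) ls) (e + (l ∸ r)))
      ≡⟨ cong (when (m ≤ᵇ r)) (mk-cong true m r (λ e → trans (linear-sumW us (op-linear true ls e) r (λ w (ρ , e) → sumT ρ us (λ t → Ψ (w ∷ t) e))) (respects (sumW-linear us r) (λ w → op-sumX b n (λ t → Ψ (w ∷ t)) e))) (e + (l ∸ r))) ⟩
    when (m ≤ᵇ r) (mk true m r (λ e → sumW r us (λ w → Y w e)) (e + (l ∸ r)))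
      ≡⟨ cong (when (m ≤ᵇ r)) (sym (linear-mk (sumW-linear us r) true m r (λ e w → Y w e) (e + (l ∸ r)))) ⟩
    when (m ≤ᵇ r) (sumW r us (λ w → mk true m r (Y w) (e + (l ∸ r))))
      ≡⟨ sym (linear-when (sumW-linear us r) (m ≤ᵇ r) _) ⟩
    sumW r us (λ w → when (m ≤ᵇ r) (mk true m r (Y w) (e + (l ∸ r))))
      ≡⟨ sumW-cong (nonemptySubsets-letters n) r (λ {w} _ len → cell r w len) ⟩
    sumW r us (λ w → sumX n ls (λ x → Z r ((w , false , l ∸ r) ∷ x)) +ℤ when (0 <ᵇ r) (sumX n ls (λ x → Z r ((w , true , l ∸ r) ∷ x)))) ∎))
  where
  us = nonemptySubsets n
  m = nxt ls
  Y : List (List ℕ) → ℕ → ℤ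
  Y w e = sumX n ls (λ x → when (interlaced ls x) (sign (bits x) *ℤ Ψ (w ∷ old x) (e + marks x)))
  Z : ℕ → List ERow → ℤ
  Z r x = when (interlaced (l ∷ ls) x) (sign (bits x) *ℤ Ψ (old x) (e + marks x))
  unmarked : ∀ r w → length w ≡ r → when (m ≤ᵇ r) (Y w (e + (l ∸ r))) ≡ sumX n ls (λ x → Z r ((w , false , l ∸ r) ∷ x))
  unmarked r w refl = trans (sym (linear-when (sumX-linear n ls) (m ≤ᵇ r) _)) (respects (sumX-linear n ls) (λ x → trans (when-∧ (m ≤ᵇ r) (interlaced ls x) _)
    (cong₂ (λ y z → when (y ∧ interlaced ls x) (sign (bits x) *ℤ Ψ (w ∷ old x) z)) (sym (∧-identityʳ (m ≤ᵇ r))) (ℕ.+-assoc e (l ∸ r) (marks x)))))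
  marked : ∀ r w → length w ≡ r → when (m ≤ᵇ r) (when (m <ᵇ r) (- Y w (suc (e + (l ∸ r))))) ≡ when (0 <ᵇ r) (sumX n ls (λ x → Z r ((w , true , l ∸ r) ∷ x)))
  marked r w refl = trans (when-∧ (m ≤ᵇ r) (m <ᵇ r) _) (trans (cong (when _) (sym (linear-neg (sumX-linear n ls) _))) (trans (sym (linear-when (sumX-linear n ls) ((m ≤ᵇ r) ∧ (m <ᵇ r)) _))
    (trans (respects (sumX-linear n ls) pointwise) (linear-when (sumX-linear n ls) (0 <ᵇ r) _))))
    where
    pointwise : ∀ x → when ((m ≤ᵇ r) ∧ (m <ᵇ r)) (- when (interlaced ls x) (sign (bits x) *ℤ Ψ (w ∷ old x) (suc (e + (l ∸ r)) + marks x))) ≡ when (0 <ᵇ r) (Z r ((w , true , l ∸ r) ∷ x))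
    pointwise x with <-≤-connex m r
    ... | inj₁ q rewrite ≤ᵇ-true (<⇒≤ q) | <ᵇ-true q | <ᵇ-true (≤-<-trans (z≤n {m}) q) with interlaced ls x
    ...   | true  = trans (ℤ.neg-distribˡ-* (sign (bits x)) _) (cong₂ (λ y z → y *ℤ Ψ (w ∷ old x) z) (sym (sign-suc (bits x))) (trans (sym (+-suc _ (marks x))) (trans (ℕ.+-assoc e (l ∸ r) _) (cong (λ z → e + z) (+-suc (l ∸ r) (marks x))))))
    ...   | false = refl
    pointwise x | inj₂ q rewrite <ᵇ-false q | ∧-zeroʳ (m ≤ᵇ r) = sym (when-0 (0 <ᵇ r))
  cell : ∀ r w → length w ≡ r → when (m ≤ᵇ r) (mk true m r (Y w) (e + (l ∸ r))) ≡ sumX n ls (λ x → Z r ((w , false , l ∸ r) ∷ x)) +ℤ when (0 <ᵇ r) (sumX n ls (λ x → Z r ((w , true , l ∸ r) ∷ x)))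
  cell r w len = trans (split (m ≤ᵇ r) (m <ᵇ r) (Y w (e + (l ∸ r))) (Y w (suc (e + (l ∸ r))))) (cong₂ _+ℤ_ (unmarked r w len) (marked r w len))
    where
    split : ∀ a c x y → when a (if c then x +ℤ - y else x) ≡ when a x +ℤ when a (when c (- y))
    split true  true  x y = refl
    split true  false x y = sym (ℤ.+-identityʳ x)
    split false c     x y = refl

∧-falseʳ : ∀ a {b} → b ≡ false → a ∧ b ≡ false
∧-falseʳ a refl = ∧-zeroʳ a

≤ᵇ-suc : ∀ m n → (suc m ≤ᵇ suc n) ≡ (m ≤ᵇ n)
≤ᵇ-suc zero    n = refl
≤ᵇ-suc (suc m) n = refl

extend-head : ∀ {n s w} → Letters n s → ∀ b k → ∃ λ s′ → (extend n (s ∷ w) b k ≡ s′ ∷ extend n w b k) × (minL s′ ≡ minL s)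
extend-head {w = []}    p true  k = _ , refl , minL-∷ʳ p
extend-head {w = []}    p false k = _ , refl , refl
extend-head {w = _ ∷ _} p b     k = _ , refl , refl

zipAll-extend-∷ : ∀ {n s w w₂} → Letters n s → All (Letters n) w₂ → ∀ b b₂ k k₂ → length w₂ + k₂ ≤ suc (length w + k) →
  extend n (s ∷ w) b k ≡ s ∷ extend n w b k →
  (∀ {w₂} → All (Letters n) w₂ → ∀ b₂ k₂ → length w₂ + k₂ ≤ length w + k →
    zipAll maxmin< (extend n w b k) (extend n w₂ b₂ k₂) ≡ zipAll maxmin< w w₂ ∧ ((length w₂ + k₂ ≤ᵇ length w) ∧ (if b then length w₂ + k₂ <ᵇ length w else true))) →
  zipAll maxmin< (extend n (s ∷ w) b k) (extend n w₂ b₂ k₂) ≡ zipAll maxmin< (s ∷ w) w₂ ∧ ((length w₂ + k₂ ≤ᵇ suc (length w)) ∧ (if b then length w₂ + k₂ <ᵇ suc (length w) else true))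
zipAll-extend-∷ p [] true  b₂ k zero q eq ih rewrite eq = refl
zipAll-extend-∷ p [] false b₂ k zero q eq ih rewrite eq = refl
zipAll-extend-∷ {n} {s} {w} p [] b b₂ k (suc k₂) q eq ih rewrite eq | <ᵇ-true (s≤s (maxL-bounded (bounded p))) | ≤ᵇ-suc k₂ (length w) =
  trans (ih [] b₂ k₂ (≤-pred q)) (cong (_∧ ((k₂ ≤ᵇ length w) ∧ (if b then k₂ <ᵇ length w else true))) (zipAll-[] maxmin< w))
zipAll-extend-∷ {n} {s} {w} {s₂ ∷ w₂} p (p₂ ∷ ps₂) b b₂ k k₂ q eq ih with extend-head {w = w₂} p₂ b₂ k₂
... | s′ , e , m rewrite eq | e | m | ≤ᵇ-suc (length w₂ + k₂) (length w) =
  trans (cong (maxmin< s s₂ ∧_) (ih ps₂ b₂ k₂ (≤-pred q))) (sym (∧-assoc (maxmin< s s₂) (zipAll maxmin< w w₂) _))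

-- An unmarked old cell above a cell {n + 1} satisfies strictness automatically, and a cell
-- containing n + 1 with any cell below it violates it. Beyond the condition on the old parts only
-- the lengths matter.
zipAll-extend : ∀ {n} {w w₂} → All (Letters n) w → All (Letters n) w₂ → ∀ b b₂ k k₂ → (b ≡ true → 0 < length w) → length w₂ + k₂ ≤ length w + k →
  zipAll maxmin< (extend n w b k) (extend n w₂ b₂ k₂) ≡ zipAll maxmin< w w₂ ∧ ((length w₂ + k₂ ≤ᵇ length w) ∧ (if b then length w₂ + k₂ <ᵇ length w else true))
zipAll-extend {w = []} p p₂ true b₂ k k₂ h q with () ← h refl
zipAll-extend {w = []} p [] false b₂ k zero h q = zipAll-[] maxmin< (replicate k _)
zipAll-extend {n} {w = []} p [] false b₂ (suc k) (suc k₂) h q rewrite <ᵇ-false (≤-refl {suc n}) = refl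
zipAll-extend {n} {w = []} {s₂ ∷ []} p (p₂ ∷ []) false true (suc k) k₂ h q rewrite minL-∷ʳ p₂ | <ᵇ-false (m≤n⇒m≤1+n (minL-bounded p₂)) = refl
zipAll-extend {n} {w = []} {s₂ ∷ []} p (p₂ ∷ []) false false (suc k) k₂ h q rewrite <ᵇ-false (m≤n⇒m≤1+n (minL-bounded p₂)) = refl
zipAll-extend {n} {w = []} {s₂ ∷ _ ∷ _} p (p₂ ∷ _) false b₂ (suc k) k₂ h q rewrite <ᵇ-false (m≤n⇒m≤1+n (minL-bounded p₂)) = refl
zipAll-extend {n} {w = s ∷ []} (p ∷ []) [] true b₂ k zero h q = refl
zipAll-extend {n} {w = s ∷ []} (p ∷ []) [] true b₂ k (suc k₂) h q rewrite maxL-∷ʳ (bounded p) | <ᵇ-false (≤-refl {suc n}) = sym (∧-zeroʳ (k₂ <ᵇ 1))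
zipAll-extend {n} {w = s ∷ []} {s₂ ∷ []} (p ∷ []) (p₂ ∷ []) true true k k₂ h q rewrite maxL-∷ʳ (bounded p) | minL-∷ʳ p₂ | <ᵇ-false (m≤n⇒m≤1+n (minL-bounded p₂)) = sym (∧-falseʳ (maxmin< s s₂ ∧ true) (∧-falseʳ (suc k₂ ≤ᵇ 1) refl))
zipAll-extend {n} {w = s ∷ []} {s₂ ∷ []} (p ∷ []) (p₂ ∷ []) true false k k₂ h q rewrite maxL-∷ʳ (bounded p) | <ᵇ-false (m≤n⇒m≤1+n (minL-bounded p₂)) = sym (∧-falseʳ (maxmin< s s₂ ∧ true) (∧-falseʳ (suc k₂ ≤ᵇ 1) refl))
zipAll-extend {n} {w = s ∷ []} {s₂ ∷ w₂@(_ ∷ _)} (p ∷ []) (p₂ ∷ _) true b₂ k k₂ h q rewrite maxL-∷ʳ (bounded p) | <ᵇ-false (m≤n⇒m≤1+n (minL-bounded p₂)) = sym (∧-falseʳ (maxmin< s s₂ ∧ true) (∧-falseʳ (length (s₂ ∷ w₂) + k₂ ≤ᵇ 1) refl))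
zipAll-extend {n} {w = s ∷ []} (p ∷ []) p₂ false b₂ k k₂ h q = zipAll-extend-∷ p p₂ false b₂ k k₂ q refl (λ q₂ c₂ j₂ le → zipAll-extend [] q₂ false c₂ k j₂ (λ ()) le)
zipAll-extend {n} {w = s ∷ w@(_ ∷ _)} (p ∷ ps) p₂ b b₂ k k₂ h q = zipAll-extend-∷ p p₂ b b₂ k k₂ q refl (λ q₂ c₂ j₂ le → zipAll-extend ps q₂ b c₂ k j₂ (λ _ → s≤s z≤n) le)

eqList-∷ʳ : ∀ xs ys x y → length xs ≡ length ys → eqList (xs ∷ʳ x) (ys ∷ʳ y) ≡ eqList xs ys ∧ (x ≡ᵇ y)
eqList-∷ʳ []        []        x y e = ∧-identityʳ (x ≡ᵇ y)
eqList-∷ʳ (x′ ∷ xs) (y′ ∷ ys) x y e = trans (cong ((x′ ≡ᵇ y′) ∧_) (eqList-∷ʳ xs ys x y (suc-injective e))) (sym (∧-assoc (x′ ≡ᵇ y′) (eqList xs ys) (x ≡ᵇ y)))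

length-oneTo : ∀ n → length (oneTo n) ≡ n
length-oneTo n = trans (ListP.length-map suc (upTo n)) (ListP.length-upTo n)

map-cong-All : {A B : Set} {P : A → Set} {xs : List A} → All P xs → {f g : A → B} → (∀ {x} → P x → f x ≡ g x) → map f xs ≡ map g xs
map-cong-All []       h = refl
map-cong-All (p ∷ ps) h = cong₂ _∷_ (h p) (map-cong-All ps h)

any-∷ʳ : {A : Set} (p : A → Bool) (xs : List A) (y : A) → any p (xs ∷ʳ y) ≡ any p xs ∨ p y
any-∷ʳ p []       y with p y
... | true  = refl
... | false = refl
any-∷ʳ p (x ∷ xs) y with p x
... | true  = refl
... | false = any-∷ʳ p xs y

has-bounded : ∀ {n s} → All (_≤ n) s → has (suc n) s ≡ false
has-bounded []       = refl
has-bounded {n} {x ∷ s} (p ∷ ps) rewrite ≡ᵇ-false {x} {suc n} (λ e → 1+n≰n (subst (_≤ n) e p)) = has-bounded ps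

countᵇ-replicate : {A : Set} (q : A → Bool) (k : ℕ) (v : A) → countᵇ q (replicate k v) ≡ (if q v then k else 0)
countᵇ-replicate q zero    v with q v
... | true  = refl
... | false = refl
countᵇ-replicate q (suc k) v with q v in eq
... | true  = cong suc (trans (countᵇ-replicate q k v) (cong (λ z → if z then k else 0) eq))
... | false = trans (countᵇ-replicate q k v) (cong (λ z → if z then k else 0) eq)

count-extend-old : ∀ {n r} → r ≤ n → ∀ w b k → countᵇ (has r) (extend n w b k) ≡ countᵇ (has r) w
count-extend-old {n} {r} r≤n = go
  where
  other : (suc n ≡ᵇ r) ≡ false
  other = ≡ᵇ-false (λ e → 1+n≰n (subst (_≤ n) (sym e) r≤n))
  tops : ∀ k → countᵇ (has r) (replicate k (suc n ∷ [])) ≡ 0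
  tops k = trans (countᵇ-replicate (has r) k (suc n ∷ [])) (cong (λ z → if z ∨ false then k else 0) other)
  same : ∀ s → has r (s ∷ʳ suc n) ≡ has r s
  same s = trans (any-∷ʳ (λ e → e ≡ᵇ r) s (suc n)) (trans (cong (has r s ∨_) other) (∨-identityʳ (has r s)))
  go : ∀ w b k → countᵇ (has r) (extend n w b k) ≡ countᵇ (has r) w
  go []          b     k = tops k
  go (s ∷ [])    true  k = trans (countᵇ-∷ (has r) (s ∷ʳ suc n) _) (trans (cong₂ (λ x y → (if x then 1 else 0) + y) (same s) (tops k)) (sym (countᵇ-∷ (has r) s [])))
  go (s ∷ [])    false k = trans (countᵇ-∷ (has r) s _) (trans (cong (λ z → (if has r s then 1 else 0) + z) (tops k)) (sym (countᵇ-∷ (has r) s [])))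
  go (s ∷ t ∷ w) b     k = trans (countᵇ-∷ (has r) s _) (trans (cong (λ z → (if has r s then 1 else 0) + z) (go (t ∷ w) b k)) (sym (countᵇ-∷ (has r) s (t ∷ w))))

count-extend-new : ∀ {n w} → All (Letters n) w → ∀ b k → (b ≡ true → 0 < length w) → countᵇ (has (suc n)) (extend n w b k) ≡ b2n b + k
count-extend-new {n} = go
  where
  tops : ∀ k → countᵇ (has (suc n)) (replicate k (suc n ∷ [])) ≡ k
  tops k = trans (countᵇ-replicate (has (suc n)) k (suc n ∷ [])) (cong (λ z → if z ∨ false then k else 0) (≡ᵇ-refl n))
  go : ∀ {w} → All (Letters n) w → ∀ b k → (b ≡ true → 0 < length w) → countᵇ (has (suc n)) (extend n w b k) ≡ b2n b + k
  go []            true  k h with () ← h refl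
  go []            false k h = tops k
  go {s ∷ []} (p ∷ []) true  k h = trans (countᵇ-∷ (has (suc n)) (s ∷ʳ suc n) _) (cong₂ (λ x y → (if x then 1 else 0) + y)
    (trans (any-∷ʳ (λ e → e ≡ᵇ suc n) s (suc n)) (trans (cong₂ _∨_ (has-bounded (bounded p)) (≡ᵇ-refl n)) refl)) (tops k))
  go {s ∷ []} (p ∷ []) false k h = trans (countᵇ-∷ (has (suc n)) s _) (cong₂ (λ x y → (if x then 1 else 0) + y) (has-bounded (bounded p)) (tops k))
  go {s ∷ _ ∷ _} (p ∷ ps@(_ ∷ _)) b k h = trans (countᵇ-∷ (has (suc n)) s _) (cong₂ (λ x y → (if x then 1 else 0) + y) (has-bounded (bounded p)) (go ps b k (λ _ → s≤s z≤n)))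

sum-map-+ : {A : Set} (f g : A → ℕ) (xs : List A) → sum (map (λ x → f x + g x) xs) ≡ sum (map f xs) + sum (map g xs)
sum-map-+ f g []       = refl
sum-map-+ f g (x ∷ xs) = trans (cong (λ z → f x + g x + z) (sum-map-+ f g xs)) (ℕ+.interchange (f x) (g x) (sum (map f xs)) (sum (map g xs)))

content-new : ∀ {n ls x} → Extended n ls x → contentT (suc n) (new n x) ≡ contentT n (old x) ∷ʳ marks x
content-new {n} {ls} {x} v = begin
  map (λ r → countT (has r) (new n x)) (oneTo (suc n))
    ≡⟨ trans (cong (map (λ r → countT (has r) (new n x))) (oneTo-suc n)) (ListP.map-++ _ (oneTo n) (suc n ∷ [])) ⟩
  map (λ r → countT (has r) (new n x)) (oneTo n) ∷ʳ countT (has (suc n)) (new n x)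
    ≡⟨ cong₂ _∷ʳ_ (map-cong-All (oneTo-bounded n) (λ { (_ , r≤n) → olds r≤n x })) (news v) ⟩
  map (λ r → countT (has r) (old x)) (oneTo n) ∷ʳ marks x ∎
  where
  olds : ∀ {r} → r ≤ n → ∀ x → countT (has r) (new n x) ≡ countT (has r) (old x)
  olds r≤n []                = refl
  olds r≤n ((w , b , k) ∷ x) = cong₂ _+_ (count-extend-old r≤n w b k) (olds r≤n x)
  news : ∀ {ls x} → Extended n ls x → countT (has (suc n)) (new n x) ≡ marks x
  news []            = refl
  news (row p _ h v) = cong₂ _+_ (count-extend-new p _ _ h) (news v)

lengths : {V : Set} → List (List V) → List ℕ
lengths = map length

length-∷ʳ : ∀ (s : List ℕ) y → length (s ∷ʳ y) ≡ suc (length s)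
length-∷ʳ s y = trans (ListP.length-++ s) (ℕ.+-comm (length s) 1)

sum-length-replicate : ∀ k (y : ℕ) → sum (map length (replicate k (y ∷ []))) ≡ k
sum-length-replicate zero    y = refl
sum-length-replicate (suc k) y = cong suc (sum-length-replicate k y)

entries-extend : ∀ n w b k → (b ≡ true → 0 < length w) → sum (map length (extend n w b k)) ≡ sum (map length w) + (b2n b + k)
entries-extend n []          true  k h with () ← h refl
entries-extend n []          false k h = sum-length-replicate k (suc n)
entries-extend n (s ∷ [])    true  k h = trans (cong₂ _+_ (length-∷ʳ s (suc n)) (sum-length-replicate k (suc n))) (shuffle (length s) k)
  where
  shuffle : ∀ a k → suc a + k ≡ (a + 0) + suc k
  shuffle = ℕSolver.solve-∀
entries-extend n (s ∷ [])    false k h = cong₂ _+_ (sym (ℕ.+-identityʳ (length s))) (sum-length-replicate k (suc n))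
entries-extend n (s ∷ t ∷ w) b     k h = trans (cong (λ z → length s + z) (entries-extend n (t ∷ w) b k (λ _ → s≤s z≤n))) (sym (ℕ.+-assoc (length s) _ _))

letters-length : ∀ {n w} → All (Letters n) w → length w ≤ sum (map length w)
letters-length [] = z≤n
letters-length {w = (x ∷ s) ∷ w} (p ∷ ps) = s≤s (≤-trans (letters-length ps) (m≤n+m _ (length s)))

-- A cell {n + 1} adds one entry and one cell, so only the marks on old cells add to the excess. The
-- tableaux have at least as many entries as cells, which makes the truncated subtractions exact.
entries-new : ∀ {n ls x} → Extended n ls x → sign (entriesT (new n x) ∸ sum ls) ≡ sign (bits x) *ℤ sign (entriesT (old x) ∸ sum (lengths (old x)))
entries-new {n} {ls} {x} v = trans (cong sign (trans (cong₂ _∸_ (total v) (size≡ v)) difference)) (trans (cong sign (ℕ.+-comm (e′ ∸ r′) (bits x))) (sign-+ (bits x) (e′ ∸ r′)))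
  where
  e′ = entriesT (old x)
  r′ = sum (lengths (old x))
  K : List ERow → ℕ
  K x = sum (map (λ (w , b , k) → k) x)
  shuffle : ∀ a b c d → (a + b) + (c + d) ≡ (a + c) + (b + d)
  shuffle = ℕSolver.solve-∀
  total : ∀ {ls x} → Extended n ls x → entriesT (new n x) ≡ entriesT (old x) + marks x
  total []                                     = refl
  total (row {w = w} {b} {k} {x} p e h v) = trans (cong₂ _+_ (entries-extend n w b k h) (total v)) (shuffle (sum (map length w)) (b2n b + k) (entriesT (old x)) (marks x))
  size≡ : ∀ {ls x} → Extended n ls x → sum ls ≡ sum (lengths (old x)) + K x
  size≡ []                                     = refl
  size≡ (row {w = w} {b} {k} {x} p e h v) = trans (cong₂ _+_ (sym e) (size≡ v)) (shuffle (length w) k (sum (lengths (old x))) (K x))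
  enough : ∀ {ls x} → Extended n ls x → sum (lengths (old x)) ≤ entriesT (old x)
  enough []            = z≤n
  enough (row p _ _ v) = +-mono-≤ (letters-length p) (enough v)
  difference : (e′ + marks x) ∸ (r′ + K x) ≡ (e′ ∸ r′) + bits x
  difference = trans (cong (λ z → (e′ + z) ∸ (r′ + K x)) (sum-map-+ (λ (w , b , k) → b2n b) (λ (w , b , k) → k) x))
    (trans (sub-+ (enough v) (m≤n+m (K x) (bits x))) (cong (λ z → (e′ ∸ r′) + z) (m+n∸n≡m (bits x) (K x))))

cols-new : ∀ {n L u ls x} → Box L u ls → Extended n ls x → cols (new n x) ≡ cols (old x) ∧ interlaced ls x
cols-new []      []                                     = refl
cols-new (p ∷ b) (row {l} {ls} {w} {b₁} {k} {x} q e h v) = trans (cong₂ _∧_ (first b v) (cols-new b v)) (∧-interchange (zipAll maxmin< w (headRow (old x))) _ (cols (old x)) (interlaced ls x))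
  where
  first : ∀ {L ls x} → Box L l ls → Extended _ ls x → zipAll maxmin< (extend _ w b₁ k) (headRow (new _ x)) ≡ zipAll maxmin< w (headRow (old x)) ∧ ((nxt ls ≤ᵇ length w) ∧ (if b₁ then nxt ls <ᵇ length w else true))
  first [] [] = trans (zipAll-[] maxmin< (extend _ w b₁ k)) (sym (trans (cong (_∧ (true ∧ (if b₁ then 0 <ᵇ length w else true))) (zipAll-[] maxmin< w)) (marked b₁ h)))
    where
    marked : ∀ b → (b ≡ true → 0 < length w) → (if b then 0 <ᵇ length w else true) ≡ true
    marked true  h = <ᵇ-true (h refl)
    marked false h = refl
  first (p₂ ∷ _) (row {b = b₂} {k₂} q₂ refl h₂ _) = zipAll-extend q q₂ b₁ b₂ k k₂ h (subst (_ ≤_) (sym e) p₂)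

-- The size is read off the tableau, so the weight no longer refers to the shape over which the
-- transfer operator sums.
svtWeight′ : ℕ → List ℕ → List (List (List ℕ)) → ℤ
svtWeight′ n a t = svtWeight n a (sum (lengths t)) t

sumT-cong : {V : Set} {P : V → Set} {vs : List V} → All P vs → ∀ ls {F H : List (List V) → ℤ} → (∀ {t} → lengths t ≡ ls → All (All P) t → F t ≡ H t) → sumT ls vs F ≡ sumT ls vs H
sumT-cong ps []       h = h refl []
sumT-cong ps (l ∷ ls) h = sumW-cong ps l (λ p e → sumT-cong ps ls (λ e′ ps → h (cong₂ _∷_ e e′) (p ∷ ps)))

-- The branching rule of G for its largest letter: old parts of the rows form the smaller tableau,
-- `interlaced` is the strip condition, and `marks` is the exponent of the new letter.
G-∷ʳ : ∀ {L u ls} → Box L u ls → ∀ a m → G ls (a ∷ʳ m) ≡ Ac m (λ ρ → G ρ a) ls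
G-∷ʳ {ls = ls} b a m = begin
  G ls (a ∷ʳ m)
    ≡⟨ G-sumT ls (a ∷ʳ m) ⟩
  sumT ls (nonemptySubsets (length (a ∷ʳ m))) (svtWeight (length (a ∷ʳ m)) (a ∷ʳ m) (sum ls))
    ≡⟨ cong (λ z → sumT ls (nonemptySubsets z) (svtWeight z (a ∷ʳ m) (sum ls))) (length-∷ʳ a m) ⟩
  sumT ls (nonemptySubsets (suc n)) (svtWeight (suc n) (a ∷ʳ m) (sum ls))
    ≡⟨ respects (sumT-linear (nonemptySubsets (suc n)) ls) (λ t → trans (cong (λ z → when (z ∧ eqList (contentT (suc n) t) (a ∷ʳ m)) (sign (entriesT t ∸ sum ls))) (svt-split t)) (peel (allLinked t) (cols t) _ _)) ⟩
  sumT ls (nonemptySubsets (suc n)) (λ t → when (allLinked t) (Φ t))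
    ≡⟨ sumT-extend n ls Φ ⟩
  sumX n ls (λ x → when (allLinked (old x)) (Φ (new n x)))
    ≡⟨ sumX-cong n ls pointwise ⟩
  sumX n ls (λ x → when (interlaced ls x) (sign (bits x) *ℤ when (marks x ≡ᵇ m) (svtWeight′ n a (old x))))
    ≡⟨ sym (op-sumX b n (λ t e → when (e ≡ᵇ m) (svtWeight′ n a t)) 0) ⟩
  op true (λ ρ e → sumT ρ (nonemptySubsets n) (λ t → when (e ≡ᵇ m) (svtWeight′ n a t))) ls 0
    ≡⟨ respects (op-linear true ls 0) (λ (ρ , e) → trans (linear-when (sumT-linear (nonemptySubsets n) ρ) (e ≡ᵇ m) (svtWeight′ n a))
         (cong (when (e ≡ᵇ m)) (trans (sumT-cong (nonemptySubsets-letters n) ρ (λ {t} e _ → cong (λ z → svtWeight n a (sum z) t) e)) (sym (G-sumT ρ a))))) ⟩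
  Ac m (λ ρ → G ρ a) ls ∎
  where
  n = length a
  Φ : List (List (List ℕ)) → ℤ
  Φ t = when (cols t ∧ eqList (contentT (suc n) t) (a ∷ʳ m)) (sign (entriesT t ∸ sum ls))
  peel : ∀ a b c x → when ((a ∧ b) ∧ c) x ≡ when a (when (b ∧ c) x)
  peel true  b c x = refl
  peel false b c x = refl
  pointwise : ∀ {x} → Extended n ls x → when (allLinked (old x)) (Φ (new n x)) ≡ when (interlaced ls x) (sign (bits x) *ℤ when (marks x ≡ᵇ m) (svtWeight′ n a (old x)))
  pointwise {x} v = begin
    when (allLinked (old x)) (when (cols (new n x) ∧ eqList (contentT (suc n) (new n x)) (a ∷ʳ m)) (sign (entriesT (new n x) ∸ sum ls)))
      ≡⟨ cong (when (allLinked (old x))) (cong₂ when (cong₂ _∧_ (cols-new b v) (trans (cong (λ z → eqList z (a ∷ʳ m)) (content-new v)) (eqList-∷ʳ (contentT n (old x)) a (marks x) m (trans (ListP.length-map _ (oneTo n)) (length-oneTo n))))) (entries-new v)) ⟩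
    when (allLinked (old x)) (when ((cols (old x) ∧ interlaced ls x) ∧ (eqList (contentT n (old x)) a ∧ (marks x ≡ᵇ m))) (sign (bits x) *ℤ s))
      ≡⟨ arrange (allLinked (old x)) (cols (old x)) (interlaced ls x) (eqList (contentT n (old x)) a) (marks x ≡ᵇ m) (sign (bits x)) s ⟩
    when (interlaced ls x) (sign (bits x) *ℤ when (marks x ≡ᵇ m) (when ((allLinked (old x) ∧ cols (old x)) ∧ eqList (contentT n (old x)) a) s))
      ≡⟨ cong (λ z → when (interlaced ls x) (sign (bits x) *ℤ when (marks x ≡ᵇ m) (when (z ∧ eqList (contentT n (old x)) a) s))) (sym (svt-split (old x))) ⟩
    when (interlaced ls x) (sign (bits x) *ℤ when (marks x ≡ᵇ m) (svtWeight′ n a (old x))) ∎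
    where
    s = sign (entriesT (old x) ∸ sum (lengths (old x)))
    arrange : ∀ a b c d e x y → when a (when ((b ∧ c) ∧ (d ∧ e)) (x *ℤ y)) ≡ when c (x *ℤ when e (when ((a ∧ b) ∧ d) y))
    arrange true  true  true  true  true  x y = refl
    arrange true  true  true  true  false x y = sym (ℤ.*-zeroʳ x)
    arrange true  true  true  false e     x y = sym (trans (cong (x *ℤ_) (when-0 e)) (ℤ.*-zeroʳ x))
    arrange true  true  false d     e     x y = refl
    arrange true  false c     d     e     x y = sym (trans (cong (when c) (trans (cong (x *ℤ_) (when-0 e)) (ℤ.*-zeroʳ x))) (when-0 c))
    arrange false b     c     d     e     x y = sym (trans (cong (when c) (trans (cong (x *ℤ_) (when-0 e)) (ℤ.*-zeroʳ x))) (when-0 c))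


sumT-[] : {V : Set} (ls : List ℕ) (F : List (List V) → ℤ) (c : ℤ) → F (map (λ _ → []) ls) ≡ c → sumT ls [] F ≡ when (sum ls ≡ᵇ 0) c
sumT-[] []           F c e = e
sumT-[] (zero ∷ ls)  F c e = sumT-[] ls (λ t → F ([] ∷ t)) c e
sumT-[] (suc l ∷ ls) F c e = refl

G-[] : ∀ ls → G ls [] ≡ δ∅ ls
G-[] ls = begin
  G ls []
    ≡⟨ G-sumT ls [] ⟩
  sumT ls [] (svtWeight 0 [] (sum ls))
    ≡⟨ sumT-[] ls (svtWeight 0 [] (sum ls)) (+ 1) (trans (cong₂ (λ x y → when (x ∧ true) (sign (y ∸ sum ls))) (svt-empty ls) (entries-empty ls)) (cong sign (0∸n≡0 (sum ls)))) ⟩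
  δ∅ ls ∎
  where
  svt-empty : ∀ (ls : List ℕ) → svt (map (λ _ → []) ls) ≡ true
  svt-empty []       = refl
  svt-empty (_ ∷ ls) = svt-empty ls
  entries-empty : ∀ (ls : List ℕ) → entriesT (map (λ _ → []) ls) ≡ 0
  entries-empty []       = refl
  entries-empty (_ ∷ ls) = entries-empty ls

-- Induction on words from the right, matching the removal of the largest letter.
snoc-induction : (Q : List ℕ → Set) → Q [] → (∀ a m → Q a → Q (a ∷ʳ m)) → ∀ a → Q a
snoc-induction Q base step a = subst Q (ListP.reverse-involutive a) (go (reverse a))
  where
  go : ∀ a → Q (reverse a)
  go []      = base
  go (m ∷ a) = subst Q (sym (ListP.unfold-reverse m a)) (step (reverse a) m (go a))

AA-∷ʳ : ∀ a m g → AA (a ∷ʳ m) g ≡ Ac m (AA a g)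
AA-∷ʳ []       m g = refl
AA-∷ʳ (x ∷ a) m g = AA-∷ʳ a m (Ac x g)

Ac-cong : ∀ {L u ls} → Box L u ls → ∀ m {f g} → (∀ {ρ} → Box L u ρ → f ρ ≡ g ρ) → Ac m f ls ≡ Ac m g ls
Ac-cong b m h = op-cong true b (λ bρ e → cong (when (e ≡ᵇ m)) (h bρ)) 0

G-grothendieck : ∀ a {L u ls} → Box L u ls → G ls a ≡ grothendieck a ls
G-grothendieck = snoc-induction (λ a → ∀ {L u ls} → Box L u ls → G ls a ≡ grothendieck a ls)
  (λ {_} {_} {ls} b → G-[] ls)
  (λ a m ih {_} {_} {ls} b → trans (G-∷ʳ b a m) (trans (Ac-cong b m ih) (cong (λ f → f ls) (sym (AA-∷ʳ a m δ∅)))))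

-- Valued-set tableaux and the transfer operator of j

Entry : Set
Entry = ℕ × Bool

entryLetters : ℕ → List Entry
entryLetters n = concatMap (λ v → (v , false) ∷ (v , true) ∷ []) (oneTo n)

-- A glue bit belongs to the lower of two cells but its condition involves both, so `downJ` attaches
-- it to the vertical pair; only the top row needs the separate condition `unglued`.
<-entry ≤-entry glueable downJ : Entry → Entry → Bool
<-entry (v , _) (w , _) = v <ᵇ w
≤-entry (v , _) (w , _) = v ≤ᵇ w
glueable (u , _) (v , g) = if g then u ≡ᵇ v else true
downJ u v = ≤-entry u v ∧ glueable u v

unglued : Entry → Bool
unglued (_ , g) = not g

counts : ℕ → Entry → Bool
counts r (v , g) = (v ≡ᵇ r) ∧ not g

linkedJ colsJ vst : List (List Entry) → Bool
linkedJ []      = true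
linkedJ (w ∷ t) = linked <-entry w ∧ linkedJ t
colsJ []      = true
colsJ (w ∷ t) = zipAll downJ w (headRow t) ∧ colsJ t
vst t = all unglued (headRow t) ∧ (linkedJ t ∧ colsJ t)

contentV : ℕ → List (List Entry) → List ℕ
contentV n t = map (λ r → countT (counts r) t) (oneTo n)

zipAll-∧ : {V : Set} (D O : V → V → Bool) (w w′ : List V) → zipAll (λ u v → D u v ∧ O u v) w w′ ≡ zipAll D w w′ ∧ zipAll O w w′
zipAll-∧ D O []      w′       = refl
zipAll-∧ D O (_ ∷ _) []       = refl
zipAll-∧ D O (v ∷ w) (v′ ∷ w′) = trans (cong ((D v v′ ∧ O v v′) ∧_) (zipAll-∧ D O w w′)) (∧-interchange (D v v′) (O v v′) (zipAll D w w′) (zipAll O w w′))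

ownJ : ℕ → ℕ → Maybe Entry → Entry → Bool
ownJ zero    j m (v , g) = not g
ownJ (suc i) j m (v , g) = if g then atM m (λ u → proj₁ u ≡ᵇ v) else true

isVST-vst : ∀ t → isVST (flatten 0 (offsets [] t)) ≡ vst t
isVST-vst t = trans (all-cong same f) (trans (Check.all-ok <-entry ≤-entry ownJ (λ _ _ _ → refl) (offsets [] t))
  (trans (check-structured <-entry ≤-entry glueable P₀ ownJ (λ _ _ _ → refl) 0 [] t (λ _ → refl) (λ j c v → sym (∧-identityʳ (unglued v))) below)
    (top t)))
  where
  f = flatten 0 (offsets [] t)
  P₀ : ℕ → Entry → Bool
  P₀ zero    v = unglued v
  P₀ (suc _) v = true
  same : ∀ cv → _ ≡ Check.ok <-entry ≤-entry ownJ (λ _ _ _ → refl) f cv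
  same ((zero , j) , (v , true))   = refl
  same ((zero , j) , (v , false))  = refl
  same ((suc i , j) , (v , true))  = cong (λ z → atCell f (suc i , suc j) (<-entry (v , true)) ∧ (atCell f (suc (suc i) , j) (≤-entry (v , true)) ∧ z)) (atCell-atM f (i , j) (λ w → proj₁ w ≡ᵇ v))
  same ((suc i , j) , (v , false)) = refl
  below : ∀ i j m v → ownJ (suc i) j m v ≡ P₀ (suc i) v ∧ atM m (λ u → glueable u v)
  below i j m        (v , true)  = refl
  below i j (just _) (v , false) = refl
  below i j nothing  (v , false) = refl
  shuffle : ∀ a b c d e f → (a ∧ (b ∧ c)) ∧ (d ∧ (e ∧ f)) ≡ c ∧ ((a ∧ e) ∧ ((b ∧ d) ∧ f))
  shuffle true  true  true  true  e f = refl
  shuffle true  true  true  false e f = sym (∧-zeroʳ e)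
  shuffle true  true  false d     e f = refl
  shuffle true  false true  d     e f = sym (∧-zeroʳ e)
  shuffle true  false false d     e f = refl
  shuffle false b     true  d     e f = refl
  shuffle false b     false d     e f = refl
  later : ∀ i w₀ t → structured <-entry ≤-entry glueable P₀ (suc i) w₀ t ≡ zipAll glueable w₀ (headRow t) ∧ (linkedJ t ∧ colsJ t)
  later i []       []      = refl
  later i (_ ∷ _)  []      = refl
  later i w₀       (w ∷ t) = trans (cong₂ (λ x y → (linked <-entry w ∧ (zipAll ≤-entry w (headRow t) ∧ (x ∧ zipAll glueable w₀ w))) ∧ y) (all-true w) (later (suc i) w t))
    (trans (shuffle (linked <-entry w) (zipAll ≤-entry w (headRow t)) (zipAll glueable w₀ w) (zipAll glueable w (headRow t)) (linkedJ t) (colsJ t))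
      (cong (λ z → zipAll glueable w₀ w ∧ ((linked <-entry w ∧ linkedJ t) ∧ (z ∧ colsJ t))) (sym (zipAll-∧ ≤-entry glueable w (headRow t)))))
  top : ∀ t → structured <-entry ≤-entry glueable P₀ 0 [] t ≡ vst t
  top []      = refl
  top (w ∷ t) = trans (cong₂ (λ x y → (linked <-entry w ∧ (zipAll ≤-entry w (headRow t) ∧ x)) ∧ y) (∧-identityʳ (all unglued w)) (later 0 w t))
    (trans (shuffle (linked <-entry w) (zipAll ≤-entry w (headRow t)) (all unglued w) (zipAll glueable w (headRow t)) (linkedJ t) (colsJ t))
      (cong (λ z → all unglued w ∧ ((linked <-entry w ∧ linkedJ t) ∧ (z ∧ colsJ t))) (sym (zipAll-∧ ≤-entry glueable w (headRow t)))))

+countᵇ : {A : Set} (p : A → Bool) (xs : List A) → + countᵇ p xs ≡ ∑ xs (λ x → when (p x) (+ 1))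
+countᵇ p []       = refl
+countᵇ p (x ∷ xs) with p x
... | true  = cong (+ 1 +ℤ_) (+countᵇ p xs)
... | false = trans (+countᵇ p xs) (sym (ℤ.+-identityˡ _))

vstWeight : ℕ → List ℕ → List (List Entry) → ℤ
vstWeight n a t = when (vst t ∧ eqList (contentV n t) a) (+ 1)

j-sumT : ∀ ls a → j ls a ≡ sumT ls (entryLetters (length a)) (vstWeight (length a) a)
j-sumT ls a = begin
  j ls a
    ≡⟨ +countᵇ _ (assignments (cells ls) us) ⟩
  ∑ (assignments (cells ls) us) F
    ≡⟨ cong (λ z → ∑ (assignments z us) F) (cells-cellsFrom ls) ⟩
  ∑ (assignments (cellsFrom 0 [] ls) us) F
    ≡⟨ ∑-assignments-cells us 0 [] ls F ⟩
  sumT ls us (λ t → F (flatten 0 (offsets [] t)))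
    ≡⟨ respects (sumT-linear us ls) (λ t → cong (λ z → when z (+ 1)) (cong₂ _∧_ (isVST-vst t) (cong (λ z → eqList z a) (ListP.map-cong (λ r → countᵇ-flatten (counts r) 0 t) (oneTo n))))) ⟩
  sumT ls us (vstWeight n a) ∎
  where
  n = length a
  us = entryLetters n
  F : List (Cell × Entry) → ℤ
  F T = when (isVST T ∧ eqList (vstContent n T) a) (+ 1)

∑-entryLetters-suc : ∀ n (F : Entry → ℤ) → ∑ (entryLetters (suc n)) F ≡ ∑ (entryLetters n) F +ℤ (F (suc n , false) +ℤ F (suc n , true))
∑-entryLetters-suc n F = begin
  ∑ (entryLetters (suc n)) F
    ≡⟨ trans (∑-concatMap pair (oneTo (suc n)) F) (trans (cong (λ z → ∑ z (λ v → ∑ (pair v) F)) (oneTo-suc n)) (∑-++ (oneTo n) (suc n ∷ []) (λ v → ∑ (pair v) F))) ⟩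
  ∑ (oneTo n) (λ v → ∑ (pair v) F) +ℤ (∑ (pair (suc n)) F +ℤ + 0)
    ≡⟨ cong₂ _+ℤ_ (sym (∑-concatMap pair (oneTo n) F)) (tidy (F (suc n , false)) (F (suc n , true))) ⟩
  ∑ (entryLetters n) F +ℤ (F (suc n , false) +ℤ F (suc n , true)) ∎
  where
  pair : ℕ → List Entry
  pair v = (v , false) ∷ (v , true) ∷ []
  tidy : ∀ a b → (a +ℤ (b +ℤ + 0)) +ℤ + 0 ≡ a +ℤ b
  tidy = solve-∀

entryLetters-bounded : ∀ n → All (λ v → proj₁ v ≤ n) (entryLetters n)
entryLetters-bounded n = go (oneTo-bounded n)
  where
  go : ∀ {xs} → All (λ k → 1 ≤ k × k ≤ n) xs → All (λ v → proj₁ v ≤ n) (concatMap (λ v → (v , false) ∷ (v , true) ∷ []) xs)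
  go []             = []
  go ((_ , p) ∷ ps) = p ∷ p ∷ go ps

-- Rows increase strictly, so n + 1 occurs at most once in a row, in the last cell, with either glue
-- bit. This is why the new cells form a vertical strip.
sumW-snoc : ∀ n l (F : List Entry → ℤ) → sumW l (entryLetters (suc n)) (λ w → when (linked <-entry w) (F w)) ≡
  sumW l (entryLetters n) (λ w → when (linked <-entry w) (F w)) +ℤ
  pre l (λ k → sumW k (entryLetters n) (λ w → when (linked <-entry w) (F (w ∷ʳ (suc n , false)) +ℤ F (w ∷ʳ (suc n , true)))))
sumW-snoc n zero    F = sym (ℤ.+-identityʳ _)
sumW-snoc n (suc l) F = begin
  ∑ us′ (λ v → X v)
    ≡⟨ ∑-entryLetters-suc n X ⟩
  ∑ us X +ℤ (X (suc n , false) +ℤ X (suc n , true))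
    ≡⟨ cong₂ _+ℤ_ (trans (∑-cong-All (entryLetters-bounded n) (λ {v} p → lower v p)) (additive (∑-is-linear us) _ _)) (cong₂ _+ℤ_ (upper false l) (upper true l)) ⟩
  (sumW (suc l) us (λ w → when (linked <-entry w) (F w)) +ℤ ∑ us (λ v → pre l (Y v))) +ℤ (top l false +ℤ top l true)
    ≡⟨ ℤ.+-assoc (sumW (suc l) us (λ w → when (linked <-entry w) (F w))) _ _ ⟩
  sumW (suc l) us (λ w → when (linked <-entry w) (F w)) +ℤ (∑ us (λ v → pre l (Y v)) +ℤ (top l false +ℤ top l true))
    ≡⟨ cong (sumW (suc l) us (λ w → when (linked <-entry w) (F w)) +ℤ_) (close l) ⟩
  sumW (suc l) us (λ w → when (linked <-entry w) (F w)) +ℤ sumW l us (λ w → when (linked <-entry w) (F (w ∷ʳ (suc n , false)) +ℤ F (w ∷ʳ (suc n , true)))) ∎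
  where
  us = entryLetters n
  us′ = entryLetters (suc n)
  X : Entry → ℤ
  X v = sumW l us′ (λ w → when (atM (head? w) (<-entry v) ∧ linked <-entry w) (F (v ∷ w)))
  Y : Entry → ℕ → ℤ
  Y v k = sumW k us (λ w → when (atM (head? w) (<-entry v) ∧ linked <-entry w) (F (v ∷ w ∷ʳ (suc n , false)) +ℤ F (v ∷ w ∷ʳ (suc n , true))))
  top : ℕ → Bool → ℤ
  top zero    g = F ((suc n , g) ∷ [])
  top (suc _) g = + 0
  upper : ∀ g l → sumW l us′ (λ w → when (atM (head? w) (<-entry (suc n , g)) ∧ linked <-entry w) (F ((suc n , g) ∷ w))) ≡ top l g
  upper g zero    = refl
  upper g (suc l) = trans (∑-cong-All (entryLetters-bounded (suc n)) (λ {v} p → trans (respects (sumW-linear us′ l) (λ w → cong (λ z → when (z ∧ (atM (head? w) (<-entry v) ∧ linked <-entry w)) (F ((suc n , g) ∷ v ∷ w))) (<ᵇ-false p))) (linear-zero (sumW-linear us′ l))))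
    (linear-zero (∑-is-linear us′))
  swap : ∀ a b x → when (a ∧ b) x ≡ when b (when a x)
  swap true  b x = refl
  swap false b x = sym (when-0 b)
  collect : ∀ a b x y → when b (when a x +ℤ when a y) ≡ when (a ∧ b) (x +ℤ y)
  collect true  b     x y = refl
  collect false b     x y = when-0 b
  head-snoc : ∀ v → proj₁ v ≤ n → ∀ w g → atM (head? (w ∷ʳ (suc n , g))) (<-entry v) ≡ atM (head? w) (<-entry v)
  head-snoc v p []      g = <ᵇ-true (s≤s p)
  head-snoc v p (_ ∷ _) g = refl
  lower : ∀ v → proj₁ v ≤ n → X v ≡ sumW l us (λ w → when (atM (head? w) (<-entry v) ∧ linked <-entry w) (F (v ∷ w))) +ℤ pre l (Y v)
  lower v p = trans (respects (sumW-linear us′ l) (λ w → swap (atM (head? w) (<-entry v)) (linked <-entry w) (F (v ∷ w))))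
    (trans (sumW-snoc n l (λ w → when (atM (head? w) (<-entry v)) (F (v ∷ w)))) (cong₂ _+ℤ_ (respects (sumW-linear us l) (λ w → sym (swap (atM (head? w) (<-entry v)) (linked <-entry w) (F (v ∷ w)))))
      (pre-cong l (λ k _ → respects (sumW-linear us k) (λ w → trans (cong₂ (λ x y → when (linked <-entry w) (when x (F (v ∷ w ∷ʳ (suc n , false))) +ℤ when y (F (v ∷ w ∷ʳ (suc n , true))))) (head-snoc v p w false) (head-snoc v p w true))
        (collect (atM (head? w) (<-entry v)) (linked <-entry w) _ _))))))
  close : ∀ l → ∑ us (λ v → pre l (Y v)) +ℤ (top l false +ℤ top l true) ≡ sumW l us (λ w → when (linked <-entry w) (F (w ∷ʳ (suc n , false)) +ℤ F (w ∷ʳ (suc n , true))))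
  close zero    = trans (cong (_+ℤ (top 0 false +ℤ top 0 true)) (linear-zero (∑-is-linear us))) (ℤ.+-identityˡ _)
  close (suc k) = ℤ.+-identityʳ _

-- The second component tells whether the row ends in a cell n + 1 and, if so, gives the glue bit of
-- that cell.
JRow : Set
JRow = List Entry × Maybe Bool

snocJ : ℕ → List Entry → Maybe Bool → List Entry
snocJ n w nothing  = w
snocJ n w (just g) = w ∷ʳ (suc n , g)

oldJ : List JRow → List (List Entry)
oldJ = map proj₁

newJ : ℕ → List JRow → List (List Entry)
newJ n = map (λ (w , o) → snocJ n w o)

freshGroup : Maybe Bool → ℕ
freshGroup (just false) = 1
freshGroup _            = 0

marksJ : List JRow → ℕ
marksJ x = sum (map (λ (w , o) → freshGroup o) x)

sumY : ℕ → List ℕ → (List JRow → ℤ) → ℤ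
sumY n []       Ψ = Ψ []
sumY n (l ∷ ls) Ψ = sumW l (entryLetters n) (λ w → sumY n ls (λ x → Ψ ((w , nothing) ∷ x))) +ℤ
  pre l (λ k → sumW k (entryLetters n) (λ w → sumY n ls (λ x → Ψ ((w , just false) ∷ x)) +ℤ sumY n ls (λ x → Ψ ((w , just true) ∷ x))))

cellCount : Maybe Bool → ℕ
cellCount nothing  = 0
cellCount (just _) = 1

data ExtendedJ (n : ℕ) : List ℕ → List JRow → Set where
  []  : ExtendedJ n [] []
  row : ∀ {l ls w o x} → All (λ v → proj₁ v ≤ n) w → length w + cellCount o ≡ l → ExtendedJ n ls x → ExtendedJ n (l ∷ ls) ((w , o) ∷ x)

sumY-linear : ∀ n ls → Linear (sumY n ls)
sumY-linear n []       = linear-eval []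
sumY-linear n (l ∷ ls) = linear-+ (words l nothing) (pre-linear (λ k → both k) l)
  where
  us = entryLetters n
  words : ∀ k o → Linear (λ Ψ → sumW k us (λ w → sumY n ls (λ x → Ψ ((w , o) ∷ x))))
  words k o = linear-∘ (sumW-linear us k) (λ w → linear-precomp ((w , o) ∷_) (sumY-linear n ls))
  both : ∀ k → Linear (λ Ψ → sumW k us (λ w → sumY n ls (λ x → Ψ ((w , just false) ∷ x)) +ℤ sumY n ls (λ x → Ψ ((w , just true) ∷ x))))
  both k = linear-∘ (sumW-linear us k) (λ w → linear-+ (linear-precomp ((w , just false) ∷_) (sumY-linear n ls)) (linear-precomp ((w , just true) ∷_) (sumY-linear n ls)))

sumY-cong : ∀ n ls {Ψ Ψ′} → (∀ {x} → ExtendedJ n ls x → Ψ x ≡ Ψ′ x) → sumY n ls Ψ ≡ sumY n ls Ψ′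
sumY-cong n []       h = h []
sumY-cong n (l ∷ ls) h = cong₂ _+ℤ_
  (sumW-cong (entryLetters-bounded n) l (λ {w} p e → sumY-cong n ls (λ v → h (row p (trans (ℕ.+-identityʳ (length w)) e) v))))
  (pre-cong l (λ { k refl → sumW-cong (entryLetters-bounded n) k (λ {w} p e → cong₂ _+ℤ_
    (sumY-cong n ls (λ v → h (row p (trans (ℕ.+-comm (length w) 1) (cong suc e)) v)))
    (sumY-cong n ls (λ v → h (row p (trans (ℕ.+-comm (length w) 1) (cong suc e)) v)))) }))

sumT-snoc : ∀ n ls (Φ : List (List Entry) → ℤ) → sumT ls (entryLetters (suc n)) (λ t → when (linkedJ t) (Φ t)) ≡ sumY n ls (λ x → when (linkedJ (oldJ x)) (Φ (newJ n x)))
sumT-snoc n []       Φ = refl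
sumT-snoc n (l ∷ ls) Φ = begin
  sumW l us′ (λ w → sumT ls us′ (λ t → when (linked <-entry w ∧ linkedJ t) (Φ (w ∷ t))))
    ≡⟨ respects (sumW-linear us′ l) (λ w → trans (trans (respects (sumT-linear us′ ls) (λ t → sym (when-∧ (linked <-entry w) (linkedJ t) _))) (linear-when (sumT-linear us′ ls) (linked <-entry w) _))
         (cong (when (linked <-entry w)) (sumT-snoc n ls (λ t → Φ (w ∷ t))))) ⟩
  sumW l us′ (λ w → when (linked <-entry w) (Θ w))
    ≡⟨ sumW-snoc n l Θ ⟩
  sumW l us (λ w → when (linked <-entry w) (Θ w)) +ℤ pre l (λ k → sumW k us (λ w → when (linked <-entry w) (Θ (w ∷ʳ (suc n , false)) +ℤ Θ (w ∷ʳ (suc n , true)))))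
    ≡⟨ cong₂ _+ℤ_ (respects (sumW-linear us l) (λ w → inside w nothing)) (pre-cong l (λ k _ → respects (sumW-linear us k) (λ w → trans (spread (linked <-entry w) _ _) (cong₂ _+ℤ_ (inside w (just false)) (inside w (just true)))))) ⟩
  sumY n (l ∷ ls) (λ x → when (linkedJ (oldJ x)) (Φ (newJ n x))) ∎
  where
  us = entryLetters n
  us′ = entryLetters (suc n)
  Θ : List Entry → ℤ
  Θ w = sumY n ls (λ x → when (linkedJ (oldJ x)) (Φ (w ∷ newJ n x)))
  spread : ∀ a x y → when a (x +ℤ y) ≡ when a x +ℤ when a y
  spread true  x y = refl
  spread false x y = refl
  inside : ∀ w o → when (linked <-entry w) (Θ (snocJ n w o)) ≡ sumY n ls (λ x → when (linked <-entry w ∧ linkedJ (oldJ x)) (Φ (snocJ n w o ∷ newJ n x)))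
  inside w o = trans (sym (linear-when (sumY-linear n ls) (linked <-entry w) _)) (respects (sumY-linear n ls) (λ x → when-∧ (linked <-entry w) (linkedJ (oldJ x)) _))

notGlued occupied : Maybe Bool → Bool
notGlued (just true) = false
notGlued _           = true
occupied nothing  = false
occupied (just _) = true

-- `u` counts the old cells of the row above. A row of length at most `u` has only old cells above
-- it, so its n + 1 cannot be glued. A longer row has a cell below an n + 1, which must be n + 1 as
-- well, glued or not. These are the two branches of `tr`.
compatible : ℕ → ℕ → Maybe Bool → Bool
compatible u l o = if l ≤ᵇ u then notGlued o else occupied o

interlacedJ : ℕ → List ℕ → List JRow → Bool
interlacedJ u (l ∷ ls) ((w , o) ∷ x) = compatible u l o ∧ interlacedJ (length w) ls x
interlacedJ u _        _             = true

transferB-sumY : ∀ {L u ls} → Box L (suc u) ls → ∀ n (Ψ : List (List Entry) → ℕ → ℤ) e →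
  transferB u (λ ρ e → sumT ρ (entryLetters n) (λ t → Ψ t e)) ls e ≡ sumY n ls (λ x → when (interlacedJ u ls x) (Ψ (oldJ x) (e + marksJ x)))
transferB-sumY [] n Ψ e = cong (Ψ []) (sym (ℕ.+-identityʳ e))
transferB-sumY {suc L} {u} {l ∷ ls} (p ∷ b) n Ψ e = rows (m≤n⇒m<n∨m≡n p)
  where
  us = entryLetters n
  f : List ℕ → ℕ → ℤ
  f ρ e = sumT ρ us (λ t → Ψ t e)
  Z : List JRow → ℤ
  Z x = when (interlacedJ u (l ∷ ls) x) (Ψ (oldJ x) (e + marksJ x))
  row-sum : ∀ k e → Box L (suc k) ls → transferB k (λ ρ → f (k ∷ ρ)) ls e ≡ sumW k us (λ w → sumY n ls (λ x → when (interlacedJ k ls x) (Ψ (w ∷ oldJ x) (e + marksJ x))))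
  row-sum k e b = trans (linear-sumW us (tr-linear (+ 1) (+ 1) k ls e) k (λ w (ρ , e) → sumT ρ us (λ t → Ψ (w ∷ t) e))) (respects (sumW-linear us k) (λ w → transferB-sumY b n (λ t → Ψ (w ∷ t)) e))
  matched : ∀ k e′ o → Box L (suc k) ls → compatible u l o ≡ true → e′ ≡ e + freshGroup o → transferB k (λ ρ → f (k ∷ ρ)) ls e′ ≡ sumW k us (λ w → sumY n ls (λ x → Z ((w , o) ∷ x)))
  matched k e′ o b c refl = trans (row-sum k e′ b) (sumW-cong (entryLetters-bounded n) k (λ {w} _ len → respects (sumY-linear n ls) (λ x →
    cong₂ when (sym (trans (cong (_∧ interlacedJ (length w) ls x) c) (cong (λ z → interlacedJ z ls x) len))) (cong (Ψ (w ∷ oldJ x)) (ℕ.+-assoc e (freshGroup o) (marksJ x))))))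
  unmatched : ∀ k o → compatible u l o ≡ false → sumW k us (λ w → sumY n ls (λ x → Z ((w , o) ∷ x))) ≡ + 0
  unmatched k o c = trans (respects (sumW-linear us k) (λ w → trans (respects (sumY-linear n ls) (λ x → cong (λ z → when (z ∧ interlacedJ (length w) ls x) _) c)) (linear-zero (sumY-linear n ls)))) (linear-zero (sumW-linear us k))
  split : ∀ k → sumW k us (λ w → sumY n ls (λ x → Z ((w , just false) ∷ x)) +ℤ sumY n ls (λ x → Z ((w , just true) ∷ x))) ≡
    sumW k us (λ w → sumY n ls (λ x → Z ((w , just false) ∷ x))) +ℤ sumW k us (λ w → sumY n ls (λ x → Z ((w , just true) ∷ x)))
  split k = additive (sumW-linear us k) _ _
  1* : ∀ x → + 1 *ℤ x ≡ x
  1* = ℤ.*-identityˡ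
  rows : (l < suc u) ⊎ (l ≡ suc u) → transferB u f (l ∷ ls) e ≡ sumY n (l ∷ ls) Z
  rows (inj₁ (s≤s q)) = trans (tr-free (+ 1) (+ 1) ls f e q) (cong₂ _+ℤ_ (matched l e nothing (Box-weaken b (n≤1+n l)) (comp nothing refl) (sym (ℕ.+-identityʳ e)))
      (trans (1* _) (pre-cong l (λ { k refl → trans (matched k (suc e) (just false) b (comp (just false) refl) (ℕ.+-comm 1 e))
        (sym (trans (split k) (trans (cong (sumW k us (λ w → sumY n ls (λ x → Z ((w , just false) ∷ x))) +ℤ_) (unmatched k (just true) (comp (just true) refl))) (ℤ.+-identityʳ _)))) }))))
    where
    comp : ∀ o {c} → notGlued o ≡ c → compatible u l o ≡ c
    comp o e rewrite ≤ᵇ-true q = e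
  rows (inj₂ refl) = begin
    transferB u f (suc u ∷ ls) e
      ≡⟨ tr-forced (+ 1) (+ 1) u ls f e ⟩
    + 1 *ℤ transferB u (λ ρ → f (u ∷ ρ)) ls (suc e) +ℤ + 1 *ℤ transferB u (λ ρ → f (u ∷ ρ)) ls e
      ≡⟨ cong₂ _+ℤ_ (trans (1* _) (matched u (suc e) (just false) b (comp (just false) refl) (ℕ.+-comm 1 e))) (trans (1* _) (matched u e (just true) b (comp (just true) refl) (sym (ℕ.+-identityʳ e)))) ⟩
    sumW u us (λ w → sumY n ls (λ x → Z ((w , just false) ∷ x))) +ℤ sumW u us (λ w → sumY n ls (λ x → Z ((w , just true) ∷ x)))
      ≡⟨ sym (trans (cong (_+ℤ sumW u us (λ w → sumY n ls (λ x → Z ((w , just false) ∷ x)) +ℤ sumY n ls (λ x → Z ((w , just true) ∷ x)))) (unmatched (suc u) nothing (comp nothing refl))) (trans (ℤ.+-identityˡ _) (split u))) ⟩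
    sumY n (suc u ∷ ls) Z ∎
    where
    comp : ∀ o {c} → occupied o ≡ c → compatible u (suc u) o ≡ c
    comp o e rewrite ≤ᵇ-false (n<1+n u) = e

all-∷ʳ : {A : Set} (p : A → Bool) (xs : List A) (y : A) → all p (xs ∷ʳ y) ≡ all p xs ∧ p y
all-∷ʳ p []       y = ∧-identityʳ (p y)
all-∷ʳ p (x ∷ xs) y = trans (cong (p x ∧_) (all-∷ʳ p xs y)) (sym (∧-assoc (p x) (all p xs) (p y)))

zipAll-snoc : ∀ {n w w₂} → All (λ v → proj₁ v ≤ n) w → All (λ v → proj₁ v ≤ n) w₂ → ∀ o o₂ → length w₂ + cellCount o₂ ≤ length w + cellCount o →
  zipAll downJ (snocJ n w o) (snocJ n w₂ o₂) ≡ zipAll downJ w w₂ ∧ compatible (length w) (length w₂ + cellCount o₂) o₂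
zipAll-snoc {w = []} [] [] nothing  nothing  q = refl
zipAll-snoc {w = []} [] [] nothing  (just g) ()
zipAll-snoc {w = []} [] (_ ∷ _) nothing o₂ ()
zipAll-snoc {w = []} [] [] (just g) nothing  q = refl
zipAll-snoc {n} {w = []} [] [] (just g) (just false) q rewrite ≤ᵇ-true (≤-refl {suc n}) = refl
zipAll-snoc {n} {w = []} [] [] (just g) (just true)  q rewrite ≤ᵇ-true (≤-refl {suc n}) | ≡ᵇ-refl n = refl
zipAll-snoc {n} {w = []} {v ∷ []} [] (p ∷ []) (just g) nothing q rewrite ≤ᵇ-false (s≤s p) = refl
zipAll-snoc {n} {w = []} {v ∷ []} [] (p ∷ []) (just g) (just g₂) (s≤s ())
zipAll-snoc {n} {w = []} {v ∷ _ ∷ _} [] (p ∷ _) (just g) o₂ (s≤s ())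
zipAll-snoc {n} {w = v ∷ w} {[]} (p ∷ ps) [] o nothing q = zipAll-[] downJ (snocJ n (v ∷ w) o)
zipAll-snoc {n} {w = v ∷ w} {[]} (p ∷ ps) [] o (just g) q = trans (first o) (last g)
  where
  first : ∀ o → zipAll downJ (snocJ n (v ∷ w) o) ((suc n , g) ∷ []) ≡ downJ v (suc n , g)
  first nothing  = trans (cong (downJ v (suc n , g) ∧_) (zipAll-[] downJ w)) (∧-identityʳ _)
  first (just _) = trans (cong (downJ v (suc n , g) ∧_) (zipAll-[] downJ (w ∷ʳ _))) (∧-identityʳ _)
  last : ∀ g → downJ v (suc n , g) ≡ compatible (suc (length w)) 1 (just g)
  last true  rewrite ≤ᵇ-true (m≤n⇒m≤1+n p) = ≡ᵇ-false (<⇒≢ (s≤s p))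
  last false rewrite ≤ᵇ-true (m≤n⇒m≤1+n p) = refl
zipAll-snoc {n} {w = v ∷ w} {v₂ ∷ w₂} (p ∷ ps) (p₂ ∷ ps₂) o o₂ q = trans (heads o o₂) (trans (cong (downJ v v₂ ∧_) (zipAll-snoc ps ps₂ o o₂ (≤-pred q)))
  (trans (sym (∧-assoc (downJ v v₂) (zipAll downJ w w₂) _)) (cong (λ z → zipAll downJ (v ∷ w) (v₂ ∷ w₂) ∧ (if z then notGlued o₂ else occupied o₂)) (sym (≤ᵇ-suc (length w₂ + cellCount o₂) (length w))))))
  where
  heads : ∀ o o₂ → zipAll downJ (snocJ n (v ∷ w) o) (snocJ n (v₂ ∷ w₂) o₂) ≡ downJ v v₂ ∧ zipAll downJ (snocJ n w o) (snocJ n w₂ o₂)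
  heads nothing  nothing  = refl
  heads nothing  (just _) = refl
  heads (just _) nothing  = refl
  heads (just _) (just _) = refl

colsJ-new : ∀ {n L u ls x l w o} → Box L u (l ∷ ls) → ExtendedJ n (l ∷ ls) ((w , o) ∷ x) → colsJ (newJ n ((w , o) ∷ x)) ≡ colsJ (oldJ ((w , o) ∷ x)) ∧ interlacedJ (length w) ls x
colsJ-new {n} {w = w} {o} (p ∷ []) (row q e []) = trans (cong (_∧ true) (zipAll-[] downJ (snocJ n w o))) (sym (trans (∧-identityʳ _) (trans (∧-identityʳ _) (zipAll-[] downJ w))))
colsJ-new {n} {w = w} {o} (p ∷ b@(p₂ ∷ _)) (row q refl v@(row {w = w₂} {o₂} {x₂} q₂ refl _)) =
  trans (cong₂ _∧_ (zipAll-snoc q q₂ o o₂ p₂) (colsJ-new b v)) (∧-interchange (zipAll downJ w w₂) _ (colsJ (w₂ ∷ oldJ x₂)) _)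

top-new : ∀ {n L u ls x} → Box L u ls → ExtendedJ n ls x → all unglued (headRow (newJ n x)) ∧ colsJ (newJ n x) ≡ (all unglued (headRow (oldJ x)) ∧ colsJ (oldJ x)) ∧ interlacedJ u ls x
top-new []      [] = refl
top-new {n} {u = u} (p ∷ b) v@(row {l} {w = w} {o} q e _) = trans (cong₂ _∧_ (first o) (colsJ-new (p ∷ b) v)) (∧-interchange (all unglued w) _ _ _)
  where
  comp : ∀ o → compatible u l o ≡ notGlued o
  comp o rewrite ≤ᵇ-true p = refl
  first : ∀ o → all unglued (snocJ n w o) ≡ all unglued w ∧ compatible u l o
  first nothing      = sym (trans (cong (all unglued w ∧_) (comp nothing)) (∧-identityʳ _))
  first (just false) = trans (all-∷ʳ unglued w _) (cong (all unglued w ∧_) (sym (comp (just false))))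
  first (just true)  = trans (all-∷ʳ unglued w _) (cong (all unglued w ∧_) (sym (comp (just true))))

count-snoc : ∀ {n} r w o → countᵇ (counts r) (snocJ n w o) ≡ countᵇ (counts r) w + (if suc n ≡ᵇ r then freshGroup o else 0)
count-snoc {n} r w nothing with suc n ≡ᵇ r
... | true  = sym (ℕ.+-identityʳ _)
... | false = sym (ℕ.+-identityʳ _)
count-snoc {n} r w (just g) = trans (countᵇ-++ (counts r) w _) (cong (λ z → countᵇ (counts r) w + z) (trans (countᵇ-∷ (counts r) (suc n , g) []) (single (suc n ≡ᵇ r) g)))
  where
  single : ∀ b g → (if b ∧ not g then 1 else 0) + 0 ≡ (if b then freshGroup (just g) else 0)
  single true  true  = refl
  single true  false = refl
  single false g     = refl

count-bounded : ∀ {n w} → All (λ v → proj₁ v ≤ n) w → countᵇ (counts (suc n)) w ≡ 0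
count-bounded [] = refl
count-bounded {n} {(v , g) ∷ w} (p ∷ ps) rewrite ≡ᵇ-false {v} {suc n} (λ e → 1+n≰n (subst (_≤ n) e p)) = count-bounded ps

contentV-new : ∀ {n ls x} → ExtendedJ n ls x → contentV (suc n) (newJ n x) ≡ contentV n (oldJ x) ∷ʳ marksJ x
contentV-new {n} {ls} {x} v = begin
  map (λ r → countT (counts r) (newJ n x)) (oneTo (suc n))
    ≡⟨ trans (cong (map (λ r → countT (counts r) (newJ n x))) (oneTo-suc n)) (ListP.map-++ _ (oneTo n) (suc n ∷ [])) ⟩
  map (λ r → countT (counts r) (newJ n x)) (oneTo n) ∷ʳ countT (counts (suc n)) (newJ n x)
    ≡⟨ cong₂ _∷ʳ_ (map-cong-All (oneTo-bounded n) (λ { (_ , r≤n) → olds r≤n x })) (news v) ⟩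
  map (λ r → countT (counts r) (oldJ x)) (oneTo n) ∷ʳ marksJ x ∎
  where
  olds : ∀ {r} → r ≤ n → ∀ x → countT (counts r) (newJ n x) ≡ countT (counts r) (oldJ x)
  olds r≤n []            = refl
  olds {r} r≤n ((w , o) ∷ x) = cong₂ _+_ (trans (count-snoc r w o) (trans (cong (λ z → countᵇ (counts r) w + (if z then freshGroup o else 0)) (≡ᵇ-false {suc n} {r} (λ e → 1+n≰n (subst (_≤ n) (sym e) r≤n)))) (ℕ.+-identityʳ _))) (olds r≤n x)
  news : ∀ {ls x} → ExtendedJ n ls x → countT (counts (suc n)) (newJ n x) ≡ marksJ x
  news []                           = refl
  news (row {w = w} {o} p _ v) = cong₂ _+_ (trans (count-snoc (suc n) w o) (cong₂ _+_ (count-bounded p) (cong (λ z → if z then freshGroup o else 0) (≡ᵇ-refl n)))) (news v)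

j-∷ʳ : ∀ {N ls} → Box N N ls → ∀ a m → j ls (a ∷ʳ m) ≡ Bc N m (λ ρ → j ρ a) ls
j-∷ʳ {N} {ls} b a m = begin
  j ls (a ∷ʳ m)
    ≡⟨ j-sumT ls (a ∷ʳ m) ⟩
  sumT ls (entryLetters (length (a ∷ʳ m))) (vstWeight (length (a ∷ʳ m)) (a ∷ʳ m))
    ≡⟨ cong (λ z → sumT ls (entryLetters z) (vstWeight z (a ∷ʳ m))) (length-∷ʳ a m) ⟩
  sumT ls (entryLetters (suc n)) (vstWeight (suc n) (a ∷ʳ m))
    ≡⟨ respects (sumT-linear (entryLetters (suc n)) ls) (λ t → peel (all unglued (headRow t)) (linkedJ t) (colsJ t) _) ⟩
  sumT ls (entryLetters (suc n)) (λ t → when (linkedJ t) (Φ t))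
    ≡⟨ sumT-snoc n ls Φ ⟩
  sumY n ls (λ x → when (linkedJ (oldJ x)) (Φ (newJ n x)))
    ≡⟨ sumY-cong n ls pointwise ⟩
  sumY n ls (λ x → when (interlacedJ N ls x) (when (marksJ x ≡ᵇ m) (vstWeight n a (oldJ x))))
    ≡⟨ sym (transferB-sumY (Box-weaken b (n≤1+n N)) n (λ t e → when (e ≡ᵇ m) (vstWeight n a t)) 0) ⟩
  transferB N (λ ρ e → sumT ρ (entryLetters n) (λ t → when (e ≡ᵇ m) (vstWeight n a t))) ls 0
    ≡⟨ respects (tr-linear (+ 1) (+ 1) N ls 0) (λ (ρ , e) → trans (linear-when (sumT-linear (entryLetters n) ρ) (e ≡ᵇ m) (vstWeight n a)) (cong (when (e ≡ᵇ m)) (sym (j-sumT ρ a)))) ⟩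
  Bc N m (λ ρ → j ρ a) ls ∎
  where
  n = length a
  Φ : List (List Entry) → ℤ
  Φ t = when ((all unglued (headRow t) ∧ colsJ t) ∧ eqList (contentV (suc n) t) (a ∷ʳ m)) (+ 1)
  peel : ∀ a b c d → when ((a ∧ (b ∧ c)) ∧ d) (+ 1) ≡ when b (when ((a ∧ c) ∧ d) (+ 1))
  peel true  b c d = sym (trans (when-∧ b (c ∧ d) (+ 1)) (cong (λ z → when z (+ 1)) (sym (∧-assoc b c d))))
  peel false b c d = sym (when-0 b)
  pointwise : ∀ {x} → ExtendedJ n ls x → when (linkedJ (oldJ x)) (Φ (newJ n x)) ≡ when (interlacedJ N ls x) (when (marksJ x ≡ᵇ m) (vstWeight n a (oldJ x)))
  pointwise {x} v = trans (cong (when (linkedJ (oldJ x))) (cong (λ z → when z (+ 1)) (cong₂ _∧_ (top-new b v) (trans (cong (λ z → eqList z (a ∷ʳ m)) (contentV-new v)) (eqList-∷ʳ (contentV n (oldJ x)) a (marksJ x) m (trans (ListP.length-map _ (oneTo n)) (length-oneTo n)))))))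
    (arrange (linkedJ (oldJ x)) (all unglued (headRow (oldJ x))) (colsJ (oldJ x)) (interlacedJ N ls x) (eqList (contentV n (oldJ x)) a) (marksJ x ≡ᵇ m))
    where
    arrange : ∀ l t c i e m → when l (when (((t ∧ c) ∧ i) ∧ (e ∧ m)) (+ 1)) ≡ when i (when m (when ((t ∧ (l ∧ c)) ∧ e) (+ 1)))
    arrange true  true  true  true  true  m = refl
    arrange true  true  true  true  false m = sym (when-0 m)
    arrange true  true  true  false e     m = refl
    arrange true  true  false i     e     m = sym (trans (cong (when i) (when-0 m)) (when-0 i))
    arrange true  false c     i     e     m = sym (trans (cong (when i) (when-0 m)) (when-0 i))
    arrange false true  c     i     e     m = sym (trans (cong (when i) (when-0 m)) (when-0 i))
    arrange false false c     i     e     m = sym (trans (cong (when i) (when-0 m)) (when-0 i))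

j-[] : ∀ ls → j ls [] ≡ δ∅ ls
j-[] ls = trans (j-sumT ls []) (sumT-[] ls (vstWeight 0 []) (+ 1) (cong (λ z → when (z ∧ true) (+ 1)) (vst-empty ls)))
  where
  empty : ∀ (ls : List ℕ) → linkedJ (map (λ _ → []) ls) ∧ colsJ (map (λ _ → []) ls) ≡ true
  empty []       = refl
  empty (_ ∷ ls) = empty ls
  vst-empty : ∀ (ls : List ℕ) → vst (map (λ _ → []) ls) ≡ true
  vst-empty []       = refl
  vst-empty (l ∷ ls) = empty (l ∷ ls)

BB-∷ʳ : ∀ N a m g → BB N (a ∷ʳ m) g ≡ Bc N m (BB N a g)
BB-∷ʳ N []       m g = refl
BB-∷ʳ N (x ∷ a) m g = BB-∷ʳ N a m (Bc N x g)

j-dualGrothendieck : ∀ a {N ls} → Box N N ls → j ls a ≡ dualGrothendieck N a ls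
j-dualGrothendieck = snoc-induction (λ a → ∀ {N ls} → Box N N ls → j ls a ≡ dualGrothendieck N a ls)
  (λ {_} {ls} b → j-[] ls)
  (λ a m ih {N} {ls} b → trans (j-∷ʳ b a m) (trans (Bc-cong b m ih) (cong (λ f → f ls) (sym (BB-∷ʳ N a m δ∅)))))

-- Restricted plane partitions

geq : ℕ → ℕ → Bool
geq v w = w ≤ᵇ v

-- Labels k, …, k + n - 1 followed by the marker k + n, which stands for the cells of μ.
labels : ℕ → ℕ → List ℕ
labels k zero    = k ∷ []
labels k (suc n) = k ∷ labels (suc k) n

labels-≥ : ∀ k n → All (k ≤_) (labels k n)
labels-≥ k n = go k n ≤-refl
  where
  go : ∀ k n {b} → b ≤ k → All (b ≤_) (labels k n)
  go k zero    p = p ∷ []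
  go k (suc n) p = p ∷ go (suc k) n (m≤n⇒m≤1+n p)

sumW-bottom : ∀ k n l (F : List ℕ → ℤ) → sumW l (k ∷ labels (suc k) n) (λ w → when (atM (head? w) (geq k) ∧ linked geq w) (F w)) ≡ F (replicate l k)
sumW-bottom k n zero    F = refl
sumW-bottom k n (suc l) F = trans (cong₂ _+ℤ_
    (trans (respects (sumW-linear us l) (λ w → cong (λ z → when (z ∧ (atM (head? w) (geq k) ∧ linked geq w)) (F (k ∷ w))) (≤ᵇ-true (≤-refl {k})))) (sumW-bottom k n l (λ w → F (k ∷ w))))
    (trans (∑-cong-All (labels-≥ (suc k) n) (λ {v} p → trans (respects (sumW-linear us l) (λ w → cong (λ z → when (z ∧ (atM (head? w) (geq v) ∧ linked geq w)) (F (v ∷ w))) (≤ᵇ-false p))) (linear-zero (sumW-linear us l)))) (linear-zero (∑-is-linear (labels (suc k) n)))))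
  (ℤ.+-identityʳ _)
  where us = k ∷ labels (suc k) n

-- Rows decrease weakly, so the smallest label `k` fills a final segment of each row.
sumW-peel : ∀ k n l (F : List ℕ → ℤ) → sumW l (k ∷ labels (suc k) n) (λ w → when (linked geq w) (F w)) ≡
  sum< (suc l) (λ r → sumW r (labels (suc k) n) (λ w → when (linked geq w) (F (w ++ replicate (l ∸ r) k))))
sumW-peel k n zero    F = sym (ℤ.+-identityˡ _)
sumW-peel k n (suc l) F = begin
  X k +ℤ ∑ us X
    ≡⟨ cong₂ _+ℤ_ (sumW-bottom k n l (λ w → F (k ∷ w))) (∑-cong-All (labels-≥ (suc k) n) (λ {v} p → upper v p)) ⟩
  F (replicate (suc l) k) +ℤ ∑ us (λ v → sum< (suc l) (λ r → Y v r))
    ≡⟨ cong (F (replicate (suc l) k) +ℤ_) (linear-sum< (∑-is-linear us) (λ r v → Y v r) (suc l)) ⟩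
  F (replicate (suc l) k) +ℤ sum< (suc l) (λ r → ∑ us (λ v → Y v r))
    ≡⟨ sym (sum<-head (suc l) (λ r → sumW r us (λ w → when (linked geq w) (F (w ++ replicate (suc l ∸ r) k))))) ⟩
  sum< (suc (suc l)) (λ r → sumW r us (λ w → when (linked geq w) (F (w ++ replicate (suc l ∸ r) k)))) ∎
  where
  us = labels (suc k) n
  X : ℕ → ℤ
  X v = sumW l (k ∷ us) (λ w → when (atM (head? w) (geq v) ∧ linked geq w) (F (v ∷ w)))
  Y : ℕ → ℕ → ℤ
  Y v r = sumW r us (λ w → when (atM (head? w) (geq v) ∧ linked geq w) (F (v ∷ w ++ replicate (l ∸ r) k)))
  swap : ∀ a b x → when (a ∧ b) x ≡ when b (when a x)
  swap true  b x = refl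
  swap false b x = sym (when-0 b)
  head-append : ∀ v → suc k ≤ v → ∀ w c → atM (head? (w ++ replicate c k)) (geq v) ≡ atM (head? w) (geq v)
  head-append v p []      zero    = refl
  head-append v p []      (suc c) = ≤ᵇ-true (<⇒≤ p)
  head-append v p (_ ∷ _) c       = refl
  upper : ∀ v → suc k ≤ v → X v ≡ sum< (suc l) (Y v)
  upper v p = trans (respects (sumW-linear (k ∷ us) l) (λ w → swap (atM (head? w) (geq v)) (linked geq w) (F (v ∷ w))))
    (trans (sumW-peel k n l (λ w → when (atM (head? w) (geq v)) (F (v ∷ w)))) (sum<-cong (suc l) (λ r _ → respects (sumW-linear us r) (λ w →
      trans (cong (λ z → when (linked geq w) (when z (F (v ∷ w ++ replicate (l ∸ r) k)))) (head-append v p w (l ∸ r))) (sym (swap (atM (head? w) (geq v)) (linked geq w) _))))))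

PRow : Set
PRow = List ℕ × ℕ

oldP : List PRow → List (List ℕ)
oldP = map proj₁

newP : ℕ → List PRow → List (List ℕ)
newP k = map (λ (w , c) → w ++ replicate c k)

sumP : List ℕ → List ℕ → (List PRow → ℤ) → ℤ
sumP us []       Ψ = Ψ []
sumP us (l ∷ ls) Ψ = sum< (suc l) (λ r → sumW r us (λ w → sumP us ls (λ x → Ψ ((w , l ∸ r) ∷ x))))

sumP-linear : ∀ us ls → Linear (sumP us ls)
sumP-linear us []       = linear-eval []
sumP-linear us (l ∷ ls) = sum<-linear (λ r → linear-∘ (sumW-linear us r) (λ w → linear-precomp ((w , l ∸ r) ∷_) (sumP-linear us ls))) (suc l)

data ExtendedP (P : ℕ → Set) : List ℕ → List PRow → Set where
  []  : ExtendedP P [] []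
  row : ∀ {l ls w c x} → All P w → length w + c ≡ l → ExtendedP P ls x → ExtendedP P (l ∷ ls) ((w , c) ∷ x)

sumP-cong : ∀ {P us} → All P us → ∀ ls {Ψ Ψ′} → (∀ {x} → ExtendedP P ls x → Ψ x ≡ Ψ′ x) → sumP us ls Ψ ≡ sumP us ls Ψ′
sumP-cong ps []       h = h []
sumP-cong ps (l ∷ ls) h = sum<-cong (suc l) (λ r r< → sumW-cong ps r (λ p e → sumP-cong ps ls (λ v → h (row p (trans (cong (_+ (l ∸ r)) e) (m+[n∸m]≡n (≤-pred r<))) v))))

linkedP zipsP : List (List ℕ) → Bool
linkedP []      = true
linkedP (w ∷ t) = linked geq w ∧ linkedP t
zipsP []      = true
zipsP (w ∷ t) = zipAll geq w (headRow t) ∧ zipsP t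

within : ℕ → ℕ → ℕ → List ℕ → Bool
within B i j []      = true
within B i j (v ∷ w) = ((v ≡ᵇ B) ∨ (v ≤ᵇ i + j)) ∧ within B i (suc j) w

withinT : ℕ → ℕ → List (List ℕ) → Bool
withinT B i []      = true
withinT B i (w ∷ t) = within B i 0 w ∧ withinT B (suc i) t

-- A filling of a skew shape is treated as a filling of the straight shape whose largest label `B`
-- fills the inner diagram; this recovers the inner diagram.
markerShape : ℕ → List (List ℕ) → List ℕ
markerShape B t = map (countᵇ (λ v → v ≡ᵇ B)) t

sumT-peel : ∀ k n ls (Φ : List (List ℕ) → ℤ) → sumT ls (labels k (suc n)) (λ t → when (linkedP t) (Φ t)) ≡ sumP (labels (suc k) n) ls (λ x → when (linkedP (oldP x)) (Φ (newP k x)))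
sumT-peel k n []       Φ = refl
sumT-peel k n (l ∷ ls) Φ = begin
  sumW l us′ (λ w → sumT ls us′ (λ t → when (linked geq w ∧ linkedP t) (Φ (w ∷ t))))
    ≡⟨ respects (sumW-linear us′ l) (λ w → trans (trans (respects (sumT-linear us′ ls) (λ t → sym (when-∧ (linked geq w) (linkedP t) _))) (linear-when (sumT-linear us′ ls) (linked geq w) _))
         (cong (when (linked geq w)) (sumT-peel k n ls (λ t → Φ (w ∷ t))))) ⟩
  sumW l us′ (λ w → when (linked geq w) (Θ w))
    ≡⟨ sumW-peel k n l Θ ⟩
  sum< (suc l) (λ r → sumW r us (λ w → when (linked geq w) (Θ (w ++ replicate (l ∸ r) k))))
    ≡⟨ sum<-cong (suc l) (λ r _ → respects (sumW-linear us r) (λ w → trans (sym (linear-when (sumP-linear us ls) (linked geq w) _)) (respects (sumP-linear us ls) (λ x → when-∧ (linked geq w) (linkedP (oldP x)) _)))) ⟩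
  sumP us (l ∷ ls) (λ x → when (linkedP (oldP x)) (Φ (newP k x))) ∎
  where
  us = labels (suc k) n
  us′ = labels k (suc n)
  Θ : List ℕ → ℤ
  Θ w = sumP us ls (λ x → when (linkedP (oldP x)) (Φ (w ∷ newP k x)))

-- Which shapes the cells of label > k may form below a row of length u.
admissible : ℕ → ℕ → ℕ → List PRow → Bool
admissible k i u []            = true
admissible k i u ((w , c) ∷ x) = ((length w ≤ᵇ u) ∧ ((c ≡ᵇ 0) ∨ (k ≤ᵇ i + length w))) ∧ admissible k (suc i) (length w) x

sum<-exchange : ∀ a b (X : ℕ → ℤ) → sum< (suc a) (λ r → when (r ≤ᵇ b) (X r)) ≡ sum< (suc b) (λ r → when (r ≤ᵇ a) (X r))
sum<-exchange a b X = trans (meet a b) (trans (cong (λ z → sum< (suc z) X) (ℕ.⊓-comm a b)) (sym (meet b a)))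
  where
  meet : ∀ a b → sum< (suc a) (λ r → when (r ≤ᵇ b) (X r)) ≡ sum< (suc (a ⊓ b)) X
  meet a b = trans (sum<-cong (suc a) (λ r r< → cong (λ z → when z (X r)) (T⇒≡ (λ t → ≤ᵇ-intro (⊓-glb (≤-pred r<) (≤ᵇ-elim r b t))) (λ t → ≤ᵇ-intro (≤-trans (≤ᵇ-elim r (a ⊓ b) t) (m⊓n≤n a b))))))
    (sum<-window {a} {0} {a ⊓ b} z≤n (m⊓n≤m a b) X)

threshold-∸ : ∀ k i → threshold 0 k i ≡ k ∸ i
threshold-∸ k i with ≤-<-connex k i
... | inj₁ p rewrite ≤ᵇ-true p = sym (m≤n⇒m∸n≡0 p)
... | inj₂ p rewrite ≤ᵇ-false p = refl

-- The cells of label `k` in row i start at column `length w`. If the bound k ≤ i + j holds there it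
-- holds for the rest of the row, so `admissible` is the kernel of `beyond (threshold 0 k)` together
-- with the condition that the remaining rows decrease.
sumP-removal : ∀ {L v ls} → Box L v ls → ∀ k i u us (Ψ : List (List ℕ) → ℤ) →
  sumP us ls (λ x → when (admissible k i u x) (Ψ (oldP x))) ≡ ΣD L u (λ ρ → when (ker (λ d → beyond (threshold 0 k) (i + d)) ls ρ) (sumT ρ us Ψ))
sumP-removal []      k i u us Ψ = refl
sumP-removal {suc L} {ls = l ∷ ls} (p ∷ b) k i u us Ψ = begin
  sum< (suc l) (λ r → sumW r us (λ w → sumP us ls (λ x → when (admissible k i u ((w , l ∸ r) ∷ x)) (Ψ (w ∷ oldP x)))))
    ≡⟨ sum<-cong (suc l) (λ r r< → trans (sumW-cong all⊤ r (λ {w} _ e → cell r w e)) (linear-when (sumW-linear us r) (r ≤ᵇ u) _)) ⟩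
  sum< (suc l) (λ r → when (r ≤ᵇ u) (X r))
    ≡⟨ sum<-exchange l u X ⟩
  sum< (suc u) (λ r → when (r ≤ᵇ l) (X r))
    ≡⟨ sum<-cong (suc u) (λ r _ → assemble r) ⟩
  ΣD (suc L) u (λ ρ → when (ker (λ d → beyond (threshold 0 k) (i + d)) (l ∷ ls) ρ) (sumT ρ us Ψ)) ∎
  where
  all⊤ : ∀ {us : List ℕ} → All (λ _ → ⊤) us
  all⊤ {[]}    = []
  all⊤ {_ ∷ _} = tt ∷ all⊤
  free : ℕ → Bool
  free r = (l ∸ r ≡ᵇ 0) ∨ (k ≤ᵇ i + r)
  X : ℕ → ℤ
  X r = sumW r us (λ w → when (free r) (ΣD L r (λ ρ → when (ker (λ d → beyond (threshold 0 k) (suc i + d)) ls ρ) (sumT ρ us (λ t → Ψ (w ∷ t))))))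
  cell : ∀ r w → length w ≡ r → sumP us ls (λ x → when (admissible k i u ((w , l ∸ r) ∷ x)) (Ψ (w ∷ oldP x))) ≡
    when (r ≤ᵇ u) (when (free r) (ΣD L r (λ ρ → when (ker (λ d → beyond (threshold 0 k) (suc i + d)) ls ρ) (sumT ρ us (λ t → Ψ (w ∷ t))))))
  cell r w refl = trans (respects (sumP-linear us ls) (λ x → sym (trans (when-∧ (r ≤ᵇ u) (free r) _) (when-∧ ((r ≤ᵇ u) ∧ free r) (admissible k (suc i) r x) (Ψ (w ∷ oldP x))))))
    (trans (linear-when (sumP-linear us ls) (r ≤ᵇ u) _) (cong (when (r ≤ᵇ u)) (trans (linear-when (sumP-linear us ls) (free r) _) (cong (when (free r)) (sumP-removal b k (suc i) r us (λ t → Ψ (w ∷ t)))))))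
  bool : ∀ r → (r ≤ᵇ l) ∧ free r ≡ beyond (threshold 0 k) (i + 0) l r
  bool r rewrite ℕ.+-identityʳ i = T⇒≡
    (λ t → to (≤ᵇ-elim r l (∧-Tˡ (r ≤ᵇ l) t)) (∨-elim (l ∸ r ≡ᵇ 0) (k ≤ᵇ i + r) (∧-Tʳ (r ≤ᵇ l) t)))
    (λ t → ∧-T (≤ᵇ-intro (beyond-⊆ (threshold 0 k) i l r t)) (from (beyond-elim (threshold 0 k) i l r t)))
    where
    to : r ≤ l → T (l ∸ r ≡ᵇ 0) ⊎ T (k ≤ᵇ i + r) → T (beyond (threshold 0 k) i l r)
    to q (inj₁ t) = beyond-≡ (threshold 0 k) i (≤-antisym q (m∸n≡0⇒m≤n (≡ᵇ-elim (l ∸ r) 0 t)))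
    to q (inj₂ t) = beyond-≤ (threshold 0 k) i (≤-trans (≤-reflexive (threshold-∸ k i)) (ℕ.m≤n+o⇒m∸n≤o k i (≤ᵇ-elim k (i + r) t))) q
    from : (r ≡ l) ⊎ ((threshold 0 k i ≤ r) × (r ≤ l)) → T (free r)
    from (inj₁ refl)    = ∨-introˡ (subst (λ z → T (z ≡ᵇ 0)) (sym (n∸n≡0 r)) tt)
    from (inj₂ (q , _)) = ∨-introʳ (l ∸ r ≡ᵇ 0) (≤ᵇ-intro (≤-trans (m≤n+m∸n k i) (+-monoʳ-≤ i (subst (_≤ r) (threshold-∸ k i) q))))
  shift : ∀ r → ΣD L r (λ ρ → when (ker (λ d → beyond (threshold 0 k) (suc i + d)) ls ρ) (sumW r us (λ w → sumT ρ us (λ t → Ψ (w ∷ t)))))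
    ≡ ΣD L r (λ ρ → when (ker (λ d → beyond (threshold 0 k) (i + suc d)) ls ρ) (sumT (r ∷ ρ) us Ψ))
  shift r = ΣD-cong L r (λ {ρ} c → cong (λ z → when z (sumT (r ∷ ρ) us Ψ)) (ker-cong _ _ b c (λ d _ l r _ _ → cong (λ z → beyond (threshold 0 k) z l r) (sym (+-suc i d)))))
  assemble : ∀ r → when (r ≤ᵇ l) (X r) ≡ ΣD L r (λ ρ → when (beyond (threshold 0 k) (i + 0) l r ∧ ker (λ d → beyond (threshold 0 k) (i + suc d)) ls ρ) (sumT (r ∷ ρ) us Ψ))
  assemble r = begin
    when (r ≤ᵇ l) (X r)
      ≡⟨ cong (when (r ≤ᵇ l)) (trans (linear-when (sumW-linear us r) (free r) _) (cong (when (free r)) (trans (linear-ΣD (sumW-linear us r) L r (λ ρ w → when (ker (λ d → beyond (threshold 0 k) (suc i + d)) ls ρ) (sumT ρ us (λ t → Ψ (w ∷ t)))))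
           (ΣD-cong L r (λ {ρ} _ → linear-when (sumW-linear us r) (ker (λ d → beyond (threshold 0 k) (suc i + d)) ls ρ) _))))) ⟩
    when (r ≤ᵇ l) (when (free r) (ΣD L r (λ ρ → when (ker (λ d → beyond (threshold 0 k) (suc i + d)) ls ρ) (sumW r us (λ w → sumT ρ us (λ t → Ψ (w ∷ t)))))))
      ≡⟨ trans (when-∧ (r ≤ᵇ l) (free r) _) (cong₂ when (bool r) (shift r)) ⟩
    when (beyond (threshold 0 k) (i + 0) l r) (ΣD L r (λ ρ → when (ker (λ d → beyond (threshold 0 k) (i + suc d)) ls ρ) (sumT (r ∷ ρ) us Ψ)))
      ≡⟨ trans (sym (linear-when (ΣD-linear L r) (beyond (threshold 0 k) (i + 0) l r) _)) (ΣD-cong L r (λ {ρ} _ → when-∧ (beyond (threshold 0 k) (i + 0) l r) (ker (λ d → beyond (threshold 0 k) (i + suc d)) ls ρ) _)) ⟩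
    ΣD L r (λ ρ → when (beyond (threshold 0 k) (i + 0) l r ∧ ker (λ d → beyond (threshold 0 k) (i + suc d)) ls ρ) (sumT (r ∷ ρ) us Ψ)) ∎

zipAll-append : ∀ {k w w₂} → All (suc k ≤_) w → All (suc k ≤_) w₂ → ∀ c c₂ → length w₂ + c₂ ≤ length w + c →
  zipAll geq (w ++ replicate c k) (w₂ ++ replicate c₂ k) ≡ zipAll geq w w₂ ∧ (length w₂ ≤ᵇ length w)
zipAll-append {w = []} [] [] zero    c₂       q = refl
zipAll-append {w = []} [] [] (suc c) zero     q = refl
zipAll-append {k} {w = []} [] [] (suc c) (suc c₂) q rewrite ≤ᵇ-true (≤-refl {k}) = zipAll-append {w = []} {[]} [] [] c c₂ (≤-pred q)
zipAll-append {w = []} [] (p ∷ ps) (suc c) c₂ q rewrite ≤ᵇ-false p = refl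
zipAll-append {w = []} [] (p ∷ ps) zero c₂ ()
zipAll-append {w = v ∷ w} (p ∷ ps) [] c zero q = refl
zipAll-append {k} {w = v ∷ w} (p ∷ ps) [] c (suc c₂) q rewrite ≤ᵇ-true (<⇒≤ p) = trans (zipAll-append ps [] c c₂ (≤-pred q)) (cong (_∧ true) (zipAll-[] geq w))
zipAll-append {w = v ∷ w} {v₂ ∷ w₂} (p ∷ ps) (p₂ ∷ ps₂) c c₂ q = trans (cong (geq v v₂ ∧_) (zipAll-append ps ps₂ c c₂ (≤-pred q)))
  (trans (sym (∧-assoc (geq v v₂) (zipAll geq w w₂) _)) (cong (zipAll geq (v ∷ w) (v₂ ∷ w₂) ∧_) (sym (≤ᵇ-suc (length w₂) (length w)))))

within-append : ∀ B k i j w c → k < B → within B i j (w ++ replicate c k) ≡ within B i j w ∧ ((c ≡ᵇ 0) ∨ (k ≤ᵇ i + (j + length w)))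
within-append B k i j []      zero    q = refl
within-append B k i j []      (suc c) q rewrite ≡ᵇ-false (<⇒≢ q) | ℕ.+-identityʳ j = tail c j ≤-refl
  where
  tail : ∀ c j′ → j ≤ j′ → (k ≤ᵇ i + j) ∧ within B i (suc j′) (replicate c k) ≡ (k ≤ᵇ i + j)
  tail zero    j′ p = ∧-identityʳ _
  tail (suc c) j′ p rewrite ≡ᵇ-false (<⇒≢ q) = trans (sym (∧-assoc (k ≤ᵇ i + j) (k ≤ᵇ i + suc j′) _)) (trans (cong (_∧ within B i (suc (suc j′)) (replicate c k)) absorb) (tail c (suc j′) (m≤n⇒m≤1+n p)))
    where
    absorb : (k ≤ᵇ i + j) ∧ (k ≤ᵇ i + suc j′) ≡ (k ≤ᵇ i + j)
    absorb = T⇒≡ (∧-Tˡ (k ≤ᵇ i + j)) (λ t → ∧-T t (≤ᵇ-intro (≤-trans (≤ᵇ-elim k (i + j) t) (+-monoʳ-≤ i (m≤n⇒m≤1+n p)))))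
within-append B k i j (v ∷ w) c q = trans (cong (((v ≡ᵇ B) ∨ (v ≤ᵇ i + j)) ∧_) (trans (within-append B k i (suc j) w c q) (cong (λ z → within B i (suc j) w ∧ ((c ≡ᵇ 0) ∨ (k ≤ᵇ i + z))) (sym (+-suc j (length w))))))
  (sym (∧-assoc ((v ≡ᵇ B) ∨ (v ≤ᵇ i + j)) (within B i (suc j) w) _))


conditions-row : ∀ {B k L l ls w c x} → k < B → Box L l ls → ExtendedP (suc k ≤_) (l ∷ ls) ((w , c) ∷ x) → ∀ i →
  zipsP (newP k ((w , c) ∷ x)) ∧ withinT B i (newP k ((w , c) ∷ x)) ≡
  (zipsP (w ∷ oldP x) ∧ withinT B i (w ∷ oldP x)) ∧ (((c ≡ᵇ 0) ∨ (k ≤ᵇ i + length w)) ∧ admissible k (suc i) (length w) x)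
conditions-row {B} {k} {w = w} {c} q [] (row ps e []) i = trans (cong₂ (λ x y → (x ∧ true) ∧ (y ∧ true)) (zipAll-[] geq (w ++ replicate c k)) (within-append B k i 0 w c q))
  (trans (∧-identityʳ (within B i 0 w ∧ _)) (sym (cong₂ (λ x y → x ∧ y) (cong₂ (λ x y → (x ∧ true) ∧ y) (zipAll-[] geq w) (∧-identityʳ (within B i 0 w))) (∧-identityʳ _))))
conditions-row {B} {k} {w = w} {c} q (p₂ ∷ b) (row ps refl v@(row {w = w₂} {c₂} {x₂} ps₂ refl _)) i = begin
  (zipAll geq (w ++ replicate c k) (w₂ ++ replicate c₂ k) ∧ Z) ∧ (within B i 0 (w ++ replicate c k) ∧ W)
    ≡⟨ ∧-interchange (zipAll geq (w ++ replicate c k) (w₂ ++ replicate c₂ k)) Z (within B i 0 (w ++ replicate c k)) W ⟩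
  (zipAll geq (w ++ replicate c k) (w₂ ++ replicate c₂ k) ∧ within B i 0 (w ++ replicate c k)) ∧ (Z ∧ W)
    ≡⟨ cong₂ _∧_ (cong₂ _∧_ (zipAll-append ps ps₂ c c₂ p₂) (within-append B k i 0 w c q)) (conditions-row q b v (suc i)) ⟩
  ((z ∧ u) ∧ (w₀ ∧ f)) ∧ ((Z₀ ∧ W₀) ∧ (f₂ ∧ A))
    ≡⟨ cong (_∧ ((Z₀ ∧ W₀) ∧ (f₂ ∧ A))) (∧-interchange z u w₀ f) ⟩
  ((z ∧ w₀) ∧ (u ∧ f)) ∧ ((Z₀ ∧ W₀) ∧ (f₂ ∧ A))
    ≡⟨ ∧-interchange (z ∧ w₀) (u ∧ f) (Z₀ ∧ W₀) (f₂ ∧ A) ⟩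
  ((z ∧ w₀) ∧ (Z₀ ∧ W₀)) ∧ ((u ∧ f) ∧ (f₂ ∧ A))
    ≡⟨ cong₂ _∧_ (∧-interchange z w₀ Z₀ W₀) (trans (cong (_∧ (f₂ ∧ A)) (∧-comm u f)) (trans (∧-assoc f u (f₂ ∧ A)) (cong (f ∧_) (sym (∧-assoc u f₂ A))))) ⟩
  ((z ∧ Z₀) ∧ (w₀ ∧ W₀)) ∧ (f ∧ ((u ∧ f₂) ∧ A)) ∎
  where
  Z = zipsP (newP k ((w₂ , c₂) ∷ x₂))
  W = withinT B (suc i) (newP k ((w₂ , c₂) ∷ x₂))
  z = zipAll geq w w₂
  u = length w₂ ≤ᵇ length w
  w₀ = within B i 0 w
  f = (c ≡ᵇ 0) ∨ (k ≤ᵇ i + length w)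
  f₂ = (c₂ ≡ᵇ 0) ∨ (k ≤ᵇ suc i + length w₂)
  Z₀ = zipsP (w₂ ∷ oldP x₂)
  W₀ = withinT B (suc i) (w₂ ∷ oldP x₂)
  A = admissible k (suc (suc i)) (length w₂) x₂

conditions-new : ∀ {B k L u ls x} → k < B → Box L u ls → ExtendedP (suc k ≤_) ls x → ∀ i →
  zipsP (newP k x) ∧ withinT B i (newP k x) ≡ (zipsP (oldP x) ∧ withinT B i (oldP x)) ∧ admissible k i u x
conditions-new q []      []                           i = refl
conditions-new {B} {k} {x = (w , c) ∷ x} q (p ∷ b) v@(row ps e v′) i = trans (conditions-row q b v i)
  (cong (λ z → (zipsP (w ∷ oldP x) ∧ withinT B i (w ∷ oldP x)) ∧ ((z ∧ ((c ≡ᵇ 0) ∨ (k ≤ᵇ i + length w))) ∧ admissible k (suc i) (length w) x))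
    (sym (≤ᵇ-true (≤-trans (ℕ.m+n≤o⇒m≤o (length w) (≤-reflexive e)) p))))

-- The labels below `k` count as already peeled off. An arbitrary `g` of the inner shape makes the
-- count an operator, so that peeling label after label yields `chain`.
planePartitions : ℕ → ℕ → ℕ → List ℕ → (List ℕ → ℤ) → ℤ
planePartitions B k n ls g = sumT ls (labels k n) (λ t → when (linkedP t ∧ (zipsP t ∧ withinT B 0 t)) (g (markerShape B t)))

planePartitions-step : ∀ {N ls} → Box N N ls → ∀ B k n g → k < B →
  planePartitions B k (suc n) ls g ≡ removal N (beyond (threshold 0 k)) (λ ρ → planePartitions B (suc k) n ρ g) ls
planePartitions-step {N} {ls} b B k n g q = begin
  planePartitions B k (suc n) ls g
    ≡⟨ respects (sumT-linear (labels k (suc n)) ls) (λ t → sym (when-∧ (linkedP t) (zipsP t ∧ withinT B 0 t) _)) ⟩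
  sumT ls (labels k (suc n)) (λ t → when (linkedP t) (when (zipsP t ∧ withinT B 0 t) (g (markerShape B t))))
    ≡⟨ sumT-peel k n ls _ ⟩
  sumP us ls (λ x → when (linkedP (oldP x)) (when (zipsP (newP k x) ∧ withinT B 0 (newP k x)) (g (markerShape B (newP k x)))))
    ≡⟨ sumP-cong (labels-≥ (suc k) n) ls (λ {x} v → trans (cong (when (linkedP (oldP x))) (cong₂ when (conditions-new q b v 0) (cong g (marker x)))) (arrange (linkedP (oldP x)) _ (admissible k 0 N x) _)) ⟩
  sumP us ls (λ x → when (admissible k 0 N x) (when (linkedP (oldP x) ∧ (zipsP (oldP x) ∧ withinT B 0 (oldP x))) (g (markerShape B (oldP x)))))
    ≡⟨ sumP-removal b k 0 N us (λ t → when (linkedP t ∧ (zipsP t ∧ withinT B 0 t)) (g (markerShape B t))) ⟩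
  removal N (beyond (threshold 0 k)) (λ ρ → planePartitions B (suc k) n ρ g) ls ∎
  where
  us = labels (suc k) n
  arrange : ∀ a c d x → when a (when (c ∧ d) x) ≡ when d (when (a ∧ c) x)
  arrange true  true  d x = refl
  arrange true  false d x = sym (when-0 d)
  arrange false c     d x = sym (when-0 d)
  marker : ∀ x → markerShape B (newP k x) ≡ markerShape B (oldP x)
  marker []            = refl
  marker ((w , c) ∷ x) = cong₂ _∷_ (trans (countᵇ-++ (λ v → v ≡ᵇ B) w _) (trans (cong (λ z → countᵇ (λ v → v ≡ᵇ B) w + z) (trans (countᵇ-replicate (λ v → v ≡ᵇ B) c k) (cong (λ z → if z then c else 0) (≡ᵇ-false (<⇒≢ q))))) (ℕ.+-identityʳ _))) (marker x)

planePartitions-base : ∀ B ls g → planePartitions B B 0 ls g ≡ g ls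
planePartitions-base B ls g = trans (sumT-one ls _) (trans (cong (λ z → when z (g (markerShape B t))) (cong₂ _∧_ (linked-t ls) (cong₂ _∧_ (zips-t ls) (within-t 0 ls)))) (cong g (shape ls)))
  where
  t = map (λ l → replicate l B) ls
  sumW-one : ∀ l F → sumW l (B ∷ []) F ≡ F (replicate l B)
  sumW-one zero    F = refl
  sumW-one (suc l) F = trans (ℤ.+-identityʳ _) (sumW-one l (λ w → F (B ∷ w)))
  sumT-one : ∀ ls F → sumT ls (B ∷ []) F ≡ F (map (λ l → replicate l B) ls)
  sumT-one []       F = refl
  sumT-one (l ∷ ls) F = trans (sumW-one l _) (sumT-one ls _)
  B≤B : (B ≤ᵇ B) ≡ true
  B≤B = ≤ᵇ-true (≤-refl {B})
  linked-row : ∀ l → linked geq (replicate l B) ≡ true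
  linked-row zero    = refl
  linked-row (suc l) = trans (cong (_∧ linked geq (replicate l B)) (top l)) (linked-row l)
    where
    top : ∀ l → atM (head? (replicate l B)) (geq B) ≡ true
    top zero    = refl
    top (suc l) = B≤B
  linked-t : ∀ ls → linkedP (map (λ l → replicate l B) ls) ≡ true
  linked-t []       = refl
  linked-t (l ∷ ls) rewrite linked-row l = linked-t ls
  zip-row : ∀ l m → zipAll geq (replicate l B) (replicate m B) ≡ true
  zip-row zero    m       = refl
  zip-row (suc l) zero    = refl
  zip-row (suc l) (suc m) rewrite B≤B = zip-row l m
  zips-t : ∀ ls → zipsP (map (λ l → replicate l B) ls) ≡ true
  zips-t []           = refl
  zips-t (l ∷ [])     = trans (∧-identityʳ _) (zip-row l 0)
  zips-t (l ∷ m ∷ ls) = trans (cong (_∧ zipsP (map (λ l → replicate l B) (m ∷ ls))) (zip-row l m)) (zips-t (m ∷ ls))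
  within-row : ∀ i j l → within B i j (replicate l B) ≡ true
  within-row i j zero    = refl
  within-row i j (suc l) rewrite ≡ᵇ-refl B = within-row i (suc j) l
  within-t : ∀ i ls → withinT B i (map (λ l → replicate l B) ls) ≡ true
  within-t i []       = refl
  within-t i (l ∷ ls) rewrite within-row i 0 l = within-t (suc i) ls
  shape : ∀ ls → markerShape B (map (λ l → replicate l B) ls) ≡ ls
  shape []       = refl
  shape (l ∷ ls) = cong₂ _∷_ (trans (countᵇ-replicate (λ v → v ≡ᵇ B) l B) (cong (λ z → if z then l else 0) (≡ᵇ-refl B))) (shape ls)

planePartitions-chain : ∀ {N ls} B k n → k + n ≡ B → Box N N ls → ∀ g → planePartitions B k n ls g ≡ chain N 0 k n g ls
planePartitions-chain {ls = ls} B k zero eq b g rewrite sym eq | ℕ.+-identityʳ k = planePartitions-base k ls g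
planePartitions-chain {N} {ls} B k (suc n) eq b g = trans (planePartitions-step b B k n g (subst (k <_) eq (m<m+n k (s≤s z≤n))))
  (removal-cong N (beyond (threshold 0 k)) ls (λ c → planePartitions-chain B (suc k) n (trans (sym (+-suc k n)) eq) c g))

-- Words over A with a maximal marker: m markers followed by a word over A.
sumW-marker : ∀ M {A} → All (_≤ M) A → ∀ l m (F : List ℕ → ℤ) → m ≤ l →
  sumW l (A ∷ʳ suc M) (λ w → when (linked geq w) (when (m ≡ᵇ countᵇ (λ v → v ≡ᵇ suc M) w) (F w))) ≡
  sumW (l ∸ m) A (λ w → when (linked geq w) (F (replicate m (suc M) ++ w)))
sumW-marker M {A} ps = go
  where
  B = suc M
  # : List ℕ → ℕ
  # = countᵇ (λ v → v ≡ᵇ B)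
  #-∷ : ∀ {v} w → v ≤ M → # (v ∷ w) ≡ # w
  #-∷ {v} w p rewrite ≡ᵇ-false {v} {B} (<⇒≢ (s≤s p)) = refl
  #-B : ∀ w → # (B ∷ w) ≡ suc (# w)
  #-B w rewrite ≡ᵇ-refl B = refl
  ps′ : All (_≤ B) (A ∷ʳ B)
  ps′ = All-++ (All-weaken ps) (≤-refl ∷ [])
    where
    All-weaken : ∀ {xs} → All (_≤ M) xs → All (_≤ B) xs
    All-weaken []       = []
    All-weaken (p ∷ ps) = m≤n⇒m≤1+n p ∷ All-weaken ps
  snoc : ∀ (X : ℕ → ℤ) → ∑ (A ∷ʳ B) X ≡ ∑ A X +ℤ X B
  snoc X = trans (∑-++ A (B ∷ []) X) (cong (∑ A X +ℤ_) (ℤ.+-identityʳ (X B)))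
  none : ∀ w v → v ≤ M → T (atM (head? w) (geq v) ∧ linked geq w) → # w ≡ 0
  none []      v p t = refl
  none (x ∷ w) v p t = trans (#-∷ w x≤M) (none w x x≤M (∧-Tʳ (x ≤ᵇ v) t))
    where x≤M = ≤-trans (≤ᵇ-elim x v (∧-Tˡ (x ≤ᵇ v) t)) p
  unmarked : ∀ l (F : List ℕ → ℤ) → sumW l (A ∷ʳ B) (λ w → when (linked geq w) (when (0 ≡ᵇ # w) (F w))) ≡ sumW l A (λ w → when (linked geq w) (F w))
  unmarked zero    F = refl
  unmarked (suc l) F = begin
    ∑ (A ∷ʳ B) X
      ≡⟨ snoc X ⟩
    ∑ A X +ℤ X B
      ≡⟨ cong₂ _+ℤ_ (∑-cong-All ps (λ {v} p → first v p)) (trans (respects (sumW-linear (A ∷ʳ B) l) (λ w → trans (cong (λ z → when (linked geq (B ∷ w)) (when (0 ≡ᵇ z) (F (B ∷ w)))) (#-B w)) (when-0 (linked geq (B ∷ w))))) (linear-zero (sumW-linear (A ∷ʳ B) l))) ⟩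
    sumW (suc l) A (λ w → when (linked geq w) (F w)) +ℤ + 0
      ≡⟨ ℤ.+-identityʳ _ ⟩
    sumW (suc l) A (λ w → when (linked geq w) (F w)) ∎
    where
    X : ℕ → ℤ
    X v = sumW l (A ∷ʳ B) (λ w → when (linked geq (v ∷ w)) (when (0 ≡ᵇ # (v ∷ w)) (F (v ∷ w))))
    arrange : ∀ a b c x → when (a ∧ b) (when c x) ≡ when b (when c (when a x))
    arrange true  b c x = refl
    arrange false b c x = sym (trans (cong (when b) (when-0 c)) (when-0 b))
    first : ∀ v → v ≤ M → X v ≡ sumW l A (λ w → when (linked geq (v ∷ w)) (F (v ∷ w)))
    first v p = trans (respects (sumW-linear (A ∷ʳ B) l) (λ w → trans (cong (λ z → when (linked geq (v ∷ w)) (when (0 ≡ᵇ z) (F (v ∷ w)))) (#-∷ w p)) (arrange (atM (head? w) (geq v)) (linked geq w) (0 ≡ᵇ # w) _)))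
      (trans (unmarked l (λ w → when (atM (head? w) (geq v)) (F (v ∷ w)))) (respects (sumW-linear A l) (λ w → trans (when-comm (linked geq w) (atM (head? w) (geq v)) _) (when-∧ (atM (head? w) (geq v)) (linked geq w) _))))
  go : ∀ l m (F : List ℕ → ℤ) → m ≤ l → sumW l (A ∷ʳ B) (λ w → when (linked geq w) (when (m ≡ᵇ # w) (F w))) ≡ sumW (l ∸ m) A (λ w → when (linked geq w) (F (replicate m B ++ w)))
  go l       zero    F p       = unmarked l F
  go (suc l) (suc m) F (s≤s p) = begin
    ∑ (A ∷ʳ B) X
      ≡⟨ snoc X ⟩
    ∑ A X +ℤ X B
      ≡⟨ cong₂ _+ℤ_ (trans (∑-cong-All ps (λ {v} p → trans (respects (sumW-linear (A ∷ʳ B) l) (λ w → trans (when-cong (linked geq (v ∷ w)) (λ t → cong (λ z → when (suc m ≡ᵇ z) (F (v ∷ w))) (trans (#-∷ w p) (none w v p t)))) (when-0 (linked geq (v ∷ w))))) (linear-zero (sumW-linear (A ∷ʳ B) l)))) (linear-zero (∑-is-linear A)))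
           (trans (sumW-cong ps′ l (λ {w} q _ → cong₂ (λ x y → when (x ∧ linked geq w) (when (suc m ≡ᵇ y) (F (B ∷ w)))) (topmost q) (#-B w))) (go l m (λ w → F (B ∷ w)) p)) ⟩
    + 0 +ℤ sumW (l ∸ m) A (λ w → when (linked geq w) (F (B ∷ replicate m B ++ w)))
      ≡⟨ ℤ.+-identityˡ _ ⟩
    sumW (l ∸ m) A (λ w → when (linked geq w) (F (replicate (suc m) B ++ w))) ∎
    where
    X : ℕ → ℤ
    X v = sumW l (A ∷ʳ B) (λ w → when (linked geq (v ∷ w)) (when (suc m ≡ᵇ # (v ∷ w)) (F (v ∷ w))))
    topmost : ∀ {w} → All (_≤ B) w → atM (head? w) (geq B) ≡ true
    topmost []      = refl
    topmost (q ∷ _) = ≤ᵇ-true q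

differences : List ℕ → List ℕ → List ℕ
differences (m ∷ μ) (l ∷ ls) = (l ∸ m) ∷ differences μ ls
differences _       ls       = ls

mark : ℕ → List ℕ → List (List ℕ) → List (List ℕ)
mark B (m ∷ μ) (w ∷ t) = (replicate m B ++ w) ∷ mark B μ t
mark B _       t       = t

sumT-marker : ∀ M {A} → All (_≤ M) A → ∀ {L u v μ ls} → Box L u μ → Box L v ls → (∀ i → at μ i ≤ at ls i) → ∀ (Φ : List (List ℕ) → ℤ) →
  sumT ls (A ∷ʳ suc M) (λ t → when (linkedP t) (when (eqList μ (markerShape (suc M) t)) (Φ t))) ≡ sumT (differences μ ls) A (λ t → when (linkedP t) (Φ (mark (suc M) μ t)))
sumT-marker M ps [] [] h Φ = refl
sumT-marker M {A} ps {μ = m ∷ μ} {l ∷ ls} (_ ∷ b) (_ ∷ c) h Φ = begin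
  sumW l us (λ w → sumT ls us (λ t → when (linked geq w ∧ linkedP t) (when ((m ≡ᵇ # w) ∧ eqList μ (markerShape (suc M) t)) (Φ (w ∷ t)))))
    ≡⟨ respects (sumW-linear us l) (λ w → trans (respects (sumT-linear us ls) (λ t → arrange (linked geq w) (linkedP t) (m ≡ᵇ # w) (eqList μ (markerShape (suc M) t)) (Φ (w ∷ t))))
         (trans (linear-when (sumT-linear us ls) (linked geq w) _) (cong (when (linked geq w)) (trans (linear-when (sumT-linear us ls) (m ≡ᵇ # w) _) (cong (when (m ≡ᵇ # w)) (sumT-marker M ps b c (h ∘ suc) (λ t → Φ (w ∷ t)))))))) ⟩
  sumW l us (λ w → when (linked geq w) (when (m ≡ᵇ # w) (sumT (differences μ ls) A (λ t → when (linkedP t) (Φ (w ∷ mark (suc M) μ t))))))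
    ≡⟨ sumW-marker M ps l m _ (h 0) ⟩
  sumW (l ∸ m) A (λ w → when (linked geq w) (sumT (differences μ ls) A (λ t → when (linkedP t) (Φ ((replicate m (suc M) ++ w) ∷ mark (suc M) μ t)))))
    ≡⟨ respects (sumW-linear A (l ∸ m)) (λ w → trans (sym (linear-when (sumT-linear A (differences μ ls)) (linked geq w) _)) (respects (sumT-linear A (differences μ ls)) (λ t → when-∧ (linked geq w) (linkedP t) _))) ⟩
  sumT (differences (m ∷ μ) (l ∷ ls)) A (λ t → when (linkedP t) (Φ (mark (suc M) (m ∷ μ) t))) ∎
  where
  us = A ∷ʳ suc M
  # : List ℕ → ℕ
  # = countᵇ (λ v → v ≡ᵇ suc M)
  arrange : ∀ a b c d x → when (a ∧ b) (when (c ∧ d) x) ≡ when a (when c (when b (when d x)))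
  arrange true  true  true  d x = refl
  arrange true  true  false d x = refl
  arrange true  false c     d x = sym (when-0 c)
  arrange false b     c     d x = refl

contained-to : ∀ μ ls → T (contained μ ls) → ∀ i → at μ i ≤ at ls i
contained-to μ ls t i with <-≤-connex i (length μ)
... | inj₂ p = ≤-trans (≤-reflexive (beyond-length μ i p)) z≤n
  where
  beyond-length : ∀ μ i → length μ ≤ i → at μ i ≡ 0
  beyond-length []      i       p       = refl
  beyond-length (m ∷ μ) (suc i) (s≤s p) = beyond-length μ i p
... | inj₁ p = ≤ᵇ-elim (at μ i) (at ls i) (pick (λ i → at μ i ≤ᵇ at ls i) (length μ) i p (subst (λ z → T (and z)) (ListP.map-upTo (λ i → at μ i ≤ᵇ at ls i) (length μ)) t))
  where
  pick : ∀ (f : ℕ → Bool) n i → i < n → T (and (applyUpTo f n)) → T (f i)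
  pick f (suc n) zero    p       t = ∧-Tˡ (f 0) t
  pick f (suc n) (suc i) (s≤s p) t = pick (f ∘ suc) n i p (∧-Tʳ (f 0) t)

contained-from : ∀ μ ls → (∀ i → at μ i ≤ at ls i) → T (contained μ ls)
contained-from μ ls h = subst (λ z → T (and z)) (sym (ListP.map-upTo (λ i → at μ i ≤ᵇ at ls i) (length μ))) (build (length μ) (λ i → ≤ᵇ-intro (h i)))
  where
  build : ∀ {f : ℕ → Bool} n → (∀ i → T (f i)) → T (and (applyUpTo f n))
  build zero    h = tt
  build (suc n) h = ∧-T (h 0) (build n (h ∘ suc))

rppCount : List ℕ → List ℕ → ℕ
rppCount μ ls = countᵇ (isRPP μ) (assignments (skewCells ls μ) (oneTo (size μ)))

filter-++ : {A : Set} (p : A → Bool) (xs ys : List A) → filterᵇ p (xs ++ ys) ≡ filterᵇ p xs ++ filterᵇ p ys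
filter-++ p []       ys = refl
filter-++ p (x ∷ xs) ys with p x
... | true  = cong (x ∷_) (filter-++ p xs ys)
... | false = filter-++ p xs ys

filter-rowCells : ∀ (μ : List ℕ) i j l → filterᵇ (λ c → not (inDiagram μ c)) (rowCells i j l) ≡ rowCells i (j ⊔ at μ i) (l ∸ (at μ i ∸ j))
filter-rowCells μ i j zero rewrite 0∸n≡0 (at μ i ∸ j) = refl
filter-rowCells μ i j (suc l) with <-≤-connex j (at μ i)
... | inj₁ p rewrite <ᵇ-true p = trans (filter-rowCells μ i (suc j) l) (cong₂ (rowCells i) (trans (m≤n⇒m⊔n≡n p) (sym (m≤n⇒m⊔n≡n (<⇒≤ p)))) (sym (cong (suc l ∸_) (+-∸-assoc 1 p))))
... | inj₂ p rewrite <ᵇ-false p = trans (cong ((i , j) ∷_) (trans (filter-rowCells μ i (suc j) l) (cong₂ (rowCells i) (m≥n⇒m⊔n≡m (m≤n⇒m≤1+n p)) (cong (l ∸_) (m≤n⇒m∸n≡0 (m≤n⇒m≤1+n p))))))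
    (sym (cong₂ (rowCells i) (m≥n⇒m⊔n≡m p) (cong (suc l ∸_) (m≤n⇒m∸n≡0 p))))

skewCells-cellsFrom : ∀ μ ls → skewCells ls μ ≡ cellsFrom 0 μ (differences μ ls)
skewCells-cellsFrom μ ls = trans (cong (filterᵇ (λ c → not (inDiagram μ c))) (cells-cellsFrom ls)) (go 0 μ ls (λ d → refl))
  where
  go : ∀ i μ′ ls → (∀ d → at μ (i + d) ≡ at μ′ d) → filterᵇ (λ c → not (inDiagram μ c)) (cellsFrom i [] ls) ≡ cellsFrom i μ′ (differences μ′ ls)
  skewRow : ∀ i m l → at μ i ≡ m → filterᵇ (λ c → not (inDiagram μ c)) (rowCells i 0 l) ≡ rowCells i m (l ∸ m)
  skewRow i m l refl = filter-rowCells μ i 0 l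
  go i []       []       h = refl
  go i (m ∷ μ′) []       h = refl
  go i []       (l ∷ ls) h = trans (filter-++ _ (rowCells i 0 l) _) (cong₂ _++_ (skewRow i 0 l (trans (cong (at μ) (sym (ℕ.+-identityʳ i))) (h 0))) (go (suc i) [] ls (λ d → trans (cong (at μ) (sym (+-suc i d))) (h (suc d)))))
  go i (m ∷ μ′) (l ∷ ls) h = trans (filter-++ _ (rowCells i 0 l) _) (cong₂ _++_ (skewRow i m l (trans (cong (at μ) (sym (ℕ.+-identityʳ i))) (h 0))) (go (suc i) μ′ ls (λ d → trans (cong (at μ) (sym (+-suc i d))) (h (suc d)))))

-- For λ = μ there is no cell to fill, and the single empty filling accounts for the value 1.
P-rppCount : ∀ μ ls → P μ ls ≡ (if contained μ ls then rppCount μ ls else 0)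
P-rppCount μ ls with contained μ ls
... | false = refl
... | true with eqList μ ls in eq
...   | false = refl
...   | true  = sym (trans (cong (λ z → countᵇ (isRPP μ) (assignments z (oneTo (size μ)))) (trans (cong (λ z → skewCells z μ) (sym (eqList-elim μ ls (true-T eq)))) (trans (skewCells-cellsFrom μ μ) (empty 0 μ)))) refl)
  where
  empty : ∀ i μ → cellsFrom i μ (differences μ μ) ≡ []
  empty i []      = refl
  empty i (m ∷ μ) rewrite n∸n≡0 m = empty (suc i) μ


-- Hooks at addable cells, and the bound i + j

inHook : ℕ → ℕ → Cell → Bool
inHook i o c = ((proj₂ c ≡ᵇ o) ∧ (proj₁ c <ᵇ i)) ∨ ((proj₁ c ≡ᵇ i) ∧ (proj₂ c <ᵇ o))

module _ (p : Cell → Bool) where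

  count-none : ∀ i j l → (∀ c → j ≤ c → p (i , c) ≡ false) → countᵇ p (rowCells i j l) ≡ 0
  count-none i j zero    h = refl
  count-none i j (suc l) h rewrite h j ≤-refl = count-none i (suc j) l (λ c q → h c (<⇒≤ q))

  count-all : ∀ i j l → (∀ c → c < j + l → p (i , c) ≡ true) → countᵇ p (rowCells i j l) ≡ l
  count-all i j zero    h = refl
  count-all i j (suc l) h rewrite h j (m<m+n j (s≤s z≤n)) = cong suc (count-all i (suc j) l (λ c q → h c (<-≤-trans q (≤-reflexive (sym (+-suc j l))))))

  count-one : ∀ i j l o → (∀ c → p (i , c) ≡ (c ≡ᵇ o)) → j ≤ o → o < j + l → countᵇ p (rowCells i j l) ≡ 1
  count-one i j zero    o h q r = ⊥-elim (<⇒≱ r (≤-trans (≤-reflexive (ℕ.+-identityʳ j)) q))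
  count-one i j (suc l) o h q r with m≤n⇒m<n∨m≡n q
  ... | inj₁ j<o rewrite h j | ≡ᵇ-false (<⇒≢ j<o) = count-one i (suc j) l o h j<o (<-≤-trans r (≤-reflexive (+-suc j l)))
  ... | inj₂ refl rewrite h j | ≡ᵇ-refl j = cong suc (count-none i (suc j) l (λ c q → trans (h c) (≡ᵇ-false (>⇒≢ q))))

  count-rows : ∀ k ls → (∀ i c → k ≤ i → p (i , c) ≡ false) → countᵇ p (cellsFrom k [] ls) ≡ 0
  count-rows k []       h = refl
  count-rows k (l ∷ ls) h = trans (countᵇ-++ p (rowCells k 0 l) _) (cong₂ _+_ (count-none k 0 l (λ c _ → h k c ≤-refl)) (count-rows (suc k) ls (λ i c q → h i c (<⇒≤ q))))

-- Each of the `d` rows above reaches column `o` and contributes one cell; the cell's own row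
-- consists of the `o` cells to its left. The index `k` only shifts the row numbers for the
-- recursion.
count-hook : ∀ k d o μ → at μ d ≡ o → (∀ e → e < d → o < at μ e) → countᵇ (inHook (k + d) o) (cellsFrom k [] μ) ≡ d + o
count-hook k zero    o []      refl h = refl
count-hook k (suc d) o []      e    h = ⊥-elim (n≮0 (h 0 (s≤s z≤n)))
count-hook k zero    o (m ∷ μ) refl h rewrite ℕ.+-identityʳ k = trans (countᵇ-++ (inHook k m) (rowCells k 0 m) _) (trans (cong₂ _+_
    (count-all (inHook k m) k 0 m (λ c q → trans (cong (((c ≡ᵇ m) ∧ (k <ᵇ k)) ∨_) (cong₂ _∧_ (≡ᵇ-refl k) (<ᵇ-true q))) (∨-true ((c ≡ᵇ m) ∧ (k <ᵇ k)))))
    (count-rows (inHook k m) (suc k) μ (λ i c q → cong₂ _∨_ (trans (cong ((c ≡ᵇ m) ∧_) (<ᵇ-false (<⇒≤ q))) (∧-zeroʳ (c ≡ᵇ m))) (cong (_∧ (c <ᵇ m)) (≡ᵇ-false (>⇒≢ q))))))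
  (ℕ.+-identityʳ m))
  where
  ∨-true : ∀ b → b ∨ true ≡ true
  ∨-true true  = refl
  ∨-true false = refl
count-hook k (suc d) o (m ∷ μ) e h = trans (countᵇ-++ (inHook (k + suc d) o) (rowCells k 0 m) _) (cong₂ _+_
  (count-one (inHook (k + suc d) o) k 0 m o (λ c → trans (cong₂ _∨_ (trans (cong ((c ≡ᵇ o) ∧_) (<ᵇ-true k<)) (∧-identityʳ (c ≡ᵇ o))) (cong (_∧ (c <ᵇ o)) (≡ᵇ-false (<⇒≢ k<)))) (∨-identityʳ (c ≡ᵇ o))) z≤n (h 0 (s≤s z≤n)))
  (trans (cong (λ z → countᵇ (inHook z o) (cellsFrom (suc k) [] μ)) (+-suc k d)) (count-hook (suc k) d o μ e (λ e q → h (suc e) (s≤s q)))))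
  where
  k< : k < k + suc d
  k< = m<m+n k (s≤s z≤n)

at-decreasing : ∀ {L u ρ} → Box L u ρ → ∀ {e d} → e ≤ d → at ρ d ≤ at ρ e
at-decreasing []      _             = z≤n
at-decreasing (p ∷ b) {d = zero}  z≤n     = ≤-refl
at-decreasing (p ∷ b) {d = suc d} z≤n     = at-Box b d
at-decreasing (p ∷ b) (s≤s q) = at-decreasing b q

hook-addable : ∀ {L u μ} → Box L u μ → ∀ i o → T (addable μ (i , o)) → hook μ (i , o) ≡ i + o
hook-addable {μ = μ} b i o t = trans (cong (countᵇ (inHook i o)) (cells-cellsFrom μ)) (count-hook 0 i o μ (corner i o t) (above i o t))
  where
  corner : ∀ i o → T (addable μ (i , o)) → at μ i ≡ o
  corner zero    o t = sym (≡ᵇ-elim o (at μ 0) t)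
  corner (suc i) o t = sym (≡ᵇ-elim o (at μ (suc i)) (∧-Tˡ (o ≡ᵇ at μ (suc i)) t))
  above : ∀ i o → T (addable μ (i , o)) → ∀ e → e < i → o < at μ e
  above (suc i) o t e (s≤s q) = <-≤-trans (<ᵇ⇒< o (at μ i) (∧-Tʳ (o ≡ᵇ at μ (suc i)) t)) (at-decreasing b q)

within-replicate : ∀ B i j m w → within B i j (replicate m B ++ w) ≡ within B i (j + m) w
within-replicate B i j zero    w = cong (λ z → within B i z w) (sym (ℕ.+-identityʳ j))
within-replicate B i j (suc m) w rewrite ≡ᵇ-refl B = trans (within-replicate B i (suc j) m w) (cong (λ z → within B i z w) (sym (+-suc j m)))

zipAll-replicate : ∀ {B} m m₂ w w₂ → m₂ ≤ m → All (_≤ B) w₂ → zipAll geq (replicate m B ++ w) (replicate m₂ B ++ w₂) ≡ zipAll geq w (drop (m ∸ m₂) w₂)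
zipAll-replicate {B} (suc m) (suc m₂) w w₂       (s≤s q) ps rewrite ≤ᵇ-true (≤-refl {B}) = zipAll-replicate m m₂ w w₂ q ps
zipAll-replicate     zero    zero     w w₂       z≤n     ps = refl
zipAll-replicate     (suc m) zero     w []       z≤n     ps = sym (zipAll-[] geq w)
zipAll-replicate     (suc m) zero     w (v ∷ w₂) z≤n     (p ∷ ps) rewrite ≤ᵇ-true p = zipAll-replicate m zero w w₂ z≤n ps

rowAt-drop : ∀ {V : Set} {m₂ m} (w : List V) c → m₂ ≤ m → rowAt m₂ w (m + c) ≡ rowAt 0 (drop (m ∸ m₂) w) c
rowAt-drop {m = m} w c z≤n = go m w
  where
  go : ∀ m w → rowAt 0 w (m + c) ≡ rowAt 0 (drop m w) c
  go zero    w       = refl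
  go (suc m) []      = refl
  go (suc m) (_ ∷ w) = go m w
rowAt-drop w c (s≤s q) = rowAt-drop w c q

module _ (μ : List ℕ) where

  ownCell : ℕ → ℕ → ℕ → Bool
  ownCell i o v = if addable μ (i , o) then (1 ≤ᵇ v) ∧ (v ≤ᵇ hook μ (i , o)) else true

  ownRow : ℕ → ℕ → List ℕ → Bool
  ownRow i o []      = true
  ownRow i o (v ∷ w) = ownCell i o v ∧ ownRow i (suc o) w

  ownT : ℕ → List ℕ → List (List ℕ) → Bool
  ownT i (m ∷ μ′) (w ∷ t) = ownRow i m w ∧ ownT (suc i) μ′ t
  ownT i _        _       = true

  module RPP = Check {ℕ} geq geq (λ i o _ v → ownCell i o v) (λ o m v → refl)

  checkRow-skew : ∀ i o w w₂ {above below} → (∀ c → below (o + c) ≡ rowAt 0 w₂ c) → RPP.checkRow i o w above below ≡ linked geq w ∧ (zipAll geq w w₂ ∧ ownRow i o w)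
  checkRow-skew i o []      w₂ h = refl
  checkRow-skew i o (v ∷ w) w₂ {above} {below} h = trans (cong₂ (λ x y → (atM (head? w) (geq v) ∧ (atM x (geq v) ∧ ownCell i o v)) ∧ y)
      (trans (cong below (sym (ℕ.+-identityʳ o))) (h 0))
      (checkRow-skew i (suc o) w (drop 1 w₂) {above} (λ c → trans (cong below (sym (+-suc o c))) (trans (h (suc c)) (tail w₂ c)))))
    (trans (∧-interchange (atM (head? w) (geq v)) (atM (rowAt 0 w₂ 0) (geq v) ∧ ownCell i o v) (linked geq w) _)
      (cong ((atM (head? w) (geq v) ∧ linked geq w) ∧_) (trans (∧-interchange (atM (rowAt 0 w₂ 0) (geq v)) (ownCell i o v) (zipAll geq w (drop 1 w₂)) (ownRow i (suc o) w)) (cong (_∧ ownRow i o (v ∷ w)) (zip w w₂)))))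
    where
    tail : ∀ (w : List ℕ) c → rowAt 0 w (suc c) ≡ rowAt 0 (drop 1 w) c
    tail []      c = refl
    tail (_ ∷ _) c = refl
    zip : ∀ w w₂ → atM (rowAt 0 w₂ 0) (geq v) ∧ zipAll geq w (drop 1 w₂) ≡ zipAll geq (v ∷ w) w₂
    zip []      []       = refl
    zip (_ ∷ _) []       = refl
    zip w       (_ ∷ w₂) = refl

  check-skew : ∀ {B L u μ′} → Box L u μ′ → ∀ t → length t ≡ L → All (All (_≤ B)) t → ∀ i above →
    RPP.check i above (offsets μ′ t) ≡ linkedP t ∧ (zipsP (mark B μ′ t) ∧ ownT i μ′ t)
  check-skew []      []      e ps i above = refl
  check-skew {B} {μ′ = m ∷ μ′} (p ∷ b) (w ∷ t) e (q ∷ ps) i above = trans (cong₂ _∧_ (this b t (suc-injective e) ps) (check-skew b t (suc-injective e) ps (suc i) (rowAt m w)))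
    (trans (∧-interchange (linked geq w) _ (linkedP t) _) (cong (linkedP (w ∷ t) ∧_) (∧-interchange (zipAll geq (replicate m B ++ w) (headRow (mark B μ′ t))) (ownRow i m w) (zipsP (mark B μ′ t)) (ownT (suc i) μ′ t))))
    where
    this : ∀ {L μ′} → Box L m μ′ → ∀ t → length t ≡ L → All (All (_≤ B)) t → RPP.checkRow i m w above (cellAt (offsets μ′ t) 0) ≡
      linked geq w ∧ (zipAll geq (replicate m B ++ w) (headRow (mark B μ′ t)) ∧ ownRow i m w)
    this [] [] e [] = trans (checkRow-skew i m w [] (λ c → refl)) (cong (λ z → linked geq w ∧ (z ∧ ownRow i m w)) (trans (zipAll-[] geq w) (sym (zipAll-[] geq (replicate m B ++ w)))))
    this (_∷_ {r = m₂} p b) (w₂ ∷ t) e (q ∷ ps) = trans (checkRow-skew i m w (drop (m ∸ m₂) w₂) (λ c → rowAt-drop w₂ c p)) (cong (λ z → linked geq w ∧ (z ∧ ownRow i m w)) (sym (zipAll-replicate m m₂ w w₂ p q)))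

  isRPP-check : ∀ t → isRPP μ (flatten 0 (offsets μ t)) ≡ RPP.check 0 (λ _ → nothing) (offsets μ t)
  isRPP-check t = trans (all-cong (λ { ((i , o) , v) → refl }) (flatten 0 (offsets μ t))) (RPP.all-ok (offsets μ t))

module _ {L u : ℕ} {μ : List ℕ} (bμ : Box L u μ) where

  ownCell-from : ∀ {B v} i o → 1 ≤ v → v < B → T ((v ≡ᵇ B) ∨ (v ≤ᵇ i + o)) → T (ownCell μ i o v)
  ownCell-from {B} {v} i o p q t with addable μ (i , o) in eq
  ... | false = tt
  ... | true  = ∧-T (≤ᵇ-intro p) (subst (λ z → T (v ≤ᵇ z)) (sym (hook-addable bμ i o (true-T eq))) (small (∨-elim (v ≡ᵇ B) (v ≤ᵇ i + o) t)))
    where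
    small : T (v ≡ᵇ B) ⊎ T (v ≤ᵇ i + o) → T (v ≤ᵇ i + o)
    small (inj₁ e) = ⊥-elim (<⇒≢ q (≡ᵇ-elim v B e))
    small (inj₂ s) = s

  ownRow-from : ∀ {B} i o {w} → All (λ k → 1 ≤ k × k < B) w → T (within B i o w) → T (ownRow μ i o w)
  ownRow-from i o []             t = tt
  ownRow-from {B} i o {v ∷ w} ((p , q) ∷ ps) t = ∧-T (ownCell-from i o p q (∧-Tˡ ((v ≡ᵇ B) ∨ (v ≤ᵇ i + o)) t)) (ownRow-from i (suc o) ps (∧-Tʳ ((v ≡ᵇ B) ∨ (v ≤ᵇ i + o)) t))

  ownT-from : ∀ {B} i μ′ {t} → All (All (λ k → 1 ≤ k × k < B)) t → T (withinT B i (mark B μ′ t)) → T (ownT μ i μ′ t)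
  ownT-from     i []       ps       h = tt
  ownT-from     i (m ∷ μ′) []       h = tt
  ownT-from {B} i (m ∷ μ′) {w ∷ t} (p ∷ ps) h = ∧-T (ownRow-from i m p (subst T (within-replicate B i 0 m w) (∧-Tˡ (within B i 0 (replicate m B ++ w)) h)))
    (ownT-from (suc i) μ′ ps (∧-Tʳ (within B i 0 (replicate m B ++ w)) h))

  within-linked : ∀ {B} i o w → T (atM (head? w) (λ v → v ≤ᵇ i + o)) → T (linked geq w) → T (within B i o w)
  within-linked     i o []      h t = tt
  within-linked {B} i o (v ∷ w) h t = ∧-T (∨-introʳ (v ≡ᵇ B) h) (within-linked i (suc o) w (next w t) (∧-Tʳ (atM (head? w) (geq v)) t))
    where
    next : ∀ w → T (atM (head? w) (geq v) ∧ linked geq w) → T (atM (head? w) (λ v′ → v′ ≤ᵇ i + suc o))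
    next []       t = tt
    next (v′ ∷ w) t = ≤ᵇ-intro (≤-trans (≤ᵇ-elim v′ v (∧-Tˡ (v′ ≤ᵇ v) t)) (≤-trans (≤ᵇ-elim v (i + o) h) (+-monoʳ-≤ i (n≤1+n o))))

  ownCell-to : ∀ i o {v} → T (addable μ (i , o)) → T (ownCell μ i o v) → v ≤ i + o
  ownCell-to i o {v} a t = ≤-trans (≤ᵇ-elim v (hook μ (i , o)) (∧-Tʳ (1 ≤ᵇ v) (subst (λ z → T (if z then (1 ≤ᵇ v) ∧ (v ≤ᵇ hook μ (i , o)) else true)) (T-true a) t))) (≤-reflexive (hook-addable bμ i o a))

  headBound : ℕ → List ℕ → List (List ℕ) → Bool
  headBound i (m ∷ _) (w ∷ _) = atM (head? w) (λ v → v ≤ᵇ i + m)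
  headBound i _       _       = true

  -- A label in the first cell of a row is bounded by its hook if that cell is addable, and by the label above it otherwise.
  ownT-to : ∀ {B i L u v μ′ ls} → (∀ d → at μ (i + d) ≡ at μ′ d) → Box L u μ′ → Box L v ls → ∀ t → lengths t ≡ differences μ′ ls → All (All (_≤ B)) t →
    T (linkedP t) → T (zipsP (mark B μ′ t)) → T (ownT μ i μ′ t) → T (headBound i μ′ t) → T (withinT B i (mark B μ′ t))
  ownT-to k [] [] [] e ps x y z h = tt
  ownT-to {B} {i} {μ′ = m ∷ μ′} {l ∷ ls} k (p ∷ b) (q ∷ c) (w ∷ t) e (_ ∷ ps) x y z h = ∧-T
    (subst T (sym (within-replicate B i 0 m w)) (within-linked i m w h (∧-Tˡ (linked geq w) x)))
    (ownT-to (λ d → trans (cong (at μ) (sym (+-suc i d))) (k (suc d))) b c t (proj₂ (ListP.∷-injective e)) ps (∧-Tʳ (linked geq w) x) (∧-Tʳ (zipAll geq (replicate m B ++ w) (headRow (mark B μ′ t))) y) (∧-Tʳ (ownRow μ i m w) z)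
      (next b c t (proj₂ (ListP.∷-injective e)) ps (λ d → k (suc d)) (∧-Tˡ (zipAll geq (replicate m B ++ w) (headRow (mark B μ′ t))) y) (∧-Tʳ (ownRow μ i m w) z)))
    where
    len : length w ≡ l ∸ m
    len = proj₁ (ListP.∷-injective e)
    next : ∀ {L μ′ ls} → Box L m μ′ → Box L l ls → ∀ t → lengths t ≡ differences μ′ ls → All (All (_≤ B)) t → (∀ d → at μ (i + suc d) ≡ at μ′ d) →
      T (zipAll geq (replicate m B ++ w) (headRow (mark B μ′ t))) → T (ownT μ (suc i) μ′ t) → T (headBound (suc i) μ′ t)
    next [] [] t e ps k y z = tt
    next (_ ∷ _) (_ ∷ _) ([] ∷ t) e ps k y z = tt
    next {μ′ = m₂ ∷ _} (p ∷ _) (_∷_ {r = l₂} q _) ((v₂ ∷ w₂) ∷ t) e (ps ∷ _) k′ y z with m≤n⇒m<n∨m≡n p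
    ... | inj₁ m₂<m = ≤ᵇ-intro {v₂} (ownCell-to (suc i) m₂ {v₂} (subst T (sym (cong₂ (λ a b → (m₂ ≡ᵇ a) ∧ (m₂ <ᵇ b)) (trans (cong (at μ) (ℕ.+-comm 1 i)) (k′ 0)) (trans (cong (at μ) (sym (ℕ.+-identityʳ i))) (k 0))))
        (∧-T (≡ᵇ-intro {m₂} refl) (<⇒<ᵇ m₂<m))) (∧-Tˡ (ownCell μ (suc i) m₂ v₂) (∧-Tˡ (ownRow μ (suc i) m₂ (v₂ ∷ w₂)) z)))
    ... | inj₂ refl = ≤ᵇ-intro (≤-trans (below-first w len h (subst T (trans (zipAll-replicate m m w (v₂ ∷ w₂) ≤-refl ps) (cong (λ z → zipAll geq w (drop z (v₂ ∷ w₂))) (n∸n≡0 m))) y)) (n≤1+n (i + m)))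
      where
      below-first : ∀ w → length w ≡ l ∸ m → T (atM (head? w) (λ v → v ≤ᵇ i + m)) → T (zipAll geq w (v₂ ∷ w₂)) → v₂ ≤ i + m
      below-first []      e₁ h t = ⊥-elim (n≮0 (≤-trans (≤-reflexive (proj₁ (ListP.∷-injective e))) (≤-trans (ℕ.∸-monoˡ-≤ m q) (≤-reflexive (sym e₁)))))
      below-first (v ∷ w) e₁ h t = ≤-trans (≤ᵇ-elim v₂ v (∧-Tˡ (v₂ ≤ᵇ v) t)) (≤ᵇ-elim v (i + m) h)

  -- At an addable cell the hook is i + j. To the right and downwards labels decrease weakly while i
  -- + j grows, so bounding the addable cells by their hooks bounds every cell (i , j) of the skew
  -- shape by i + j.
  isRPP-mark : ∀ {v ls B} → Box L v ls → ∀ t → lengths t ≡ differences μ ls → All (All (λ k → 1 ≤ k × k < B)) t →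
    isRPP μ (flatten 0 (offsets μ t)) ≡ linkedP t ∧ (zipsP (mark B μ t) ∧ withinT B 0 (mark B μ t))
  isRPP-mark {B = B} bl t e ps = trans (trans (isRPP-check μ t) (check-skew μ bμ t len ps′ 0 (λ _ → nothing)))
    (T⇒≡ (λ h → let x = ∧-Tˡ (linkedP t) h ; y = ∧-Tˡ (zipsP (mark B μ t)) (∧-Tʳ (linkedP t) h) ; z = ∧-Tʳ (zipsP (mark B μ t)) (∧-Tʳ (linkedP t) h) in
           ∧-T x (∧-T y (ownT-to (λ d → refl) bμ bl t e ps′ x y z (first μ t refl z))))
         (λ h → ∧-T (∧-Tˡ (linkedP t) h) (∧-T (∧-Tˡ (zipsP (mark B μ t)) (∧-Tʳ (linkedP t) h)) (ownT-from 0 μ ps (∧-Tʳ (zipsP (mark B μ t)) (∧-Tʳ (linkedP t) h))))))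
    where
    weaken : ∀ {t} → All (All (λ k → 1 ≤ k × k < B)) t → All (All (_≤ B)) t
    weaken = All-weaken (All-weaken (λ { (_ , q) → <⇒≤ q }))
      where
      All-weaken : ∀ {A : Set} {P Q : A → Set} → (∀ {x} → P x → Q x) → ∀ {xs} → All P xs → All Q xs
      All-weaken h []       = []
      All-weaken h (p ∷ ps) = h p ∷ All-weaken h ps
    ps′ = weaken ps
    len : length t ≡ L
    len = trans (sym (ListP.length-map length t)) (trans (cong length e) (count bμ bl))
      where
      count : ∀ {L u v μ ls} → Box L u μ → Box L v ls → length (differences μ ls) ≡ L
      count []      []      = refl
      count (_ ∷ b) (_ ∷ c) = cong suc (count b c)
    first : ∀ μ′ t → μ ≡ μ′ → T (ownT μ 0 μ′ t) → T (headBound 0 μ′ t)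
    first []       t              e z = tt
    first (m ∷ μ′) []             e z = tt
    first (m ∷ μ′) ([] ∷ t)       e z = tt
    first (m ∷ μ′) ((v ∷ w) ∷ t) e z = ≤ᵇ-intro {v} (ownCell-to 0 m {v} (≡ᵇ-intro {m} (sym (cong (λ z → at z 0) e))) (∧-Tˡ (ownCell μ 0 m v) (∧-Tˡ (ownRow μ 0 m (v ∷ w)) z)))

labels-applyUpTo : ∀ {f : ℕ → ℕ} k n → (∀ i → f i ≡ k + i) → labels k n ≡ applyUpTo f (suc n)
labels-applyUpTo k zero    h = cong (_∷ []) (sym (trans (h 0) (ℕ.+-identityʳ k)))
labels-applyUpTo k (suc n) h = cong₂ _∷_ (sym (trans (h 0) (ℕ.+-identityʳ k))) (labels-applyUpTo (suc k) n (λ i → trans (h (suc i)) (+-suc k i)))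

-- Labels range over 1, ..., |μ|, so |μ| + 1 is free to serve as the largest label marking μ; the
-- delta function fixes the marked shape.
rppCount-planePartitions : ∀ {L u v μ ls} → Box L u μ → Box L v ls → (∀ i → at μ i ≤ at ls i) → + rppCount μ ls ≡ planePartitions (suc (sum μ)) 1 (sum μ) ls (δ μ)
rppCount-planePartitions {μ = μ} {ls} b c h = begin
  + rppCount μ ls
    ≡⟨ +countᵇ (isRPP μ) (assignments (skewCells ls μ) (oneTo M′)) ⟩
  ∑ (assignments (skewCells ls μ) (oneTo M′)) (λ f → when (isRPP μ f) (+ 1))
    ≡⟨ trans (cong (λ z → ∑ (assignments z (oneTo M′)) (λ f → when (isRPP μ f) (+ 1))) (skewCells-cellsFrom μ ls)) (∑-assignments-cells (oneTo M′) 0 μ D _) ⟩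
  sumT D (oneTo M′) (λ t → when (isRPP μ (flatten 0 (offsets μ t))) (+ 1))
    ≡⟨ sumT-cong (All-map-id (oneTo-bounded M′)) D (λ {t} e ps → trans (cong (λ z → when z (+ 1)) (isRPP-mark b c t e ps)) (sym (when-∧ (linkedP t) _ (+ 1)))) ⟩
  sumT D (oneTo M′) (λ t → when (linkedP t) (when (zipsP (mark B μ t) ∧ withinT B 0 (mark B μ t)) (+ 1)))
    ≡⟨ sym (sumT-marker M′ (All-snd (oneTo-bounded M′)) b c h (λ t → when (zipsP t ∧ withinT B 0 t) (+ 1))) ⟩
  sumT ls (oneTo M′ ∷ʳ B) (λ t → when (linkedP t) (when (eqList μ (markerShape B t)) (when (zipsP t ∧ withinT B 0 t) (+ 1))))
    ≡⟨ trans (cong (λ z → sumT ls z (λ t → when (linkedP t) (when (eqList μ (markerShape B t)) (when (zipsP t ∧ withinT B 0 t) (+ 1))))) (trans (sym (oneTo-suc M′)) (trans (ListP.map-upTo suc (suc M′)) (sym (labels-applyUpTo 1 M′ (λ i → refl))))))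
         (respects (sumT-linear (labels 1 M′) ls) (λ t → trans (cong (when (linkedP t)) (when-comm (eqList μ (markerShape B t)) (zipsP t ∧ withinT B 0 t) (+ 1))) (when-∧ (linkedP t) _ _))) ⟩
  planePartitions B 1 M′ ls (δ μ) ∎
  where
  M′ = sum μ
  B = suc (sum μ)
  D = differences μ ls
  All-map-id : ∀ {xs} → All (λ k → 1 ≤ k × k ≤ M′) xs → All (λ k → 1 ≤ k × k < B) xs
  All-map-id []             = []
  All-map-id ((p , q) ∷ ps) = (p , s≤s q) ∷ All-map-id ps
  All-snd : ∀ {xs} → All (λ k → 1 ≤ k × k ≤ M′) xs → All (_≤ M′) xs
  All-snd []             = []
  All-snd ((_ , q) ∷ ps) = q ∷ All-snd ps

positive-rows : ∀ i {μ : List ℕ} → (∀ e → e < i → 0 < at μ e) → i + at μ i ≤ sum μ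
positive-rows zero    {[]}    h = z≤n
positive-rows zero    {m ∷ μ} h = m≤m+n m (sum μ)
positive-rows (suc i) {[]}    h = ⊥-elim (n≮0 (h 0 (s≤s z≤n)))
positive-rows (suc i) {m ∷ μ} h = +-mono-≤ (h 0 (s≤s z≤n)) (positive-rows i {μ} (λ e q → h (suc e) (s≤s q)))

-- A diagram with fewer than k cells has no cell (i , j) with i + j ≥ k.
beyond-size : ∀ {N μ ρ} → Box N N μ → Box N N ρ → ∀ k → sum μ < k → ker (beyond (threshold 0 k)) ρ μ ≡ eqList μ ρ
beyond-size {N} {μ} {ρ} b c k p = T⇒≡ to from
  where
  len : length ρ ≡ length μ
  len = trans (Box-length c) (sym (Box-length b))
  from : T (eqList μ ρ) → T (ker (beyond (threshold 0 k)) ρ μ)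
  from t = ker-from (beyond (threshold 0 k)) c b (λ i _ → beyond-≡ (threshold 0 k) i (cong (λ z → at z i) (eqList-elim μ ρ t)))
  to : T (ker (beyond (threshold 0 k)) ρ μ) → T (eqList μ ρ)
  to t = true-T (subst (λ z → eqList μ z ≡ true) (sym (Box-ext c b (λ i _ → equal (suc i) i ≤-refl))) (eqList-refl μ))
    where
    inside = beyond-ker-to (threshold 0 k) ρ μ len t
    equal : ∀ n i → i < n → at ρ i ≡ at μ i
    equal (suc n) i (s≤s q) with m≤n⇒m<n∨m≡n (proj₁ inside i)
    ... | inj₂ e = sym e
    ... | inj₁ r = ⊥-elim (<-irrefl refl (proj₂ inside i (at μ i) low r))
      where
      small : i + at μ i < k
      small = ≤-<-trans (positive-rows i {μ} (λ e s → <-≤-trans (≤-<-trans z≤n r) (≤-trans (at-decreasing c (<⇒≤ s)) (≤-reflexive (equal n e (<-≤-trans s q)))))) p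
      i<k : i < k
      i<k = ≤-<-trans (m≤m+n i (at μ i)) small
      low : at μ i < threshold 0 k i
      low = subst (at μ i <_) (sym (threshold-< 0 i<k)) (m+n≤o⇒m≤o∸n (suc (at μ i)) (≤-trans (≤-reflexive (cong suc (ℕ.+-comm (at μ i) i))) small))

chain-stable : ∀ N p k m n g → (∀ k′ → k + m ≤ k′ → ∀ {ρ} → Box N N ρ → removal N (beyond (threshold p k′)) g ρ ≡ g ρ) → ∀ {ls} → Box N N ls → chain N p k (m + n) g ls ≡ chain N p k m g ls
chain-stable N p k zero    zero    g h b = refl
chain-stable N p k zero    (suc n) g h {ls} b = trans (removal-cong N (beyond (threshold p k)) ls (λ c → chain-stable N p (suc k) 0 n g (λ k′ q → h k′ (≤-trans (n≤1+n _) q)) c)) (h k (≤-reflexive (ℕ.+-identityʳ k)) b)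
chain-stable N p k (suc m) n       g h {ls} b = removal-cong N (beyond (threshold p k)) ls (λ c → chain-stable N p (suc k) m n g (λ k′ q → h k′ (≤-trans (≤-reflexive (+-suc k m)) q)) c)

chain-zero : ∀ N p k n {g ls} → Box N N ls → (∀ {ρ} → Box N N ρ → (∀ i → at ρ i ≤ at ls i) → g ρ ≡ + 0) → chain N p k n g ls ≡ + 0
chain-zero N p k zero    b h = h b (λ i → ≤-refl)
chain-zero N p k (suc n) {g} {ls} b h = ΣD-zero N N (λ {ρ} c → trans (when-cong (ker (beyond (threshold p k)) ls ρ) (λ t →
    let sub = proj₁ (beyond-ker-to (threshold p k) ls ρ (trans (Box-length b) (sym (Box-length c))) t) in
    chain-zero N p (suc k) n c (λ d h′ → h d (λ i → ≤-trans (h′ i) (sub i))))) (when-0 (ker (beyond (threshold p k)) ls ρ)))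

-- P uses labels up to |μ| and `RT` levels up to N + N. By `beyond-size` no cell can be removed at a
-- level above |μ| on the way to μ, so the extra levels act trivially. If μ is not contained in λ,
-- no sequence of removals reaches it.
+P : ∀ {N μ ls} → Box N N μ → Box N N ls → sum μ ≤ N + N → + P μ ls ≡ RT N (δ μ) ls
+P {N} {μ} {ls} b c p rewrite P-rppCount μ ls with contained μ ls in eq
... | false = sym (chain-zero N 0 1 (N + N) c (λ {ρ} d sub → cong (λ z → when z (+ 1)) (eqList-false {μ} {ρ} (λ e → absurd (contained-from μ ls (λ i → ≤-trans (≤-reflexive (cong (λ z → at z i) e)) (sub i)))))))
  where
  absurd : T (contained μ ls) → ⊥
  absurd t rewrite eq = t
... | true  = begin
  + rppCount μ ls
    ≡⟨ rppCount-planePartitions b c (contained-to μ ls (true-T eq)) ⟩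
  planePartitions (suc (sum μ)) 1 (sum μ) ls (δ μ)
    ≡⟨ planePartitions-chain (suc (sum μ)) 1 (sum μ) refl c (δ μ) ⟩
  chain N 0 1 (sum μ) (δ μ) ls
    ≡⟨ sym (chain-stable N 0 1 (sum μ) (N + N ∸ sum μ) (δ μ) (λ k q {ρ} d → trans (ΣD-cong N N (λ {σ} _ → when-comm (ker (beyond (threshold 0 k)) ρ σ) (eqList μ σ) (+ 1)))
         (trans (ΣD-δ b (λ σ → when (ker (beyond (threshold 0 k)) ρ σ) (+ 1))) (cong (λ z → when z (+ 1)) (beyond-size b d k q)))) c) ⟩
  chain N 0 1 (sum μ + (N + N ∸ sum μ)) (δ μ) ls
    ≡⟨ cong (λ z → chain N 0 1 z (δ μ) ls) (m+[n∸m]≡n p) ⟩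
  RT N (δ μ) ls ∎
 

-- Padded partitions

pad : ℕ → List ℕ → List ℕ
pad N ls = ls ++ replicate (N ∸ length ls) 0

at-pad : ∀ ls c i → at (ls ++ replicate c 0) i ≡ at ls i
at-pad []       zero    i       = refl
at-pad []       (suc c) zero    = refl
at-pad []       (suc c) (suc i) = at-pad [] c i
at-pad (l ∷ ls) c       zero    = refl
at-pad (l ∷ ls) c       (suc i) = at-pad ls c i

sum-pad : ∀ ls c → sum (ls ++ replicate c 0) ≡ sum ls
sum-pad []       zero    = refl
sum-pad []       (suc c) = sum-pad [] c
sum-pad (l ∷ ls) c       = cong (λ z → l + z) (sum-pad ls c)

cells-pad : ∀ ls c → cells (ls ++ replicate c 0) ≡ cells ls
cells-pad ls c = trans (cells-cellsFrom (ls ++ replicate c 0)) (trans (go 0 ls c) (sym (cells-cellsFrom ls)))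
  where
  go : ∀ k ls c → cellsFrom k [] (ls ++ replicate c 0) ≡ cellsFrom k [] ls
  go k []       zero    = refl
  go k []       (suc c) = go (suc k) [] c
  go k (l ∷ ls) c       = cong (rowCells k 0 l ++_) (go (suc k) ls c)

G-pad : ∀ N ls a → G (pad N ls) a ≡ G ls a
G-pad N ls a = cong₂ (λ s cs → sumℤ (map (λ T → sign (entries T ∸ s)) (filterᵇ (λ T → isSVT T ∧ eqList (svtContent (length a) T) a) (assignments cs (nonemptySubsets (length a))))))
  (sum-pad ls _) (cells-pad ls _)

jt-pad : ∀ N ls a → jt (pad N ls) a ≡ jt ls a
jt-pad N ls a = cong₂ (λ s cs → sign (s + sum a) *ℤ + countᵇ (λ T → isVST T ∧ eqList (vstContent (length a) T) a)
    (assignments cs (concatMap (λ v → (v , false) ∷ (v , true) ∷ []) (oneTo (length a)))))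
  (sum-pad ls _) (cells-pad ls _)

filterᵇ-cong : {A : Set} {p q : A → Bool} → (∀ x → p x ≡ q x) → ∀ xs → filterᵇ p xs ≡ filterᵇ q xs
filterᵇ-cong         h []       = refl
filterᵇ-cong {q = q} h (x ∷ xs) rewrite h x with q x
... | true  = cong (x ∷_) (filterᵇ-cong h xs)
... | false = filterᵇ-cong h xs

-- P sees its arguments only through row lengths, cells and the size of the inner shape, none of
-- which changes with trailing zeros.
P-cong : ∀ {μ μ′ ls ls′} → (∀ i → at μ i ≡ at μ′ i) → cells μ ≡ cells μ′ → sum μ ≡ sum μ′ → (∀ i → at ls i ≡ at ls′ i) → cells ls ≡ cells ls′ → P μ ls ≡ P μ′ ls′
P-cong {μ} {μ′} {ls} {ls′} h c s h′ c′ = begin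
  P μ ls
    ≡⟨ P-rppCount μ ls ⟩
  (if contained μ ls then rppCount μ ls else 0)
    ≡⟨ cong₂ (λ x y → if x then y else 0) (T⇒≡ (λ t → contained-from μ′ ls′ (λ i → cast (h i) (h′ i) (contained-to μ ls t i))) (λ t → contained-from μ ls (λ i → cast (sym (h i)) (sym (h′ i)) (contained-to μ′ ls′ t i)))) count ⟩
  (if contained μ′ ls′ then rppCount μ′ ls′ else 0)
    ≡⟨ sym (P-rppCount μ′ ls′) ⟩
  P μ′ ls′ ∎
  where
  cast : ∀ {a b c d} → a ≡ b → c ≡ d → a ≤ c → b ≤ d
  cast refl refl p = p
  skew : skewCells ls μ ≡ skewCells ls′ μ′
  skew = trans (cong (filterᵇ _) c′) (filterᵇ-cong (λ { (i , o) → cong (λ z → not (o <ᵇ z)) (h i) }) (cells ls′))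
  corner : ∀ i o → addable μ (i , o) ≡ addable μ′ (i , o)
  corner zero    o = cong (o ≡ᵇ_) (h 0)
  corner (suc i) o = cong₂ (λ x y → (o ≡ᵇ x) ∧ (o <ᵇ y)) (h (suc i)) (h i)
  rpp : ∀ f → isRPP μ f ≡ isRPP μ′ f
  rpp f = all-cong (λ { ((i , o) , v) → cong₂ (λ x y → atCell f (i , suc o) (λ w → w ≤ᵇ v) ∧ (atCell f (suc i , o) (λ w → w ≤ᵇ v) ∧ (if x then (1 ≤ᵇ v) ∧ (v ≤ᵇ y) else true))) (corner i o) (cong (countᵇ (inHook i o)) c) }) f
  count : rppCount μ ls ≡ rppCount μ′ ls′
  count = trans (cong length (filterᵇ-cong rpp (assignments (skewCells ls μ) (oneTo (sum μ))))) (cong₂ (λ x y → countᵇ (isRPP μ′) (assignments x (oneTo y))) skew s)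

P-pad : ∀ N μ K ls → P (pad N μ) (pad K ls) ≡ P μ ls
P-pad N μ K ls = P-cong {pad N μ} {μ} {pad K ls} {ls} (at-pad μ c) (cells-pad μ c) (sum-pad μ c) (at-pad ls d) (cells-pad ls d)
  where
  c = N ∸ length μ
  d = K ∸ length ls

length-pad : ∀ {N} ls → length ls ≤ N → length (pad N ls) ≡ N
length-pad {N} ls p = trans (ListP.length-++ ls) (trans (cong (λ z → length ls + z) (ListP.length-replicate (N ∸ length ls))) (m+[n∸m]≡n p))

length-≤-sum : ∀ {ls} → All (1 ≤_) ls → length ls ≤ sum ls
length-≤-sum []       = z≤n
length-≤-sum (p ∷ ps) = +-mono-≤ p (length-≤-sum ps)

Box-pad : ∀ {N ls} → All (1 ≤_) ls → (∀ i → at ls (suc i) ≤ at ls i) → sum ls ≤ N → Box N N (pad N ls)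
Box-pad {N} {ls} ps d p = Box-from-at N (pad N ls) (length-pad ls (≤-trans (length-≤-sum ps) p)) (cast 0 (≤-trans (head-≤-sum ls) p))
  (λ i _ → cast (suc i) (≤-trans (d i) (≤-reflexive (sym (at-pad ls _ i)))))
  where
  cast : ∀ i {b} → at ls i ≤ b → at (pad N ls) i ≤ b
  cast i q = ≤-trans (≤-reflexive (at-pad ls _ i)) q
  head-≤-sum : ∀ ls → at ls 0 ≤ sum ls
  head-≤-sum []       = z≤n
  head-≤-sum (l ∷ ls) = m≤m+n l (sum ls)

Box-pad-partition : ∀ {N ls} → IsPartition ls → sum ls ≤ N → Box N N (pad N ls)
Box-pad-partition (ps , ln) p = Box-pad ps (linked-at ln) p
  where
  linked-at : ∀ {ls} → Linked _≥_ ls → ∀ i → at ls (suc i) ≤ at ls i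
  linked-at []       i       = z≤n
  linked-at [-]      zero    = z≤n
  linked-at [-]      (suc i) = z≤n
  linked-at (p ∷ ln) zero    = p
  linked-at (p ∷ ln) (suc i) = linked-at ln i

pad-conj : ∀ {N ls} → Box N N (pad N ls) → pad N (conj ls) ≡ τ N (pad N ls)
pad-conj {N} {ls} b = begin
  conj ls ++ replicate (N ∸ length (conj ls)) 0
    ≡⟨ cong (λ z → z ++ replicate (N ∸ length z) 0) (ListP.map-upTo (col ls) (at ls 0)) ⟩
  applyUpTo (col ls) n ++ replicate (N ∸ length (applyUpTo (col ls) n)) 0
    ≡⟨ cong (λ z → applyUpTo (col ls) n ++ replicate (N ∸ z) 0) (ListP.length-applyUpTo (col ls) n) ⟩
  applyUpTo (col ls) n ++ replicate (N ∸ n) 0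
    ≡⟨ zero-tail (col ls) (cast (at-Box b 0)) (λ i q → trans (sym (col-pad i)) (beyond-first i q)) ⟩
  applyUpTo (col ls) N
    ≡⟨ applyUpTo-cong N (λ i _ → sym (col-pad i)) ⟩
  τ N (pad N ls) ∎
  where
  n = at ls 0
  cast : at (pad N ls) 0 ≤ N → n ≤ N
  cast q = ≤-trans (≤-reflexive (sym (at-pad ls _ 0))) q
  zero-tail : ∀ (f : ℕ → ℕ) {n N} → n ≤ N → (∀ i → n ≤ i → f i ≡ 0) → applyUpTo f n ++ replicate (N ∸ n) 0 ≡ applyUpTo f N
  zero-tail f {zero} {zero}  z≤n h = refl
  zero-tail f {zero} {suc N} z≤n h = cong₂ _∷_ (sym (h 0 z≤n)) (zero-tail (f ∘ suc) {zero} {N} z≤n (λ i q → h (suc i) z≤n))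
  zero-tail f (s≤s q) h = cong (f 0 ∷_) (zero-tail (f ∘ suc) q (λ i q → h (suc i) (s≤s q)))
  col-pad : ∀ i → col (pad N ls) i ≡ col ls i
  col-pad i = trans (countᵇ-++ (λ r → i <ᵇ r) ls _) (trans (cong (λ z → col ls i + z) (zeros (N ∸ length ls))) (ℕ.+-identityʳ _))
    where
    zeros : ∀ c → col (replicate c 0) i ≡ 0
    zeros zero    = refl
    zeros (suc c) = zeros c
  beyond-first : ∀ i → n ≤ i → col (pad N ls) i ≡ 0
  beyond-first i q = ℕ.n≤0⇒n≡0 (ℕ.≮⇒≥ (λ t → <⇒≱ (col-to b 0 i t) (≤-trans (≤-reflexive (at-pad ls _ 0)) q)))

flat-0 : ∀ {L ρ} → Box L 0 ρ → flat ρ ≡ []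
flat-0 []         = refl
flat-0 (z≤n ∷ b) = flat-0 b

pad-flat : ∀ {L u ρ} → Box L u ρ → pad L (flat ρ) ≡ ρ
pad-flat [] = refl
pad-flat (_∷_ {r = suc r} p b) = cong (suc r ∷_) (pad-flat b)
pad-flat (_∷_ {L} {r = zero} {ρ} p b) = trans (cong (pad (suc L)) (flat-0 b)) (cong (0 ∷_) (trans (cong (pad L) (sym (flat-0 b))) (pad-flat b)))

flat-pad : ∀ {α} N → All (1 ≤_) α → flat (pad N α) ≡ α
flat-pad {α} N ps = go ps (N ∸ length α)
  where
  go : ∀ {α} → All (1 ≤_) α → ∀ c → flat (α ++ replicate c 0) ≡ α
  go []                zero    = refl
  go []                (suc c) = go [] c
  go (s≤s {n = x} p ∷ ps) c    = cong (suc x ∷_) (go ps c)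

decreasingᵇ-to : ∀ α → T (decreasingᵇ α) → ∀ i → at α (suc i) ≤ at α i
decreasingᵇ-to []          t i       = z≤n
decreasingᵇ-to (x ∷ [])    t i       = z≤n
decreasingᵇ-to (x ∷ y ∷ α) t zero    = ≤ᵇ-elim y x (∧-Tˡ (y ≤ᵇ x) t)
decreasingᵇ-to (x ∷ y ∷ α) t (suc i) = decreasingᵇ-to (y ∷ α) (∧-Tʳ (y ≤ᵇ x) t) i

decreasingᵇ-from : ∀ α → (∀ i → at α (suc i) ≤ at α i) → T (decreasingᵇ α)
decreasingᵇ-from []          h = tt
decreasingᵇ-from (x ∷ [])    h = tt
decreasingᵇ-from (x ∷ y ∷ α) h = ∧-T (≤ᵇ-intro (h 0)) (decreasingᵇ-from (y ∷ α) (λ i → h (suc i)))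

decreasingᵇ-flat : ∀ {L u ρ} → Box L u ρ → T (decreasingᵇ (flat ρ))
decreasingᵇ-flat {ρ = ρ} b = decreasingᵇ-from (flat ρ) (λ i → ≤-trans (≤-reflexive (value (suc i))) (≤-trans (at-anti b i) (≤-reflexive (sym (value i)))))
  where
  value : ∀ i → at (flat ρ) i ≡ at ρ i
  value i = trans (sym (at-pad (flat ρ) _ i)) (cong (λ z → at z i) (pad-flat b))

-- `pad N` and `flat` are inverse to each other between partitions of n ≤ N and the lists of size n
-- in the box; as in `ΣD-τ`, a delta function carries one sum to the other.
∑-partitionsOf : ∀ {n N} → n ≤ N → ∀ f → ∑ (partitionsOf n) f ≡ ΣD N N (λ ρ → when (sum ρ ≡ᵇ n) (f (flat ρ)))
∑-partitionsOf {n} {N} p f = begin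
  ∑ (partitionsOf n) f
    ≡⟨ ∑-filter decreasingᵇ (compositions n) f ⟩
  ∑ (compositions n) (λ α → when (decreasingᵇ α) (f α))
    ≡⟨ ∑-compositions-cong n (λ α ps e → unflatten α ps (≤-trans (≤-reflexive e) p)) ⟩
  ∑ (compositions n) (λ α → ΣD N N (λ ρ → when (eqList (flat ρ) α) (f α)))
    ≡⟨ linear-ΣD (∑-is-linear (compositions n)) N N (λ ρ α → when (eqList (flat ρ) α) (f α)) ⟩
  ΣD N N (λ ρ → ∑ (compositions n) (λ α → when (eqList (flat ρ) α) (f α)))
    ≡⟨ ΣD-cong N N (λ {ρ} _ → trans (∑-compositions-δ (flat ρ) (flat-pos ρ) n f) (cong (λ z → when (z ≡ᵇ n) (f (flat ρ))) (sum-flat ρ))) ⟩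
  ΣD N N (λ ρ → when (sum ρ ≡ᵇ n) (f (flat ρ))) ∎
  where
  unflatten : ∀ α → All (1 ≤_) α → sum α ≤ N → when (decreasingᵇ α) (f α) ≡ ΣD N N (λ ρ → when (eqList (flat ρ) α) (f α))
  unflatten α ps q with decreasingᵇ α in eq
  ... | true  = sym (trans (ΣD-cong N N (λ {ρ} b → cong (λ z → when z (f α)) (adjoint b))) (ΣD-δ (Box-pad ps (decreasingᵇ-to α (true-T eq)) q) (λ _ → f α)))
    where
    adjoint : ∀ {ρ} → Box N N ρ → eqList (flat ρ) α ≡ eqList (pad N α) ρ
    adjoint {ρ} b = T⇒≡ (λ t → eqList-intro (trans (cong (pad N) (sym (eqList-elim (flat ρ) α t))) (pad-flat b)))
      (λ t → eqList-intro (trans (cong flat (sym (eqList-elim (pad N α) ρ t))) (flat-pad N ps)))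
  ... | false = sym (ΣD-zero N N (λ {ρ} b → cong (λ z → when z (f α)) (eqList-false {flat ρ} {α} (λ e → subst T (trans (cong decreasingᵇ e) eq) (decreasingᵇ-flat b)))))

∑-partitionsUpTo : ∀ {d N} → d ≤ N → ∀ {f g} → (∀ {ρ} → Box N N ρ → d < sum ρ → g ρ ≡ + 0) → (∀ {ρ} → Box N N ρ → sum ρ ≤ d → f (flat ρ) ≡ g ρ) →
  ∑ (partitionsUpTo d) f ≡ ΣD N N g
∑-partitionsUpTo {d} {N} p {f} {g} h₀ h = begin
  ∑ (partitionsUpTo d) f
    ≡⟨ trans (∑-concatMap partitionsOf (upTo (suc d)) f) (∑-upTo (suc d) (λ n → ∑ (partitionsOf n) f)) ⟩
  sum< (suc d) (λ n → ∑ (partitionsOf n) f)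
    ≡⟨ sum<-cong (suc d) (λ n q → ∑-partitionsOf (≤-trans (≤-pred q) p) f) ⟩
  sum< (suc d) (λ n → ΣD N N (λ ρ → when (sum ρ ≡ᵇ n) (f (flat ρ))))
    ≡⟨ sym (linear-sum< (ΣD-linear N N) (λ n ρ → when (sum ρ ≡ᵇ n) (f (flat ρ))) (suc d)) ⟩
  ΣD N N (λ ρ → sum< (suc d) (λ n → when (sum ρ ≡ᵇ n) (f (flat ρ))))
    ≡⟨ ΣD-cong N N (λ {ρ} b → pick b (≤-<-connex (sum ρ) d)) ⟩
  ΣD N N g ∎
  where
  pick : ∀ {ρ} → Box N N ρ → (sum ρ ≤ d) ⊎ (d < sum ρ) → sum< (suc d) (λ n → when (sum ρ ≡ᵇ n) (f (flat ρ))) ≡ g ρ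
  pick {ρ} b (inj₁ q) = trans (sum<-δ (s≤s q) (λ _ → f (flat ρ))) (h b q)
  pick {ρ} b (inj₂ q) = trans (sum<-zero (suc d) (λ n r → cong (λ z → when z (f (flat ρ))) (≡ᵇ-false (>⇒≢ (≤-<-trans (≤-pred r) q))))) (sym (h₀ b q))

-- Degree bounds, and the antipodes of G and of the signed j

-- A strip trades cells for powers of x, and the term -x of the factor 1 - x only raises the
-- exponent, so size plus exponent never decreases. `c` collects the rows already treated.
op-degree : ∀ b K c {f} → (∀ ρ e → K < c + (sum ρ + e) → f ρ e ≡ + 0) → ∀ ls e → K < c + (sum ls + e) → op b f ls e ≡ + 0
op-degree b K c h []       e q = h [] e q
op-degree b K c {f} h (l ∷ ls) e q = cs-zero (nxt ls) (l ∸ nxt ls) e (<-≤-trans q (≤-trans (≤-reflexive (regroup₁ c l (sum ls) e)) (+-monoʳ-≤ (c + sum ls) (+-monoˡ-≤ e (m≤n+m∸n l (nxt ls))))))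
  where
  regroup₁ : ∀ c l s e → c + (l + s + e) ≡ (c + s) + (l + e)
  regroup₁ = ℕSolver.solve-∀
  regroup₂ : ∀ c s r e → (c + s) + (r + e) ≡ (c + r) + (s + e)
  regroup₂ = ℕSolver.solve-∀
  regroup₃ : ∀ c r s e → (c + r) + (s + e) ≡ c + (r + s + e)
  regroup₃ = ℕSolver.solve-∀
  F : ℕ → ℕ → ℤ
  F r = mk b (nxt ls) r (op b (λ ρ → f (r ∷ ρ)) ls)
  F₀ : ∀ r e → K < (c + sum ls) + (r + e) → op b (λ ρ → f (r ∷ ρ)) ls e ≡ + 0
  F₀ r e q = op-degree b K (c + r) (λ ρ e q → h (r ∷ ρ) e (subst (K <_) (regroup₃ c r (sum ρ) e) q)) ls e (subst (K <_) (regroup₂ c (sum ls) r e) q)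
  F-zero : ∀ r e → K < (c + sum ls) + (r + e) → F r e ≡ + 0
  F-zero r e q with b ∧ (nxt ls <ᵇ r)
  ... | false = F₀ r e q
  ... | true  = cong₂ (λ x y → x +ℤ - y) (F₀ r e q) (F₀ r (suc e) (<-≤-trans q (+-monoʳ-≤ (c + sum ls) (+-monoʳ-≤ r (n≤1+n e)))))
  cs-zero : ∀ n d e → K < (c + sum ls) + ((n + d) + e) → cs F n d e ≡ + 0
  cs-zero n zero    e q = F-zero n e (subst (λ z → K < (c + sum ls) + (z + e)) (ℕ.+-identityʳ n) q)
  cs-zero n (suc d) e q = cong₂ _+ℤ_ (cs-zero n d (suc e) (subst (λ z → K < (c + sum ls) + z) (trans (cong (_+ e) (+-suc n d)) (sym (+-suc (n + d) e))) q)) (F-zero (n + suc d) e q)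

grothendieck-degree : ∀ a ls → sum a < sum ls → grothendieck a ls ≡ + 0
grothendieck-degree a ls = go a 0 δ∅ (λ ρ q → cong (λ z → when z (+ 1)) (≡ᵇ-false (>⇒≢ q))) ls
  where
  go : ∀ as n g → (∀ ρ → n < sum ρ → g ρ ≡ + 0) → ∀ ls → n + sum as < sum ls → AA as g ls ≡ + 0
  go []       n g h ls q = h ls (subst (_< sum ls) (ℕ.+-identityʳ n) q)
  go (a ∷ as) n g h ls q = go as (n + a) (Ac a g)
    (λ ρ q → op-degree true (n + a) 0 (λ σ e q → trans (when-cong (e ≡ᵇ a) (λ t → h σ (ℕ.+-cancelʳ-< a n (sum σ) (subst (λ z → n + a < sum σ + z) (≡ᵇ-elim e a t) q)))) (when-0 (e ≡ᵇ a)))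
      ρ 0 (subst (n + a <_) (sym (ℕ.+-identityʳ (sum ρ))) q))
    ls (subst (_< sum ls) (sym (ℕ.+-assoc n a (sum as))) q)

schur-degree : ∀ a {L u ls} → Box L u ls → sum ls ≢ sum a → schur a ls ≡ + 0
schur-degree a b q = go a 0 δ∅ (λ _ q → cong (λ z → when z (+ 1)) (≡ᵇ-false q)) b q
  where
  go : ∀ as n g → (∀ {L u ρ} → Box L u ρ → sum ρ ≢ n → g ρ ≡ + 0) → ∀ {L u ls} → Box L u ls → sum ls ≢ n + sum as → HH as g ls ≡ + 0
  go []       n g h b q = h b (λ e → q (trans e (sym (ℕ.+-identityʳ n))))
  go (a ∷ as) n g h b q = go as (n + a) (Hc a g) (λ {L} {u} {ls} b q → trans (op-kernel b _ 0) (ΣD-zero L u (λ {ρ} c → trans (when-cong (hs ls ρ) (λ t → trans (when-cong (sum ls ∸ sum ρ ≡ᵇ a) (λ t′ → h c (λ e →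
      q (trans (sym (m+[n∸m]≡n (at-mono-sum b c (λ i → proj₂ (hs-to ls ρ t i))))) (cong₂ _+_ e (≡ᵇ-elim _ a t′)))))) (when-0 (sum ls ∸ sum ρ ≡ᵇ a)))) (when-0 (hs ls ρ)))))
    b (λ e → q (trans e (ℕ.+-assoc n a (sum as))))

RT-linear : ∀ N ls → Linear (λ g → RT N g ls)
RT-linear N = go 1 (N + N)
  where
  go : ∀ k n ls → Linear (λ g → chain N 0 k n g ls)
  go k zero    ls = linear-eval ls
  go k (suc n) ls = linear-∘ (ΣD-linear N N) (λ ρ → when-linear (ker (beyond (threshold 0 k)) ls ρ) (go (suc k) n ρ))

δ-comm : ∀ ν ρ → δ ν ρ ≡ δ ρ ν
δ-comm ν ρ = cong (λ z → when z (+ 1)) (eqList-sym ν ρ)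

RT-expand : ∀ {N ls} → Box N N ls → ∀ g → RT N g ls ≡ ΣD N N (λ μ → RT N (δ μ) ls *ℤ g μ)
RT-expand {N} {ls} b g = begin
  RT N g ls
    ≡⟨ chain-cong N 0 1 (N + N) b (λ {ρ} c → sym (trans (ΣD-cong N N (λ {μ} _ → trans (ℤ.*-comm (g μ) (δ μ ρ)) (cong (_*ℤ g μ) (δ-comm μ ρ)))) (ΣD-δ* c g))) ⟩
  RT N (λ ρ → ΣD N N (λ μ → g μ *ℤ δ μ ρ)) ls
    ≡⟨ linear-ΣD (RT-linear N ls) N N (λ μ ρ → g μ *ℤ δ μ ρ) ⟩
  ΣD N N (λ μ → RT N (λ ρ → g μ *ℤ δ μ ρ) ls)
    ≡⟨ ΣD-cong N N (λ {μ} _ → trans (scalar (RT-linear N ls) (g μ) (δ μ)) (ℤ.*-comm (g μ) _)) ⟩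
  ΣD N N (λ μ → RT N (δ μ) ls *ℤ g μ) ∎
 

RT-δ-degree : ∀ {N μ ls} → Box N N ls → sum ls < sum μ → RT N (δ μ) ls ≡ + 0
RT-δ-degree {N} {μ} {ls} b p = chain-zero N 0 1 (N + N) b (λ {ρ} c sub → cong (λ z → when z (+ 1)) (eqList-false {μ} {ρ} (λ e → <⇒≱ p (≤-trans (≤-reflexive (cong sum e)) (at-mono-sum b c sub)))))

sgn-τ : ∀ {N ρ} → Box N N ρ → sgn (τ N ρ) ≡ sgn ρ
sgn-τ b = cong sign (sum-τ b)

δ-τ : ∀ {N ν ρ} → Box N N ν → Box N N ρ → δ (τ N ν) (τ N ρ) ≡ δ ν ρ
δ-τ {N} {ν} {ρ} b c = cong (λ z → when z (+ 1)) (T⇒≡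
  (λ t → eqList-intro (trans (sym (τ-involutive b)) (trans (cong (τ N) (eqList-elim (τ N ν) (τ N ρ) t)) (τ-involutive c))))
  (λ t → eqList-intro (cong (τ N) (eqList-elim ν ρ t))))

-- ET-factorisation for a delta function, where both diagonal sign factors can be evaluated.
ET-δ-τ : ∀ {N ν ls} → Box N N ν → Box N N ls → sgn ν *ℤ ET N (δ (τ N ν)) ls ≡ RT N (λ ρ → ET N (δ ν) (τ N ρ) *ℤ sgn (τ N ρ)) ls
ET-δ-τ {N} {ν} {ls} b c = begin
  sgn ν *ℤ ET N (δ (τ N ν)) ls
    ≡⟨ cong (sgn ν *ℤ_) (sym (ET-factorisation c (δ (τ N ν)))) ⟩
  sgn ν *ℤ RT N (λ ρ → sgn ρ *ℤ ET N (λ σ → sgn σ *ℤ δ (τ N ν) (τ N σ)) (τ N ρ)) ls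
    ≡⟨ cong (sgn ν *ℤ_) (chain-cong N 0 1 (N + N) c (λ {ρ} d → cong (sgn ρ *ℤ_) (trans (ET-cong (Box-τ d) (λ {σ} s → trans (cong (sgn σ *ℤ_) (δ-τ b s)) (evaluate σ))) (scalar (ET-linear N (τ N ρ)) (sgn ν) (δ ν))))) ⟩
  sgn ν *ℤ RT N (λ ρ → sgn ρ *ℤ (sgn ν *ℤ ET N (δ ν) (τ N ρ))) ls
    ≡⟨ sym (scalar (RT-linear N ls) (sgn ν) _) ⟩
  RT N (λ ρ → sgn ν *ℤ (sgn ρ *ℤ (sgn ν *ℤ ET N (δ ν) (τ N ρ)))) ls
    ≡⟨ chain-cong N 0 1 (N + N) c (λ {ρ} d → trans (shuffle (sgn ν) (sgn ρ) (ET N (δ ν) (τ N ρ))) (trans (sign-cancel (sum ν) _) (cong (ET N (δ ν) (τ N ρ) *ℤ_) (sym (sgn-τ d))))) ⟩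
  RT N (λ ρ → ET N (δ ν) (τ N ρ) *ℤ sgn (τ N ρ)) ls ∎
  where
  evaluate : ∀ σ → sgn σ *ℤ δ ν σ ≡ sgn ν *ℤ δ ν σ
  evaluate σ = trans (sym (when-* (eqList ν σ) (sgn σ) (+ 1))) (trans (when-cong (eqList ν σ) (λ t → cong (λ z → sgn z *ℤ + 1) (sym (eqList-elim ν σ t)))) (when-* (eqList ν σ) (sgn ν) (+ 1)))
  shuffle : ∀ a b x → a *ℤ (b *ℤ (a *ℤ x)) ≡ a *ℤ (a *ℤ (x *ℤ b))
  shuffle = solve-∀

-- `E` is injective, and both sides have the image sgn ν s_{ν^t} at ν. On the left S passes through
-- `E` by linearity, and `S-schur` applies. On the right the matrix coefficients of `E`, the signs
-- and R combine by `ET-δ-τ` into those of `E` at the conjugate shape, which again send G to Schur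
-- functions.
S-grothendieck : ∀ {N} a → sum a ≤ N → length a ≤ N → ∀ {μ} → Box N N μ →
  S (λ α → grothendieck α μ) a ≡ sgn μ *ℤ ΣD N N (λ ls → RT N (δ (τ N μ)) ls *ℤ grothendieck a ls)
S-grothendieck {N} a p q {μ} b = ℤ.i-j≡0⇒i≡j (X μ) (Y μ) (E-injective N {N} {λ κ → X κ +ℤ - Y κ} difference b)
  where
  X Y : List ℕ → ℤ
  X κ = S (λ α → grothendieck α κ) a
  Y κ = sgn κ *ℤ ΣD N N (λ ls → RT N (δ (τ N κ)) ls *ℤ grothendieck a ls)
  E-X : ∀ {ν} → Box N N ν → E X ν ≡ sgn ν *ℤ schur a (τ N ν)
  E-X {ν} c = trans (sym (linear-S (E-linear ν) (λ α κ → grothendieck α κ) a))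
    (trans (S-cong a (λ α ps e → E-grothendieck α (≤-trans (length-≤-sum ps) (≤-trans (≤-reflexive e) p)) c)) (S-schur c a))
  E-Y : ∀ {ν} → Box N N ν → E Y ν ≡ sgn ν *ℤ schur a (τ N ν)
  E-Y {ν} c = begin
    E Y ν
      ≡⟨ E-expand c Y ⟩
    ΣD N N (λ κ → e κ *ℤ Y κ)
      ≡⟨ ΣD-cong N N (λ {κ} _ → trans (sym (ℤ.*-assoc (e κ) (sgn κ) _)) (trans (sym (scalar (ΣD-linear N N) (e κ *ℤ sgn κ) _)) (ΣD-cong N N (λ {ls} _ → shuffle (e κ *ℤ sgn κ) (RT N (δ (τ N κ)) ls) (grothendieck a ls))))) ⟩
    ΣD N N (λ κ → ΣD N N (λ ls → grothendieck a ls *ℤ (RT N (δ (τ N κ)) ls *ℤ (e κ *ℤ sgn κ))))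
      ≡⟨ ΣD-swap N N N N _ ⟩
    ΣD N N (λ ls → ΣD N N (λ κ → grothendieck a ls *ℤ (RT N (δ (τ N κ)) ls *ℤ (e κ *ℤ sgn κ))))
      ≡⟨ ΣD-cong N N (λ {ls} d → trans (scalar (ΣD-linear N N) (grothendieck a ls) _) (trans (cong (grothendieck a ls *ℤ_) (inner d)) (outer (sgn ν) (ET N (δ (τ N ν)) ls) (grothendieck a ls)))) ⟩
    ΣD N N (λ ls → sgn ν *ℤ (ET N (δ (τ N ν)) ls *ℤ grothendieck a ls))
      ≡⟨ trans (scalar (ΣD-linear N N) (sgn ν) _) (cong (sgn ν *ℤ_) (trans (sym (E-expand (Box-τ c) (grothendieck a))) (E-grothendieck a q (Box-τ c)))) ⟩
    sgn ν *ℤ schur a (τ N ν) ∎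
    where
    e : List ℕ → ℤ
    e = ET N (δ ν)
    shuffle : ∀ c x y → c *ℤ (x *ℤ y) ≡ y *ℤ (x *ℤ c)
    shuffle = solve-∀
    outer : ∀ s x y → y *ℤ (s *ℤ x) ≡ s *ℤ (x *ℤ y)
    outer = solve-∀
    inner : ∀ {ls} → Box N N ls → ΣD N N (λ κ → RT N (δ (τ N κ)) ls *ℤ (e κ *ℤ sgn κ)) ≡ sgn ν *ℤ ET N (δ (τ N ν)) ls
    inner {ls} d = begin
      ΣD N N (λ κ → RT N (δ (τ N κ)) ls *ℤ (e κ *ℤ sgn κ))
        ≡⟨ ΣD-cong N N (λ {κ} k → cong (λ z → RT N (δ (τ N κ)) ls *ℤ (e z *ℤ sgn z)) (sym (τ-involutive k))) ⟩
      ΣD N N (λ κ → RT N (δ (τ N κ)) ls *ℤ (e (τ N (τ N κ)) *ℤ sgn (τ N (τ N κ))))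
        ≡⟨ ΣD-τ N (λ κ → RT N (δ κ) ls *ℤ (e (τ N κ) *ℤ sgn (τ N κ))) ⟩
      ΣD N N (λ κ → RT N (δ κ) ls *ℤ (e (τ N κ) *ℤ sgn (τ N κ)))
        ≡⟨ trans (sym (RT-expand d (λ κ → e (τ N κ) *ℤ sgn (τ N κ)))) (sym (ET-δ-τ c d)) ⟩
      sgn ν *ℤ ET N (δ (τ N ν)) ls ∎
  difference : ∀ {ν} → Box N N ν → E (λ κ → X κ +ℤ - Y κ) ν ≡ + 0
  difference {ν} c = trans (additive (E-linear ν) X (λ κ → - Y κ)) (trans (cong₂ _+ℤ_ (E-X c) (trans (linear-neg (E-linear ν) Y) (cong -_ (E-Y c)))) (ℤ.+-inverseʳ (sgn ν *ℤ schur a (τ N ν))))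

sgn-schur : ∀ a {L u ls} → Box L u ls → sgn ls *ℤ schur a ls ≡ sign (sum a) *ℤ schur a ls
sgn-schur a {ls = ls} b with sum ls ℕ.≟ sum a
... | yes e = cong (λ z → sign z *ℤ schur a ls) e
... | no  e rewrite schur-degree a b e = trans (ℤ.*-zeroʳ (sgn ls)) (sym (ℤ.*-zeroʳ (sign (sum a))))

j-ET : ∀ {N} a {ls} → Box N N ls → j ls a ≡ ET N (λ ρ → schur a (τ N ρ)) ls
j-ET {N} a b = trans (j-dualGrothendieck a b) (trans (dualGrothendieck-ET a b) (ET-cong b (λ c → VV-schur a c)))

-- S preserves the degree, so the sign (-1)^{|a|} in `jt` is a constant. `S-schur` contributes the
-- sign of the size of ρ, which by homogeneity is (-1)^{|a|} too; the two cancel and only the sign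
-- of the outer shape remains.
S-jt : ∀ {N} a {ls} → Box N N ls → S (jt ls) a ≡ sgn ls *ℤ ET N (schur a) ls
S-jt {N} a {ls} b = begin
  S (jt ls) a
    ≡⟨ S-cong a (λ α _ e → cong₂ (λ x y → sign (sum ls + x) *ℤ y) e (j-ET α b)) ⟩
  S (λ α → sign (sum ls + sum a) *ℤ ET N (λ ρ → schur α (τ N ρ)) ls) a
    ≡⟨ scalar (S-linear a) (sign (sum ls + sum a)) _ ⟩
  sign (sum ls + sum a) *ℤ S (λ α → ET N (λ ρ → schur α (τ N ρ)) ls) a
    ≡⟨ cong (sign (sum ls + sum a) *ℤ_) (trans (linear-S (ET-linear N ls) (λ α ρ → schur α (τ N ρ)) a) (trans (ET-cong b (λ {ρ} c → antipode c)) (scalar (ET-linear N ls) (sign (sum a)) (schur a)))) ⟩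
  sign (sum ls + sum a) *ℤ (sign (sum a) *ℤ ET N (schur a) ls)
    ≡⟨ trans (cong (_*ℤ (sign (sum a) *ℤ ET N (schur a) ls)) (sign-+ (sum ls) (sum a))) (trans (ℤ.*-assoc (sgn ls) (sign (sum a)) _) (cong (sgn ls *ℤ_) (sign-cancel (sum a) _))) ⟩
  sgn ls *ℤ ET N (schur a) ls ∎
  where
  antipode : ∀ {ρ} → Box N N ρ → S (λ α → schur α (τ N ρ)) a ≡ sign (sum a) *ℤ schur a ρ
  antipode {ρ} c = trans (S-schur (Box-τ c) a) (trans (cong₂ _*ℤ_ (sgn-τ c) (cong (schur a) (τ-involutive c))) (sgn-schur a c))

-- The factorisation applied to `schur a`. The symmetry of R moves the conjugation from the outer
-- shape to the summation shape, and homogeneity converts the sign (-1)^{|a|} of `jt` into the inner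
-- diagonal sign.
RT-jt : ∀ {N} a {ls} → Box N N ls → ΣD N N (λ μ → RT N (δ μ) (τ N ls) *ℤ jt μ a) ≡ ET N (schur a) ls
RT-jt {N} a {ls} b = begin
  ΣD N N (λ μ → RT N (δ μ) (τ N ls) *ℤ jt μ a)
    ≡⟨ sym (RT-expand (Box-τ b) (λ μ → jt μ a)) ⟩
  RT N (λ μ → jt μ a) (τ N ls)
    ≡⟨ trans (RT-τ (Box-τ b) (λ μ → jt μ a)) (cong (RT N (λ μ → jt (τ N μ) a)) (τ-involutive b)) ⟩
  RT N (λ μ → jt (τ N μ) a) ls
    ≡⟨ chain-cong N 0 1 (N + N) b (λ {ρ} c → trans (cong₂ _*ℤ_ (trans (sign-+ (sum (τ N ρ)) (sum a)) (cong (_*ℤ sign (sum a)) (sgn-τ c))) (j-ET a (Box-τ c)))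
         (trans (ℤ.*-assoc (sgn ρ) (sign (sum a)) _) (cong (sgn ρ *ℤ_) (trans (sym (scalar (ET-linear N (τ N ρ)) (sign (sum a)) _)) (ET-cong (Box-τ c) (λ {σ} d → sym (signed-schur d))))))) ⟩
  RT N (λ ρ → sgn ρ *ℤ ET N (λ σ → sgn σ *ℤ schur a (τ N σ)) (τ N ρ)) ls
    ≡⟨ ET-factorisation b (schur a) ⟩
  ET N (schur a) ls ∎
  where
  signed-schur : ∀ {σ} → Box N N σ → sgn σ *ℤ schur a (τ N σ) ≡ sign (sum a) *ℤ schur a (τ N σ)
  signed-schur {σ} d = trans (cong (_*ℤ schur a (τ N σ)) (sym (sgn-τ d))) (sgn-schur a (Box-τ d))

theorem8p8 :
    ((μ : List ℕ) → IsPartition μ → (a : List ℕ) →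
       S (G μ) a ≡ sign (size μ) *ℤ sumℤ (map (λ λ′ → (+ P (conj μ) λ′) *ℤ G λ′ a) (partitionsUpTo (sum a))))
    ×
    ((λ′ : List ℕ) → IsPartition λ′ → (a : List ℕ) →
       S (jt λ′) a ≡ sign (size λ′) *ℤ sumℤ (map (λ μ → (+ P μ (conj λ′)) *ℤ jt μ a) (partitionsUpTo (size λ′))))
theorem8p8 = part-a , part-b
  where
  part-a : ∀ μ → IsPartition μ → ∀ a → S (G μ) a ≡ sign (size μ) *ℤ ∑ (partitionsUpTo (sum a)) (λ λ′ → (+ P (conj μ) λ′) *ℤ G λ′ a)
  part-a μ part a = begin
    S (G μ) a
      ≡⟨ S-cong a (λ α _ _ → trans (sym (G-pad N μ α)) (G-grothendieck α b)) ⟩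
    S (λ α → grothendieck α p) a
      ≡⟨ S-grothendieck a a≤N (≤-trans (m≤n+m (length a) (sum a)) (m≤n+m _ (sum μ))) b ⟩
    sgn p *ℤ ΣD N N (λ ls → RT N (δ (τ N p)) ls *ℤ grothendieck a ls)
      ≡⟨ cong₂ _*ℤ_ (cong sign (sum-pad μ (N ∸ length μ))) (sym (∑-partitionsUpTo a≤N {λ λ′ → (+ P (conj μ) λ′) *ℤ G λ′ a} {λ ls → RT N (δ (τ N p)) ls *ℤ grothendieck a ls}
           -- G has no terms of degree below the size of its shape, so only finitely many λ
           -- contribute to a given coefficient.
           (λ {ls} c q → trans (cong (RT N (δ (τ N p)) ls *ℤ_) (grothendieck-degree a ls q)) (ℤ.*-zeroʳ (RT N (δ (τ N p)) ls)))
           (λ {ls} c _ → cong₂ _*ℤ_ (count c) (value c)))) ⟩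
    sign (size μ) *ℤ ∑ (partitionsUpTo (sum a)) (λ λ′ → (+ P (conj μ) λ′) *ℤ G λ′ a) ∎
    where
    -- `sum μ` makes room for μ, `sum a` for every λ contributing to the coefficient of x^a, and
    -- `length a` for the rows created by the letters, as `E-grothendieck` requires.
    N = sum μ + (sum a + length a)
    p = pad N μ
    a≤N : sum a ≤ N
    a≤N = ≤-trans (m≤m+n (sum a) (length a)) (m≤n+m _ (sum μ))
    b : Box N N p
    b = Box-pad-partition part (m≤m+n (sum μ) _)
    small : sum (τ N p) ≤ N + N
    small = ≤-trans (≤-reflexive (trans (sum-τ b) (sum-pad μ (N ∸ length μ)))) (≤-trans (m≤m+n (sum μ) _) (m≤m+n N N))
    count : ∀ {ls} → Box N N ls → + P (conj μ) (flat ls) ≡ RT N (δ (τ N p)) ls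
    count {ls} c = trans (cong +_ (trans (sym (P-pad N (conj μ) N (flat ls))) (cong₂ P (pad-conj {N} {μ} b) (pad-flat c)))) (+P (Box-τ b) c small)
    value : ∀ {ls} → Box N N ls → G (flat ls) a ≡ grothendieck a ls
    value {ls} c = trans (sym (G-pad N (flat ls) a)) (trans (cong (λ z → G z a) (pad-flat c)) (G-grothendieck a c))
  part-b : ∀ λ′ → IsPartition λ′ → ∀ a → S (jt λ′) a ≡ sign (size λ′) *ℤ ∑ (partitionsUpTo (size λ′)) (λ μ → (+ P μ (conj λ′)) *ℤ jt μ a)
  part-b λ′ part a = begin
    S (jt λ′) a
      ≡⟨ S-cong a (λ α _ _ → sym (jt-pad N λ′ α)) ⟩
    S (jt p) a
      ≡⟨ S-jt a b ⟩
    sgn p *ℤ ET N (schur a) p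
      ≡⟨ cong₂ _*ℤ_ (cong sign (sum-pad λ′ (N ∸ length λ′))) (trans (sym (RT-jt a b)) (sym (∑-partitionsUpTo ≤-refl {λ μ → (+ P μ (conj λ′)) *ℤ jt μ a} {λ ρ → RT N (δ ρ) (τ N p) *ℤ jt ρ a}
           (λ {ρ} c q → cong (_*ℤ jt ρ a) (RT-δ-degree {μ = ρ} (Box-τ b) (subst (_< sum ρ) (sym (trans (sum-τ b) (sum-pad λ′ (N ∸ length λ′)))) q)))
           (λ {ρ} c q → cong₂ _*ℤ_ (count c q) (trans (sym (jt-pad N (flat ρ) a)) (cong (λ z → jt z a) (pad-flat c))))))) ⟩
    sign (size λ′) *ℤ ∑ (partitionsUpTo (size λ′)) (λ μ → (+ P μ (conj λ′)) *ℤ jt μ a) ∎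
    where
    -- Whatever the exponent vector, only shapes with at most |λ| cells occur, because the removals
    -- start from λ or its conjugate.
    N = sum λ′
    p = pad N λ′
    b : Box N N p
    b = Box-pad-partition part ≤-refl
    count : ∀ {ρ} → Box N N ρ → sum ρ ≤ N → + P (flat ρ) (conj λ′) ≡ RT N (δ ρ) (τ N p)
    count {ρ} c q = trans (cong +_ (trans (sym (P-pad N (flat ρ) N (conj λ′))) (cong₂ P (pad-flat c) (pad-conj {N} {λ′} b)))) (+P c (Box-τ b) (≤-trans q (m≤m+n N N)))
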